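{- Let $k>\ell\ge1$ be integers with $k+\ell\ge5$, let $\lambda\in[0,k+\ell-5]$ be an integer, let $m$ be an integer with $$m\ge\max\Big\{5T\big(\tfrac1{k+\ell}\big),\ (k+\ell+\lambda+4)\big(1+\tfrac1{k+\ell}\big)(k+\ell)^{1/(k+\ell-2)}\Big\},$$ and suppose $p=(k+\ell)m+2+\lambda$ is prime. Let $n\ge1$. If $A\subset\mathbb F_p^n$ is a nontrivial $(k,\ell)$-sum-free set with $|A|\ge mp^{n-1}$, then $A$ is normal up to isomorphism, i.e. $A$ is of type 1 or of type 2.
   Context: For a subset $X$ of an abelian group and $h\ge1$, $hX=\{x_1+\dots+x_h:x_i\in X\}$. A nonempty $A\subseteq\mathbb F_p^n$ is $(k,\ell)$-sum-free if $kA\cap\ell A=\emptyset$. Subsets of $\mathbb F_p^n$ are isomorphic if an automorphism of the additive group $\mathbb F_p^n$ maps one onto the other. For $a,b\in\mathbb F_p$, $[a,b]=\{a,a+1,\dots,b\}\subseteq\mathbb F_p$ (cyclic interval). For $j\in[0,\lceil\frac{\lambda+1}2\rceil-1]$ let $a_j=-(km+1+j)(k-\ell)^{ -1}\in\mathbb F_p$ and $A_{k,\ell,p,j}=[a_j,a_j+m]\times\mathbb F_p^{n-1}$ (extremal cuboids). A $(k,\ell)$-sum-free set is trivial if it is isomorphic to a subset of some $A_{k,\ell,p,j}$, and nontrivial otherwise. Types (for $A\subseteq\mathbb F_p^n$ with $|A|=mp^{n-1}$): $A$ is of type 1 if $A$ is isomorphic to $[a,a+m-1]\times\mathbb F_p^{n-1}$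 for some $a\in\mathbb F_p$ such that the element $\ell a-k(a+m-1)\in\mathbb F_p$ lies in $[1,\ell]$ or in $[\lambda+\ell+2,k]$ (the latter option only when $\lambda+\ell+2\le k$). $A$ is of type 2 if $\ell=1$, $n\ge2$, and $A$ is isomorphic to $(\{a\}\times(\mathbb F_p^{n-1}\setminus V))\sqcup([a+1,a+m-1]\times\mathbb F_p^{n-1})\sqcup(\{a+m\}\times V)$, where $a=mk(\ell-k)^{ -1}\in\mathbb F_p$ and $V\subset\mathbb F_p^{n-1}$ is a proper linear subspace. $A$ is normal if it is of type 1 or 2. The function $T$: a finite $X\subseteq\mathbb F_p$ has the covering property if $X$ is contained in an arithmetic progression of length $|X+X|-|X|+1$. For $c\in(0,1)$, $\tau\in(0,1]$ is feasible for $c$ if (for every prime $p$) every $X\subseteq\mathbb F_p$ with $|X|\le cp$ and $|X+X|\le(2+\tau)|X|-3$ has the covering property; $\tau(c)$ is the supremum of the feasible $\tau$, and $T(c)=1/\tau(c)$. -}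

module Defs where

open import Data.Nat using (ℕ; zero; suc; _+_; _*_; _∸_; _^_; _≤_; _<_; NonZero; ⌈_/2⌉)
open import Data.Nat.DivMod using (_mod_)
open import Data.Nat.Primality using (Prime)
open import Data.Fin using (Fin; toℕ)
open import Data.Vec using (Vec; []; _∷_; zipWith; replicate; foldr)
import Data.Vec as Vec
open import Data.Vec.Relation.Unary.All using (All)
open import Data.List using (List; concatMap; map; allFin)
open import Data.Nat.ListAction using (sum)
open import Data.Bool.ListAction using (any)
import Data.List as List
open import Data.Bool using (Bool; true; false; if_then_else_; _∧_)
open import Data.Product using (Σ; ∃; ∃-syntax; _×_; _,_)
open import Data.Sum using (_⊎_)
open import Relation.Binary.PropositionalEquality using (_≡_; _≢_)
open import Relation.Nullary using (¬_)

count : {A : Set} → (A → Bool) → List A → ℕ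
count f xs = sum (map (λ x → if f x then 1 else 0) xs)

module _ (p : ℕ) .{{_ : NonZero p}} where

  emb : ℕ → Fin p
  emb c = c mod p

  _+ₚ_ : Fin p → Fin p → Fin p
  a +ₚ b = (toℕ a + toℕ b) mod p

  -ₚ_ : Fin p → Fin p
  -ₚ a = (p ∸ toℕ a) mod p

  _-ₚ_ : Fin p → Fin p → Fin p
  a -ₚ b = a +ₚ (-ₚ b)

  _*ₚ_ : Fin p → Fin p → Fin p
  a *ₚ b = (toℕ a * toℕ b) mod p

  _·ₚ_ : ℕ → Fin p → Fin p
  c ·ₚ a = (c * toℕ a) mod p

  -- cyclic interval [b, c] = {b, b+1, ..., c} ⊆ F_p
  _∈[_,_] : Fin p → Fin p → Fin p → Set
  x ∈[ b , c ] = toℕ (x -ₚ b) ≤ toℕ (c -ₚ b)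

  Vp : ℕ → Set
  Vp n = Vec (Fin p) n

  _+v_ : {n : ℕ} → Vp n → Vp n → Vp n
  _+v_ = zipWith _+ₚ_

  0v : {n : ℕ} → Vp n
  0v = replicate _ (emb 0)

  _*v_ : {n : ℕ} → Fin p → Vp n → Vp n
  c *v x = Vec.map (c *ₚ_) x

  vsum : {n h : ℕ} → Vec (Vp n) h → Vp n
  vsum = foldr _ _+v_ 0v

  allVecs : (n : ℕ) → List (Vp n)
  allVecs zero = [] List.∷ List.[]
  allVecs (suc n) = concatMap (λ a → map (a ∷_) (allVecs n)) (allFin p)

  card : {n : ℕ} → (Vp n → Bool) → ℕ
  card {n} A = count A (allVecs n)

  IsAut : {n : ℕ} → (Vp n → Vp n) → Set
  IsAut {n} φ = (∀ x y → φ (x +v y) ≡ φ x +v φ y)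
              × Σ (Vp n → Vp n) (λ ψ → (∀ x → ψ (φ x) ≡ x) × (∀ y → φ (ψ y) ≡ y))

  SumFree : {n : ℕ} → ℕ → ℕ → (Vp n → Bool) → Set
  SumFree {n} k l A =
    (∃[ x ] A x ≡ true) ×
    (∀ (xs : Vec (Vp n) k) (ys : Vec (Vp n) l) →
       All (λ x → A x ≡ true) xs → All (λ y → A y ≡ true) ys →
       vsum xs ≢ vsum ys)

  -- Trivial sets: isomorphic to a subset of an extremal cuboid
  -- A_{k,l,p,j} = [a_j, a_j + m] × F_p^{n-1}, a_j = -(km+1+j)(k-l)^{-1},
  -- j ∈ [0, ⌈(λ+1)/2⌉ - 1].  The element a_j is described as the
  -- solution a of (k-l)·a = -(km+1+j) in F_p (k-l is invertible in F_p).
  -- Here n = suc n'.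

  Trivial : (k l lam m n' : ℕ) → (Vp (suc n') → Bool) → Set
  Trivial k l lam m n' A =
    ∃[ j ] (j ≤ ⌈ suc lam /2⌉ ∸ 1) ×
    ∃[ a ] ((k ∸ l) ·ₚ a ≡ -ₚ emb (k * m + 1 + j)) ×
    ∃[ φ ] IsAut φ ×
    (∀ x → A x ≡ true → Vec.head (φ x) ∈[ a , a +ₚ emb m ])

  Nontrivial : (k l lam m n' : ℕ) → (Vp (suc n') → Bool) → Set
  Nontrivial k l lam m n' A = ¬ Trivial k l lam m n' A

  Type1 : (k l lam m n' : ℕ) → (Vp (suc n') → Bool) → Set
  Type1 k l lam m n' A =
    ∃[ a ] (let v = (l ·ₚ a) -ₚ (k ·ₚ (a +ₚ emb (m ∸ 1))) in
             (v ∈[ emb 1 , emb l ])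
             ⊎ ((lam + l + 2 ≤ k) × (v ∈[ emb (lam + l + 2) , emb k ]))) ×
    ∃[ φ ] IsAut φ ×
    (∀ x → (A x ≡ true → Vec.head (φ x) ∈[ a , a +ₚ emb (m ∸ 1) ])
         × (Vec.head (φ x) ∈[ a , a +ₚ emb (m ∸ 1) ] → A x ≡ true))

  IsProperSubspace : {n : ℕ} → (Vp n → Bool) → Set
  IsProperSubspace {n} V =
    (V 0v ≡ true) ×
    (∀ x y → V x ≡ true → V y ≡ true → V (x +v y) ≡ true) ×
    (∀ c x → V x ≡ true → V (c *v x) ≡ true) ×
    (∃[ x ] V x ≡ false)

  Type2Set : (m n' : ℕ) → Fin p → (Vp n' → Bool) → Vp (suc n') → Set
  Type2Set m n' a V (c ∷ y) =
    ((c ≡ a) × (V y ≡ false))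
    ⊎ (c ∈[ a +ₚ emb 1 , a +ₚ emb (m ∸ 1) ])
    ⊎ ((c ≡ a +ₚ emb m) × (V y ≡ true))

  -- a = mk(l-k)^{-1}, described as the solution of (l-k)·a = mk,
  -- where (l-k)·a = -((k-l)·a) in F_p.
  Type2 : (k l lam m n' : ℕ) → (Vp (suc n') → Bool) → Set
  Type2 k l lam m n' A =
    (l ≡ 1) × (1 ≤ n') ×
    ∃[ a ] (-ₚ ((k ∸ l) ·ₚ a) ≡ emb (m * k)) ×
    ∃[ V ] IsProperSubspace V ×
    ∃[ φ ] IsAut φ ×
    (∀ x → (A x ≡ true → Type2Set m n' a V (φ x))
         × (Type2Set m n' a V (φ x) → A x ≡ true))

  Normal : (k l lam m n' : ℕ) → (Vp (suc n') → Bool) → Set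
  Normal k l lam m n' A = Type1 k l lam m n' A ⊎ Type2 k l lam m n' A

  cardₚ : (Fin p → Bool) → ℕ
  cardₚ X = count X (allFin p)

  sumset : (Fin p → Bool) → Fin p → Bool
  sumset X z = any (λ x → X x ∧ X (z -ₚ x)) (allFin p)

  Covering : (Fin p → Bool) → Set
  Covering X =
    ∃[ a ] ∃[ d ] (∀ x → X x ≡ true →
      ∃[ i ] (i < cardₚ (sumset X) ∸ cardₚ X + 1) × (x ≡ a +ₚ (i ·ₚ d)))

-- Feasibility of τ = t/b for c = 1/K:
-- for every prime p, every X ⊆ F_p with |X| ≤ p/K and
-- |X+X| ≤ (2 + t/b)|X| - 3 has the covering property.
-- (Both inequalities are cleared of denominators.)

Feasible : (K t b : ℕ) → Set
Feasible K t b =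
  ∀ (p : ℕ) .{{_ : NonZero p}} → Prime p → (X : Fin p → Bool) →
  K * cardₚ p X ≤ p →
  b * cardₚ p (sumset p X) + 3 * b ≤ (2 * b + t) * cardₚ p X →
  Covering p X

-- m ≥ 5 T(1/K), i.e. τ(1/K) ≥ 5/m: every rational τ = t/b ∈ (0,1]
-- with τ < 5/m is feasible (and 5/m ≤ 1, since τ(c) ≤ 1).
FiveTBound : (K m : ℕ) → Set
FiveTBound K m =
  (5 ≤ m) ×
  (∀ t b → 1 ≤ t → t ≤ b → t * m < 5 * b → Feasible K t b)

-- m ≥ (K+λ+4)(1 + 1/K) K^{1/(K-2)}, raised to the power K-2 and
-- multiplied by K^{K-2} (K ≥ 5, so K-2 ≥ 3):
-- (mK)^{K-2} ≥ ((K+λ+4)(K+1))^{K-2} · K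
RootBound : (K lam m : ℕ) → Set
RootBound K lam m = ((K + lam + 4) * (K + 1)) ^ (K ∸ 2) * K ≤ (m * K) ^ (K ∸ 2)

{-# OPTIONS --safe #-}
module Submission where

open import Defs
open import Data.Nat using (ℕ; zero; suc; _+_; _*_; _∸_; _^_; _≤_; _<_; z≤n; s≤s; NonZero; _≤?_; _<?_; >-nonZero; ⌈_/2⌉; ⌊_/2⌋)
open import Data.Nat.Properties as ℕₚ using (≤-refl; ≤-trans; ≤-reflexive; ≤-<-trans; +-mono-≤; +-monoˡ-≤; +-monoʳ-≤; *-monoˡ-≤; *-monoʳ-≤; *-mono-≤; m≤m+n; m≤n+m; ≰⇒>; ≮⇒≥; <⇒≱; <⇒≤; n≤1+n; +-cancelˡ-≤; +-cancelʳ-≤)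
open import Data.Nat.DivMod using (_/_; _%_; m%n<n; %-distribˡ-+; %-distribˡ-*; m<n⇒m%n≡m; [m+kn]%n≡m%n; m/n*n≤m; m≡m%n+[m/n]*n; /-monoˡ-≤; m*n/n≡m)
open import Data.Nat.Divisibility using (_∣_; divides; ∣1⇒≡1)
open import Data.Nat.Primality using (Prime; prime; prime[2]; euclidsLemma; prime⇒irreducible)
open import Data.Nat.Coprimality using (prime⇒coprime; coprime-Bézout)
open import Data.Nat.GCD using (module Bézout)
open import Data.Nat.ListAction using (sum)
open import Data.Nat.Tactic.RingSolver using (solve-∀)
import Data.Integer as ℤ
open import Data.Integer using (ℤ; +_; -[1+_])
import Data.Integer.Properties as ℤₚ
open import Data.Integer.Tactic.RingSolver using () renaming (solve-∀ to solveℤ-∀)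
open import Data.Fin using (Fin; toℕ)
import Data.Fin.Properties as Finₚ
open import Data.Vec using (Vec; []; _∷_; zipWith)
import Data.Vec as Vec
import Data.Vec.Properties as Vecₚ
import Data.Vec.Relation.Unary.All as VAll
open import Data.List using (List; []; _∷_; map; foldr; concatMap; allFin; _++_; length; replicate; tabulate)
import Data.List.Properties as Listₚ
open import Data.List.Relation.Unary.All as All using (All; []; _∷_)
import Data.List.Relation.Unary.All.Properties as Allₚ
open import Data.List.Relation.Binary.Pointwise using (Pointwise; []; _∷_)
open import Data.List.Relation.Binary.Permutation.Propositional using (_↭_; ↭-sym; ↭-trans; ↭-refl; prep; swap)
import Data.List.Relation.Binary.Permutation.Propositional as Perm
import Data.List.Relation.Binary.Permutation.Propositional.Properties as ↭ₚ
open import Data.Maybe using (Maybe; just; nothing)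
open import Data.Bool using (Bool; true; false; if_then_else_; _∧_; _∨_; not)
open import Data.Bool.Properties using (∧-zeroʳ)
open import Data.Bool.ListAction using (any; or)
open import Data.Product using (Σ; ∃-syntax; _×_; _,_; proj₁; proj₂)
open import Data.Sum using (_⊎_; inj₁; inj₂)
open import Data.Empty using (⊥; ⊥-elim)
open import Function using (_∘_)
open import Relation.Binary.PropositionalEquality
open import Relation.Binary.Definitions using (DecidableEquality)
open import Relation.Nullary using (¬_; Dec; yes; no; does; ¬?; _×-dec_)
open import Relation.Nullary.Decidable using (dec-true; dec-false)
open import Algebra.Structures using (IsCommutativeSemiring; IsAbelianGroup; IsCommutativeRing)
open import Algebra.Bundles using (CommutativeRing; AbelianGroup)
open import Algebra.Solver.Ring.AlmostCommutativeRing using (fromCommutativeRing; _-Raw-AlmostCommutative⟶_; AlmostCommutativeRing)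
import Algebra.Solver.Ring
import Algebra.Properties.Ring
import Algebra.Properties.AbelianGroup
import Algebra.Properties.CommutativeSemigroup

-- Put K = k + ℓ and N = pⁿ⁻¹.  A set A is sum-free if and only if 0 is not a sum
-- of k elements of A and ℓ elements of -A.  For a linear functional c, the slice
-- sizes w(i) = |{x ∈ A : c·x = i}| have K-fold convolutions at 0 whose sum over
-- all c counts these representations; since there are none, an ℓ¹-ℓ² estimate
-- for the deviations of w from their mean shows that some c ≠ 0 has very uneven
-- slices (this replaces Fourier analysis and uses the root bound on m).  An
-- automorphism turns c into the first coordinate.
--
-- If X + Y is not the whole group G then |X| + |Y| ≤ |X + Y| + |G|/p, by Dyson's
-- transform.  Applied to the set of indices of large slices, and to the slices
-- themselves, it leaves at most m + 1 nonempty slices.  After removing the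
-- smallest one if there are m + 1, any two slices have full sumset, so that their
-- index set S is a sum-free set of m elements of 𝔽_p.  Vosper's theorem (if
-- |2S| ≥ 2m + 2) or the covering property (if |2S| ≤ 2m + 1) puts S into an
-- arithmetic progression of length m + 1, which may be assumed to be an interval;
-- the removed slice must be adjacent, because the two ends of a longer hull would
-- already represent 0.
--
-- If 0 is not in k[a,a+m] - ℓ[a,a+m] then A is trivial, and if only m slices
-- occur, the position of ℓa - k(a+m-1) decides between trivial and type 1.
-- Otherwise ℓ = 1 and k times the top slice U misses the bottom slice T, where
-- |U| + |T| = N.  Then |U + U| = |U|, so U is a coset of a subspace V and T is a
-- translate of the complement of V; a shear brings A to the form of type 2.

-- Comparing the total energy of all functionals with the error of the zero functional leaves a
-- factor (p N - |A|) / |A| ≤ K, and this is the number under the root in the bound on m. What is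
-- gained is a functional of spread at least N p (K + λ + 4) (K + 1) / K. If no slice exceeded N /
-- 2, the spread would be at most 6 N p (K + λ) / K, too little since K + 1 ≥ 6. So some slice is
-- larger than N / 2, and it anchors the count of the nonempty slices.
--
-- On the line, only two of the K positions have to be filled with heavy indices, and the others may
-- use any nonempty slice. Contradictions arise there by growing an interval of sums from the two
-- heavy positions until it covers all p residues. The condition λ ≤ K - 5 is the exact room for
-- this: two holes in m + 2 places still give K m + K - 3 consecutive sums, and p = K m + λ + 2. The
-- boundary case, in which 0 is reached only by sums of extreme indices, cannot be excluded when ℓ =
-- 1, and it is the source of type 2.

-- Moves everything to one side: a linear inequality follows from h once the
-- two sides differ by a semiring identity with slack e.
linear : ∀ {l r} x y e → l ≤ r → x + r + e ≡ y + l → x ≤ y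
linear {l} {r} x y e h eq = +-cancelʳ-≤ r x y (≤-trans (m≤m+n (x + r) e) (≤-trans (≤-reflexive eq) (+-monoʳ-≤ y h)))

absurd-linear : ∀ {l r} e → l ≤ r → l ≡ r + suc e → ⊥
absurd-linear {l} {r} e h eq = <⇒≱ (≤-trans (s≤s (m≤m+n r e)) (≤-reflexive (trans (sym (ℕₚ.+-suc r e)) (sym eq)))) h

true≢false : ∀ {b} → b ≡ true → b ≡ false → ⊥
true≢false refl ()

¬true⇒false : ∀ {b} → ¬ (b ≡ true) → b ≡ false
¬true⇒false {true}  h = ⊥-elim (h refl)
¬true⇒false {false} h = refl

bool-cases : ∀ b → (b ≡ true) ⊎ (b ≡ false)
bool-cases true  = inj₁ refl
bool-cases false = inj₂ refl

bool-ext : ∀ {b c} → (b ≡ true → c ≡ true) → (c ≡ true → b ≡ true) → b ≡ c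
bool-ext {true}          f g = sym (f refl)
bool-ext {false} {true}  f g = g refl
bool-ext {false} {false} f g = refl

not-true : ∀ {b} → not b ≡ true → b ≡ false
not-true {false} _ = refl

∧-intro : ∀ {a b} → a ≡ true → b ≡ true → a ∧ b ≡ true
∧-intro refl refl = refl

∧-elim : ∀ {a b} → a ∧ b ≡ true → (a ≡ true) × (b ≡ true)
∧-elim {true} {true} refl = refl , refl

∨-introˡ : ∀ {a b} → a ≡ true → a ∨ b ≡ true
∨-introˡ refl = refl

∨-introʳ : ∀ {a b} → b ≡ true → a ∨ b ≡ true
∨-introʳ {true}  refl = refl
∨-introʳ {false} refl = refl

∨-elim : ∀ {a b} → a ∨ b ≡ true → (a ≡ true) ⊎ (b ≡ true)
∨-elim {true}  e = inj₁ refl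
∨-elim {false} e = inj₂ e

does-true : ∀ {P : Set} (d : Dec P) → does d ≡ true → P
does-true (yes x) e = x

does-intro : ∀ {P : Set} (d : Dec P) → P → does d ≡ true
does-intro = dec-true

-- Finite sums over a commutative semiring

module Summation {R : Set} {_⊕_ _⊗_ : R → R → R} {0# 1# : R} (S : IsCommutativeSemiring _≡_ _⊕_ _⊗_ 0# 1#) where
  open IsCommutativeSemiring S hiding (refl; sym; trans)
  open ≡-Reasoning

  ∑ : {A : Set} → List A → (A → R) → R
  ∑ xs f = foldr _⊕_ 0# (map f xs)

  𝟙 : Bool → R
  𝟙 b = if b then 1# else 0#

  ∑-cong : {A : Set} (xs : List A) {f g : A → R} → (∀ x → f x ≡ g x) → ∑ xs f ≡ ∑ xs g
  ∑-cong []       h = refl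
  ∑-cong (x ∷ xs) h = cong₂ _⊕_ (h x) (∑-cong xs h)

  ∑-zero : {A : Set} (xs : List A) → ∑ xs (λ _ → 0#) ≡ 0#
  ∑-zero []       = refl
  ∑-zero (x ∷ xs) = trans (+-identityˡ _) (∑-zero xs)

  interchange : ∀ a b c d → (a ⊕ b) ⊕ (c ⊕ d) ≡ (a ⊕ c) ⊕ (b ⊕ d)
  interchange a b c d = begin
    (a ⊕ b) ⊕ (c ⊕ d)  ≡⟨ +-assoc a b _ ⟩
    a ⊕ (b ⊕ (c ⊕ d))  ≡⟨ cong (a ⊕_) (trans (sym (+-assoc b c d)) (trans (cong (_⊕ d) (+-comm b c)) (+-assoc c b d))) ⟩
    a ⊕ (c ⊕ (b ⊕ d))  ≡⟨ sym (+-assoc a c _) ⟩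
    (a ⊕ c) ⊕ (b ⊕ d)  ∎

  ∑-+ : {A : Set} (xs : List A) (f g : A → R) → ∑ xs (λ x → f x ⊕ g x) ≡ ∑ xs f ⊕ ∑ xs g
  ∑-+ []       f g = sym (+-identityˡ _)
  ∑-+ (x ∷ xs) f g = trans (cong ((f x ⊕ g x) ⊕_) (∑-+ xs f g)) (interchange _ _ _ _)

  ∑-*ˡ : {A : Set} (xs : List A) (c : R) (f : A → R) → ∑ xs (λ x → c ⊗ f x) ≡ c ⊗ ∑ xs f
  ∑-*ˡ []       c f = sym (zeroʳ c)
  ∑-*ˡ (x ∷ xs) c f = trans (cong ((c ⊗ f x) ⊕_) (∑-*ˡ xs c f)) (sym (distribˡ c _ _))

  ∑-*ʳ : {A : Set} (xs : List A) (c : R) (f : A → R) → ∑ xs (λ x → f x ⊗ c) ≡ ∑ xs f ⊗ c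
  ∑-*ʳ xs c f = trans (∑-cong xs (λ x → *-comm (f x) c)) (trans (∑-*ˡ xs c f) (*-comm c _))

  ∑-swap : {A B : Set} (xs : List A) (ys : List B) (f : A → B → R) →
           ∑ xs (λ x → ∑ ys (f x)) ≡ ∑ ys (λ y → ∑ xs (λ x → f x y))
  ∑-swap []       ys f = sym (∑-zero ys)
  ∑-swap (x ∷ xs) ys f = trans (cong (∑ ys (f x) ⊕_) (∑-swap xs ys f)) (sym (∑-+ ys _ _))

  ∑-++ : {A : Set} (xs ys : List A) (f : A → R) → ∑ (xs ++ ys) f ≡ ∑ xs f ⊕ ∑ ys f
  ∑-++ []       ys f = sym (+-identityˡ _)
  ∑-++ (x ∷ xs) ys f = trans (cong (f x ⊕_) (∑-++ xs ys f)) (sym (+-assoc _ _ _))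

  ∑-map : {A B : Set} (g : B → A) (xs : List B) (f : A → R) → ∑ (map g xs) f ≡ ∑ xs (f ∘ g)
  ∑-map g []       f = refl
  ∑-map g (x ∷ xs) f = cong (f (g x) ⊕_) (∑-map g xs f)

  ∑-concatMap : {A B : Set} (g : B → List A) (xs : List B) (f : A → R) →
                ∑ (concatMap g xs) f ≡ ∑ xs (λ b → ∑ (g b) f)
  ∑-concatMap g []       f = refl
  ∑-concatMap g (x ∷ xs) f = trans (∑-++ (g x) (concatMap g xs) f) (cong (∑ (g x) f ⊕_) (∑-concatMap g xs f))

  _×̂_ : ℕ → R → R
  zero  ×̂ r = 0#
  suc n ×̂ r = r ⊕ (n ×̂ r)

  -- The multiplicity is kept because the induction passes through tails of the list, in which `a`
  -- need no longer occur exactly once.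
  ∑-δ-mult : {A : Set} (_≟_ : DecidableEquality A) (xs : List A) (a : A) (f : A → R) →
             ∑ xs (λ x → 𝟙 (does (x ≟ a)) ⊗ f x) ≡ count (λ x → does (x ≟ a)) xs ×̂ f a
  ∑-δ-mult _≟_ []       a f = refl
  ∑-δ-mult _≟_ (x ∷ xs) a f with x ≟ a
  ... | yes refl = cong₂ _⊕_ (*-identityˡ _) (∑-δ-mult _≟_ xs a f)
  ... | no  _    = trans (cong₂ _⊕_ (zeroˡ _) (∑-δ-mult _≟_ xs a f)) (+-identityˡ _)

-- A list in which every element occurs once makes the counts of the statement, which run over
-- `allFin` and `allVecs`, into cardinalities without any conversion.
record Finite (A : Set) : Set where
  field
    elems : List A
    _≟_   : DecidableEquality A
    once  : ∀ a → count (λ x → does (x ≟ a)) elems ≡ 1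

  δ : A → A → Bool
  δ a b = does (a ≟ b)

module FiniteSummation {R : Set} {_⊕_ _⊗_ : R → R → R} {0# 1# : R} (S : IsCommutativeSemiring _≡_ _⊕_ _⊗_ 0# 1#)
                       {A : Set} (E : Finite A) where
  open IsCommutativeSemiring S hiding (refl; sym; trans)
  open Summation S
  open Finite E

  ∑-δ : ∀ a (f : A → R) → ∑ elems (λ x → 𝟙 (δ x a) ⊗ f x) ≡ f a
  ∑-δ a f = trans (∑-δ-mult _≟_ elems a f) (trans (cong (_×̂ f a) (once a)) (+-identityʳ _))

  ∑-δ₁ : ∀ a → ∑ elems (λ x → 𝟙 (δ x a)) ≡ 1#
  ∑-δ₁ a = trans (∑-cong elems (λ x → sym (*-identityʳ _))) (∑-δ a (λ _ → 1#))

  δ-sym-does : ∀ x y → does (x ≟ y) ≡ does (y ≟ x)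
  δ-sym-does x y with x ≟ y
  ... | yes refl = sym (dec-true (x ≟ x) refl)
  ... | no  x≢y  = sym (dec-false (y ≟ x) (x≢y ∘ sym))

  -- Each term is written as a delta sum and the order of summation is exchanged, so no
  -- rearrangement of the list of elements has to be exhibited.
  ∑-bijection : (σ τ : A → A) → (∀ x → σ (τ x) ≡ x) → (∀ x → τ (σ x) ≡ x) →
                (f : A → R) → ∑ elems (f ∘ σ) ≡ ∑ elems f
  ∑-bijection σ τ στ τσ f = begin
    ∑ elems (f ∘ σ)
      ≡⟨ ∑-cong elems (λ x → sym (∑-δ (σ x) f)) ⟩
    ∑ elems (λ x → ∑ elems (λ y → 𝟙 (δ y (σ x)) ⊗ f y))
      ≡⟨ ∑-swap elems elems _ ⟩
    ∑ elems (λ y → ∑ elems (λ x → 𝟙 (δ y (σ x)) ⊗ f y))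
      ≡⟨ ∑-cong elems (λ y → ∑-*ʳ elems (f y) _) ⟩
    ∑ elems (λ y → ∑ elems (λ x → 𝟙 (δ y (σ x))) ⊗ f y)
      ≡⟨ ∑-cong elems (λ y → cong (_⊗ f y) (trans (∑-cong elems (λ x → cong 𝟙 (move x y))) (∑-δ₁ (τ y)))) ⟩
    ∑ elems (λ y → 1# ⊗ f y)
      ≡⟨ ∑-cong elems (λ y → *-identityˡ _) ⟩
    ∑ elems f ∎
    where
    open ≡-Reasoning
    move : ∀ x y → δ y (σ x) ≡ δ x (τ y)
    move x y with x ≟ τ y
    ... | yes refl = dec-true (y ≟ σ (τ y)) (sym (στ y))
    ... | no  h    = dec-false (y ≟ σ x) (λ e → h (trans (sym (τσ x)) (cong τ (sym e))))

module ℕΣ = Summation ℕₚ.+-*-isCommutativeSemiring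

∑-mono : {A : Set} (xs : List A) {f g : A → ℕ} → (∀ x → f x ≤ g x) → ℕΣ.∑ xs f ≤ ℕΣ.∑ xs g
∑-mono []       h = z≤n
∑-mono (x ∷ xs) h = +-mono-≤ (h x) (∑-mono xs h)

∑-pos : {A : Set} (xs : List A) (f : A → ℕ) → 1 ≤ ℕΣ.∑ xs f → ∃[ x ] 1 ≤ f x
∑-pos (x ∷ xs) f h with f x in eq
... | zero  = ∑-pos xs f h
... | suc n = x , subst (1 ≤_) (sym eq) (s≤s z≤n)

any-intro : {A : Set} (xs : List A) (f : A → Bool) → 1 ≤ count f xs → any f xs ≡ true
any-intro (x ∷ xs) f h with f x
... | true  = refl
... | false = any-intro xs f h

any-elim : {A : Set} (xs : List A) (f : A → Bool) → any f xs ≡ true → ∃[ x ] f x ≡ true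
any-elim (x ∷ xs) f h with f x in eq
... | true  = x , eq
... | false = any-elim xs f h

-- Cardinalities of decidable subsets

module FiniteSet {A : Set} (E : Finite A) where
  open Finite E public
  open ℕΣ
  open FiniteSummation ℕₚ.+-*-isCommutativeSemiring E public using (∑-δ; ∑-δ₁; ∑-bijection)

  # : (A → Bool) → ℕ
  # X = count X elems

  _⊆_ : (A → Bool) → (A → Bool) → Set
  X ⊆ Y = ∀ x → X x ≡ true → Y x ≡ true

  card-mono : ∀ {X Y} → X ⊆ Y → (# X) ≤ (# Y)
  card-mono {X} {Y} h = ∑-mono elems λ x → aux x (X x) refl
    where
    aux : ∀ x b → X x ≡ b → 𝟙 b ≤ 𝟙 (Y x)
    aux x true  e = ≤-reflexive (cong 𝟙 (sym (h x e)))
    aux x false e = z≤n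

  card-cong : ∀ {X Y} → (∀ x → X x ≡ Y x) → (# X) ≡ (# Y)
  card-cong h = ∑-cong elems (cong 𝟙 ∘ h)

  card-bijection : (σ τ : A → A) → (∀ x → σ (τ x) ≡ x) → (∀ x → τ (σ x) ≡ x) → ∀ X → (# (X ∘ σ)) ≡ (# X)
  card-bijection σ τ στ τσ X = ∑-bijection σ τ στ τσ (𝟙 ∘ X)

  card-singleton : ∀ a → (# ((λ x → δ x a))) ≡ 1
  card-singleton = ∑-δ₁

  card-witness : ∀ X → 1 ≤ (# X) → ∃[ x ] X x ≡ true
  card-witness X h = let x , 1≤ = ∑-pos elems (𝟙 ∘ X) h in x , aux (X x) 1≤
    where
    aux : ∀ b → 1 ≤ 𝟙 b → b ≡ true
    aux true _ = refl

  δ-refl : ∀ a → δ a a ≡ true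
  δ-refl a = dec-true (a ≟ a) refl

  δ-≡ : ∀ {a b} → δ a b ≡ true → a ≡ b
  δ-≡ {a} {b} = does-true (a ≟ b)

  card-pos : ∀ X {a} → X a ≡ true → 1 ≤ (# X)
  card-pos X {a} e = ≤-trans (≤-reflexive (sym (card-singleton a)))
    (card-mono λ x d → trans (cong X (δ-≡ d)) e)

  _∪_ _∩_ _∖_ : (A → Bool) → (A → Bool) → (A → Bool)
  (X ∪ Y) x = X x ∨ Y x
  (X ∩ Y) x = X x ∧ Y x
  (X ∖ Y) x = X x ∧ not (Y x)

  full : A → Bool
  full _ = true

  ∁ : (A → Bool) → (A → Bool)
  ∁ X x = not (X x)

  card-∪∩ : ∀ X Y → (# (X ∪ Y)) + (# (X ∩ Y)) ≡ (# X) + (# Y)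
  card-∪∩ X Y = trans (sym (∑-+ elems _ _)) (trans (∑-cong elems (λ x → aux (X x) (Y x))) (∑-+ elems _ _))
    where
    aux : ∀ a b → 𝟙 (a ∨ b) + 𝟙 (a ∧ b) ≡ 𝟙 a + 𝟙 b
    aux true true = refl
    aux true false = refl
    aux false true = refl
    aux false false = refl

  card-∖ : ∀ X Y → (# (X ∖ Y)) + (# (X ∩ Y)) ≡ (# X)
  card-∖ X Y = trans (sym (∑-+ elems _ _)) (∑-cong elems (λ x → aux (X x) (Y x)))
    where
    aux : ∀ a b → 𝟙 (a ∧ not b) + 𝟙 (a ∧ b) ≡ 𝟙 a
    aux true true = refl
    aux true false = refl
    aux false true = refl
    aux false false = refl

  card-∁ : ∀ X → (# (∁ X)) + (# X) ≡ (# full)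
  card-∁ X = trans (sym (∑-+ elems _ _)) (∑-cong elems (λ x → aux (X x)))
    where
    aux : ∀ a → 𝟙 (not a) + 𝟙 a ≡ 1
    aux true = refl
    aux false = refl

  card-≤full : ∀ X → (# X) ≤ (# full)
  card-≤full X = card-mono λ _ _ → refl

  card-⊆-witness : ∀ X Y → (# Y) < (# X) → ∃[ x ] (X x ≡ true) × (Y x ≡ false)
  card-⊆-witness X Y h = let x , e = card-witness (X ∖ Y) (pos ((# (X ∖ Y))) refl)
                             e₁ , e₂ = ∧-elim e
                         in x , e₁ , not-true e₂
    where
    pos : ∀ n → (# (X ∖ Y)) ≡ n → 1 ≤ n
    pos (suc n) e = s≤s z≤n
    pos zero    e = ⊥-elim (<⇒≱ h (≤-trans (≤-reflexive (trans (sym (card-∖ X Y)) (cong (_+ (# (X ∩ Y))) e)))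
                                            (card-mono λ x → proj₂ ∘ ∧-elim)))

  ⊆-full : ∀ X → (# full) ≤ (# X) → ∀ x → X x ≡ true
  ⊆-full X h x with X x in eq
  ... | true  = refl
  ... | false = ⊥-elim (<⇒≱ (≤-trans (+-monoˡ-≤ ((# X)) (card-pos (∁ X) (cong not eq))) (≤-reflexive (card-∁ X))) h)

  -- The tool for equality cases: when a counting bound is sharp, an inclusion can be reversed.
  ⊆-antisym-card : ∀ X Y → X ⊆ Y → (# Y) ≤ (# X) → Y ⊆ X
  ⊆-antisym-card X Y s h y ey with X y in eq
  ... | true  = refl
  ... | false = ⊥-elim (<⇒≱ {(# X)} {(# Y)} lt h)
    where
    open ≡-Reasoning
    lt : (# X) < (# Y)
    lt = ≤-trans (+-mono-≤ (card-pos (Y ∖ X) (∧-intro ey (cong not eq)))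
                           (card-mono {X} {Y ∩ X} λ x e → ∧-intro (s x e) e))
                 (≤-reflexive (card-∖ Y X))

  card-≤1 : ∀ X → (∀ x y → X x ≡ true → X y ≡ true → x ≡ y) → (# X) ≤ 1
  card-≤1 X u with 1 ≤? (# X)
  ... | no  h = ≤-trans (ℕₚ.≤-pred (≰⇒> h)) z≤n
  ... | yes h = let a , ea = card-witness X h in
    ≤-trans (card-mono {X} {λ x → δ x a} λ x e → dec-true (x ≟ a) (u x a e ea)) (≤-reflexive (card-singleton a))

  any-true : ∀ (f : A → Bool) {a} → f a ≡ true → any f elems ≡ true
  any-true f e = any-intro elems f (card-pos f e)

  -- Exhaustive search, by which the later case distinctions on existence stay constructive.
  ∃? : {P : A → Set} → (∀ a → Dec (P a)) → (∃[ a ] P a) ⊎ (∀ a → ¬ P a)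
  ∃? P? with any (λ a → does (P? a)) elems in eq
  ... | true  = inj₁ (let a , e = any-elim elems _ eq in a , does-true (P? a) e)
  ... | false = inj₂ λ a h → true≢false (any-true (λ a → does (P? a)) (dec-true (P? a) h)) eq

-- Arithmetic of the prime field

-- The operations are kept abstract in the theory below, because unification
-- cannot see through modular reduction.
record FieldOps (p : ℕ) : Set where
  infixl 6 _⊞_
  infixl 7 _⊠_
  infix  8 ⊖_
  field
    _⊞_ _⊠_ : Fin p → Fin p → Fin p
    ⊖_      : Fin p → Fin p
    em      : ℕ → Fin p
    isCommutativeRing : IsCommutativeRing _≡_ _⊞_ _⊠_ ⊖_ (em 0) (em 1)
    em-+    : ∀ a b → em (a + b) ≡ em a ⊞ em b
    em-*    : ∀ a b → em (a * b) ≡ em a ⊠ em b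
    em-p    : em p ≡ em 0
    em-toℕ  : ∀ x → em (toℕ x) ≡ x
    toℕ-em-< : ∀ {c} → c < p → toℕ (em c) ≡ c
    inverse : ∀ a → a ≢ em 0 → ∃[ b ] b ⊠ a ≡ em 1
    1<p     : 1 < p

module PrimeField {p : ℕ} (F : FieldOps p) where
  open FieldOps F public

  infixl 6 _⊟_

  𝔽 : Set
  𝔽 = Fin p

  𝟘 𝟙ᶠ : 𝔽
  𝟘  = em 0
  𝟙ᶠ = em 1

  _⊟_ : 𝔽 → 𝔽 → 𝔽
  x ⊟ y = x ⊞ (⊖ y)

  𝔽-ring : CommutativeRing _ _
  𝔽-ring = record { isCommutativeRing = isCommutativeRing }

  open IsCommutativeRing isCommutativeRing public using (+-isAbelianGroup) renaming (+-assoc to ⊞-assoc; +-comm to ⊞-comm; +-identityˡ to ⊞-identityˡ; +-identityʳ to ⊞-identityʳ; -‿inverseʳ to ⊖-inverseʳ; -‿inverseˡ to ⊖-inverseˡ; *-assoc to ⊠-assoc; *-comm to ⊠-comm; *-identityˡ to ⊠-identityˡ; *-identityʳ to ⊠-identityʳ; distribˡ to ⊠-distribˡ; distribʳ to ⊠-distribʳ; zeroˡ to ⊠-zeroˡ; zeroʳ to ⊠-zeroʳ)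

  em-injective : ∀ {a b} → a < p → b < p → em a ≡ em b → a ≡ b
  em-injective a< b< e = trans (sym (toℕ-em-< a<)) (trans (cong toℕ e) (toℕ-em-< b<))

  private
    module RP = Algebra.Properties.Ring (CommutativeRing.ring 𝔽-ring)
    module AG = Algebra.Properties.AbelianGroup (CommutativeRing.+-abelianGroup 𝔽-ring)

    -- The canonical homomorphism from the integers. With integer coefficients the ring solver reads
    -- `con (+ 1)` as `em 1` by computation and can handle signs.
    ⟦_⟧ℤ : ℤ → 𝔽
    ⟦ + n ⟧ℤ      = em n
    ⟦ -[1+ n ] ⟧ℤ = ⊖ em (suc n)

    ⊖𝟘 : ⊖ 𝟘 ≡ 𝟘
    ⊖𝟘 = AG.ε⁻¹≈ε

    neg-homo : ∀ i → ⟦ ℤ.- i ⟧ℤ ≡ ⊖ ⟦ i ⟧ℤ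
    neg-homo (+ zero)  = sym ⊖𝟘
    neg-homo (+ suc n) = refl
    neg-homo -[1+ n ]  = sym (AG.⁻¹-involutive _)

    cancel1 : ∀ x y z → (z ⊞ x) ⊞ ⊖ (z ⊞ y) ≡ x ⊞ ⊖ y
    cancel1 x y z = begin
      (z ⊞ x) ⊞ ⊖ (z ⊞ y)        ≡⟨ cong₂ _⊞_ (⊞-comm z x) (sym (AG.⁻¹-∙-comm z y)) ⟩
      (x ⊞ z) ⊞ (⊖ z ⊞ ⊖ y)      ≡⟨ ⊞-assoc x z _ ⟩
      x ⊞ (z ⊞ (⊖ z ⊞ ⊖ y))      ≡⟨ cong (x ⊞_) (trans (sym (⊞-assoc z _ _)) (trans (cong (_⊞ ⊖ y) (⊖-inverseʳ z)) (⊞-identityˡ _))) ⟩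
      x ⊞ ⊖ y ∎
      where open ≡-Reasoning

    ⊖-homo : ∀ m n → ⟦ m ℤ.⊖ n ⟧ℤ ≡ em m ⊞ ⊖ em n
    ⊖-homo m zero = sym (trans (cong (em m ⊞_) ⊖𝟘) (trans (⊞-comm _ _) (⊞-identityˡ _)))
    ⊖-homo zero (suc n) = sym (⊞-identityˡ _)
    ⊖-homo (suc m) (suc n) = trans (cong ⟦_⟧ℤ (ℤₚ.[1+m]⊖[1+n]≡m⊖n m n))
      (trans (⊖-homo m n) (sym (trans (cong₂ (λ a b → a ⊞ ⊖ b) (em-+ 1 m) (em-+ 1 n)) (cancel1 (em m) (em n) (em 1)))))

    +-homo : ∀ i j → ⟦ i ℤ.+ j ⟧ℤ ≡ ⟦ i ⟧ℤ ⊞ ⟦ j ⟧ℤ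
    +-homo (+ m) (+ n) = em-+ m n
    +-homo (+ m) -[1+ n ] = ⊖-homo m (suc n)
    +-homo -[1+ m ] (+ n) = trans (⊖-homo n (suc m)) (⊞-comm _ _)
    +-homo -[1+ m ] -[1+ n ] = trans (cong ⊖_ (trans (cong (em ∘ suc) (sym (ℕₚ.+-suc m n))) (em-+ (suc m) (suc n)))) (sym (AG.⁻¹-∙-comm _ _))

    *-homo⁺ : ∀ m j → ⟦ + m ℤ.* j ⟧ℤ ≡ em m ⊠ ⟦ j ⟧ℤ
    *-homo⁺ m (+ n) = trans (cong ⟦_⟧ℤ (sym (ℤₚ.pos-* m n))) (em-* m n)
    *-homo⁺ m -[1+ n ] = trans (cong ⟦_⟧ℤ (sym (ℤₚ.neg-distribʳ-* (+ m) (+ suc n))))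
      (trans (neg-homo (+ m ℤ.* + suc n)) (trans (cong ⊖_ (*-homo⁺ m (+ suc n))) (RP.-‿distribʳ-* _ _)))

    *-homo : ∀ i j → ⟦ i ℤ.* j ⟧ℤ ≡ ⟦ i ⟧ℤ ⊠ ⟦ j ⟧ℤ
    *-homo (+ m) j = *-homo⁺ m j
    *-homo -[1+ m ] j = trans (cong ⟦_⟧ℤ (sym (ℤₚ.neg-distribˡ-* (+ suc m) j)))
      (trans (neg-homo (+ suc m ℤ.* j)) (trans (cong ⊖_ (*-homo⁺ (suc m) j)) (RP.-‿distribˡ-* _ _)))

    𝔽-acr : AlmostCommutativeRing _ _
    𝔽-acr = fromCommutativeRing 𝔽-ring

    morphism : ℤ.+-*-rawRing -Raw-AlmostCommutative⟶ 𝔽-acr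
    morphism = record { ⟦_⟧ = ⟦_⟧ℤ ; +-homo = +-homo ; *-homo = *-homo ; -‿homo = neg-homo ; 0-homo = refl ; 1-homo = refl }

    coeff≟ : ∀ i j → Maybe (⟦ i ⟧ℤ ≡ ⟦ j ⟧ℤ)
    coeff≟ i j with i ℤ.≟ j
    ... | yes e = just (cong ⟦_⟧ℤ e)
    ... | no  _ = nothing

  module 𝔽-Solver = Algebra.Solver.Ring ℤ.+-*-rawRing 𝔽-acr morphism
    coeff≟

  ⊖-involutive : ∀ x → ⊖ ⊖ x ≡ x
  ⊖-involutive = AG.⁻¹-involutive

  ⊟-≡ : ∀ {x y} → x ⊟ y ≡ 𝟘 → x ≡ y
  ⊟-≡ {x} {y} = AG.x∙y⁻¹≈ε⇒x≈y x y

module ConcreteField (p : ℕ) .{{_ : NonZero p}} where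

  infixl 6 _⊞_ _⊟_
  infixl 7 _⊠_
  infix  8 ⊖_

  𝔽 : Set
  𝔽 = Fin p

  em : ℕ → 𝔽
  em = emb p

  _⊞_ _⊟_ _⊠_ : 𝔽 → 𝔽 → 𝔽
  _⊞_ = _+ₚ_ p
  _⊟_ = _-ₚ_ p
  _⊠_ = _*ₚ_ p

  ⊖_ : 𝔽 → 𝔽
  ⊖_ = -ₚ_ p

  𝟘 𝟙ᶠ : 𝔽
  𝟘  = em 0
  𝟙ᶠ = em 1

  toℕ-em : ∀ c → toℕ (em c) ≡ c % p
  toℕ-em c = Finₚ.toℕ-fromℕ< (m%n<n c p)

  toℕ-em-< : ∀ {c} → c < p → toℕ (em c) ≡ c
  toℕ-em-< {c} h = trans (toℕ-em c) (m<n⇒m%n≡m h)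

  em-% : ∀ {a b} → a % p ≡ b % p → em a ≡ em b
  em-% {a} {b} e = Finₚ.toℕ-injective (trans (toℕ-em a) (trans e (sym (toℕ-em b))))

  em-toℕ : ∀ a → em (toℕ a) ≡ a
  em-toℕ a = Finₚ.toℕ-injective (toℕ-em-< (Finₚ.toℕ<n a))

  em-+ : ∀ a b → em (a + b) ≡ em a ⊞ em b
  em-+ a b = em-% (trans (%-distribˡ-+ a b p) (cong₂ (λ x y → (x + y) % p) (sym (toℕ-em a)) (sym (toℕ-em b))))

  em-* : ∀ a b → em (a * b) ≡ em a ⊠ em b
  em-* a b = em-% (trans (%-distribˡ-* a b p) (cong₂ (λ x y → (x * y) % p) (sym (toℕ-em a)) (sym (toℕ-em b))))

  em-p : em p ≡ 𝟘
  em-p = em-% (trans (cong (_% p) (sym (ℕₚ.*-identityˡ p))) ([m+kn]%n≡m%n 0 1 p))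

  private
    -- Every residue is `em` of a natural number and `em` respects both operations, so the ring laws
    -- descend from the natural numbers.
    via : ∀ {P : 𝔽 → Set} → (∀ a → P (em a)) → ∀ x → P x
    via {P} h x = subst P (em-toℕ x) (h (toℕ x))

    via₂ : ∀ {P : 𝔽 → 𝔽 → Set} → (∀ a b → P (em a) (em b)) → ∀ x y → P x y
    via₂ {P} h = via {λ x → ∀ y → P x y} (λ a → via (h a))

    via₃ : ∀ {P : 𝔽 → 𝔽 → 𝔽 → Set} → (∀ a b c → P (em a) (em b) (em c)) → ∀ x y z → P x y z
    via₃ {P} h = via {λ x → ∀ y z → P x y z} (λ a → via₂ (h a))

    lift+ : ∀ a b {c} → a + b ≡ c → em a ⊞ em b ≡ em c
    lift+ a b e = trans (sym (em-+ a b)) (cong em e)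

    lift* : ∀ a b {c} → a * b ≡ c → em a ⊠ em b ≡ em c
    lift* a b e = trans (sym (em-* a b)) (cong em e)

  ⊞-assoc : ∀ x y z → (x ⊞ y) ⊞ z ≡ x ⊞ (y ⊞ z)
  ⊞-assoc = via₃ λ a b c → trans (cong (_⊞ em c) (sym (em-+ a b)))
    (trans (lift+ (a + b) c (ℕₚ.+-assoc a b c)) (trans (em-+ a (b + c)) (cong (em a ⊞_) (em-+ b c))))

  ⊞-comm : ∀ x y → x ⊞ y ≡ y ⊞ x
  ⊞-comm x y = cong em (ℕₚ.+-comm (toℕ x) (toℕ y))

  ⊞-identityˡ : ∀ x → 𝟘 ⊞ x ≡ x
  ⊞-identityˡ = via λ a → lift+ 0 a refl

  ⊖-inverseʳ : ∀ x → x ⊞ ⊖ x ≡ 𝟘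
  ⊖-inverseʳ x = trans (cong (_⊞ ⊖ x) (sym (em-toℕ x)))
    (trans (lift+ (toℕ x) (p ∸ toℕ x) (ℕₚ.m+[n∸m]≡n (ℕₚ.<⇒≤ (Finₚ.toℕ<n x)))) em-p)

  ⊠-assoc : ∀ x y z → (x ⊠ y) ⊠ z ≡ x ⊠ (y ⊠ z)
  ⊠-assoc = via₃ λ a b c → trans (cong (_⊠ em c) (sym (em-* a b)))
    (trans (lift* (a * b) c (ℕₚ.*-assoc a b c)) (trans (em-* a (b * c)) (cong (em a ⊠_) (em-* b c))))

  ⊠-comm : ∀ x y → x ⊠ y ≡ y ⊠ x
  ⊠-comm x y = cong em (ℕₚ.*-comm (toℕ x) (toℕ y))

  ⊠-identityˡ : ∀ x → 𝟙ᶠ ⊠ x ≡ x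
  ⊠-identityˡ = via λ a → lift* 1 a (ℕₚ.*-identityˡ a)

  ⊠-distribˡ : ∀ x y z → x ⊠ (y ⊞ z) ≡ x ⊠ y ⊞ x ⊠ z
  ⊠-distribˡ = via₃ λ a b c → trans (cong (em a ⊠_) (sym (em-+ b c)))
    (trans (lift* a (b + c) (ℕₚ.*-distribˡ-+ a b c)) (trans (em-+ (a * b) (a * c)) (cong₂ _⊞_ (em-* a b) (em-* a c))))

  𝔽-ring : CommutativeRing _ _
  𝔽-ring = record
    { Carrier = 𝔽 ; _≈_ = _≡_ ; _+_ = _⊞_ ; _*_ = _⊠_ ; -_ = ⊖_ ; 0# = 𝟘 ; 1# = 𝟙ᶠ
    ; isCommutativeRing = record
      { isRing = record
        { +-isAbelianGroup = record
          { isGroup = record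
            { isMonoid = record
              { isSemigroup = record
                { isMagma = record { isEquivalence = isEquivalence ; ∙-cong = cong₂ _⊞_ }
                ; assoc = ⊞-assoc }
              ; identity = ⊞-identityˡ , λ x → trans (⊞-comm x 𝟘) (⊞-identityˡ x) }
            ; inverse = (λ x → trans (⊞-comm (⊖ x) x) (⊖-inverseʳ x)) , ⊖-inverseʳ
            ; ⁻¹-cong = cong ⊖_ }
          ; comm = ⊞-comm }
        ; *-cong = cong₂ _⊠_
        ; *-assoc = ⊠-assoc
        ; *-identity = ⊠-identityˡ , λ x → trans (⊠-comm x 𝟙ᶠ) (⊠-identityˡ x)
        ; distrib = ⊠-distribˡ , λ x y z → trans (⊠-comm (y ⊞ z) x) (trans (⊠-distribˡ x y z) (cong₂ _⊞_ (⊠-comm x y) (⊠-comm x z))) }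
      ; *-comm = ⊠-comm } }

  private
    module RP = Algebra.Properties.Ring (CommutativeRing.ring 𝔽-ring)
    module AG = Algebra.Properties.AbelianGroup (CommutativeRing.+-abelianGroup 𝔽-ring)

  module _ (pr : Prime p) where

    1<p : 1 < p
    1<p = aux p pr
      where
      aux : ∀ p → Prime p → 1 < p
      aux (suc (suc p)) (prime _) = s≤s (s≤s z≤n)

    private
      n<p : ∀ {a : 𝔽} {n} → toℕ a ≡ suc n → suc n < p
      n<p {a} eq = subst (_< p) eq (Finₚ.toℕ<n a)

    -- Bézout's identity for p and the representative of a. The coefficients are natural numbers,
    -- hence two cases: y inverts a if y a = 1 + x p, and -y does if 1 + y a = x p.
    inverse : ∀ a → a ≢ 𝟘 → ∃[ b ] b ⊠ a ≡ 𝟙ᶠ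
    inverse a a≢0 = go (toℕ a) refl
      where
      open ≡-Reasoning
      negate : ∀ u v → ⊖ u ⊠ v ≡ 𝟙ᶠ ⊟ (𝟙ᶠ ⊞ u ⊠ v)
      negate u v = sym (trans (cong (𝟙ᶠ ⊞_) (sym (AG.⁻¹-∙-comm 𝟙ᶠ (u ⊠ v))))
        (trans (sym (⊞-assoc 𝟙ᶠ (⊖ 𝟙ᶠ) (⊖ (u ⊠ v)))) (trans (cong (_⊞ ⊖ (u ⊠ v)) (⊖-inverseʳ 𝟙ᶠ)) (trans (⊞-identityˡ _) (RP.-‿distribˡ-* u v)))))
      go : ∀ n → toℕ a ≡ n → ∃[ b ] b ⊠ a ≡ 𝟙ᶠ
      go zero    eq = ⊥-elim (a≢0 (trans (sym (em-toℕ a)) (cong em eq)))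
      go (suc n) eq with coprime-Bézout (prime⇒coprime pr (n<p eq))
      ... | Bézout.-+ x y e = em y , (begin
              em y ⊠ a            ≡⟨ cong (em y ⊠_) (trans (sym (em-toℕ a)) (cong em eq)) ⟩
              em y ⊠ em (suc n)   ≡⟨ sym (em-* y (suc n)) ⟩
              em (y * suc n)      ≡⟨ cong em (sym e) ⟩
              em (1 + x * p)      ≡⟨ em-% ([m+kn]%n≡m%n 1 x p) ⟩
              𝟙ᶠ                  ∎)
      ... | Bézout.+- x y e = ⊖ em y , (begin
              ⊖ em y ⊠ a            ≡⟨ cong (⊖ em y ⊠_) (trans (sym (em-toℕ a)) (cong em eq)) ⟩
              ⊖ em y ⊠ em (suc n)   ≡⟨ negate (em y) (em (suc n)) ⟩
              𝟙ᶠ ⊟ (𝟙ᶠ ⊞ em y ⊠ em (suc n)) ≡⟨ cong (𝟙ᶠ ⊟_) (trans (cong (𝟙ᶠ ⊞_) (sym (em-* y (suc n)))) (sym (em-+ 1 (y * suc n)))) ⟩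
              𝟙ᶠ ⊟ em (1 + y * suc n) ≡⟨ cong (λ z → 𝟙ᶠ ⊟ em z) e ⟩
              𝟙ᶠ ⊟ em (0 + x * p)  ≡⟨ cong (𝟙ᶠ ⊟_) (em-% ([m+kn]%n≡m%n 0 x p)) ⟩
              𝟙ᶠ ⊟ 𝟘               ≡⟨ trans (cong (𝟙ᶠ ⊞_) AG.ε⁻¹≈ε) (trans (⊞-comm 𝟙ᶠ 𝟘) (⊞-identityˡ 𝟙ᶠ)) ⟩
              𝟙ᶠ                  ∎)

    fieldOps : FieldOps p
    fieldOps = record
      { _⊞_ = _⊞_ ; _⊠_ = _⊠_ ; ⊖_ = ⊖_ ; em = em ; isCommutativeRing = CommutativeRing.isCommutativeRing 𝔽-ring
      ; em-+ = em-+ ; em-* = em-* ; em-p = em-p ; em-toℕ = em-toℕ ; toℕ-em-< = toℕ-em-< ; inverse = inverse ; 1<p = 1<p }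

-- Finite vector spaces over the prime field

∑-tabulate : ∀ n {A : Set} (g : Fin n → A) (f : A → Bool) → count f (tabulate g) ≡ count (f ∘ g) (allFin n)
∑-tabulate n g f = cong (λ l → count f l) (sym (Listₚ.map-tabulate (λ x → x) g)) ∙ ℕΣ.∑-map g (allFin n) _
  where _∙_ = trans

fin-once : ∀ n (a : Fin n) → count (λ x → does (x Finₚ.≟ a)) (allFin n) ≡ 1
fin-once (suc n) Fin.zero = cong suc (trans (∑-tabulate n Fin.suc _) (ℕΣ.∑-zero (allFin n)))
fin-once (suc n) (Fin.suc a) = trans (∑-tabulate n Fin.suc _) (trans (ℕΣ.∑-cong (allFin n) (λ x → cong ℕΣ.𝟙 (suc-≟ x))) (fin-once n a))
  where
  suc-≟ : ∀ x → does (Fin.suc x Finₚ.≟ Fin.suc a) ≡ does (x Finₚ.≟ a)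
  suc-≟ x with x Finₚ.≟ a
  ... | yes _ = refl
  ... | no _  = refl

Fin-finite : ∀ n → Finite (Fin n)
Fin-finite n = record { elems = allFin n ; _≟_ = Finₚ._≟_ ; once = fin-once n }

card-Fin : ∀ n → count (λ _ → true) (allFin n) ≡ n
card-Fin zero    = refl
card-Fin (suc n) = cong suc (trans (∑-tabulate n Fin.suc _) (card-Fin n))

-- `q` is the size of a hyperplane, the largest subgroup other than the whole group, and therefore
-- the loss in the sumset inequality below. The line itself is the instance with `q` equal to 1.
record Space {p : ℕ} (F : FieldOps p) : Set₁ where
  open PrimeField F using (𝔽; _⊞_; _⊠_; 𝟙ᶠ)
  infixl 6 _+ᵛ_ _-ᵛ_
  infix  8 -ᵛ_
  infixr 7 _·_
  field
    V     : Set
    _+ᵛ_  : V → V → V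
    0ᵛ    : V
    -ᵛ_   : V → V
    _·_   : 𝔽 → V → V
    isAbelianGroup : IsAbelianGroup _≡_ _+ᵛ_ 0ᵛ -ᵛ_
    ·-distrib : ∀ a b v → (a ⊞ b) · v ≡ a · v +ᵛ b · v
    ·-assoc : ∀ a b v → (a ⊠ b) · v ≡ a · b · v
    ·-identity : ∀ v → 𝟙ᶠ · v ≡ v
    finite : Finite V
    q      : ℕ
    size   : count (λ _ → true) (Finite.elems finite) ≡ p * q

  _-ᵛ_ : V → V → V
  x -ᵛ y = x +ᵛ (-ᵛ y)

-- Sumsets and Kneser's inequality

module AdditiveCombinatorics {p : ℕ} {F : FieldOps p} (Sp : Space F) where
  open PrimeField F
  open Space Sp public
  open FiniteSet finite public
  open IsAbelianGroup isAbelianGroup public using () renaming (assoc to +ᵛ-assoc; comm to +ᵛ-comm; identityˡ to +ᵛ-identityˡ; identityʳ to +ᵛ-identityʳ; inverseʳ to -ᵛ-inverseʳ; inverseˡ to -ᵛ-inverseˡ)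

  group : AbelianGroup _ _
  group = record { isAbelianGroup = isAbelianGroup }

  private
    module AG = Algebra.Properties.AbelianGroup group
    module CS = Algebra.Properties.CommutativeSemigroup (AbelianGroup.commutativeSemigroup group)

  open AG public using () renaming (⁻¹-involutive to -ᵛ-involutive; ⁻¹-∙-comm to -ᵛ-+-comm; ε⁻¹≈ε to -ᵛ-0)

  add-sub : ∀ x y → (x +ᵛ y) -ᵛ y ≡ x
  add-sub x y = AG.//-rightDividesʳ y x

  sub-add : ∀ x y → (x -ᵛ y) +ᵛ y ≡ x
  sub-add x y = AG.//-rightDividesˡ y x

  add-sub′ : ∀ x y → (x +ᵛ y) -ᵛ x ≡ y
  add-sub′ x y = trans (cong (_-ᵛ x) (+ᵛ-comm x y)) (add-sub y x)

  sub-sub : ∀ x y → x -ᵛ (x -ᵛ y) ≡ y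
  sub-sub x y = trans (cong (x +ᵛ_) (trans (sym (-ᵛ-+-comm x (-ᵛ y))) (cong (-ᵛ x +ᵛ_) (-ᵛ-involutive y))))
    (trans (sym (+ᵛ-assoc x _ y)) (trans (cong (_+ᵛ y) (-ᵛ-inverseʳ x)) (+ᵛ-identityˡ y)))

  sub-comm : ∀ x y z → (x -ᵛ y) -ᵛ z ≡ (x -ᵛ z) -ᵛ y
  sub-comm x y z = CS.xy∙z≈xz∙y x (-ᵛ y) (-ᵛ z)

  sub-0 : ∀ x → x -ᵛ 0ᵛ ≡ x
  sub-0 x = trans (cong (x +ᵛ_) -ᵛ-0) (+ᵛ-identityʳ x)

  sub-+ : ∀ x y z → x -ᵛ (y +ᵛ z) ≡ (x -ᵛ y) -ᵛ z
  sub-+ x y z = trans (cong (x +ᵛ_) (sym (-ᵛ-+-comm y z))) (sym (+ᵛ-assoc x _ _))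

  sub-≡ : ∀ {x y} → x -ᵛ y ≡ 0ᵛ → x ≡ y
  sub-≡ {x} {y} = AG.x∙y⁻¹≈ε⇒x≈y x y

  0· : ∀ v → 𝟘 · v ≡ 0ᵛ
  0· v = trans (sym (add-sub (𝟘 · v) (𝟘 · v))) (trans (cong (_-ᵛ 𝟘 · v) (trans (sym (·-distrib 𝟘 𝟘 v)) (cong (_· v) (⊞-identityˡ 𝟘)))) (-ᵛ-inverseʳ (𝟘 · v)))

  ⊖· : ∀ a v → (⊖ a) · v ≡ -ᵛ (a · v)
  ⊖· a v = AG.inverseˡ-unique _ _ (trans (sym (·-distrib (⊖ a) a v)) (trans (cong (_· v) (⊖-inverseˡ a)) (0· v)))

  shift : V → (V → Bool) → (V → Bool)
  shift g X x = X (x -ᵛ g)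

  card-shift : ∀ g X → (# (shift g X)) ≡ (# X)
  card-shift g X = card-bijection (_-ᵛ g) (_+ᵛ g) (λ x → add-sub x g) (λ x → sub-add x g) X

  card-reflect : ∀ z X → (# ((λ x → X (z -ᵛ x)))) ≡ (# X)
  card-reflect z X = card-bijection (λ y → z -ᵛ y) (λ y → z -ᵛ y) (sub-sub z) (sub-sub z) X

  neg : (V → Bool) → (V → Bool)
  neg X x = X (-ᵛ x)

  card-neg : ∀ X → (# (neg X)) ≡ (# X)
  card-neg X = card-bijection -ᵛ_ -ᵛ_ -ᵛ-involutive -ᵛ-involutive X

  infixl 6 _⊕_
  -- Spelled out like `sumset` of the statement, so that on the line `X ⊕ X` and `sumset X` agree by
  -- computation.
  _⊕_ : (V → Bool) → (V → Bool) → (V → Bool)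
  (X ⊕ Y) z = any (λ x → X x ∧ Y (z -ᵛ x)) elems

  ⊕-intro′ : ∀ X Y {x z} → X x ≡ true → Y (z -ᵛ x) ≡ true → (X ⊕ Y) z ≡ true
  ⊕-intro′ X Y {x} {z} ex ey = any-true (λ x → X x ∧ Y (z -ᵛ x)) (∧-intro ex ey)

  ⊕-intro : ∀ X Y {x y} → X x ≡ true → Y y ≡ true → (X ⊕ Y) (x +ᵛ y) ≡ true
  ⊕-intro X Y {x} {y} ex ey = ⊕-intro′ X Y ex (trans (cong Y (add-sub′ x y)) ey)

  ⊕-elim : ∀ X Y {z} → (X ⊕ Y) z ≡ true → ∃[ x ] (X x ≡ true) × (Y (z -ᵛ x) ≡ true)
  ⊕-elim X Y {z} e = let x , h = any-elim elems _ e in x , ∧-elim h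

  ⊕-mono : ∀ {X X′ Y Y′} → X ⊆ X′ → Y ⊆ Y′ → (X ⊕ Y) ⊆ (X′ ⊕ Y′)
  ⊕-mono {X} {X′} {Y} {Y′} h h′ z e = let x , ex , ey = ⊕-elim X Y e in ⊕-intro′ X′ Y′ (h x ex) (h′ _ ey)

  ⊕-comm : ∀ X Y → (X ⊕ Y) ⊆ (Y ⊕ X)
  ⊕-comm X Y z e = let x , ex , ey = ⊕-elim X Y e in ⊕-intro′ Y X ey (trans (cong X (sub-sub z x)) ex)

  -- X and z - Y are too large to be disjoint, and a common element is a first summand of z.
  pigeonhole : ∀ X Y → (# full) < (# X) + (# Y) → ∀ z → (X ⊕ Y) z ≡ true
  pigeonhole X Y h z = let x , e = card-witness (X ∩ Y′) pos ; ex , ey = ∧-elim e in ⊕-intro′ X Y ex ey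
    where
    Y′ = λ x → Y (z -ᵛ x)
    pos : 1 ≤ (# (X ∩ Y′))
    pos = +-cancelˡ-≤ (# full) 1 _ (begin
      (# full) + 1               ≡⟨ ℕₚ.+-comm (# full) 1 ⟩
      suc (# full)               ≤⟨ h ⟩
      (# X) + (# Y)              ≡⟨ cong (_+_ (# X)) (sym (card-reflect z Y)) ⟩
      (# X) + (# Y′)             ≡⟨ sym (card-∪∩ X Y′) ⟩
      (# (X ∪ Y′)) + (# (X ∩ Y′))    ≤⟨ +-monoˡ-≤ _ (card-≤full (X ∪ Y′)) ⟩
      (# full) + (# (X ∩ Y′))      ∎)
      where open ℕₚ.≤-Reasoning

  card-⊕ˡ : ∀ X Y {y} → Y y ≡ true → (# X) ≤ (# (X ⊕ Y))
  card-⊕ˡ X Y {y} ey = ≤-trans (≤-reflexive (sym (card-shift y X)))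
    (card-mono {shift y X} {X ⊕ Y} λ z e → ⊕-intro′ X Y e (trans (cong Y (sub-sub z y)) ey))

  card-⊕ʳ : ∀ X Y {x} → X x ≡ true → (# Y) ≤ (# (X ⊕ Y))
  card-⊕ʳ X Y ex = ≤-trans (card-⊕ˡ Y X ex) (card-mono (⊕-comm Y X))

  private
    module 𝔽S = FiniteSet (Fin-finite p)

  Stab : (V → Bool) → V → Set
  Stab X h = ∀ x → X x ≡ true → X (x +ᵛ h) ≡ true

  stab-+ : ∀ X {g h} → Stab X g → Stab X h → Stab X (g +ᵛ h)
  stab-+ X sg sh x ex = trans (cong X (sym (+ᵛ-assoc x _ _))) (sh _ (sg x ex))

  -- Scalars are residues of natural numbers, so a scalar multiple is an iterated translation.
  -- Stabilisers are thus subspaces and not only subgroups.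
  stab-· : ∀ X {h} a → Stab X h → Stab X (a · h)
  stab-· X {h} a sh = subst (λ a → Stab X (a · h)) (em-toℕ a) (go (toℕ a))
    where
    go : ∀ n → Stab X (em n · h)
    go zero    x ex = trans (cong X (trans (cong (x +ᵛ_) (0· h)) (+ᵛ-identityʳ x))) ex
    go (suc n) = subst (Stab X) (trans (cong (_+ᵛ em n · h) (sym (·-identity h))) (trans (sym (·-distrib 𝟙ᶠ (em n) h)) (cong (_· h) (sym (em-+ 1 n)))))
                   (stab-+ X sh (go n))

  -- Stab X is a proper subspace missing g = z₀ - x₀, so every line of
  -- direction g meets it at most once.
  stab-bound : ∀ X Y {x₀ z₀} → X x₀ ≡ true → X z₀ ≡ false → (∀ y → Y y ≡ true → Stab X y) → (# Y) ≤ q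
  stab-bound X Y {x₀} {z₀} ex ez st = ℕₚ.*-cancelˡ-≤ p {{p≢0}} (begin
    p * (# Y)
      ≡⟨ ℕₚ.*-comm p (# Y) ⟩
    (# Y) * p
      ≡⟨ cong ((# Y) *_) (sym (card-Fin p)) ⟩
    (# Y) * ∑ (allFin p) (λ _ → 1)
      ≡⟨ sym (∑-*ˡ (allFin p) (# Y) (λ _ → 1)) ⟩
    ∑ (allFin p) (λ _ → (# Y) * 1)
      ≡⟨ ∑-cong (allFin p) (λ j → trans (ℕₚ.*-identityʳ _) (sym (trans
        (card-bijection (_+ᵛ j · g) (_-ᵛ j · g) (λ x → sub-add x _) (λ x → add-sub x _) Y) refl))) ⟩
    ∑ (allFin p) (λ j → ∑ elems (λ v → 𝟙 (Y (v +ᵛ j · g))))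
      ≡⟨ ∑-swap (allFin p) elems _ ⟩
    ∑ elems (λ v → ∑ (allFin p) (λ j → 𝟙 (Y (v +ᵛ j · g))))
      ≤⟨ ∑-mono elems (λ v → 𝔽S.card-≤1 (λ j → Y (v +ᵛ j · g)) (line v)) ⟩
    ∑ elems (λ v → 1)
      ≡⟨ size ⟩
    p * q ∎)
    where
    open ℕΣ
    open ℕₚ.≤-Reasoning
    g = z₀ -ᵛ x₀
    p≢0 : NonZero p
    p≢0 = Data.Nat.>-nonZero (≤-trans (s≤s z≤n) 1<p)
    ¬stab : ¬ Stab X g
    ¬stab s = true≢false (s x₀ ex) (trans (cong X (trans (+ᵛ-comm x₀ g) (sub-add z₀ x₀))) ez)
    line : ∀ v i j → Y (v +ᵛ i · g) ≡ true → Y (v +ᵛ j · g) ≡ true → i ≡ j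
    line v i j yi yj with i Finₚ.≟ j
    ... | yes e = e
    ... | no  ne with inverse (i ⊟ j) (ne ∘ ⊟-≡)
    ...   | b , be = ⊥-elim (¬stab (subst (Stab X) eq₂ (stab-· X b (subst (Stab X) eq₁ (stab-+ X (st _ yi) (stab-· X (⊖ 𝟙ᶠ) (st _ yj)))))))
      where
      eq₁ : (v +ᵛ i · g) +ᵛ (⊖ 𝟙ᶠ) · (v +ᵛ j · g) ≡ (i ⊟ j) · g
      eq₁ = trans (cong ((v +ᵛ i · g) +ᵛ_) (trans (⊖· 𝟙ᶠ _) (cong -ᵛ_ (·-identity _))))
            (trans (sub-+ (v +ᵛ i · g) v (j · g))
            (trans (cong (_-ᵛ j · g) (add-sub′ v (i · g)))
            (trans (cong (i · g +ᵛ_) (sym (⊖· j g))) (sym (·-distrib i (⊖ j) g)))))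
      eq₂ : b · (i ⊟ j) · g ≡ g
      eq₂ = trans (sym (·-assoc b (i ⊟ j) g)) (trans (cong (_· g) be) (·-identity g))

  private
    -- Dyson's transform replaces (X , Y) by (X ∪ (Y + e) , Y ∩ (X - e)).
    dyson : ∀ n X Y → (# Y) ≤ n → Y 0ᵛ ≡ true → ∀ {x₀ z₀} → X x₀ ≡ true → (X ⊕ Y) z₀ ≡ false → (# X) + (# Y) ≤ (# (X ⊕ Y)) + q
    dyson n X Y Y≤n y0 {x₀} {z₀} ex ez with any (λ e → X e ∧ any (λ y → Y y ∧ not (X (e +ᵛ y))) elems) elems in eq
    -- Y never leads out of X: it lies in the stabiliser of X, which bounds |Y| by `q`, and X is
    -- contained in X ⊕ Y because 0 is in Y.
    ... | false = +-mono-≤ (card-⊕ˡ X Y y0) (stab-bound X Y ex Xz₀ stab)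
      where
      Xz₀ : X z₀ ≡ false
      Xz₀ = ¬true⇒false λ e → true≢false (⊕-intro′ X Y e (trans (cong Y (-ᵛ-inverseʳ z₀)) y0)) ez
      stab : ∀ y → Y y ≡ true → Stab X y
      stab y ey x ex with X (x +ᵛ y) in exy
      ... | true  = refl
      ... | false = ⊥-elim (true≢false
              (any-true (λ e → X e ∧ any (λ y → Y y ∧ not (X (e +ᵛ y))) elems)
                (∧-intro ex (any-true (λ y → Y y ∧ not (X (x +ᵛ y))) (∧-intro ey (cong not exy))))) eq)
    dyson zero X Y Y≤n y0 ex ez | true = ⊥-elim (<⇒≱ (card-pos Y y0) Y≤n)
    -- Here e + y leaves X for some e in X and y in Y. The transform with this e removes y from Y,
    -- so the recursion on |Y| ends, and it keeps 0 in Y because e is in X.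
    dyson (suc n) X Y Y≤n y0 {x₀} {z₀} ex ez | true
      with any-elim elems _ eq
    ... | e , he with ∧-elim he
    ... | Xe , hy with any-elim elems _ hy
    ... | y , hy′ with ∧-elim hy′
    ... | Yy , nX = begin
      (# X) + (# Y)                 ≡⟨ cong (_+_ (# X)) (sym (card-shift e Y)) ⟩
      (# X) + (# (shift e Y))         ≡⟨ sym (card-∪∩ X (shift e Y)) ⟩
      (# X′) + (# (X ∩ shift e Y))    ≡⟨ cong (_+_ (# X′)) (sym Y′-card) ⟩
      (# X′) + (# Y′)               ≤⟨ dyson n X′ Y′ (ℕₚ.≤-pred (≤-trans Y′<Y Y≤n)) y0′ (∨-introˡ ex) (¬true⇒false λ h → true≢false (sub z₀ h) ez) ⟩
      (# (X′ ⊕ Y′)) + q               ≤⟨ +-monoˡ-≤ q (card-mono sub) ⟩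
      (# (X ⊕ Y)) + q                 ∎
      where
      open ℕₚ.≤-Reasoning
      X′ = X ∪ shift e Y
      Y′ = λ y → X (y +ᵛ e) ∧ Y y
      Y′-card : (# Y′) ≡ (# (X ∩ shift e Y))
      Y′-card = trans (card-cong λ y → cong (λ u → X (y +ᵛ e) ∧ Y u) (sym (add-sub y e)))
                      (card-bijection (_+ᵛ e) (_-ᵛ e) (λ x → sub-add x e) (λ x → add-sub x e) (X ∩ shift e Y))
      y0′ : Y′ 0ᵛ ≡ true
      y0′ = ∧-intro (trans (cong X (+ᵛ-identityˡ e)) Xe) y0
      Y′<Y : (# Y′) < (# Y)
      Y′<Y = ℕₚ.≰⇒> λ le → true≢false (proj₁ (∧-elim (⊆-antisym-card Y′ Y (λ u → proj₂ ∘ ∧-elim) le y Yy)))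
                             (trans (cong X (+ᵛ-comm y e)) (not-true nX))
      sub : (X′ ⊕ Y′) ⊆ (X ⊕ Y)
      sub z h with ⊕-elim X′ Y′ h
      ... | u , hu , hv with ∧-elim hv | ∨-elim {X u} hu
      ... | Xv , Yv | inj₁ Xu = ⊕-intro′ X Y Xu Yv
      ... | Xv , Yv | inj₂ Yu = ⊕-intro′ X Y Xv (trans (cong Y eqv) Yu)
        where
        eqv : z -ᵛ (z -ᵛ u +ᵛ e) ≡ u -ᵛ e
        eqv = trans (sub-+ z (z -ᵛ u) e) (cong (_-ᵛ e) (sub-sub z u))

  -- Dyson's transform wants 0 in Y. Translating Y by one of its points achieves this and merely
  -- translates the sumset.
  kneser : ∀ X Y {x₀ y₀ z₀} → X x₀ ≡ true → Y y₀ ≡ true → (X ⊕ Y) z₀ ≡ false → (# X) + (# Y) ≤ (# (X ⊕ Y)) + q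
  kneser X Y {x₀} {y₀} {z₀} ex ey ez =
    subst₂ (λ a b → (# X) + a ≤ b + q) (card-bijection (_+ᵛ y₀) (_-ᵛ y₀) (λ x → sub-add x y₀) (λ x → add-sub x y₀) Y)
      (trans (card-cong shifted) (card-bijection (_+ᵛ y₀) (_-ᵛ y₀) (λ x → sub-add x y₀) (λ x → add-sub x y₀) (X ⊕ Y)))
      (dyson (# Y′) X Y′ ≤-refl (trans (cong Y (+ᵛ-identityˡ y₀)) ey) ex
         (trans (shifted (z₀ -ᵛ y₀)) (trans (cong (X ⊕ Y) (sub-add z₀ y₀)) ez)))
    where
    Y′ = λ y → Y (y +ᵛ y₀)
    shifted : ∀ z → (X ⊕ Y′) z ≡ (X ⊕ Y) (z +ᵛ y₀)
    shifted z = any-cong λ x → cong (λ u → X x ∧ Y u) (CS.xy∙z≈xz∙y z (-ᵛ x) y₀)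
      where
      any-cong : ∀ {f g : V → Bool} → (∀ x → f x ≡ g x) → any f elems ≡ any g elems
      any-cong h = cong or (Listₚ.map-cong h elems)

  -- A representation is recorded by what is left of the target after each summand. Summands can
  -- then be peeled off one at a time, and reordering only commutes two subtractions.
  SumOf : List (V → Bool) → V → Set
  SumOf []       z = z ≡ 0ᵛ
  SumOf (X ∷ Xs) z = ∃[ x ] (X x ≡ true) × SumOf Xs (z -ᵛ x)

  Nonempty : (V → Bool) → Set
  Nonempty X = ∃[ x ] X x ≡ true

  SumOf-↭ : ∀ {Xs Ys} → Xs ↭ Ys → ∀ {z} → SumOf Xs z → SumOf Ys z
  SumOf-↭ Perm.refl s = s
  SumOf-↭ (prep X π) (x , ex , s) = x , ex , SumOf-↭ π s
  SumOf-↭ (swap X Y π) {z} (x , ex , y , ey , s) = y , ey , x , ex , subst (SumOf _) (sub-comm z x y) (SumOf-↭ π s)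
  SumOf-↭ (Perm.trans π ρ) s = SumOf-↭ ρ (SumOf-↭ π s)

  -- This is how a few large slices decide a sum of K slices: once their sumset is everything, the
  -- remaining summands only have to exist.
  SumOf-full-++ : ∀ Xs Ys → (∀ z → SumOf Xs z) → All Nonempty Ys → ∀ z → SumOf (Xs ++ Ys) z
  SumOf-full-++ Xs Ys f ne z = SumOf-↭ (↭ₚ.++-comm Ys Xs) (go Ys ne z)
    where
    go : ∀ Ys → All Nonempty Ys → ∀ z → SumOf (Ys ++ Xs) z
    go []       []               z = f z
    go (Y ∷ Ys) ((y , ey) ∷ ne) z = y , ey , go Ys ne _

  SumOf-replicate : ∀ n X x Ys z → X x ≡ true → SumOf Ys (z -ᵛ em n · x) → SumOf (replicate n X ++ Ys) z
  SumOf-replicate zero    X x Ys z ex s = subst (SumOf Ys) (trans (cong (λ u → z -ᵛ u) (0· x)) (sub-0 z)) s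
  SumOf-replicate (suc n) X x Ys z ex s = x , ex , SumOf-replicate n X x Ys (z -ᵛ x) ex
    (subst (SumOf Ys) (trans (cong (λ u → z -ᵛ u) (trans (cong (_· x) (em-+ 1 n))
      (trans (·-distrib 𝟙ᶠ (em n) x) (cong (_+ᵛ em n · x) (·-identity x))))) (sub-+ z x (em n · x))) s)

  ⨁ : List (V → Bool) → V → Bool
  ⨁ []       z = δ z 0ᵛ
  ⨁ (X ∷ Xs)   = X ⊕ ⨁ Xs

  ⨁⇒SumOf : ∀ Xs {z} → ⨁ Xs z ≡ true → SumOf Xs z
  ⨁⇒SumOf []       e = δ-≡ e
  ⨁⇒SumOf (X ∷ Xs) e = let x , ex , e′ = ⊕-elim X (⨁ Xs) e in x , ex , ⨁⇒SumOf Xs e′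

  ⨁-nonempty : ∀ Xs → All Nonempty Xs → Nonempty (⨁ Xs)
  ⨁-nonempty [] [] = 0ᵛ , δ-refl 0ᵛ
  ⨁-nonempty (X ∷ Xs) ((x , ex) ∷ ne) = let y , ey = ⨁-nonempty Xs ne in x +ᵛ y , ⊕-intro X (⨁ Xs) ex ey

  total : List (V → Bool) → ℕ
  total Xs = sum (map # Xs)

  -- Each application of Kneser's inequality costs `q`, and it applies as long as the partial sumset
  -- is not everything.
  ⨁-size : ∀ X Xs → All Nonempty (X ∷ Xs) →
           (∀ z → ⨁ (X ∷ Xs) z ≡ true) ⊎ (total (X ∷ Xs) ≤ (# (⨁ (X ∷ Xs))) + length Xs * q)
  ⨁-size X [] (_ ∷ []) = inj₂ (+-mono-≤ (card-⊕ˡ X (⨁ []) (δ-refl 0ᵛ)) z≤n)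
  ⨁-size X (Y ∷ Ys) ((x , ex) ∷ ne) with any (λ z → not (⨁ (X ∷ Y ∷ Ys) z)) elems in eq
  ... | false = inj₁ λ z → dn (¬true⇒false λ h → true≢false (any-true (λ z → not (⨁ (X ∷ Y ∷ Ys) z)) h) eq)
    where
    dn : ∀ {b} → not b ≡ false → b ≡ true
    dn {true} _ = refl
  ... | true with ⨁-size Y Ys ne
  ...   | inj₁ f = inj₁ λ z → ⊕-intro′ X (⨁ (Y ∷ Ys)) ex (f _)
  ...   | inj₂ le = let z , nz = any-elim elems _ eq
                        y , ey = ⨁-nonempty (Y ∷ Ys) ne
                    in inj₂ (arith (# X) (total (Y ∷ Ys)) (# (⨁ (Y ∷ Ys))) (# (⨁ (X ∷ Y ∷ Ys))) (length Ys) q le (kneser X (⨁ (Y ∷ Ys)) {z₀ = z} ex ey (not-true nz)))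
    where
    arith : ∀ x t s u l q → t ≤ s + l * q → x + s ≤ u + q → x + t ≤ u + (q + l * q)
    arith x t s u l q h₁ h₂ = linear (x + t) (u + (q + l * q)) 0 (+-mono-≤ h₁ h₂) (eq′ x t s u l q)
      where
      eq′ : ∀ x t s u l q → x + t + (s + l * q + (u + q)) + 0 ≡ u + (q + l * q) + (t + (x + s))
      eq′ = solve-∀

  -- Kneser's bound for all but one summand, and the pigeonhole principle for
  -- the last one, which loses nothing.
  SumOf-full : ∀ X Y Xs → All Nonempty (X ∷ Y ∷ Xs) → p * q + length Xs * q < total (X ∷ Y ∷ Xs) → ∀ z → SumOf (X ∷ Y ∷ Xs) z
  SumOf-full X Y Xs ((x , ex) ∷ ne) h z with ⨁-size Y Xs ne
  ... | inj₁ f  = ⨁⇒SumOf (X ∷ Y ∷ Xs) (⊕-intro′ X (⨁ (Y ∷ Xs)) ex (f _))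
  ... | inj₂ le = ⨁⇒SumOf (X ∷ Y ∷ Xs) (pigeonhole X (⨁ (Y ∷ Xs)) (subst (_< (# X) + (# (⨁ (Y ∷ Xs)))) (sym size)
    (arith (# X) (total (Y ∷ Xs)) (# (⨁ (Y ∷ Xs))) (length Xs * q) (p * q) le h)) z)
    where
    arith : ∀ x t s a g → t ≤ s + a → g + a < x + t → g < x + s
    arith x t s a g h₁ h₂ = linear (suc g) (x + s) 0 (+-mono-≤ h₁ h₂) (eq′ x t s a g)
      where
      eq′ : ∀ x t s a g → suc g + (s + a + (x + t)) + 0 ≡ x + s + (t + suc (g + a))
      eq′ = solve-∀

-- Vosper's theorem on the prime field

below-count : ∀ n L → L ≤ n → count (λ x → does (toℕ x <? L)) (allFin n) ≡ L
below-count n zero h = ℕΣ.∑-zero (allFin n)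
below-count (suc n) (suc L) (s≤s h) = cong suc (trans (∑-tabulate n Fin.suc _) (below-count n L h))

module PrimeLine {p : ℕ} (F : FieldOps p) where
  open PrimeField F

  𝔽-space : Space F
  𝔽-space = record
    { V = Fin p ; _+ᵛ_ = _⊞_ ; 0ᵛ = 𝟘 ; -ᵛ_ = ⊖_ ; _·_ = _⊠_
    ; isAbelianGroup = +-isAbelianGroup
    ; ·-distrib = λ a b v → ⊠-distribʳ v a b
    ; ·-assoc = ⊠-assoc ; ·-identity = ⊠-identityˡ
    ; finite = Fin-finite p ; q = 1
    ; size = trans (card-Fin p) (sym (ℕₚ.*-identityʳ p)) }

  open AdditiveCombinatorics 𝔽-space public
  open 𝔽-Solver using (solve; _:+_; _:*_; _:-_; :-_; _:=_; con)

  #full : # full ≡ p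
  #full = card-Fin p

  #≤p : ∀ X → # X ≤ p
  #≤p X = ≤-trans (card-≤full X) (≤-reflexive #full)

  em1≢0 : 𝟙ᶠ ≢ 𝟘
  em1≢0 e with em-injective 1<p (<⇒≤ 1<p) e
  ... | ()

  -- A nonzero g generates the prime field additively, so z - x₀ is a multiple of g.
  stab-all : ∀ X {g x₀} → g ≢ 𝟘 → Stab X g → X x₀ ≡ true → ∀ z → X z ≡ true
  stab-all X {g} {x₀} g≢0 st ex z = let b , be = inverse g g≢0 in
    subst (λ u → X u ≡ true) (eq b be) (stab-· X ((z ⊟ x₀) ⊠ b) st x₀ ex)
    where
    eq : ∀ b → b ⊠ g ≡ 𝟙ᶠ → x₀ ⊞ ((z ⊟ x₀) ⊠ b) ⊠ g ≡ z
    eq b be = trans (cong (x₀ ⊞_) (trans (⊠-assoc _ b g) (trans (cong ((z ⊟ x₀) ⊠_) be) (⊠-identityʳ _))))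
                    (solve 2 (λ x z → x :+ (z :- x) := z) refl x₀ z)

  missing : ∀ X → # X < p → ∃[ z ] X z ≡ false
  missing X h = let z , _ , e = card-⊆-witness full X (subst (# X <_) (sym #full) h) in z , e

  second : ∀ X {a} → 2 ≤ # X → ∃[ b ] (X b ≡ true) × (b ≢ a)
  second X {a} h = let b , eb , ne = card-⊆-witness X (λ x → δ x a) (subst (_< # X) (sym (card-singleton a)) h)
                   in b , eb , λ e → true≢false (trans (cong (λ u → δ u a) e) (δ-refl a)) ne

  third : ∀ X {a b} → 3 ≤ # X → ∃[ c ] (X c ≡ true) × (c ≢ a) × (c ≢ b)
  third X {a} {b} h = let c , ec , ne = card-⊆-witness X ((λ x → δ x a) ∪ (λ x → δ x b)) (≤-trans (s≤s two) h)
                      in c , ec , (λ e → true≢false (∨-introˡ (trans (cong (λ u → δ u a) e) (δ-refl a))) ne)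
                                , (λ e → true≢false (∨-introʳ {δ c a} (trans (cong (λ u → δ u b) e) (δ-refl b))) ne)
    where
    two : # ((λ x → δ x a) ∪ (λ x → δ x b)) ≤ 2
    two = ≤-trans (m≤m+n _ _) (≤-trans (≤-reflexive (card-∪∩ (λ x → δ x a) (λ x → δ x b)))
            (≤-reflexive (cong₂ _+_ (card-singleton a) (card-singleton b))))

  -- The situation of Vosper's theorem: the sumset is smaller than |X| + |Y| and misses at least two
  -- elements. The condition 2 ≤ |Y| is carried separately, since Y stays fixed while X is made
  -- smaller.
  Critical : (X Y : 𝔽 → Bool) → Set
  Critical X Y = (2 ≤ # X) × (2 + # (X ⊕ Y) ≤ p) × (1 + # (X ⊕ Y) ≤ # X + # Y)

  -- Every nonzero g is a difference of elements of X in at most one way.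
  Sidon : (𝔽 → Bool) → Set
  Sidon X = ∀ g → g ≢ 𝟘 → # (X ∩ shift g X) ≤ 1

  -- For 0 < |Y| < p this means that Y is an arithmetic progression with difference d, in a form
  -- that is accessible to counting.
  Near : (𝔽 → Bool) → Set
  Near Y = ∃[ d ] (d ≢ 𝟘) × (# (Y ∪ shift d Y) ≤ 1 + # Y)

  private
    gap : ∀ {x n} → 2 + x ≤ n → x < n
    gap h = ≤-trans (n≤1+n _) h

    -- X* consists of the -z with z outside X ⊕ Y. Sums of X* and Y avoid -X, and |X*| = p - |X ⊕
    -- Y|, so X* is critical again and smaller than X by the last hypothesis.
    dual : ∀ X Y → 2 ≤ # Y → Critical X Y → p < # X + # (X ⊕ Y) →
           ∃[ X′ ] Critical X′ Y × (# X′ < # X)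
    dual X Y Y≥2 (X≥2 , ≤p , crit) h = X* , (X*≥2 , XY*≤p , crit*) , X*<X
      where
      X* = neg (∁ (X ⊕ Y))
      X*-card : # X* + # (X ⊕ Y) ≡ p
      X*-card = trans (cong (_+ # (X ⊕ Y)) (card-neg (∁ (X ⊕ Y)))) (trans (card-∁ (X ⊕ Y)) #full)
      X*<X : # X* < # X
      X*<X = +-cancelʳ-≤ (# (X ⊕ Y)) _ _ (≤-trans (≤-reflexive (cong suc X*-card)) h)
      X*≥2 : 2 ≤ # X*
      X*≥2 = +-cancelʳ-≤ (# (X ⊕ Y)) _ _ (≤-trans ≤p (≤-reflexive (sym X*-card)))
      sub : (X* ⊕ Y) ⊆ neg (∁ X)
      sub z e with ⊕-elim X* Y e
      ... | u , eu , ey with X (⊖ z) in Xz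
      ... | false = refl
      ... | true  = ⊥-elim (true≢false (trans (cong (X ⊕ Y) (solve 2 (λ z u → :- u := :- z :+ (z :- u)) refl z u)) (⊕-intro X Y Xz ey)) (not-true eu))
      bound : # (X* ⊕ Y) + # X ≤ p
      bound = ≤-trans (+-monoˡ-≤ (# X) (≤-trans (card-mono sub) (≤-reflexive (card-neg (∁ X))))) (≤-reflexive (trans (card-∁ X) #full))
      XY*≤p : 2 + # (X* ⊕ Y) ≤ p
      XY*≤p = ≤-trans (≤-reflexive (ℕₚ.+-comm 2 _)) (≤-trans (+-monoʳ-≤ (# (X* ⊕ Y)) X≥2) bound)
      crit* : 1 + # (X* ⊕ Y) ≤ # X* + # Y
      crit* = arith (# (X* ⊕ Y)) (# X) (# X*) (# Y) (# (X ⊕ Y)) crit (≤-trans bound (≤-reflexive (sym X*-card)))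
        where
        arith : ∀ c* x x* y c → 1 + c ≤ x + y → c* + x ≤ x* + c → 1 + c* ≤ x* + y
        arith c* x x* y c h₁ h₂ = linear (1 + c*) (x* + y) 0 (+-mono-≤ h₁ h₂) (eq c* x x* y c)
          where
          eq : ∀ c* x x* y c → 1 + c* + (x + y + (x* + c)) + 0 ≡ x* + y + (1 + c + (c* + x))
          eq = solve-∀

    -- Submodularity of A ↦ |A ⊕ Y|, applied to X and X + g.
    intersect : ∀ X Y → 2 ≤ # Y → Critical X Y → # X + # (X ⊕ Y) ≤ p → ∀ g → g ≢ 𝟘 → 2 ≤ # (X ∩ shift g X) →
                ∃[ X′ ] Critical X′ Y × (# X′ < # X)
    intersect X Y Y≥2 (X≥2 , ≤p , crit) small g g≢0 X′≥2 = X′ , (X′≥2 , ≤-trans (s≤s (s≤s X′Y≤)) ≤p , crit′) , X′<X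
      where
      B = shift g X
      X′ = X ∩ B
      U = X ∪ B
      x₀ = card-witness X (≤-trans (s≤s z≤n) X≥2)
      y₀ = card-witness Y (≤-trans (s≤s z≤n) Y≥2)
      X⊆XY-miss : ∃[ z ] X z ≡ false
      X⊆XY-miss = missing X (≤-<-trans (card-⊕ˡ X Y (proj₂ y₀)) (gap ≤p))
      X′<X : # X′ < # X
      X′<X = ≰⇒> λ le → true≢false (stab-all X {⊖ g} (λ e → g≢0 (trans (sym (⊖-involutive g)) (trans (cong ⊖_ e) -ᵛ-0)))
                          (λ x ex → proj₂ (∧-elim (⊆-antisym-card X′ X (λ u → proj₁ ∘ ∧-elim) le x ex))) (proj₂ x₀) (proj₁ X⊆XY-miss)) (proj₂ X⊆XY-miss)
      X′Y≤ : # (X′ ⊕ Y) ≤ # (X ⊕ Y)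
      X′Y≤ = card-mono (⊕-mono {X′} {X} {Y} {Y} (λ u → proj₁ ∘ ∧-elim) (λ _ e → e))
      BY : # (B ⊕ Y) ≤ # (X ⊕ Y)
      BY = ≤-trans (card-mono {B ⊕ Y} {shift g (X ⊕ Y)} λ z e → let u , eu , ev = ⊕-elim B Y e in
             ⊕-intro′ X Y eu (trans (cong Y (solve 3 (λ z g u → z :- g :- (u :- g) := z :- u) refl z g u)) ev))
             (≤-reflexive (card-shift g (X ⊕ Y)))
      i⊆ : (X′ ⊕ Y) ⊆ ((X ⊕ Y) ∩ (B ⊕ Y))
      i⊆ z e = ∧-intro (⊕-mono {X′} {X} {Y} {Y} (λ u → proj₁ ∘ ∧-elim) (λ _ e → e) z e)
                       (⊕-mono {X′} {B} {Y} {Y} (λ u → proj₂ ∘ ∧-elim) (λ _ e → e) z e)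
      u⊆ : (U ⊕ Y) ⊆ ((X ⊕ Y) ∪ (B ⊕ Y))
      u⊆ z e with ⊕-elim U Y e
      ... | u , eu , ev with ∨-elim {X u} eu
      ... | inj₁ h = ∨-introˡ (⊕-intro′ X Y h ev)
      ... | inj₂ h = ∨-introʳ {(X ⊕ Y) z} (⊕-intro′ B Y h ev)
      submod : # (U ⊕ Y) + # (X′ ⊕ Y) ≤ # (X ⊕ Y) + # (X ⊕ Y)
      submod = ≤-trans (+-mono-≤ (card-mono u⊆) (card-mono i⊆))
                 (≤-trans (≤-reflexive (card-∪∩ (X ⊕ Y) (B ⊕ Y))) (+-monoʳ-≤ (# (X ⊕ Y)) BY))
      ui : # U + # X′ ≡ # X + # X
      ui = trans (card-∪∩ X B) (cong (_+_ (# X)) (card-shift g X))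
      crit′ : 1 + # (X′ ⊕ Y) ≤ # X′ + # Y
      crit′ with # (U ⊕ Y) <? p
      ... | yes lt = arith (# X) (# Y) (# (X ⊕ Y)) (# X′) (# U) (# (X′ ⊕ Y)) (# (U ⊕ Y)) crit submod (≤-reflexive (sym ui))
                       (kneser U Y (∨-introˡ (proj₂ x₀)) (proj₂ y₀) (proj₂ (missing (U ⊕ Y) lt)))
        where
        arith : ∀ a y c i u c₁ c₂ → 1 + c ≤ a + y → c₂ + c₁ ≤ c + c → a + a ≤ u + i → u + y ≤ c₂ + 1 → 1 + c₁ ≤ i + y
        arith a y c i u c₁ c₂ h₁ h₂ h₃ h₄ = linear (1 + c₁) (i + y) 0 (+-mono-≤ (+-mono-≤ h₁ h₁) (+-mono-≤ h₂ (+-mono-≤ h₃ h₄))) (eq a y c i u c₁ c₂)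
          where
          eq : ∀ a y c i u c₁ c₂ → 1 + c₁ + (a + y + (a + y) + (c + c + (u + i + (c₂ + 1)))) + 0 ≡ i + y + (1 + c + (1 + c) + (c₂ + c₁ + (a + a + (u + y))))
          eq = solve-∀
      ... | no ge = arith (# X) (# Y) (# (X ⊕ Y)) (# X′) (# (X′ ⊕ Y)) (# (U ⊕ Y)) p crit submod small (≮⇒≥ ge)
        where
        arith : ∀ a y c i c₁ c₂ p → 1 + c ≤ a + y → c₂ + c₁ ≤ c + c → a + c ≤ p → p ≤ c₂ → 1 + c₁ ≤ i + y
        arith a y c i c₁ c₂ p h₁ h₂ h₃ h₄ = linear (1 + c₁) (i + y) i (+-mono-≤ (+-mono-≤ h₁ h₂) (+-mono-≤ h₃ h₄)) (eq a y c i c₁ c₂ p)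
          where
          eq : ∀ a y c i c₁ c₂ p → 1 + c₁ + (a + y + (c + c) + (p + c₂)) + i ≡ i + y + (1 + c + (c₂ + c₁) + (a + c + p))
          eq = solve-∀

    -- Hamidoune's atoms: a critical set that neither passing to the complement nor intersecting
    -- with a translate can shrink meets each of its other translates in at most one point.
    reduce : ∀ n X Y → # X ≤ n → 2 ≤ # Y → Critical X Y → ∃[ X′ ] Critical X′ Y × (# X′ ≤ # X) × Sidon X′
    reduce zero X Y h Y≥2 (X≥2 , _) = ⊥-elim (<⇒≱ X≥2 (≤-trans h z≤n))
    reduce (suc n) X Y h Y≥2 cr with p <? # X + # (X ⊕ Y)
    ... | yes lt = let X₁ , cr₁ , lt₁ = dual X Y Y≥2 cr lt
                       X₂ , cr₂ , le₂ , s = reduce n X₁ Y (ℕₚ.≤-pred (≤-trans lt₁ h)) Y≥2 cr₁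
                   in X₂ , cr₂ , ≤-trans le₂ (<⇒≤ lt₁) , s
    ... | no ge with ∃? {λ g → (g ≢ 𝟘) × (2 ≤ # (X ∩ shift g X))} (λ g → ¬? (g ≟ 𝟘) ×-dec (2 ≤? # (X ∩ shift g X)))
    ...   | inj₁ (g , g≢0 , h₂) = let X₁ , cr₁ , lt₁ = intersect X Y Y≥2 cr (≮⇒≥ ge) g g≢0 h₂
                                      X₂ , cr₂ , le₂ , s = reduce n X₁ Y (ℕₚ.≤-pred (≤-trans lt₁ h)) Y≥2 cr₁
                                  in X₂ , cr₂ , ≤-trans le₂ (<⇒≤ lt₁) , s
    ...   | inj₂ none = X , cr , ≤-refl , λ g g≢0 → ℕₚ.≤-pred (≰⇒> λ le → none g (g≢0 , le))

    -- For a and b in X, the sumset X ⊕ Y contains a translate of the union of Y and Y + (b - a).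
    pair⇒near : ∀ X Y → # X ≤ 2 → Critical X Y → Near Y
    pair⇒near X Y X≤2 (X≥2 , _ , crit) with card-witness X (≤-trans (s≤s z≤n) X≥2)
    ... | a , ea with second X {a} X≥2
    ... | b , eb , b≢a = b ⊟ a , (λ e → b≢a (⊟-≡ e)) , (begin
      # (Y ∪ shift (b ⊟ a) Y)           ≡⟨ sym (card-shift a _) ⟩
      # (shift a (Y ∪ shift (b ⊟ a) Y)) ≤⟨ card-mono sub ⟩
      # (X ⊕ Y)                         ≤⟨ ℕₚ.≤-pred (≤-trans crit (+-monoˡ-≤ (# Y) X≤2)) ⟩
      1 + # Y ∎)
      where
      open ℕₚ.≤-Reasoning
      sub : shift a (Y ∪ shift (b ⊟ a) Y) ⊆ (X ⊕ Y)
      sub z e with ∨-elim {Y (z ⊟ a)} e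
      ... | inj₁ h = ⊕-intro′ X Y ea h
      ... | inj₂ h = ⊕-intro′ X Y eb (trans (cong Y (solve 3 (λ z a b → z :- b := z :- a :- (b :- a)) refl z a b)) h)

    -- W ⊕ X contains three translates of W, any two of which share at most one element.
    sidon-bound : ∀ W X → Sidon W → 3 ≤ # X → # W + # W + # W ≤ # (W ⊕ X) + 3
    sidon-bound W X sid X≥3 with card-witness X (≤-trans (s≤s z≤n) X≥3)
    ... | a , ea with second X {a} (≤-trans (s≤s (s≤s z≤n)) X≥3)
    ... | b , eb , b≢a with third X {a} {b} X≥3
    ... | c , ec , c≢a , c≢b = arith (# W) (# (A ∪ B)) (# (A ∩ B)) (# ((A ∪ B) ∪ C)) (# ((A ∪ B) ∩ C)) (# (W ⊕ X))
          (≤-reflexive (sym (trans (card-∪∩ A B) (cong₂ _+_ (card-shift a W) (card-shift b W)))))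
          (≤-reflexive (sym (trans (card-∪∩ (A ∪ B) C) (cong (_+_ (# (A ∪ B))) (card-shift c W)))))
          (meet a b b≢a)
          (≤-trans (card-mono dist) (≤-trans (m≤m+n _ _) (≤-trans (≤-reflexive (card-∪∩ (A ∩ C) (B ∩ C))) (+-mono-≤ (meet a c c≢a) (meet b c c≢b)))))
          (card-mono sub)
      where
      A = shift a W
      B = shift b W
      C = shift c W
      meet : ∀ a b → b ≢ a → # (shift a W ∩ shift b W) ≤ 1
      meet a b ne = ≤-trans (≤-reflexive (trans (card-cong λ x → cong (λ u → W (x ⊟ a) ∧ W u) (solve 3 (λ x a b → x :- b := x :- a :- (b :- a)) refl x a b))
                                                (card-shift a (W ∩ shift (b ⊟ a) W))))
                            (sid (b ⊟ a) (λ e → ne (⊟-≡ e)))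
      dist : ((A ∪ B) ∩ C) ⊆ ((A ∩ C) ∪ (B ∩ C))
      dist x e with ∧-elim {(A ∪ B) x} e
      ... | h , hc with ∨-elim {A x} h
      ... | inj₁ ha = ∨-introˡ (∧-intro ha hc)
      ... | inj₂ hb = ∨-introʳ {(A ∩ C) x} (∧-intro hb hc)
      mem : ∀ a → X a ≡ true → shift a W ⊆ (W ⊕ X)
      mem a ea z e = ⊕-intro′ W X e (trans (cong X (sub-sub z a)) ea)
      sub : ((A ∪ B) ∪ C) ⊆ (W ⊕ X)
      sub z e with ∨-elim {(A ∪ B) z} e
      ... | inj₂ h = mem c ec z h
      ... | inj₁ h with ∨-elim {A z} h
      ... | inj₁ h′ = mem a ea z h′
      ... | inj₂ h′ = mem b eb z h′
      arith : ∀ w u i v j s → w + w ≤ u + i → u + w ≤ v + j → i ≤ 1 → j ≤ 2 → v ≤ s → w + w + w ≤ s + 3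
      arith w u i v j s h₁ h₂ h₃ h₄ h₅ = linear (w + w + w) (s + 3) 0 (+-mono-≤ (+-mono-≤ h₁ h₂) (+-mono-≤ (+-mono-≤ h₃ h₄) h₅)) (eq w u i v j s)
        where
        eq : ∀ w u i v j s → w + w + w + (u + i + (v + j) + (1 + 2 + s)) + 0 ≡ s + 3 + (w + w + (u + w) + (i + j + v))
        eq = solve-∀

    -- Being near would give |X ∩ (X + d)| ≥ |X| - 1 ≥ 2.
    sidon-not-near : ∀ X → Sidon X → 3 ≤ # X → ¬ Near X
    sidon-not-near X sid X≥3 (d , d≢0 , le) = <⇒≱ (s≤s (s≤s ≤-refl))
      (arith (# X) (# (X ∪ shift d X)) (# (X ∩ shift d X)) X≥3 (≤-reflexive (sym (trans (card-∪∩ X (shift d X)) (cong (_+_ (# X)) (card-shift d X)))))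
        le (sid d d≢0))
      where
      arith : ∀ x u i → 3 ≤ x → x + x ≤ u + i → u ≤ 1 + x → i ≤ 1 → 2 ≤ 1
      arith x u i h₁ h₂ h₃ h₄ = linear 2 1 0 (+-mono-≤ (+-mono-≤ h₁ h₂) (+-mono-≤ h₃ h₄)) (eq x u i)
        where
        eq : ∀ x u i → 2 + (x + (u + i) + (1 + x + 1)) + 0 ≡ 1 + (3 + (x + x) + (u + i))
        eq = solve-∀

    critical-sym : ∀ X Y → 2 ≤ # Y → Critical X Y → Critical Y X
    critical-sym X Y Y≥2 (X≥2 , ≤p , crit) = Y≥2 , ≤-trans (s≤s (s≤s c)) ≤p , ≤-trans (s≤s c) (≤-trans crit (≤-reflexive (ℕₚ.+-comm (# X) (# Y))))
      where
      c : # (Y ⊕ X) ≤ # (X ⊕ Y)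
      c = card-mono (⊕-comm Y X)

    -- X is shrunk to a Sidon set U, and then Y, against U, to a Sidon set W. If both have at least
    -- three elements, `sidon-bound` and criticality give |W| < |U|, and by induction U would be
    -- near, which is impossible for a Sidon set of that size.
    critical⇒near : ∀ n X Y → # X ≤ n → 2 ≤ # Y → Critical X Y → Near Y
    critical⇒near zero X Y h Y≥2 (X≥2 , _) = ⊥-elim (<⇒≱ X≥2 (≤-trans h z≤n))
    critical⇒near (suc n) X Y h Y≥2 cr with reduce (# X) X Y ≤-refl Y≥2 cr
    ... | U , crU , U≤X , sidU with # U ≤? 2
    ... | yes U≤2 = pair⇒near U Y U≤2 crU
    ... | no  U>2 with reduce (# Y) Y U ≤-refl (proj₁ crU) (critical-sym U Y Y≥2 crU)
    ... | W , crW , _ , sidW with # W ≤? 2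
    ... | yes W≤2 = ⊥-elim (sidon-not-near U sidU (≰⇒> U>2) (pair⇒near W U W≤2 crW))
    ... | no  W>2 = ⊥-elim (sidon-not-near U sidU (≰⇒> U>2) (critical⇒near n W U (ℕₚ.≤-pred (≤-trans W<U (≤-trans U≤X h))) (proj₁ crU) crW))
      where
      arith : ∀ w u s → w + w + w ≤ s + 3 → 1 + s ≤ w + u → 3 ≤ w → suc w ≤ u
      arith w u s h₁ h₂ h₃ = linear (suc w) u 0 (+-mono-≤ h₁ (+-mono-≤ h₂ h₃)) (eq w u s)
        where
        eq : ∀ w u s → suc w + (s + 3 + (w + u + w)) + 0 ≡ u + (w + w + w + (1 + s + 3))
        eq = solve-∀
      W<U : # W < # U
      W<U = arith (# W) (# U) (# (W ⊕ U)) (sidon-bound W U sidW (≰⇒> U>2)) (proj₂ (proj₂ crW)) (≰⇒> W>2)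

  vosper : ∀ X Y → 2 ≤ # X → 2 ≤ # Y → ¬ Near Y → 2 + # (X ⊕ Y) ≤ p → # X + # Y ≤ # (X ⊕ Y)
  vosper X Y X≥2 Y≥2 nn ≤p with # X + # Y ≤? # (X ⊕ Y)
  ... | yes h = h
  ... | no  h = ⊥-elim (nn (critical⇒near (# X) X Y ≤-refl Y≥2 (X≥2 , ≤p , ≰⇒> h)))

  near? : ∀ Y → Near Y ⊎ ¬ Near Y
  near? Y with ∃? {λ d → (d ≢ 𝟘) × (# (Y ∪ shift d Y) ≤ 1 + # Y)} (λ d → ¬? (d ≟ 𝟘) ×-dec (# (Y ∪ shift d Y) ≤? 1 + # Y))
  ... | inj₁ h = inj₁ h
  ... | inj₂ h = inj₂ λ (d , hd) → h d hd

  interval : 𝔽 → ℕ → 𝔽 → Bool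
  interval a L x = does (toℕ (x ⊟ a) <? L)

  interval-card : ∀ a L → L ≤ p → # (interval a L) ≡ L
  interval-card a L h = trans (card-shift a (λ x → does (toℕ x <? L))) (below-count p L h)

  interval-elim : ∀ {a L x} → interval a L x ≡ true → ∃[ i ] (i < L) × (x ≡ a ⊞ em i)
  interval-elim {a} {L} {x} e = toℕ (x ⊟ a) , does-true (toℕ (x ⊟ a) <? L) e ,
    trans (solve 2 (λ x a → x := a :+ (x :- a)) refl x a) (cong (a ⊞_) (sym (em-toℕ (x ⊟ a))))

  interval-intro : ∀ {a L i} → L ≤ p → i < L → interval a L (a ⊞ em i) ≡ true
  interval-intro {a} {L} {i} L≤p i<L = does-intro (_ <? L) (subst (_< L)
    (sym (trans (cong toℕ (solve 2 (λ a i → a :+ i :- a := i) refl a (em i))) (toℕ-em-< (≤-trans i<L L≤p)))) i<L)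

  private
    pred-⊟ : ∀ a j → a ⊞ em (suc j) ⊟ 𝟙ᶠ ≡ a ⊞ em j
    pred-⊟ a j = trans (cong (λ u → a ⊞ u ⊟ 𝟙ᶠ) (em-+ 1 j)) (solve 2 (λ a j → a :+ (con (ℤ.+ 1) :+ j) :- con (ℤ.+ 1) := a :+ j) refl a (em j))

  -- At most one element of Y has its predecessor outside Y. Walking down from any element therefore
  -- stays in Y until the unique start a.
  near₁⇒interval : ∀ Y → 1 ≤ # Y → # Y < p → # (Y ∪ shift 𝟙ᶠ Y) ≤ 1 + # Y → ∃[ a ] (∀ x → Y x ≡ interval a (# Y) x)
  near₁⇒interval Y Y≥1 Y<p le with ∃? {λ x → Y x ∧ not (Y (x ⊟ 𝟙ᶠ)) ≡ true} (λ x → Data.Bool._≟_ _ true)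
  ... | inj₂ none = ⊥-elim (true≢false (stab-all Y (λ e → em1≢0 (trans (sym (⊖-involutive 𝟙ᶠ)) (trans (cong ⊖_ e) -ᵛ-0))) stab
    (proj₂ (card-witness Y Y≥1)) (proj₁ (missing Y Y<p))) (proj₂ (missing Y Y<p)))
    where
    stab : Stab Y (⊖ 𝟙ᶠ)
    stab x ex with Y (x ⊟ 𝟙ᶠ) in e
    ... | true  = refl
    ... | false = ⊥-elim (none x (∧-intro ex (cong not e)))
  ... | inj₁ (a , ha) = a , λ x → bool-ext (⊆I x) (I⊆ x)
    where
    start≤1 : # (Y ∖ shift 𝟙ᶠ Y) ≤ 1
    start≤1 = arith (# Y) (# (Y ∪ shift 𝟙ᶠ Y)) (# (Y ∩ shift 𝟙ᶠ Y)) (# (Y ∖ shift 𝟙ᶠ Y)) le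
               (≤-reflexive (sym (trans (card-∪∩ Y (shift 𝟙ᶠ Y)) (cong (_+_ (# Y)) (card-shift 𝟙ᶠ Y)))))
               (≤-reflexive (card-∖ Y (shift 𝟙ᶠ Y)))
      where
      arith : ∀ y u i s → u ≤ 1 + y → y + y ≤ u + i → s + i ≤ y → s ≤ 1
      arith y u i s h₁ h₂ h₃ = linear s 1 0 (+-mono-≤ h₁ (+-mono-≤ h₂ h₃)) (eq y u i s)
        where
        eq : ∀ y u i s → s + (1 + y + (u + i + y)) + 0 ≡ 1 + (u + (y + y + (s + i)))
        eq = solve-∀
    unique : ∀ x → (Y ∖ shift 𝟙ᶠ Y) x ≡ true → x ≡ a
    unique x ex with x ≟ a
    ... | yes e = e
    ... | no ne = ⊥-elim (<⇒≱ (s≤s (s≤s z≤n)) (≤-trans (≤-trans (≤-reflexive (sym two)) (card-mono sub)) start≤1))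
      where
      E = λ y → δ y x ∨ δ y a
      two : # E ≡ 2
      two = trans (sym (ℕₚ.+-identityʳ _)) (trans (cong (_+_ (# E)) (sym none))
        (trans (card-∪∩ (λ y → δ y x) (λ y → δ y a)) (cong₂ _+_ (card-singleton x) (card-singleton a))))
        where
        none : # ((λ y → δ y x) ∩ (λ y → δ y a)) ≡ 0
        none = trans (card-cong λ y → ¬true⇒false λ e → ne (trans (sym (δ-≡ {y} {x} (proj₁ (∧-elim {δ y x} e))))
          (δ-≡ {y} {a} (proj₂ (∧-elim {δ y x} e))))) (ℕΣ.∑-zero elems)
      sub : E ⊆ (Y ∖ shift 𝟙ᶠ Y)
      sub y e with ∨-elim {δ y x} e
      ... | inj₁ h = trans (cong (Y ∖ shift 𝟙ᶠ Y) (δ-≡ h)) ex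
      ... | inj₂ h = trans (cong (Y ∖ shift 𝟙ᶠ Y) (δ-≡ h)) ha
    down : ∀ j → suc j < p → Y (a ⊞ em (suc j)) ≡ true → Y (a ⊞ em j) ≡ true
    down j j< e with Y (a ⊞ em (suc j) ⊟ 𝟙ᶠ) in eq
    ... | true  = trans (cong Y (sym (pred-⊟ a j))) eq
    ... | false with em-injective {suc j} {0} j< (≤-trans (s≤s z≤n) j<) (trans (solve 2 (λ a j → j := a :+ j :- a) refl a (em (suc j))) (trans (cong (_⊟ a) (unique _ (∧-intro e (cong not eq)))) (⊖-inverseʳ a)))
    ...   | ()
    downs : ∀ j → j < p → Y (a ⊞ em j) ≡ true → ∀ i → i ≤ j → Y (a ⊞ em i) ≡ true
    downs zero j< e zero z≤n = e
    downs (suc j) j< e i i≤ with ℕₚ.m≤n⇒m<n∨m≡n i≤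
    ... | inj₂ refl = e
    ... | inj₁ lt = downs j (<⇒≤ j<) (down j j< e) i (ℕₚ.≤-pred lt)
    ⊆I : Y ⊆ interval a (# Y)
    -- All of the interval from a to x lies in Y, so the offset of x is below |Y|.
    ⊆I x ex = does-intro (toℕ (x ⊟ a) <? # Y) (≤-trans (≤-reflexive (sym (interval-card a _ (Finₚ.toℕ<n (x ⊟ a)))))
      (card-mono λ z ez → let i , i< , e = interval-elim {a} ez in
         trans (cong Y e) (downs (toℕ (x ⊟ a)) (Finₚ.toℕ<n (x ⊟ a)) (trans
           (cong Y (trans (cong (a ⊞_) (em-toℕ (x ⊟ a))) (solve 2 (λ x a → a :+ (x :- a) := x) refl x a))) ex) i (ℕₚ.≤-pred i<))))
    I⊆ : interval a (# Y) ⊆ Y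
    I⊆ = ⊆-antisym-card Y (interval a (# Y)) ⊆I (≤-reflexive (interval-card a (# Y) (<⇒≤ Y<p)))

-- Convolutions of integer-valued functions

ℤ-semiring = IsCommutativeRing.isCommutativeSemiring ℤₚ.+-*-isCommutativeRing

module ℤΣ = Summation ℤ-semiring

+-∑ : {A : Set} (xs : List A) (f : A → ℕ) → + ℕΣ.∑ xs f ≡ ℤΣ.∑ xs (λ x → + f x)
+-∑ []       f = refl
+-∑ (x ∷ xs) f = cong (ℤ._+_ (+ f x)) (+-∑ xs f)

∣∑∣≤ : {A : Set} (xs : List A) (f : A → ℤ) → ℤ.∣ ℤΣ.∑ xs f ∣ ≤ ℕΣ.∑ xs (λ x → ℤ.∣ f x ∣)
∣∑∣≤ []       f = z≤n
∣∑∣≤ (x ∷ xs) f = ≤-trans (ℤₚ.∣i+j∣≤∣i∣+∣j∣ (f x) _) (+-monoʳ-≤ ℤ.∣ f x ∣ (∣∑∣≤ xs f))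

+-𝟙 : ∀ b → + ℕΣ.𝟙 b ≡ ℤΣ.𝟙 b
+-𝟙 true  = refl
+-𝟙 false = refl

module Convolution {p : ℕ} {F : FieldOps p} (Sp : Space F) where
  open AdditiveCombinatorics Sp using (V; 0ᵛ; _+ᵛ_; _-ᵛ_; elems; δ; δ-≡; δ-refl; _≟_; finite; card-bijection; sub-add; add-sub; sub-sub; sub-0; sub-≡; SumOf; #; neg; -ᵛ-involutive; -ᵛ-inverseʳ; -ᵛ_)
  open ℤΣ
  open FiniteSummation ℤ-semiring finite using (∑-δ; ∑-bijection) public

  conv : List (V → ℤ) → V → ℤ
  conv []       z = 𝟙 (δ z 0ᵛ)
  conv (f ∷ fs) z = ∑ elems (λ x → f x ℤ.* conv fs (z -ᵛ x))

  ∑-shift : ∀ x (f : V → ℤ) → ∑ elems (λ z → f (z -ᵛ x)) ≡ ∑ elems f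
  ∑-shift x f = ∑-bijection (_-ᵛ x) (_+ᵛ x) (λ z → add-sub z x) (λ z → sub-add z x) f

  ∑-reflect : ∀ x (f : V → ℤ) → ∑ elems (λ z → f (x -ᵛ z)) ≡ ∑ elems f
  ∑-reflect x f = ∑-bijection (λ z → x -ᵛ z) (λ z → x -ᵛ z) (sub-sub x) (sub-sub x) f

  conv-single : ∀ f z → conv (f ∷ []) z ≡ f z
  conv-single f z = trans (∑-cong elems λ x → trans (ℤₚ.*-comm (f x) _) (cong (λ b → 𝟙 b ℤ.* f x) (move x))) (∑-δ z f)
    where
    move : ∀ x → δ (z -ᵛ x) 0ᵛ ≡ δ x z
    move x with x ≟ z
    ... | yes refl = dec-true (_ ≟ 0ᵛ) (-ᵛ-inverseʳ x)
    ... | no  ne   = dec-false (_ ≟ 0ᵛ) (λ e → ne (sym (sub-≡ e)))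

  sums : List (V → ℤ) → ℤ
  sums []       = + 1
  sums (f ∷ fs) = ∑ elems f ℤ.* sums fs

  ∑-conv : ∀ fs → ∑ elems (conv fs) ≡ sums fs
  ∑-conv [] = trans (∑-cong elems λ x → sym (ℤₚ.*-identityʳ _)) (∑-δ 0ᵛ (λ _ → + 1))
  ∑-conv (f ∷ fs) = begin
    ∑ elems (λ z → ∑ elems (λ x → f x ℤ.* conv fs (z -ᵛ x)))  ≡⟨ ∑-swap elems elems _ ⟩
    ∑ elems (λ x → ∑ elems (λ z → f x ℤ.* conv fs (z -ᵛ x)))  ≡⟨ ∑-cong elems
      (λ x → trans (∑-*ˡ elems (f x) _) (cong (f x ℤ.*_) (trans (∑-shift x (conv fs)) (∑-conv fs)))) ⟩
    ∑ elems (λ x → f x ℤ.* sums fs)                           ≡⟨ ∑-*ʳ elems (sums fs) f ⟩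
    ∑ elems f ℤ.* sums fs                                     ∎
    where open ≡-Reasoning

  -- Convolving indicator functions counts representations.
  conv-no-SumOf : ∀ Xs z → ¬ SumOf Xs z → conv (map (λ X x → 𝟙 (X x)) Xs) z ≡ + 0
  conv-no-SumOf [] z h = cong 𝟙 (dec-false (z ≟ 0ᵛ) h)
  conv-no-SumOf (X ∷ Xs) z h = trans (∑-cong elems λ x → aux x (X x) refl) (∑-zero elems)
    where
    aux : ∀ x b → X x ≡ b → 𝟙 b ℤ.* conv (map (λ X x → 𝟙 (X x)) Xs) (z -ᵛ x) ≡ + 0
    aux x true  e = trans (ℤₚ.*-identityˡ _) (conv-no-SumOf Xs (z -ᵛ x) (λ s → h (x , e , s)))
    aux x false e = refl

  conv-scale : ∀ c fs z → conv (map (λ f x → c ℤ.* f x) fs) z ≡ c ℤ.^ length fs ℤ.* conv fs z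
  conv-scale c [] z = sym (ℤₚ.*-identityˡ _)
  conv-scale c (f ∷ fs) z = trans (∑-cong elems λ x → trans (cong (c ℤ.* f x ℤ.*_) (conv-scale c fs (z -ᵛ x)))
    (assoc′ c (f x) (c ℤ.^ length fs) (conv fs (z -ᵛ x)))) (∑-*ˡ elems (c ℤ.* c ℤ.^ length fs) _)
    where
    assoc′ : ∀ c f d e → c ℤ.* f ℤ.* (d ℤ.* e) ≡ c ℤ.* d ℤ.* (f ℤ.* e)
    assoc′ = solveℤ-∀

  private
    sums-zero : ∀ g gs → ∑ elems g ≡ + 0 → sums (g ∷ gs) ≡ + 0
    sums-zero g gs e = cong (ℤ._* sums gs) e

  -- When the product is expanded, every mixed term contains the total sum of some g, which is 0.
  conv-centered : ∀ (a N : ℤ) → ∑ elems (λ _ → + 1) ≡ N → ∀ g gs → All (λ g → ∑ elems g ≡ + 0) (g ∷ gs) →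
                  ∀ z → conv (map (λ g x → a ℤ.+ g x) (g ∷ gs)) z ≡ a ℤ.^ suc (length gs) ℤ.* N ℤ.^ length gs ℤ.+ conv (g ∷ gs) z
  conv-centered a N eN g [] _ z = trans (conv-single (λ x → a ℤ.+ g x) z) (cong₂ ℤ._+_ (lem a) (sym (conv-single g z)))
    where
    lem : ∀ a → a ≡ a ℤ.* + 1 ℤ.* + 1
    lem = solveℤ-∀
  conv-centered a N eN g (g′ ∷ gs) (eg ∷ egs) z = begin
    ∑ elems (λ x → (a ℤ.+ g x) ℤ.* conv (map (λ g x → a ℤ.+ g x) (g′ ∷ gs)) (z -ᵛ x))
      ≡⟨ ∑-cong elems (λ x → trans (cong ((a ℤ.+ g x) ℤ.*_) (conv-centered a N eN g′ gs egs (z -ᵛ x))) (expand a (g x) M (conv (g′ ∷ gs) (z -ᵛ x)))) ⟩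
    ∑ elems (λ x → a ℤ.* M ℤ.* + 1 ℤ.+ (M ℤ.* g x ℤ.+ (a ℤ.* conv (g′ ∷ gs) (z -ᵛ x) ℤ.+ g x ℤ.* conv (g′ ∷ gs) (z -ᵛ x))))
      ≡⟨ trans (∑-+ elems _ _) (cong₂ ℤ._+_ (trans (∑-*ˡ elems (a ℤ.* M) (λ _ → + 1)) (cong (a ℤ.* M ℤ.*_) eN))
           (trans (∑-+ elems _ _) (cong₂ ℤ._+_ (trans (∑-*ˡ elems M g) (trans (cong (M ℤ.*_) eg) (ℤₚ.*-zeroʳ M)))
             (trans (∑-+ elems _ _) (cong (ℤ._+ conv (g ∷ g′ ∷ gs) z) (trans (∑-*ˡ elems a _)
               (trans (cong (a ℤ.*_) (trans (∑-reflect z (conv (g′ ∷ gs))) (trans (∑-conv (g′ ∷ gs)) (sums-zero g′ gs (All.head egs))))) (ℤₚ.*-zeroʳ a)))))))) ⟩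
    a ℤ.* M ℤ.* N ℤ.+ (+ 0 ℤ.+ (+ 0 ℤ.+ conv (g ∷ g′ ∷ gs) z))
      ≡⟨ collect a (a ℤ.^ suc (length gs)) N (N ℤ.^ length gs) (conv (g ∷ g′ ∷ gs) z) ⟩
    a ℤ.* a ℤ.^ suc (length gs) ℤ.* (N ℤ.* N ℤ.^ length gs) ℤ.+ conv (g ∷ g′ ∷ gs) z ∎
    where
    open ≡-Reasoning
    M = a ℤ.^ suc (length gs) ℤ.* N ℤ.^ length gs
    expand : ∀ a g M c → (a ℤ.+ g) ℤ.* (M ℤ.+ c) ≡ a ℤ.* M ℤ.* + 1 ℤ.+ (M ℤ.* g ℤ.+ (a ℤ.* c ℤ.+ g ℤ.* c))
    expand = solveℤ-∀
    collect : ∀ a A N M c → a ℤ.* (A ℤ.* M) ℤ.* N ℤ.+ (+ 0 ℤ.+ (+ 0 ℤ.+ c)) ≡ a ℤ.* A ℤ.* (N ℤ.* M) ℤ.+ c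
    collect = solveℤ-∀

  norm₁ norm₂ : (V → ℤ) → ℕ
  norm₁ g = ℕΣ.∑ elems (λ x → ℤ.∣ g x ∣)
  norm₂ g = ℕΣ.∑ elems (λ x → ℤ.∣ g x ∣ * ℤ.∣ g x ∣)

  private
    amgm : ∀ a b → 2 * (a * b) ≤ a * a + b * b
    amgm a b with ℕₚ.≤-total a b
    ... | inj₁ le = lem a (b ∸ a) b (ℕₚ.m+[n∸m]≡n le)
      where
      lem : ∀ a c b → a + c ≡ b → 2 * (a * b) ≤ a * a + b * b
      lem a c b refl = linear _ _ (c * c) (z≤n {0}) (eq a c)
        where
        eq : ∀ a c → 2 * (a * (a + c)) + 0 + c * c ≡ a * a + (a + c) * (a + c) + 0
        eq = solve-∀
    ... | inj₂ le = lem b (a ∸ b) a (ℕₚ.m+[n∸m]≡n le)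
      where
      lem : ∀ b c a → b + c ≡ a → 2 * (a * b) ≤ a * a + b * b
      lem b c a refl = linear _ _ (c * c) (z≤n {0}) (eq b c)
        where
        eq : ∀ b c → 2 * ((b + c) * b) + 0 + c * c ≡ (b + c) * (b + c) + b * b + 0
        eq = solve-∀

  -- As both norms equal Q, the inequality 2 x y ≤ x² + y² does the work of Cauchy-Schwarz without
  -- square roots.
  conv-bound₂ : ∀ Q f g → norm₂ f ≡ Q → norm₂ g ≡ Q → ∀ z → ℤ.∣ conv (f ∷ g ∷ []) z ∣ ≤ Q
  conv-bound₂ Q f g ef eg z = ℕₚ.*-cancelˡ-≤ 2 (begin
    2 * ℤ.∣ conv (f ∷ g ∷ []) z ∣
      ≤⟨ *-monoʳ-≤ 2 (∣∑∣≤ elems _) ⟩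
    2 * ℕΣ.∑ elems (λ x → ℤ.∣ f x ℤ.* conv (g ∷ []) (z -ᵛ x) ∣)
      ≡⟨ sym (ℕΣ.∑-*ˡ elems 2 _) ⟩
    ℕΣ.∑ elems (λ x → 2 * ℤ.∣ f x ℤ.* conv (g ∷ []) (z -ᵛ x) ∣)
      ≤⟨ ∑-mono elems (λ x → ≤-trans (≤-reflexive (cong (2 *_) (trans (cong (λ u → ℤ.∣ f x ℤ.* u ∣) (conv-single g (z -ᵛ x)))
        (ℤₚ.abs-* (f x) (g (z -ᵛ x)))))) (amgm ℤ.∣ f x ∣ ℤ.∣ g (z -ᵛ x) ∣)) ⟩
    ℕΣ.∑ elems (λ x → ℤ.∣ f x ∣ * ℤ.∣ f x ∣ + ℤ.∣ g (z -ᵛ x) ∣ * ℤ.∣ g (z -ᵛ x) ∣)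
      ≡⟨ ℕΣ.∑-+ elems _ _ ⟩
    norm₂ f + ℕΣ.∑ elems (λ x → ℤ.∣ g (z -ᵛ x) ∣ * ℤ.∣ g (z -ᵛ x) ∣)
      ≡⟨ cong₂ _+_ ef (trans (FiniteSet.∑-bijection finite (λ x → z -ᵛ x) (λ x → z -ᵛ x) (sub-sub z) (sub-sub z) (λ x → ℤ.∣ g x ∣ * ℤ.∣ g x ∣)) eg) ⟩
    Q + Q
      ≡⟨ cong (_+_ Q) (sym (ℕₚ.+-identityʳ Q)) ⟩
    2 * Q ∎)
    where open ℕₚ.≤-Reasoning

  -- Young's inequality, with the ℓ¹-norm for all but two of the factors.
  conv-bound : ∀ D Q f g hs → All (λ f → (norm₁ f ≤ D) × (norm₂ f ≡ Q)) (f ∷ g ∷ hs) → ∀ z →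
               ℤ.∣ conv (f ∷ g ∷ hs) z ∣ ≤ D ^ length hs * Q
  conv-bound D Q f g [] ((_ , ef) ∷ (_ , eg) ∷ []) z = ≤-trans (conv-bound₂ Q f g ef eg z) (≤-reflexive (sym (ℕₚ.*-identityˡ Q)))
  conv-bound D Q f g (h ∷ hs) ((df , _) ∷ bs) z = begin
    ℤ.∣ conv (f ∷ g ∷ h ∷ hs) z ∣
      ≤⟨ ∣∑∣≤ elems _ ⟩
    ℕΣ.∑ elems (λ x → ℤ.∣ f x ℤ.* conv (g ∷ h ∷ hs) (z -ᵛ x) ∣)
      ≤⟨ ∑-mono elems (λ x → ≤-trans (≤-reflexive (ℤₚ.abs-* (f x) _)) (*-monoʳ-≤ ℤ.∣ f x ∣ (conv-bound D Q g h hs bs (z -ᵛ x)))) ⟩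
    ℕΣ.∑ elems (λ x → ℤ.∣ f x ∣ * (D ^ length hs * Q))
      ≡⟨ ℕΣ.∑-*ʳ elems (D ^ length hs * Q) _ ⟩
    norm₁ f * (D ^ length hs * Q)
      ≤⟨ *-monoˡ-≤ _ df ⟩
    D * (D ^ length hs * Q)
      ≡⟨ sym (ℕₚ.*-assoc D _ Q) ⟩
    D ^ suc (length hs) * Q ∎
    where open ℕₚ.≤-Reasoning

-- Coordinate spaces and linear functionals

module VectorSpace {p : ℕ} .{{_ : NonZero p}} (F : FieldOps p) where
  open PrimeField F

  Vecs-finite : ∀ n → Finite (Vec 𝔽 n)
  Vecs-finite n = record { elems = allVecs p n ; _≟_ = Vecₚ.≡-dec Finₚ._≟_ ; once = once′ n }
    where
    open ℕΣ
    _≟ᵛ_ : ∀ {n} (x y : Vec 𝔽 n) → Dec (x ≡ y)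
    _≟ᵛ_ = Vecₚ.≡-dec Finₚ._≟_
    split : ∀ {n} x a (xs as : Vec 𝔽 n) → 𝟙 (does ((x ∷ xs) ≟ᵛ (a ∷ as))) ≡ 𝟙 (does (x Finₚ.≟ a)) * 𝟙 (does (xs ≟ᵛ as))
    split x a xs as with x Finₚ.≟ a | xs ≟ᵛ as
    ... | yes _ | yes _ = refl
    ... | yes _ | no _  = refl
    ... | no _  | _     = refl
    once′ : ∀ n (a : Vec 𝔽 n) → count (λ x → does (x ≟ᵛ a)) (allVecs p n) ≡ 1
    once′ zero [] = refl
    once′ (suc n) (a ∷ as) = begin
      ∑ (allVecs p (suc n)) (λ x → 𝟙 (does (x ≟ᵛ (a ∷ as))))
        ≡⟨ ∑-concatMap (λ b → map (b ∷_) (allVecs p n)) (allFin p) _ ⟩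
      ∑ (allFin p) (λ b → ∑ (map (b ∷_) (allVecs p n)) (λ x → 𝟙 (does (x ≟ᵛ (a ∷ as)))))
        ≡⟨ ∑-cong (allFin p) (λ b → trans (∑-map (b ∷_) (allVecs p n) _)
          (trans (∑-cong (allVecs p n) (λ xs → split b a xs as)) (trans (∑-*ˡ (allVecs p n) (𝟙 (does (b Finₚ.≟ a))) _)
          (trans (cong (𝟙 (does (b Finₚ.≟ a)) *_) (once′ n as)) (ℕₚ.*-identityʳ _))))) ⟩
      ∑ (allFin p) (λ b → 𝟙 (does (b Finₚ.≟ a)))
        ≡⟨ fin-once p a ⟩
      1 ∎
      where open ≡-Reasoning

  ∑-vec : ∀ n (f : Vec 𝔽 (suc n) → ℕ) → ℕΣ.∑ (allVecs p (suc n)) f ≡ ℕΣ.∑ (allFin p) (λ b → ℕΣ.∑ (allVecs p n) (λ v → f (b ∷ v)))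
  ∑-vec n f = trans (ℕΣ.∑-concatMap (λ b → map (b ∷_) (allVecs p n)) (allFin p) f) (ℕΣ.∑-cong (allFin p) (λ b → ℕΣ.∑-map (b ∷_) (allVecs p n) f))

  ∑-const : ∀ c → ℕΣ.∑ (allFin p) (λ _ → c) ≡ p * c
  ∑-const c = trans (ℕΣ.∑-cong (allFin p) (λ _ → sym (ℕₚ.*-identityˡ c))) (trans (ℕΣ.∑-*ʳ (allFin p) c (λ _ → 1)) (cong (_* c) (card-Fin p)))

  card-Vecs : ∀ n → count (λ _ → true) (allVecs p n) ≡ p ^ n
  card-Vecs zero    = refl
  card-Vecs (suc n) = trans (∑-vec n _) (trans (ℕΣ.∑-cong (allFin p) (λ b → card-Vecs n)) (∑-const (p ^ n)))

  zeros : ∀ {n} → Vec 𝔽 n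
  zeros = Vec.replicate _ 𝟘

  vecAbelianGroup : ∀ n → IsAbelianGroup _≡_ (zipWith {n = n} _⊞_) zeros (Vec.map ⊖_)
  vecAbelianGroup n = record
    { isGroup = record
      { isMonoid = record
        { isSemigroup = record
          { isMagma = record { isEquivalence = isEquivalence ; ∙-cong = cong₂ (zipWith _⊞_) }
          ; assoc = Vecₚ.zipWith-assoc ⊞-assoc }
        ; identity = Vecₚ.zipWith-identityˡ ⊞-identityˡ , Vecₚ.zipWith-identityʳ ⊞-identityʳ }
      ; inverse = Vecₚ.zipWith-inverseˡ ⊖-inverseˡ , Vecₚ.zipWith-inverseʳ ⊖-inverseʳ
      ; ⁻¹-cong = cong (Vec.map ⊖_) }
    ; comm = Vecₚ.zipWith-comm ⊞-comm }

  private
    map-distrib : ∀ {n} a b (v : Vec 𝔽 n) → Vec.map ((a ⊞ b) ⊠_) v ≡ zipWith _⊞_ (Vec.map (a ⊠_) v) (Vec.map (b ⊠_) v)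
    map-distrib a b []      = refl
    map-distrib a b (x ∷ v) = cong₂ _∷_ (⊠-distribʳ x a b) (map-distrib a b v)

    map-id′ : ∀ {n} (v : Vec 𝔽 n) → Vec.map (𝟙ᶠ ⊠_) v ≡ v
    map-id′ []      = refl
    map-id′ (x ∷ v) = cong₂ _∷_ (⊠-identityˡ x) (map-id′ v)

    map-assoc : ∀ {n} a b (v : Vec 𝔽 n) → Vec.map ((a ⊠ b) ⊠_) v ≡ Vec.map (a ⊠_) (Vec.map (b ⊠_) v)
    map-assoc a b []      = refl
    map-assoc a b (x ∷ v) = cong₂ _∷_ (⊠-assoc a b x) (map-assoc a b v)

  vecSpace : ∀ n → Space F
  vecSpace n = record
    { V = Vec 𝔽 (suc n) ; _+ᵛ_ = zipWith _⊞_ ; 0ᵛ = zeros ; -ᵛ_ = Vec.map ⊖_ ; _·_ = λ a → Vec.map (a ⊠_)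
    ; isAbelianGroup = vecAbelianGroup (suc n)
    ; ·-distrib = map-distrib ; ·-assoc = map-assoc ; ·-identity = map-id′
    ; finite = Vecs-finite (suc n) ; q = p ^ n ; size = card-Vecs (suc n) }

  dot : ∀ {n} → Vec 𝔽 n → Vec 𝔽 n → 𝔽
  dot []      []      = 𝟘
  dot (a ∷ c) (b ∷ x) = a ⊠ b ⊞ dot c x

  open 𝔽-Solver using (solve; _:+_; _:*_; _:-_; :-_; _:=_; con)

  dot-zeroˡ : ∀ {n} (x : Vec 𝔽 n) → dot zeros x ≡ 𝟘
  dot-zeroˡ []      = refl
  dot-zeroˡ (b ∷ x) = trans (cong₂ _⊞_ (⊠-zeroˡ b) (dot-zeroˡ x)) (⊞-identityˡ 𝟘)

  dot-zeroʳ : ∀ {n} (c : Vec 𝔽 n) → dot c zeros ≡ 𝟘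
  dot-zeroʳ []      = refl
  dot-zeroʳ (b ∷ x) = trans (cong₂ _⊞_ (⊠-zeroʳ b) (dot-zeroʳ x)) (⊞-identityˡ 𝟘)

  dot-+ : ∀ {n} (c x y : Vec 𝔽 n) → dot c (zipWith _⊞_ x y) ≡ dot c x ⊞ dot c y
  dot-+ [] [] [] = sym (⊞-identityˡ 𝟘)
  dot-+ (c ∷ cs) (x ∷ xs) (y ∷ ys) = trans (cong (c ⊠ (x ⊞ y) ⊞_) (dot-+ cs xs ys))
    (solve 5 (λ c x y u v → c :* (x :+ y) :+ (u :+ v) := c :* x :+ u :+ (c :* y :+ v)) refl c x y (dot cs xs) (dot cs ys))

  dot-neg : ∀ {n} (c x : Vec 𝔽 n) → dot c (Vec.map ⊖_ x) ≡ ⊖ dot c x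
  dot-neg [] [] = solve 0 (con (+ 0) := :- con (+ 0)) refl
  dot-neg (c ∷ cs) (x ∷ xs) = trans (cong (c ⊠ ⊖ x ⊞_) (dot-neg cs xs))
    (solve 3 (λ c x u → c :* (:- x) :+ (:- u) := :- (c :* x :+ u)) refl c x (dot cs xs))

  -- Where z has a nonzero coordinate, the corresponding coordinate of c is determined by the
  -- others. This is the orthogonality relation of the averaging argument.
  kernel-count : ∀ n (z : Vec 𝔽 (suc n)) → z ≢ zeros → count (λ c → does (dot c z Finₚ.≟ 𝟘)) (allVecs p (suc n)) ≡ p ^ n
  kernel-count n (z ∷ zs) nz with z Finₚ.≟ 𝟘
  ... | no z≢0 = begin
    ∑ (allVecs p (suc n)) (λ c → 𝟙 (does (dot c (z ∷ zs) Finₚ.≟ 𝟘)))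
      ≡⟨ trans (∑-vec n _) (∑-swap (allFin p) (allVecs p n) _) ⟩
    ∑ (allVecs p n) (λ c → ∑ (allFin p) (λ b → 𝟙 (does (b ⊠ z ⊞ dot c zs Finₚ.≟ 𝟘))))
      ≡⟨ ∑-cong (allVecs p n) (λ c → trans (FiniteSet.∑-bijection (Fin-finite p) (λ b → b ⊠ z ⊞ dot c zs) (λ y → (y ⊟ dot c zs) ⊠ z⁻)
        (λ y → r y (dot c zs)) (λ b → l b (dot c zs)) (λ y → 𝟙 (does (y Finₚ.≟ 𝟘)))) (fin-once p 𝟘)) ⟩
    ∑ (allVecs p n) (λ _ → 1)
      ≡⟨ card-Vecs n ⟩
    p ^ n ∎
    where
    open ≡-Reasoning
    open ℕΣ
    z⁻ = proj₁ (inverse z z≢0)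
    e : z⁻ ⊠ z ≡ 𝟙ᶠ
    e = proj₂ (inverse z z≢0)
    r : ∀ y t → (y ⊟ t) ⊠ z⁻ ⊠ z ⊞ t ≡ y
    r y t = trans (cong (_⊞ t) (trans (⊠-assoc (y ⊟ t) z⁻ z) (cong ((y ⊟ t) ⊠_) e))) (solve 2 (λ y t → (y :- t) :* con (+ 1) :+ t := y) refl y t)
    l : ∀ b t → (b ⊠ z ⊞ t ⊟ t) ⊠ z⁻ ≡ b
    l b t = trans (solve 4 (λ b z t w → (b :* z :+ t :- t) :* w := b :* (w :* z)) refl b z t z⁻) (trans (cong (b ⊠_) e) (⊠-identityʳ b))
  kernel-count zero (z ∷ []) nz | yes z≡0 = ⊥-elim (nz (cong (_∷ []) z≡0))
  kernel-count (suc n) (z ∷ zs) nz | yes z≡0 =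
    trans (∑-vec (suc n) _) (trans (ℕΣ.∑-cong (allFin p) (λ b → trans (ℕΣ.∑-cong (allVecs p (suc n)) (λ c → cong (λ u → ℕΣ.𝟙 (does (u Finₚ.≟ 𝟘))) (drop b c)))
      (kernel-count n zs (λ e → nz (cong₂ _∷_ z≡0 e))))) (∑-const (p ^ n)))
    where
    drop : ∀ b c → b ⊠ z ⊞ dot c zs ≡ dot c zs
    drop b c = trans (cong (λ u → b ⊠ u ⊞ dot c zs) z≡0) (trans (cong (_⊞ dot c zs) (⊠-zeroʳ b)) (⊞-identityˡ _))

-- Averaging slice convolutions over all functionals

module Spectral {p : ℕ} .{{_ : NonZero p}} (F : FieldOps p) (n : ℕ) where
  open PrimeField F
  open VectorSpace F
  open ℤΣ
  private
    module V = AdditiveCombinatorics (vecSpace n)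
    module W = PrimeLine F
    module CV = Convolution (vecSpace n)
    module CW = Convolution W.𝔽-space
    ⟨V⟩ = V.elems
    ⟨W⟩ = W.elems

  -- Push-forward along the functional c. For the indicator function of A it gives the sizes of the
  -- slices.
  push : V.V → (V.V → ℤ) → 𝔽 → ℤ
  push c f i = ∑ ⟨V⟩ (λ x → f x ℤ.* 𝟙 (W.δ (dot c x) i))

  push-∑ : ∀ c f (h : 𝔽 → ℤ) → ∑ ⟨W⟩ (λ i → push c f i ℤ.* h i) ≡ ∑ ⟨V⟩ (λ x → f x ℤ.* h (dot c x))
  push-∑ c f h = begin
    ∑ ⟨W⟩ (λ i → push c f i ℤ.* h i)
      ≡⟨ ∑-cong ⟨W⟩ (λ i → sym (∑-*ʳ ⟨V⟩ (h i) _)) ⟩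
    ∑ ⟨W⟩ (λ i → ∑ ⟨V⟩ (λ x → f x ℤ.* 𝟙 (W.δ (dot c x) i) ℤ.* h i))
      ≡⟨ ∑-swap ⟨W⟩ ⟨V⟩ _ ⟩
    ∑ ⟨V⟩ (λ x → ∑ ⟨W⟩ (λ i → f x ℤ.* 𝟙 (W.δ (dot c x) i) ℤ.* h i))
      ≡⟨ ∑-cong ⟨V⟩ (λ x → trans (∑-cong ⟨W⟩ (λ i → trans (ℤₚ.*-assoc (f x) _ (h i))
        (cong (λ b → f x ℤ.* (𝟙 b ℤ.* h i)) (FiniteSummation.δ-sym-does ℤ-semiring W.finite (dot c x) i))))
                                  (trans (∑-*ˡ ⟨W⟩ (f x) _) (cong (f x ℤ.*_) (CW.∑-δ (dot c x) h)))) ⟩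
    ∑ ⟨V⟩ (λ x → f x ℤ.* h (dot c x)) ∎
    where open ≡-Reasoning

  push-sum : ∀ c f → ∑ ⟨W⟩ (push c f) ≡ ∑ ⟨V⟩ f
  push-sum c f = trans (∑-cong ⟨W⟩ (λ i → sym (ℤₚ.*-identityʳ _))) (trans (push-∑ c f (λ _ → + 1)) (∑-cong ⟨V⟩ (λ x → ℤₚ.*-identityʳ _)))

  private
    δ-move : ∀ c z x i → W.δ (dot c z) (i ⊟ dot c x) ≡ W.δ (dot c (z V.+ᵛ x)) i
    δ-move c z x i with dot c z W.≟ (i ⊟ dot c x)
    ... | yes e = sym (dec-true (_ W.≟ i) (trans (dot-+ c z x) (trans (cong (_⊞ dot c x) e) (W.sub-add i (dot c x)))))
    ... | no ne = sym (dec-false (_ W.≟ i) (λ e → ne (trans (sym (W.add-sub (dot c z) (dot c x))) (cong (_⊟ dot c x) (trans (sym (dot-+ c z x)) e)))))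

  -- `dot c` is additive, so it carries convolutions to convolutions.
  conv-push : ∀ c fs i → CW.conv (map (push c) fs) i ≡ ∑ ⟨V⟩ (λ z → CV.conv fs z ℤ.* 𝟙 (W.δ (dot c z) i))
  conv-push c [] i = sym (trans (CV.∑-δ V.0ᵛ (λ z → 𝟙 (W.δ (dot c z) i)))
    (cong 𝟙 (trans (cong (λ u → W.δ u i) (dot-zeroʳ c)) (FiniteSummation.δ-sym-does ℤ-semiring W.finite 𝟘 i))))
  conv-push c (f ∷ fs) i = begin
    ∑ ⟨W⟩ (λ j → push c f j ℤ.* CW.conv (map (push c) fs) (i ⊟ j))
      ≡⟨ push-∑ c f (λ j → CW.conv (map (push c) fs) (i ⊟ j)) ⟩
    ∑ ⟨V⟩ (λ x → f x ℤ.* CW.conv (map (push c) fs) (i ⊟ dot c x))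
      ≡⟨ ∑-cong ⟨V⟩ (λ x → cong (f x ℤ.*_) (trans (conv-push c fs (i ⊟ dot c x)) (shifted x))) ⟩
    ∑ ⟨V⟩ (λ x → f x ℤ.* ∑ ⟨V⟩ (λ z → CV.conv fs (z V.-ᵛ x) ℤ.* 𝟙 (W.δ (dot c z) i)))
      ≡⟨ ∑-cong ⟨V⟩ (λ x → trans (sym (∑-*ˡ ⟨V⟩ (f x) _)) (∑-cong ⟨V⟩ (λ z → sym (ℤₚ.*-assoc (f x) _ _)))) ⟩
    ∑ ⟨V⟩ (λ x → ∑ ⟨V⟩ (λ z → f x ℤ.* CV.conv fs (z V.-ᵛ x) ℤ.* 𝟙 (W.δ (dot c z) i)))
      ≡⟨ ∑-swap ⟨V⟩ ⟨V⟩ _ ⟩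
    ∑ ⟨V⟩ (λ z → ∑ ⟨V⟩ (λ x → f x ℤ.* CV.conv fs (z V.-ᵛ x) ℤ.* 𝟙 (W.δ (dot c z) i)))
      ≡⟨ ∑-cong ⟨V⟩ (λ z → ∑-*ʳ ⟨V⟩ (𝟙 (W.δ (dot c z) i)) _) ⟩
    ∑ ⟨V⟩ (λ z → CV.conv (f ∷ fs) z ℤ.* 𝟙 (W.δ (dot c z) i)) ∎
    where
    open ≡-Reasoning
    shifted : ∀ x → ∑ ⟨V⟩ (λ z → CV.conv fs z ℤ.* 𝟙 (W.δ (dot c z) (i ⊟ dot c x))) ≡ ∑ ⟨V⟩ (λ z → CV.conv fs (z V.-ᵛ x) ℤ.* 𝟙 (W.δ (dot c z) i))
    shifted x = trans (∑-cong ⟨V⟩ (λ z → cong₂ (λ u b → CV.conv fs u ℤ.* 𝟙 b) (sym (V.add-sub z x)) (δ-move c z x i)))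
      (CV.∑-bijection (V._+ᵛ x) (V._-ᵛ x) (λ z → V.sub-add z x) (λ z → V.add-sub z x) (λ z → CV.conv fs (z V.-ᵛ x) ℤ.* 𝟙 (W.δ (dot c z) i)))

  private
    kernel : ∀ z → ∑ ⟨V⟩ (λ c → 𝟙 (W.δ (dot c z) 𝟘)) ≡ + (p ^ n) ℤ.+ 𝟙 (V.δ z V.0ᵛ) ℤ.* (+ (p ^ suc n) ℤ.- + (p ^ n))
    kernel z with z V.≟ V.0ᵛ
    ... | yes refl = trans (∑-cong ⟨V⟩ (λ c → cong 𝟙 (dec-true (_ W.≟ 𝟘) (dot-zeroʳ c))))
      (trans (sym (+-∑ ⟨V⟩ (λ _ → 1))) (trans (cong +_ (card-Vecs (suc n))) (lem (+ (p ^ suc n)) (+ (p ^ n)))))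
      where
      lem : ∀ a b → a ≡ b ℤ.+ + 1 ℤ.* (a ℤ.- b)
      lem = solveℤ-∀
    ... | no ne = trans (∑-cong ⟨V⟩ (λ c → sym (+-𝟙 _))) (trans (sym (+-∑ ⟨V⟩ _)) (trans (cong +_ (kernel-count n z ne)) (sym (ℤₚ.+-identityʳ _))))

  -- A vector z ≠ 0 is killed by p^n functionals and z = 0 by all p^(n+1) of them, so the sum over c
  -- sees only the total mass and the value at 0.
  ∑-conv-push : ∀ fs → ∑ ⟨V⟩ (λ c → CW.conv (map (push c) fs) 𝟘) ≡ + (p ^ n) ℤ.* CV.sums fs ℤ.+ (+ (p ^ suc n) ℤ.- + (p ^ n)) ℤ.* CV.conv fs V.0ᵛ
  ∑-conv-push fs = begin
    ∑ ⟨V⟩ (λ c → CW.conv (map (push c) fs) 𝟘)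
      ≡⟨ ∑-cong ⟨V⟩ (λ c → conv-push c fs 𝟘) ⟩
    ∑ ⟨V⟩ (λ c → ∑ ⟨V⟩ (λ z → CV.conv fs z ℤ.* 𝟙 (W.δ (dot c z) 𝟘)))
      ≡⟨ ∑-swap ⟨V⟩ ⟨V⟩ _ ⟩
    ∑ ⟨V⟩ (λ z → ∑ ⟨V⟩ (λ c → CV.conv fs z ℤ.* 𝟙 (W.δ (dot c z) 𝟘)))
      ≡⟨ ∑-cong ⟨V⟩ (λ z → trans (∑-*ˡ ⟨V⟩ (CV.conv fs z) _) (trans (cong (CV.conv fs z ℤ.*_) (kernel z))
        (lem (CV.conv fs z) (+ (p ^ n)) (𝟙 (V.δ z V.0ᵛ)) (+ (p ^ suc n) ℤ.- + (p ^ n))))) ⟩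
    ∑ ⟨V⟩ (λ z → + (p ^ n) ℤ.* CV.conv fs z ℤ.+ (+ (p ^ suc n) ℤ.- + (p ^ n)) ℤ.* (𝟙 (V.δ z V.0ᵛ) ℤ.* CV.conv fs z))
      ≡⟨ trans (∑-+ ⟨V⟩ (λ z → + (p ^ n) ℤ.* CV.conv fs z) (λ z → (+ (p ^ suc n) ℤ.- + (p ^ n)) ℤ.* (𝟙 (V.δ z V.0ᵛ) ℤ.* CV.conv fs z)))
        (cong₂ ℤ._+_ (trans (∑-*ˡ ⟨V⟩ (+ (p ^ n)) (CV.conv fs)) (cong (+ (p ^ n) ℤ.*_) (CV.∑-conv fs)))
        (trans (∑-*ˡ ⟨V⟩ (+ (p ^ suc n) ℤ.- + (p ^ n)) (λ z → 𝟙 (V.δ z V.0ᵛ) ℤ.* CV.conv fs z))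
        (cong ((+ (p ^ suc n) ℤ.- + (p ^ n)) ℤ.*_) (CV.∑-δ V.0ᵛ (CV.conv fs))))) ⟩
    + (p ^ n) ℤ.* CV.sums fs ℤ.+ (+ (p ^ suc n) ℤ.- + (p ^ n)) ℤ.* CV.conv fs V.0ᵛ ∎
    where
    open ≡-Reasoning
    lem : ∀ c a d b → c ℤ.* (a ℤ.+ d ℤ.* b) ≡ a ℤ.* c ℤ.+ b ℤ.* (d ℤ.* c)
    lem = solveℤ-∀

  conv-push-0 : ∀ fs → CW.conv (map (push V.0ᵛ) fs) 𝟘 ≡ CV.sums fs
  conv-push-0 fs = trans (conv-push V.0ᵛ fs 𝟘) (trans (∑-cong ⟨V⟩ (λ z → trans (cong (λ b → CV.conv fs z ℤ.* 𝟙 b) (dec-true (_ W.≟ 𝟘) (dot-zeroˡ z)))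
    (ℤₚ.*-identityʳ _))) (CV.∑-conv fs))

  module _ (A : V.V → Bool) where

    signed : Bool → V.V → Bool
    signed true  = A
    signed false = V.neg A

    a : ℕ
    a = V.# A

    ind : (V.V → Bool) → V.V → ℤ
    ind X x = 𝟙 (X x)

    -- Deviation of a slice from the mean size a / p, multiplied by p to stay in the integers.
    dev : V.V → (V.V → Bool) → 𝔽 → ℤ
    dev c X i = + p ℤ.* push c (ind X) i ℤ.- + a

    ∑-ind : ∀ σ → ∑ ⟨V⟩ (ind (signed σ)) ≡ + a
    ∑-ind true  = trans (∑-cong ⟨V⟩ (λ x → sym (+-𝟙 (A x)))) (sym (+-∑ ⟨V⟩ _))
    ∑-ind false = trans (∑-cong ⟨V⟩ (λ x → sym (+-𝟙 (V.neg A x)))) (trans (sym (+-∑ ⟨V⟩ _)) (cong +_ (V.card-neg A)))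

    private
      ∑1 : ∑ ⟨W⟩ (λ _ → + 1) ≡ + p
      ∑1 = trans (sym (+-∑ ⟨W⟩ (λ _ → 1))) (cong +_ W.#full)

    ∑-dev : ∀ c σ → ∑ ⟨W⟩ (dev c (signed σ)) ≡ + 0
    ∑-dev c σ = begin
      ∑ ⟨W⟩ (λ i → + p ℤ.* push c (ind (signed σ)) i ℤ.- + a)
        ≡⟨ ∑-cong ⟨W⟩ (λ i → cong (ℤ._+_ (+ p ℤ.* push c (ind (signed σ)) i)) (sym (ℤₚ.*-identityʳ _))) ⟩
      ∑ ⟨W⟩ (λ i → + p ℤ.* push c (ind (signed σ)) i ℤ.+ (ℤ.- + a) ℤ.* + 1)
        ≡⟨ trans (∑-+ ⟨W⟩ _ _) (cong₂ ℤ._+_ (trans (∑-*ˡ ⟨W⟩ (+ p) _) (cong (+ p ℤ.*_) (trans (push-sum c (ind (signed σ))) (∑-ind σ))))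
          (trans (∑-*ˡ ⟨W⟩ (ℤ.- + a) (λ _ → + 1)) (cong ((ℤ.- + a) ℤ.*_) ∑1))) ⟩
      + p ℤ.* + a ℤ.+ (ℤ.- + a) ℤ.* + p
        ≡⟨ lem (+ p) (+ a) ⟩
      + 0 ∎
      where
      open ≡-Reasoning
      lem : ∀ p a → p ℤ.* a ℤ.+ (ℤ.- a) ℤ.* p ≡ + 0
      lem = solveℤ-∀

    push-neg : ∀ c i → push c (ind (V.neg A)) i ≡ push c (ind A) (⊖ i)
    push-neg c i = trans (∑-cong ⟨V⟩ (λ x → cong (λ b → 𝟙 (A (V.-ᵛ x)) ℤ.* 𝟙 b) (move x)))
      (CV.∑-bijection V.-ᵛ_ V.-ᵛ_ V.-ᵛ-involutive V.-ᵛ-involutive (λ x → 𝟙 (A x) ℤ.* 𝟙 (W.δ (dot c x) (⊖ i))))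
      where
      move : ∀ x → W.δ (dot c x) i ≡ W.δ (dot c (V.-ᵛ x)) (⊖ i)
      move x with dot c x W.≟ i
      ... | yes e = sym (dec-true (_ W.≟ (⊖ i)) (trans (dot-neg c x) (cong ⊖_ e)))
      ... | no ne = sym (dec-false (_ W.≟ (⊖ i)) (λ e → ne (trans (sym (⊖-involutive _)) (trans (cong ⊖_ (trans (sym (dot-neg c x)) e)) (⊖-involutive i)))))

    spread : V.V → ℕ
    spread c = CW.norm₁ (dev c A)

    energy : V.V → ℕ
    energy c = CW.norm₂ (dev c A)

    private
      norm-signed : (f : ℕ → ℕ) → ∀ c σ → ℕΣ.∑ ⟨W⟩ (λ i → f ℤ.∣ dev c (signed σ) i ∣) ≡ ℕΣ.∑ ⟨W⟩ (λ i → f ℤ.∣ dev c A i ∣)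
      norm-signed f c true  = refl
      norm-signed f c false = trans (ℕΣ.∑-cong ⟨W⟩ (λ i → cong (λ u → f ℤ.∣ + p ℤ.* u ℤ.- + a ∣) (push-neg c i)))
        (W.∑-bijection ⊖_ ⊖_ ⊖-involutive ⊖-involutive (λ i → f ℤ.∣ dev c A i ∣))

      sq : ∀ i → + (ℤ.∣ i ∣ * ℤ.∣ i ∣) ≡ i ℤ.* i
      sq (+ k) = ℤₚ.pos-* k k
      sq ℤ.-[1+ k ] = refl

      -- Reading the sum of squares as a convolution for A and -A makes the averaging identity
      -- compute the total energy as well.
      ∑-sq : ∀ c → ∑ ⟨W⟩ (λ i → push c (ind A) i ℤ.* push c (ind A) i) ≡ CW.conv (map (push c) (ind A ∷ ind (V.neg A) ∷ [])) 𝟘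
      ∑-sq c = ∑-cong ⟨W⟩ (λ i → cong (push c (ind A) i ℤ.*_) (sym (trans (CW.conv-single (push c (ind (V.neg A))) (𝟘 ⊟ i))
        (trans (push-neg c (𝟘 ⊟ i)) (cong (push c (ind A)) (trans (cong ⊖_ (⊞-identityˡ (⊖ i))) (⊖-involutive i)))))))

      energy-eq : ∀ c → + energy c ≡ + p ℤ.* + p ℤ.* CW.conv (map (push c) (ind A ∷ ind (V.neg A) ∷ [])) 𝟘 ℤ.- + p ℤ.* (+ a ℤ.* + a)
      energy-eq c = begin
        + energy c
          ≡⟨ +-∑ ⟨W⟩ _ ⟩
        ∑ ⟨W⟩ (λ i → + (ℤ.∣ dev c A i ∣ * ℤ.∣ dev c A i ∣))
          ≡⟨ ∑-cong ⟨W⟩ (λ i → trans (sq (dev c A i)) (expand (+ p) (push c (ind A) i) (+ a))) ⟩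
        ∑ ⟨W⟩ (λ i → + p ℤ.* + p ℤ.* (push c (ind A) i ℤ.* push c (ind A) i) ℤ.+ ((+ a ℤ.* + a) ℤ.* + 1 ℤ.+ (ℤ.- (+ 2 ℤ.* + p ℤ.* + a)) ℤ.* push c (ind A) i))
          ≡⟨ trans (∑-+ ⟨W⟩ _ _) (cong₂ ℤ._+_ (trans (∑-*ˡ ⟨W⟩ (+ p ℤ.* + p) _) (cong (+ p ℤ.* + p ℤ.*_) (∑-sq c)))
               (trans (∑-+ ⟨W⟩ _ _) (cong₂ ℤ._+_ (trans (∑-*ˡ ⟨W⟩ (+ a ℤ.* + a) (λ _ → + 1)) (cong ((+ a ℤ.* + a) ℤ.*_) ∑1))
                 (trans (∑-*ˡ ⟨W⟩ (ℤ.- (+ 2 ℤ.* + p ℤ.* + a)) (push c (ind A)))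
                   (cong ((ℤ.- (+ 2 ℤ.* + p ℤ.* + a)) ℤ.*_) (trans (push-sum c (ind A)) (∑-ind true))))))) ⟩
        + p ℤ.* + p ℤ.* S ℤ.+ ((+ a ℤ.* + a) ℤ.* + p ℤ.+ (ℤ.- (+ 2 ℤ.* + p ℤ.* + a)) ℤ.* + a)
          ≡⟨ collect (+ p) (+ a) S ⟩
        + p ℤ.* + p ℤ.* S ℤ.- + p ℤ.* (+ a ℤ.* + a) ∎
        where
        open ≡-Reasoning
        S = CW.conv (map (push c) (ind A ∷ ind (V.neg A) ∷ [])) 𝟘
        expand : ∀ p w a → (p ℤ.* w ℤ.- a) ℤ.* (p ℤ.* w ℤ.- a) ≡ p ℤ.* p ℤ.* (w ℤ.* w) ℤ.+ ((a ℤ.* a) ℤ.* + 1 ℤ.+ (ℤ.- (+ 2 ℤ.* p ℤ.* a)) ℤ.* w)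
        expand = solveℤ-∀
        collect : ∀ p a S → p ℤ.* p ℤ.* S ℤ.+ ((a ℤ.* a) ℤ.* p ℤ.+ (ℤ.- (+ 2 ℤ.* p ℤ.* a)) ℤ.* a) ≡ p ℤ.* p ℤ.* S ℤ.- p ℤ.* (a ℤ.* a)
        collect = solveℤ-∀

      sums₂ : CV.sums (ind A ∷ ind (V.neg A) ∷ []) ≡ + a ℤ.* + a
      sums₂ = trans (cong₂ (λ u v → u ℤ.* (v ℤ.* + 1)) (∑-ind true) (∑-ind false)) (cong (+ a ℤ.*_) (ℤₚ.*-identityʳ (+ a)))

      conv₂ : CV.conv (ind A ∷ ind (V.neg A) ∷ []) V.0ᵛ ≡ + a
      conv₂ = trans (∑-cong ⟨V⟩ (λ x → trans (cong (ind A x ℤ.*_) (trans (CV.conv-single (ind (V.neg A)) (V.0ᵛ V.-ᵛ x))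
        (cong (ind A) (trans (cong V.-ᵛ_ (V.+ᵛ-identityˡ (V.-ᵛ x))) (V.-ᵛ-involutive x))))) (idem (A x)))) (∑-ind true)
        where
        idem : ∀ b → 𝟙 b ℤ.* 𝟙 b ≡ 𝟙 b
        idem true  = refl
        idem false = refl

      pos-^ : ∀ x k → + (x ^ k) ≡ (+ x) ℤ.^ k
      pos-^ x zero    = refl
      pos-^ x (suc k) = trans (ℤₚ.pos-* x (x ^ k)) (cong (+ x ℤ.*_) (pos-^ x k))

      sums-signed : ∀ σs → CV.sums (map (ind ∘ signed) σs) ≡ (+ a) ℤ.^ length σs
      sums-signed []       = refl
      sums-signed (σ ∷ σs) = cong₂ ℤ._*_ (∑-ind σ) (sums-signed σs)

      map-∘₂ : ∀ {A B C : Set} (f : B → C) (g : A → B) xs → map f (map g xs) ≡ map (λ x → f (g x)) xs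
      map-∘₂ f g []       = refl
      map-∘₂ f g (x ∷ xs) = cong (f (g x) ∷_) (map-∘₂ f g xs)

    module _ (p₁ : ℕ) (p≡ : p ≡ suc p₁) where

      private
        P₁ = + p₁
        P≡ : + p ≡ + 1 ℤ.+ P₁
        P≡ = cong +_ p≡

      energy-0 : energy V.0ᵛ ≡ p * p₁ * (a * a)
      energy-0 = ℤₚ.+-injective (trans (energy-eq V.0ᵛ) (trans (cong (λ u → + p ℤ.* + p ℤ.* u ℤ.- + p ℤ.* (+ a ℤ.* + a))
        (trans (conv-push-0 (ind A ∷ ind (V.neg A) ∷ [])) sums₂))
        (trans (cong (λ u → + p ℤ.* u ℤ.* (+ a ℤ.* + a) ℤ.- + p ℤ.* (+ a ℤ.* + a)) P≡)
          (trans (lem (+ p) P₁ (+ a)) (sym (trans (ℤₚ.pos-* (p * p₁) (a * a)) (cong₂ ℤ._*_ (ℤₚ.pos-* p p₁) (ℤₚ.pos-* a a))))))))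
        where
        lem : ∀ p q a → p ℤ.* (+ 1 ℤ.+ q) ℤ.* (a ℤ.* a) ℤ.- p ℤ.* (a ℤ.* a) ≡ p ℤ.* q ℤ.* (a ℤ.* a)
        lem = solveℤ-∀

      energy-sum : ℕΣ.∑ ⟨V⟩ energy ≡ p * p * (p ^ n * p₁) * a
      energy-sum = ℤₚ.+-injective (begin
        + ℕΣ.∑ ⟨V⟩ energy
          ≡⟨ trans (+-∑ ⟨V⟩ energy) (∑-cong ⟨V⟩ (λ c → trans (energy-eq c) (split (+ p ℤ.* + p ℤ.* S c) (+ p ℤ.* (+ a ℤ.* + a))))) ⟩
        ∑ ⟨V⟩ (λ c → + p ℤ.* + p ℤ.* S c ℤ.+ (ℤ.- (+ p ℤ.* (+ a ℤ.* + a))) ℤ.* + 1)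
          ≡⟨ trans (∑-+ ⟨V⟩ _ _) (cong₂ ℤ._+_ (trans (∑-*ˡ ⟨V⟩ (+ p ℤ.* + p) S)
            (cong (+ p ℤ.* + p ℤ.*_) (trans (∑-conv-push (ind A ∷ ind (V.neg A) ∷ []))
            (cong₂ (λ u v → + (p ^ n) ℤ.* u ℤ.+ (+ (p ^ suc n) ℤ.- + (p ^ n)) ℤ.* v) sums₂ conv₂))))
               (trans (∑-*ˡ ⟨V⟩ (ℤ.- (+ p ℤ.* (+ a ℤ.* + a))) (λ _ → + 1))
                 (cong ((ℤ.- (+ p ℤ.* (+ a ℤ.* + a))) ℤ.*_) (trans (sym (+-∑ ⟨V⟩ (λ _ → 1))) (trans (cong +_ (card-Vecs (suc n))) (ℤₚ.pos-* p (p ^ n))))))) ⟩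
        + p ℤ.* + p ℤ.* (N ℤ.* (+ a ℤ.* + a) ℤ.+ (+ (p ^ suc n) ℤ.- N) ℤ.* + a) ℤ.+ (ℤ.- (+ p ℤ.* (+ a ℤ.* + a))) ℤ.* (+ p ℤ.* N)
          ≡⟨ cong (λ u → + p ℤ.* + p ℤ.* (N ℤ.* (+ a ℤ.* + a) ℤ.+ (u ℤ.- N) ℤ.* + a) ℤ.+ (ℤ.- (+ p ℤ.* (+ a ℤ.* + a))) ℤ.* (+ p ℤ.* N))
            (trans (ℤₚ.pos-* p (p ^ n)) (cong (ℤ._* N) P≡)) ⟩
        + p ℤ.* + p ℤ.* (N ℤ.* (+ a ℤ.* + a) ℤ.+ ((+ 1 ℤ.+ P₁) ℤ.* N ℤ.- N) ℤ.* + a) ℤ.+ (ℤ.- (+ p ℤ.* (+ a ℤ.* + a))) ℤ.* (+ p ℤ.* N)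
          ≡⟨ lem (+ p) N (+ a) P₁ ⟩
        + p ℤ.* + p ℤ.* (N ℤ.* P₁) ℤ.* + a
          ≡⟨ sym (trans (ℤₚ.pos-* (p * p * (p ^ n * p₁)) a) (cong (ℤ._* + a)
            (trans (ℤₚ.pos-* (p * p) (p ^ n * p₁)) (cong₂ ℤ._*_ (ℤₚ.pos-* p p) (ℤₚ.pos-* (p ^ n) p₁))))) ⟩
        + (p * p * (p ^ n * p₁) * a) ∎)
        where
        open ≡-Reasoning
        N = + (p ^ n)
        S = λ c → CW.conv (map (push c) (ind A ∷ ind (V.neg A) ∷ [])) 𝟘
        split : ∀ x y → x ℤ.- y ≡ x ℤ.+ (ℤ.- y) ℤ.* + 1
        split = solveℤ-∀
        lem : ∀ p N a q → p ℤ.* p ℤ.* (N ℤ.* (a ℤ.* a) ℤ.+ ((+ 1 ℤ.+ q) ℤ.* N ℤ.- N) ℤ.* a) ℤ.+ (ℤ.- (p ℤ.* (a ℤ.* a))) ℤ.* (p ℤ.* N) ≡ p ℤ.* p ℤ.*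
          (N ℤ.* q) ℤ.* a
        lem = solveℤ-∀

      module _ (σ : Bool) (σs : List Bool) (sf : ¬ V.SumOf (map signed (σ ∷ σs)) V.0ᵛ) where
        private
          K = suc (length σs)
          fs = map (ind ∘ signed) (σ ∷ σs)

          E : V.V → ℤ
          E c = CW.conv (map (dev c ∘ signed) (σ ∷ σs)) 𝟘

          length-map : ∀ {A B : Set} (f : A → B) xs → length (map f xs) ≡ length xs
          length-map f []       = refl
          length-map f (x ∷ xs) = cong suc (length-map f xs)

          E-eq : ∀ c → (+ p) ℤ.^ K ℤ.* CW.conv (map (push c) fs) 𝟘 ≡ (+ a) ℤ.^ K ℤ.* (+ p) ℤ.^ length σs ℤ.+ E c
          E-eq c = begin
            (+ p) ℤ.^ K ℤ.* CW.conv (map (push c) fs) 𝟘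
              ≡⟨ cong (λ k → (+ p) ℤ.^ k ℤ.* CW.conv (map (push c) fs) 𝟘) (sym (trans (length-map (push c) fs) (length-map (ind ∘ signed) (σ ∷ σs)))) ⟩
            (+ p) ℤ.^ length (map (push c) fs) ℤ.* CW.conv (map (push c) fs) 𝟘
              ≡⟨ sym (CW.conv-scale (+ p) (map (push c) fs) 𝟘) ⟩
            CW.conv (map (λ f i → + p ℤ.* f i) (map (push c) fs)) 𝟘
              ≡⟨ conv-ext (σ ∷ σs) 𝟘 ⟩
            CW.conv (map (λ g i → + a ℤ.+ g i) (map (dev c ∘ signed) (σ ∷ σs))) 𝟘
              ≡⟨ CW.conv-centered (+ a) (+ p) ∑1 (dev c (signed σ)) (map (dev c ∘ signed) σs) (allZero (σ ∷ σs)) 𝟘 ⟩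
            (+ a) ℤ.^ suc (length (map (dev c ∘ signed) σs)) ℤ.* (+ p) ℤ.^ length (map (dev c ∘ signed) σs) ℤ.+ E c
              ≡⟨ cong (λ k → (+ a) ℤ.^ suc k ℤ.* (+ p) ℤ.^ k ℤ.+ E c) (length-map (dev c ∘ signed) σs) ⟩
            (+ a) ℤ.^ K ℤ.* (+ p) ℤ.^ length σs ℤ.+ E c ∎
            where
            open ≡-Reasoning
            allZero : ∀ σs → All (λ g → ∑ ⟨W⟩ g ≡ + 0) (map (dev c ∘ signed) σs)
            allZero []       = []
            allZero (σ ∷ σs) = ∑-dev c σ ∷ allZero σs
            cancel : ∀ p a → p ≡ a ℤ.+ (p ℤ.- a)
            cancel = solveℤ-∀
            conv-ext : ∀ σs z → CW.conv (map (λ f i → + p ℤ.* f i) (map (push c) (map (ind ∘ signed) σs))) z ≡ CW.conv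
              (map (λ g i → + a ℤ.+ g i) (map (dev c ∘ signed) σs)) z
            conv-ext []       z = refl
            conv-ext (σ ∷ σs) z = ∑-cong ⟨W⟩ (λ i → cong₂ ℤ._*_ (cancel (+ p ℤ.* push c (ind (signed σ)) i) (+ a)) (conv-ext σs (z ⊟ i)))

          conv-fs-0 : CV.conv fs V.0ᵛ ≡ + 0
          conv-fs-0 = trans (cong (λ l → CV.conv l V.0ᵛ) (sym (map-∘₂ ind signed (σ ∷ σs)))) (CV.conv-no-SumOf (map signed (σ ∷ σs)) V.0ᵛ sf)

          M = (+ a) ℤ.^ K ℤ.* (+ p) ℤ.^ length σs

          -- Since 0 has no representation, averaging leaves only the total mass, and this is
          -- p^(n+1) times the main term M.
          ∑-E : ∑ ⟨V⟩ E ≡ + 0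
          ∑-E = begin
            ∑ ⟨V⟩ E
              ≡⟨ ∑-cong ⟨V⟩ (λ c → trans (isolate M (E c)) (cong (λ u → u ℤ.+ (ℤ.- M) ℤ.* + 1) (sym (E-eq c)))) ⟩
            ∑ ⟨V⟩ (λ c → (+ p) ℤ.^ K ℤ.* CW.conv (map (push c) fs) 𝟘 ℤ.+ (ℤ.- M) ℤ.* + 1)
              ≡⟨ trans (∑-+ ⟨V⟩ _ _) (cong₂ ℤ._+_ (trans (∑-*ˡ ⟨V⟩ ((+ p) ℤ.^ K) _)
                (cong ((+ p) ℤ.^ K ℤ.*_) (trans (∑-conv-push fs) (cong₂ (λ u v → N ℤ.* u ℤ.+ (+ (p ^ suc n) ℤ.- N) ℤ.* v) (sums-signed (σ ∷ σs)) conv-fs-0))))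
                   (trans (∑-*ˡ ⟨V⟩ (ℤ.- M) (λ _ → + 1)) (cong ((ℤ.- M) ℤ.*_)
                     (trans (sym (+-∑ ⟨V⟩ (λ _ → 1))) (trans (cong +_ (card-Vecs (suc n))) (ℤₚ.pos-* p (p ^ n))))))) ⟩
            (+ p) ℤ.^ K ℤ.* (N ℤ.* (+ a) ℤ.^ K ℤ.+ (+ (p ^ suc n) ℤ.- N) ℤ.* + 0) ℤ.+ (ℤ.- M) ℤ.* (+ p ℤ.* N)
              ≡⟨ lem (+ p) ((+ p) ℤ.^ length σs) N ((+ a) ℤ.^ K) (+ (p ^ suc n)) ⟩
            + 0 ∎
            where
            open ≡-Reasoning
            N = + (p ^ n)
            isolate : ∀ M E → E ≡ M ℤ.+ E ℤ.+ (ℤ.- M) ℤ.* + 1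
            isolate = solveℤ-∀
            lem : ∀ p P N A R → p ℤ.* P ℤ.* (N ℤ.* A ℤ.+ (R ℤ.- N) ℤ.* + 0) ℤ.+ (ℤ.- (A ℤ.* P)) ℤ.* (p ℤ.* N) ≡ + 0
            lem = solveℤ-∀

          -- For c = 0 all of A falls into the slice at 0. The errors of the other functionals have
          -- to cancel this large one.
          E-0 : E V.0ᵛ ≡ + (a ^ K * p ^ length σs * p₁)
          E-0 = begin
            E V.0ᵛ
              ≡⟨ isolate M (E V.0ᵛ) ⟩
            M ℤ.+ E V.0ᵛ ℤ.- M
              ≡⟨ cong (ℤ._- M) (trans (sym (E-eq V.0ᵛ)) (cong ((+ p) ℤ.^ K ℤ.*_) (trans (conv-push-0 fs) (sums-signed (σ ∷ σs))))) ⟩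
            (+ p) ℤ.^ K ℤ.* (+ a) ℤ.^ K ℤ.- M
              ≡⟨ cong (λ u → u ℤ.* (+ p) ℤ.^ length σs ℤ.* (+ a) ℤ.^ K ℤ.- M) P≡ ⟩
            (+ 1 ℤ.+ P₁) ℤ.* (+ p) ℤ.^ length σs ℤ.* (+ a) ℤ.^ K ℤ.- M
              ≡⟨ lem P₁ ((+ p) ℤ.^ length σs) ((+ a) ℤ.^ K) ⟩
            (+ a) ℤ.^ K ℤ.* (+ p) ℤ.^ length σs ℤ.* P₁
              ≡⟨ sym (trans (ℤₚ.pos-* (a ^ K * p ^ length σs) p₁) (cong (ℤ._* P₁)
                (trans (ℤₚ.pos-* (a ^ K) (p ^ length σs)) (cong₂ ℤ._*_ (pos-^ a K) (pos-^ p (length σs)))))) ⟩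
            + (a ^ K * p ^ length σs * p₁) ∎
            where
            open ≡-Reasoning
            isolate : ∀ M E → E ≡ M ℤ.+ E ℤ.- M
            isolate = solveℤ-∀
            lem : ∀ q P A → (+ 1 ℤ.+ q) ℤ.* P ℤ.* A ℤ.- A ℤ.* P ≡ A ℤ.* P ℤ.* q
            lem = solveℤ-∀

          off : V.V → ℕ
          off c = ℕΣ.𝟙 (not (V.δ c V.0ᵛ))

          E-off : ℤ.∣ E V.0ᵛ ∣ ≤ ℕΣ.∑ ⟨V⟩ (λ c → off c * ℤ.∣ E c ∣)
          E-off = ≤-trans (≤-reflexive (trans (sym (ℤₚ.∣-i∣≡∣i∣ (E V.0ᵛ))) (cong ℤ.∣_∣ (sym rest))))
            (≤-trans (∣∑∣≤ ⟨V⟩ _) (≤-reflexive (ℕΣ.∑-cong ⟨V⟩ (λ c → ℤₚ.abs-* (+ off c) (E c)))))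
            where
            open ≡-Reasoning
            compl : ∀ b e → + ℕΣ.𝟙 (not b) ℤ.* e ≡ e ℤ.+ (ℤ.- + 1) ℤ.* (𝟙 b ℤ.* e)
            compl true  e = solve′ e
              where
              solve′ : ∀ e → + 0 ℤ.* e ≡ e ℤ.+ (ℤ.- + 1) ℤ.* (+ 1 ℤ.* e)
              solve′ = solveℤ-∀
            compl false e = solve′ e
              where
              solve′ : ∀ e → + 1 ℤ.* e ≡ e ℤ.+ (ℤ.- + 1) ℤ.* (+ 0 ℤ.* e)
              solve′ = solveℤ-∀
            rest : ∑ ⟨V⟩ (λ c → + off c ℤ.* E c) ≡ ℤ.- E V.0ᵛ
            rest = begin
              ∑ ⟨V⟩ (λ c → + off c ℤ.* E c)
                ≡⟨ ∑-cong ⟨V⟩ (λ c → compl (V.δ c V.0ᵛ) (E c)) ⟩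
              ∑ ⟨V⟩ (λ c → E c ℤ.+ (ℤ.- + 1) ℤ.* (𝟙 (V.δ c V.0ᵛ) ℤ.* E c))
                ≡⟨ trans (∑-+ ⟨V⟩ _ _) (cong₂ ℤ._+_ ∑-E (trans (∑-*ˡ ⟨V⟩ (ℤ.- + 1) _) (cong ((ℤ.- + 1) ℤ.*_) (CV.∑-δ V.0ᵛ E)))) ⟩
              + 0 ℤ.+ (ℤ.- + 1) ℤ.* E V.0ᵛ
                ≡⟨ fin (E V.0ᵛ) ⟩
              ℤ.- E V.0ᵛ ∎
              where
              fin : ∀ e → + 0 ℤ.+ (ℤ.- + 1) ℤ.* e ≡ ℤ.- e
              fin = solveℤ-∀

          off-energy : ℕΣ.∑ ⟨V⟩ (λ c → off c * energy c) + energy V.0ᵛ ≡ ℕΣ.∑ ⟨V⟩ energy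
          off-energy = trans (cong (_+_ (ℕΣ.∑ ⟨V⟩ (λ c → off c * energy c))) (sym (V.∑-δ V.0ᵛ energy)))
            (trans (sym (ℕΣ.∑-+ ⟨V⟩ _ _)) (ℕΣ.∑-cong ⟨V⟩ (λ c → split (V.δ c V.0ᵛ) (energy c))))
            where
            split : ∀ b e → ℕΣ.𝟙 (not b) * e + ℕΣ.𝟙 b * e ≡ e
            split true  e = ℕₚ.*-identityˡ e
            split false e = trans (ℕₚ.+-identityʳ _) (ℕₚ.*-identityˡ e)

        -- The error at c = 0 is at most the sum of the others, and each of these is at most Δ^(K-2)
        -- times its energy. The energy of c = 0 stands on the left because it is to be removed from
        -- the total.
        spectral-bound : ∀ Δ τ τs → σs ≡ τ ∷ τs → (∀ c → c ≢ V.0ᵛ → spread c ≤ Δ) →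
          a ^ K * p ^ length σs * p₁ + Δ ^ length τs * (p * p₁ * (a * a)) ≤ Δ ^ length τs * (p * p * (p ^ n * p₁) * a)
        spectral-bound Δ τ τs refl h = begin
          a ^ K * p ^ length σs * p₁ + Δ ^ length τs * (p * p₁ * (a * a))
            ≡⟨ cong₂ (λ u v → u + Δ ^ length τs * v) (sym (cong ℤ.∣_∣ E-0)) (sym energy-0) ⟩
          ℤ.∣ E V.0ᵛ ∣ + Δ ^ length τs * energy V.0ᵛ
            ≤⟨ +-monoˡ-≤ _ (≤-trans E-off (∑-mono ⟨V⟩ pointwise)) ⟩
          ℕΣ.∑ ⟨V⟩ (λ c → Δ ^ length τs * (off c * energy c)) + Δ ^ length τs * energy V.0ᵛ
            ≡⟨ cong (_+ Δ ^ length τs * energy V.0ᵛ) (ℕΣ.∑-*ˡ ⟨V⟩ (Δ ^ length τs) _) ⟩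
          Δ ^ length τs * ℕΣ.∑ ⟨V⟩ (λ c → off c * energy c) + Δ ^ length τs * energy V.0ᵛ
            ≡⟨ sym (ℕₚ.*-distribˡ-+ (Δ ^ length τs) _ _) ⟩
          Δ ^ length τs * (ℕΣ.∑ ⟨V⟩ (λ c → off c * energy c) + energy V.0ᵛ)
            ≡⟨ cong (Δ ^ length τs *_) (trans off-energy energy-sum) ⟩
          Δ ^ length τs * (p * p * (p ^ n * p₁) * a) ∎
          where
          open ℕₚ.≤-Reasoning
          pointwise : ∀ c → off c * ℤ.∣ E c ∣ ≤ Δ ^ length τs * (off c * energy c)
          pointwise c with c V.≟ V.0ᵛ
          ... | yes _ = z≤n
          ... | no ne = ≤-trans (≤-reflexive (ℕₚ.*-identityˡ ℤ.∣ E c ∣))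
              (≤-trans (CW.conv-bound Δ (energy c) (dev c (signed σ)) (dev c (signed τ)) (map (dev c ∘ signed) τs) (bounds (σ ∷ τ ∷ τs)) 𝟘)
                       (≤-reflexive (cong₂ (λ k e → Δ ^ k * e) (length-map (dev c ∘ signed) τs) (sym (ℕₚ.*-identityˡ (energy c))))))
            where
            bounds : ∀ σs → All (λ f → (CW.norm₁ f ≤ Δ) × (CW.norm₂ f ≡ energy c)) (map (dev c ∘ signed) σs)
            bounds []       = []
            bounds (σ ∷ σs) = (≤-trans (≤-reflexive (norm-signed (λ x → x) c σ)) (h c ne) , norm-signed (λ x → x * x) c σ) ∷ bounds σs

-- The root bound against evenly distributed slices

root-bound⇒m : ∀ K₂ lam m → RootBound (3 + K₂) lam m → (3 + K₂ + lam + 4) * (3 + K₂ + 1) ≤ m * (3 + K₂)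
root-bound⇒m K₂ lam m rb = ℕₚ.≮⇒≥ λ lt → <⇒≱ (ℕₚ.^-monoˡ-< (1 + K₂) lt)
  (≤-trans (≤-trans (≤-reflexive (sym (ℕₚ.*-identityʳ _))) (*-monoʳ-≤ (((3 + K₂ + lam + 4) * (3 + K₂ + 1)) ^ (1 + K₂)) (s≤s {n = 2 + K₂} z≤n))) rb)

private
  ^-distribʳ-* : ∀ a b n → (a * b) ^ n ≡ a ^ n * b ^ n
  ^-distribʳ-* a b zero    = refl
  ^-distribʳ-* a b (suc n) = trans (cong (a * b *_) (^-distribʳ-* a b n)) (lem a b (a ^ n) (b ^ n))
    where
    lem : ∀ a b x y → a * b * (x * y) ≡ a * x * (b * y)
    lem = solve-∀

-- Divided by p (p - 1) a, the inequality reads a (a p)^(K-2) ≤ Δ^(K-2) (p N - a). Here p N - a ≤ K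
-- m N ≤ K a, so (a p)^(K-2) ≤ K Δ^(K-2). This factor K is the one whose root appears in the
-- hypothesis on m.
root-contradiction : ∀ K₂ lam m p p₁ N a Δ → let K = 3 + K₂ ; X = (K + lam + 4) * (K + 1) in
  RootBound K lam m → p ≡ K * m + 2 + lam → p ≡ suc p₁ → 1 ≤ p₁ → 1 ≤ N → m * N ≤ a → K * Δ < N * p * X →
  ¬ (a ^ K * p ^ (2 + K₂) * p₁ + Δ ^ (1 + K₂) * (p * p₁ * (a * a)) ≤ Δ ^ (1 + K₂) * (p * p * (N * p₁) * a))
root-contradiction K₂ lam m p p₁ N a Δ rb p≡ p≡₁ 1≤p₁ 1≤N mN≤a KΔ< h =
  <⇒≱ (ℕₚ.^-monoˡ-< (1 + K₂) KΔ<) step₅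
  where
  open ℕₚ.≤-Reasoning
  K = 3 + K₂
  X = (K + lam + 4) * (K + 1)
  D = Δ ^ (1 + K₂)
  X≤mK : X ≤ m * K
  X≤mK = root-bound⇒m K₂ lam m rb
  m≥ : K + lam + 4 ≤ m
  m≥ = ℕₚ.*-cancelʳ-≤ _ m K (≤-trans (*-monoʳ-≤ (K + lam + 4) (m≤m+n K 1)) X≤mK)
  1≤m : 1 ≤ m
  1≤m = ≤-trans (s≤s z≤n) m≥
  1≤a : 1 ≤ a
  1≤a = ≤-trans (*-mono-≤ 1≤m 1≤N) mN≤a
  1≤p : 1 ≤ p
  1≤p = ≤-trans (s≤s z≤n) (≤-reflexive (sym p≡₁))
  instance
    nz₁ : NonZero (p * p₁ * a)
    nz₁ = >-nonZero (*-mono-≤ (*-mono-≤ 1≤p 1≤p₁) 1≤a)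
    nz₂ : NonZero (m * N)
    nz₂ = >-nonZero (*-mono-≤ 1≤m 1≤N)
  step₁ : a * (a * p) ^ (1 + K₂) + D * a ≤ D * (p * N)
  step₁ = ℕₚ.*-cancelˡ-≤ (p * p₁ * a) (begin
    p * p₁ * a * (a * (a * p) ^ (1 + K₂) + D * a)             ≡⟨ cong (λ u → p * p₁ * a * (a * u + D * a)) (^-distribʳ-* a p (1 + K₂)) ⟩
    p * p₁ * a * (a * (a ^ (1 + K₂) * p ^ (1 + K₂)) + D * a)  ≡⟨ lem₁ p p₁ a (a ^ (1 + K₂)) (p ^ (1 + K₂)) D ⟩
    a ^ K * p ^ (2 + K₂) * p₁ + D * (p * p₁ * (a * a))        ≤⟨ h ⟩
    D * (p * p * (N * p₁) * a)                                ≡⟨ lem₂ p p₁ a D N ⟩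
    p * p₁ * a * (D * (p * N))                                ∎)
    where
    lem₁ : ∀ p q a A P D → p * q * a * (a * (A * P) + D * a) ≡ a * (a * A) * (p * P) * q + D * (p * q * (a * a))
    lem₁ = solve-∀
    lem₂ : ∀ p q a D N → D * (p * p * (N * q) * a) ≡ p * q * a * (D * (p * N))
    lem₂ = solve-∀
  -- p - m ≤ K m
  step₂ : a * (a * p) ^ (1 + K₂) ≤ D * (N * (K * m))
  step₂ = linear (a * (a * p) ^ (1 + K₂)) (D * (N * (K * m))) 0 (+-mono-≤ step₁ (+-mono-≤ (*-monoʳ-≤ D mN≤a) (*-monoʳ-≤ D (*-monoˡ-≤ N p≤))))
            (lem (a * (a * p) ^ (1 + K₂)) D N K m a p)
    where
    p≤ : p ≤ K * m + m
    p≤ = subst (_≤ K * m + m) (sym (trans p≡ (ℕₚ.+-assoc (K * m) 2 lam))) (+-monoʳ-≤ (K * m) (≤-trans (lem lam K₂) m≥))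
      where
      lem : ∀ lam K₂ → 2 + lam ≤ 3 + K₂ + lam + 4
      lem lam K₂ = linear _ _ (5 + K₂) (z≤n {0}) (eq lam K₂)
        where
        eq : ∀ lam K₂ → 2 + lam + 0 + (5 + K₂) ≡ 3 + K₂ + lam + 4 + 0
        eq = solve-∀
    lem : ∀ L D N K m a p → L + (D * (p * N) + (D * a + D * ((K * m + m) * N))) + 0 ≡ D * (N * (K * m)) + (L + D * a + (D * (m * N) + D * (p * N)))
    lem = solve-∀
  step₃ : (a * p) ^ (1 + K₂) ≤ D * K
  step₃ = ℕₚ.*-cancelˡ-≤ (m * N) (begin
    m * N * (a * p) ^ (1 + K₂)  ≤⟨ *-monoˡ-≤ _ mN≤a ⟩
    a * (a * p) ^ (1 + K₂)      ≤⟨ step₂ ⟩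
    D * (N * (K * m))           ≡⟨ lem D N K m ⟩
    m * N * (D * K)             ∎)
    where
    lem : ∀ D N K m → D * (N * (K * m)) ≡ m * N * (D * K)
    lem = solve-∀
  step₄ : (N * p * X) ^ (1 + K₂) * K ≤ (K * Δ) ^ (1 + K₂) * K
  step₄ = begin
    (N * p * X) ^ (1 + K₂) * K                     ≡⟨ cong (_* K) (^-distribʳ-* (N * p) X (1 + K₂)) ⟩
    (N * p) ^ (1 + K₂) * X ^ (1 + K₂) * K          ≡⟨ ℕₚ.*-assoc ((N * p) ^ (1 + K₂)) _ K ⟩
    (N * p) ^ (1 + K₂) * (X ^ (1 + K₂) * K)        ≤⟨ *-monoʳ-≤ ((N * p) ^ (1 + K₂)) rb ⟩
    (N * p) ^ (1 + K₂) * (m * K) ^ (1 + K₂)        ≡⟨ sym (^-distribʳ-* (N * p) (m * K) (1 + K₂)) ⟩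
    (N * p * (m * K)) ^ (1 + K₂)                   ≤⟨ ℕₚ.^-monoˡ-≤ (1 + K₂) (≤-trans (≤-reflexive (lem N p m K)) (*-monoʳ-≤ K (*-monoˡ-≤ p mN≤a))) ⟩
    (K * (a * p)) ^ (1 + K₂)                       ≡⟨ ^-distribʳ-* K (a * p) (1 + K₂) ⟩
    K ^ (1 + K₂) * (a * p) ^ (1 + K₂)              ≤⟨ *-monoʳ-≤ (K ^ (1 + K₂)) step₃ ⟩
    K ^ (1 + K₂) * (D * K)                         ≡⟨ sym (ℕₚ.*-assoc (K ^ (1 + K₂)) D K) ⟩
    K ^ (1 + K₂) * D * K                           ≡⟨ cong (_* K) (sym (^-distribʳ-* K Δ (1 + K₂))) ⟩
    (K * Δ) ^ (1 + K₂) * K                         ∎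
    where
    lem : ∀ N p m K → N * p * (m * K) ≡ K * (m * N * p)
    lem = solve-∀
  step₅ : (N * p * X) ^ (1 + K₂) ≤ (K * Δ) ^ (1 + K₂)
  step₅ = ℕₚ.*-cancelʳ-≤ _ _ K step₄

-- Linear automorphisms and slices

module Isomorphism {p : ℕ} .{{_ : NonZero p}} (F : FieldOps p) where
  open PrimeField F
  open VectorSpace F
  open 𝔽-Solver using (solve; _:+_; _:*_; _:-_; :-_; _:=_; con)

  infixl 6 _⊹_
  _⊹_ : ∀ {n} → Vec 𝔽 n → Vec 𝔽 n → Vec 𝔽 n
  _⊹_ = zipWith _⊞_

  Aut : ∀ {n} → (Vec 𝔽 n → Vec 𝔽 n) → Set
  Aut {n} φ = (∀ x y → φ (x ⊹ y) ≡ φ x ⊹ φ y) × Σ (Vec 𝔽 n → Vec 𝔽 n) (λ ψ → (∀ x → ψ (φ x) ≡ x) × (∀ y → φ (ψ y) ≡ y))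

  Aut-∘ : ∀ {n} {φ φ′ : Vec 𝔽 n → Vec 𝔽 n} → Aut φ → Aut φ′ → Aut (φ′ ∘ φ)
  Aut-∘ {φ = φ} {φ′} (h , ψ , ψφ , φψ) (h′ , ψ′ , ψφ′ , φψ′) =
    (λ x y → trans (cong φ′ (h x y)) (h′ (φ x) (φ y))) , ψ ∘ ψ′ ,
    (λ x → trans (cong ψ (ψφ′ (φ x))) (ψφ x)) , (λ y → trans (cong φ′ (φψ (ψ′ y))) (φψ′ y))

  Aut-inverse : ∀ {n} {φ : Vec 𝔽 n → Vec 𝔽 n} (a : Aut φ) → Aut (proj₁ (proj₂ a))
  Aut-inverse {φ = φ} (h , ψ , ψφ , φψ) = (λ x y → trans (cong₂ (λ u v → ψ (u ⊹ v)) (sym (φψ x)) (sym (φψ y)))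
    (trans (cong ψ (sym (h (ψ x) (ψ y)))) (ψφ _))) , φ , φψ , ψφ

  rowMap : ∀ {n} → 𝔽 → Vec 𝔽 n → Vec 𝔽 (suc n) → Vec 𝔽 (suc n)
  rowMap s t (x₀ ∷ x) = (s ⊠ x₀ ⊞ dot t x) ∷ x

  rowMap-aut : ∀ {n} s (t : Vec 𝔽 n) → s ≢ 𝟘 → Aut (rowMap s t)
  rowMap-aut s t s≢0 = add , ψ , ψφ , φψ
    where
    s⁻ = proj₁ (inverse s s≢0)
    e : s⁻ ⊠ s ≡ 𝟙ᶠ
    e = proj₂ (inverse s s≢0)
    ψ : Vec 𝔽 _ → Vec 𝔽 _
    ψ (y₀ ∷ y) = (s⁻ ⊠ (y₀ ⊟ dot t y)) ∷ y
    add : ∀ x y → rowMap s t (x ⊹ y) ≡ rowMap s t x ⊹ rowMap s t y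
    add (x₀ ∷ x) (y₀ ∷ y) = cong (_∷ (x ⊹ y)) (trans (cong (s ⊠ (x₀ ⊞ y₀) ⊞_) (dot-+ t x y))
      (solve 5 (λ s x y u v → s :* (x :+ y) :+ (u :+ v) := s :* x :+ u :+ (s :* y :+ v)) refl s x₀ y₀ (dot t x) (dot t y)))
    ψφ : ∀ x → ψ (rowMap s t x) ≡ x
    ψφ (x₀ ∷ x) = cong (_∷ x) (trans (solve 4 (λ w s x u → w :* (s :* x :+ u :- u) := (w :* s) :* x) refl s⁻ s x₀ (dot t x))
      (trans (cong (_⊠ x₀) e) (⊠-identityˡ x₀)))
    φψ : ∀ y → rowMap s t (ψ y) ≡ y
    φψ (y₀ ∷ y) = cong (_∷ y) (trans (solve 4 (λ w s y u → s :* (w :* (y :- u)) :+ u := (w :* s) :* (y :- u) :+ u) refl s⁻ s y₀ (dot t y))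
      (trans (cong (λ o → o ⊠ (y₀ ⊟ dot t y) ⊞ dot t y) e) (solve 2 (λ y u → con (+ 1) :* (y :- u) :+ u := y) refl y₀ (dot t y))))

  -- If the leading coefficient of c is not 0, c replaces the first coordinate. Otherwise the
  -- automorphism for the remaining coordinates is applied and its first coordinate is moved to the
  -- front.
  functional-aut : ∀ n (c : Vec 𝔽 (suc n)) → c ≢ zeros → ∃[ φ ] Aut φ × (∀ x → Vec.head (φ x) ≡ dot c x)
  functional-aut n (c₀ ∷ c) c≢0 with c₀ Finₚ.≟ 𝟘
  ... | no c₀≢0 = rowMap c₀ c , rowMap-aut c₀ c c₀≢0 , λ { (x₀ ∷ x) → refl }
  functional-aut zero (c₀ ∷ []) c≢0 | yes e = ⊥-elim (c≢0 (cong (_∷ []) e))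
  functional-aut (suc n) (c₀ ∷ c) c≢0 | yes e with functional-aut n c (λ e′ → c≢0 (cong₂ _∷_ e e′))
  ... | φ , (add , ψ , ψφ , φψ) , hd = φ′ , (add′ , ψ′ , ψφ′ , φψ′) , hd′
    where
    ins : ∀ {n} → 𝔽 → Vec 𝔽 (suc n) → Vec 𝔽 (suc (suc n))
    ins x (y ∷ ys) = y ∷ x ∷ ys
    ins-+ : ∀ {n} x x′ (y y′ : Vec 𝔽 (suc n)) → ins (x ⊞ x′) (y ⊹ y′) ≡ ins x y ⊹ ins x′ y′
    ins-+ x x′ (y ∷ ys) (y′ ∷ ys′) = refl
    φ′ ψ′ : Vec 𝔽 _ → Vec 𝔽 _
    φ′ (x₀ ∷ x) = ins x₀ (φ x)
    ψ′ (y ∷ x ∷ ys) = x ∷ ψ (y ∷ ys)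
    add′ : ∀ x y → φ′ (x ⊹ y) ≡ φ′ x ⊹ φ′ y
    add′ (x₀ ∷ x) (y₀ ∷ y) = trans (cong (ins (x₀ ⊞ y₀)) (add x y)) (ins-+ x₀ y₀ (φ x) (φ y))
    ψ′-ins : ∀ x (v : Vec 𝔽 (suc n)) → ψ′ (ins x v) ≡ x ∷ ψ v
    ψ′-ins x (y ∷ ys) = refl
    ψφ′ : ∀ x → ψ′ (φ′ x) ≡ x
    ψφ′ (x₀ ∷ x) = trans (ψ′-ins x₀ (φ x)) (cong (x₀ ∷_) (ψφ x))
    φψ′ : ∀ y → φ′ (ψ′ y) ≡ y
    φψ′ (y ∷ x ∷ ys) = cong (ins x) (φψ (y ∷ ys))
    head-ins : ∀ x (v : Vec 𝔽 (suc n)) → Vec.head (ins x v) ≡ Vec.head v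
    head-ins x (y ∷ ys) = refl
    hd′ : ∀ x → Vec.head (φ′ x) ≡ dot (c₀ ∷ c) x
    hd′ (x₀ ∷ x) = trans (head-ins x₀ (φ x)) (trans (hd x) (sym (trans (cong (_⊞ dot c x) (trans (cong (_⊠ x₀) e) (⊠-zeroˡ x₀))) (⊞-identityˡ _))))

  slice : ∀ {n} → (Vec 𝔽 (suc n) → Bool) → 𝔽 → Vec 𝔽 n → Bool
  slice B i y = B (i ∷ y)

  weight : ∀ {n} → (Vec 𝔽 (suc n) → Bool) → 𝔽 → ℕ
  weight {n} B i = count (slice B i) (allVecs p n)

  module _ (n : ℕ) (A : Vec 𝔽 (suc n) → Bool) where
    private
      module V = AdditiveCombinatorics (vecSpace n)
      module W = PrimeLine F
      module Sp = Spectral F n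

    card-weight : ∀ (B : Vec 𝔽 (suc n) → Bool) → count B (allVecs p (suc n)) ≡ ℕΣ.∑ (allFin p) (weight B)
    card-weight B = ∑-vec n _

    card-aut : ∀ {φ} (aut : Aut φ) → count (A ∘ proj₁ (proj₂ aut)) (allVecs p (suc n)) ≡ count A (allVecs p (suc n))
    card-aut {φ} (_ , ψ , ψφ , φψ) = V.card-bijection ψ φ ψφ φψ A

    spread-weight : ∀ c {φ} (aut : Aut φ) → (∀ x → Vec.head (φ x) ≡ dot c x) →
      Sp.spread A c ≡ ℕΣ.∑ (allFin p) (λ i → ℤ.∣ + p ℤ.* + weight (A ∘ proj₁ (proj₂ aut)) i ℤ.- + count A (allVecs p (suc n)) ∣)
    spread-weight c {φ} (_ , ψ , ψφ , φψ) hd = ℕΣ.∑-cong (allFin p) (λ i → cong (λ u → ℤ.∣ + p ℤ.* u ℤ.- + count A (allVecs p (suc n)) ∣) (push≡ i))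
      where
      open ≡-Reasoning
      push≡ : ∀ i → Sp.push c (Sp.ind A A) i ≡ + weight (A ∘ ψ) i
      push≡ i = begin
        ℤΣ.∑ V.elems (λ x → ℤΣ.𝟙 (A x) ℤ.* ℤΣ.𝟙 (W.δ (dot c x) i))
          ≡⟨ ℤΣ.∑-cong V.elems (λ x → trans (cong₂ ℤ._*_ (sym (+-𝟙 (A x))) (sym (+-𝟙 (W.δ (dot c x) i)))) (sym (ℤₚ.pos-* (ℕΣ.𝟙 (A x)) _))) ⟩
        ℤΣ.∑ V.elems (λ x → + (ℕΣ.𝟙 (A x) * ℕΣ.𝟙 (W.δ (dot c x) i)))
          ≡⟨ sym (+-∑ V.elems _) ⟩
        + ℕΣ.∑ V.elems (λ x → ℕΣ.𝟙 (A x) * ℕΣ.𝟙 (W.δ (dot c x) i))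
          ≡⟨ cong +_ (sym (V.∑-bijection ψ φ ψφ φψ (λ x → ℕΣ.𝟙 (A x) * ℕΣ.𝟙 (W.δ (dot c x) i)))) ⟩
        + ℕΣ.∑ V.elems (λ y → ℕΣ.𝟙 (A (ψ y)) * ℕΣ.𝟙 (W.δ (dot c (ψ y)) i))
          ≡⟨ cong +_ (trans (ℕΣ.∑-cong V.elems (λ y → cong (λ u → ℕΣ.𝟙 (A (ψ y)) * ℕΣ.𝟙 (W.δ u i)) (trans (sym (hd (ψ y))) (cong Vec.head (φψ y)))))
            (∑-vec n _)) ⟩
        + ℕΣ.∑ (allFin p) (λ b → ℕΣ.∑ (allVecs p n) (λ y → ℕΣ.𝟙 (A (ψ (b ∷ y))) * ℕΣ.𝟙 (W.δ b i)))
          ≡⟨ cong +_ (ℕΣ.∑-cong (allFin p) (λ b → trans (ℕΣ.∑-*ʳ (allVecs p n) (ℕΣ.𝟙 (W.δ b i)) _) (ℕₚ.*-comm (weight (A ∘ ψ) b) _))) ⟩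
        + ℕΣ.∑ (allFin p) (λ b → ℕΣ.𝟙 (W.δ b i) * weight (A ∘ ψ) b)
          ≡⟨ cong +_ (W.∑-δ i (weight (A ∘ ψ))) ⟩
        + weight (A ∘ ψ) i ∎

    good-functional : ∀ K₂ lam m p₁ → let K = 3 + K₂ ; X = (K + lam + 4) * (K + 1) in
      RootBound K lam m → p ≡ K * m + 2 + lam → p ≡ suc p₁ → m * p ^ n ≤ count A (allVecs p (suc n)) →
      ∀ σ τ τs → length τs ≡ 1 + K₂ → ¬ V.SumOf (map (Sp.signed A) (σ ∷ τ ∷ τs)) V.0ᵛ →
      ∃[ c ] (c ≢ zeros) × (p ^ n * p * X ≤ K * Sp.spread A c)
    good-functional K₂ lam m p₁ rb p≡ p≡₁ mN≤a σ τ τs len sf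
      with V.∃? {λ c → (c ≢ zeros) × (p ^ n * p * ((3 + K₂ + lam + 4) * (3 + K₂ + 1)) ≤ (3 + K₂) * Sp.spread A c)} (λ c → ¬? (c V.≟ zeros) ×-dec (_ ≤? _))
    ... | inj₁ found = found
    ... | inj₂ none = ⊥-elim (root-contradiction K₂ lam m p p₁ (p ^ n) (V.# A) Δ rb p≡ p≡₁ (ℕₚ.≤-pred (subst (1 <_) p≡₁ 1<p)) 1≤N mN≤a KΔ<
        (subst (λ t → V.# A ^ suc (suc t) * p ^ suc t * p₁ + Δ ^ t * (p * p₁ * (V.# A * V.# A)) ≤ Δ ^ t * (p * p * (p ^ n * p₁) * V.# A)) len
          (Sp.spectral-bound A p₁ p≡₁ σ (τ ∷ τs) sf Δ τ τs refl small)))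
      where
      K = 3 + K₂
      Z = p ^ n * p * ((K + lam + 4) * (K + 1))
      -- The largest integer with K Δ < Z: a spread that fails the claim is at most Δ.
      Δ = (Z ∸ 1) / K
      1≤p : 1 ≤ p
      1≤p = <⇒≤ 1<p
      1≤N : 1 ≤ p ^ n
      1≤N = ℕₚ.m^n>0 p {{>-nonZero 1≤p}} n
      1≤Z : 1 ≤ Z
      1≤Z = *-mono-≤ (*-mono-≤ 1≤N 1≤p) (s≤s {n = _} z≤n)
      KΔ< : K * Δ < Z
      KΔ< = ≤-trans (s≤s (≤-trans (≤-reflexive (ℕₚ.*-comm K Δ)) (m/n*n≤m (Z ∸ 1) K))) (≤-reflexive (trans (ℕₚ.+-comm 1 (Z ∸ 1)) (ℕₚ.m∸n+n≡m 1≤Z)))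
      small : ∀ c → c ≢ zeros → Sp.spread A c ≤ Δ
      small c c≢0 = ≤-trans (≤-reflexive (sym (m*n/n≡m (Sp.spread A c) K)))
        (/-monoˡ-≤ K (ℕₚ.≤-pred (≤-trans (s≤s (≤-reflexive (ℕₚ.*-comm (Sp.spread A c) K)))
          (≤-trans (≰⇒> (λ le → none c (c≢0 , le))) (≤-reflexive (sym (trans (ℕₚ.+-comm 1 (Z ∸ 1)) (ℕₚ.m∸n+n≡m 1≤Z))))))))

-- Together with `≤-/` this makes `suc (L / r)` the least h with r h > L, the form in which the
-- thresholds below are chosen.
<-suc-/ : ∀ L r .{{_ : NonZero r}} → L < r * suc (L / r)
<-suc-/ L r = ≤-trans (s≤s (≤-trans (≤-reflexive (m≡m%n+[m/n]*n L r)) ≤-refl))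
  (≤-trans (+-monoˡ-≤ (L / r * r) (m%n<n L r)) (≤-reflexive (ℕₚ.*-comm (suc (L / r)) r)))

≤-/ : ∀ L r .{{_ : NonZero r}} {w} → w < suc (L / r) → r * w ≤ L
≤-/ L r {w} (s≤s h) = ≤-trans (≤-reflexive (ℕₚ.*-comm r w)) (≤-trans (*-monoˡ-≤ r h) (m/n*n≤m L r))

-- Level sets of the slice sizes

module Tuples {p : ℕ} .{{_ : NonZero p}} (F : FieldOps p) where
  open PrimeField F
  open VectorSpace F
  open Isomorphism F using (weight; slice)
  module W = PrimeLine F

  IdxSum : List (Bool × 𝔽) → 𝔽 → Set
  IdxSum []             i = i ≡ 𝟘
  IdxSum ((_ , j) ∷ js) i = IdxSum js (i ⊟ j)

  flip : Bool → 𝔽 → 𝔽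
  flip true  i = i
  flip false i = ⊖ i

  card-flip : ∀ σ (X : 𝔽 → Bool) → W.# (X ∘ flip σ) ≡ W.# X
  card-flip true  X = refl
  card-flip false X = W.card-neg X

  module Thresholds (w : 𝔽 → ℕ) where

    Level : Bool × ℕ → 𝔽 → Bool
    Level (σ , h) i = does (h ≤? w (flip σ i))

    level : ℕ → ℕ
    level h = W.# (λ i → does (h ≤? w i))

    level-signed : ∀ σ h → W.# (Level (σ , h)) ≡ level h
    level-signed σ h = card-flip σ (λ i → does (h ≤? w i))

    level-pos : ∀ {h i} → h ≤ w i → 1 ≤ level h
    level-pos {h} {i} le = W.card-pos (λ i → does (h ≤? w i)) (dec-true (h ≤? w i) le)

    level-anti : ∀ {h h′} → h ≤ h′ → level h′ ≤ level h
    level-anti {h} {h′} le = W.card-mono λ i e → dec-true (h ≤? w i) (≤-trans le (does-true (h′ ≤? w i) e))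

    Meets : Bool × ℕ → Bool × 𝔽 → Set
    Meets (σ , h) (τ , i) = (σ ≡ τ) × (h ≤ w (flip τ i))

    extract : ∀ zs z → W.SumOf (map Level zs) z → ∃[ ps ] Pointwise Meets zs ps × IdxSum ps z
    extract [] z e = [] , [] , e
    extract ((σ , h) ∷ zs) z (i , ei , s) = let ps , pw , is = extract zs (z ⊟ i) s in
      (σ , i) ∷ ps , (refl , does-true (h ≤? w (flip σ i)) ei) ∷ pw , is

    extract-++ : ∀ hs ls z → W.SumOf (map Level (hs ++ ls)) z → ∃[ ps ] ∃[ qs ] Pointwise Meets hs ps × Pointwise Meets ls qs × IdxSum (ps ++ qs) z
    extract-++ [] ls z s = let qs , pw , is = extract ls z s in [] , qs , [] , pw , is
    extract-++ ((σ , h) ∷ hs) ls z (i , ei , s) = let ps , qs , pw , pw′ , is = extract-++ hs ls (z ⊟ i) s in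
      (σ , i) ∷ ps , qs , (refl , does-true (h ≤? w (flip σ i)) ei) ∷ pw , pw′ , is

  module Slices (r : ℕ) (B : Vec 𝔽 (2 + r) → Bool) where
    module H = AdditiveCombinatorics (vecSpace r)
    module V = AdditiveCombinatorics (vecSpace (suc r))
    open Spectral F (suc r) using (signed)

    w : 𝔽 → ℕ
    w = weight B

    open Thresholds w public

    piece : Bool × 𝔽 → Vec 𝔽 (suc r) → Bool
    piece (σ , i) = slice (signed B σ) i

    card-piece : ∀ σ i → H.# (piece (σ , i)) ≡ w (flip σ i)
    card-piece true  i = refl
    card-piece false i = H.card-neg (slice B (⊖ i))

    lift-SumOf : ∀ ps i y → IdxSum ps i → H.SumOf (map piece ps) y → V.SumOf (map (signed B ∘ proj₁) ps) (i ∷ y)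
    lift-SumOf [] i y ei ey = cong₂ _∷_ ei ey
    lift-SumOf ((σ , j) ∷ ps) i y is (u , eu , s) = (j ∷ u) , eu , lift-SumOf ps (i ⊟ j) (y H.-ᵛ u) is s

    -- Kneser's inequality on two floors. On the line, level sets of large total size give indices
    -- with sum 0. In the slice space, the heavy slices at these indices have full sumset because
    -- their thresholds are large in total, and the light ones only need to be nonempty. So 0 would
    -- be represented.
    heavy-light : ∀ hs₁ hs₂ hs ls (σs : List Bool) → map proj₁ (hs₁ ∷ hs₂ ∷ hs ++ ls) ≡ σs → ¬ V.SumOf (map (signed B) σs) V.0ᵛ →
      All (λ z → (1 ≤ proj₂ z) × (1 ≤ level (proj₂ z))) (hs₁ ∷ hs₂ ∷ hs ++ ls) →
      p * p ^ r + length hs * p ^ r < sum (map proj₂ (hs₁ ∷ hs₂ ∷ hs)) →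
      ¬ (p * 1 + length (hs ++ ls) * 1 < sum (map (level ∘ proj₂) (hs₁ ∷ hs₂ ∷ hs ++ ls)))
    heavy-light h₁ h₂ hs ls σs signs sf pos big total
      with extract-++ (h₁ ∷ h₂ ∷ hs) ls 𝟘
             (W.SumOf-full (Level h₁) (Level h₂) (map Level (hs ++ ls)) (nonempty (h₁ ∷ h₂ ∷ hs ++ ls) pos)
               (subst₂ (λ u v → p * 1 + u * 1 < v) (sym (Listₚ.length-map Level (hs ++ ls))) (totals (h₁ ∷ h₂ ∷ hs ++ ls)) total) 𝟘)
      where
      nonempty : ∀ zs → All (λ z → (1 ≤ proj₂ z) × (1 ≤ level (proj₂ z))) zs → All W.Nonempty (map Level zs)
      nonempty [] [] = []
      nonempty ((σ , h) ∷ zs) ((_ , 1≤) ∷ pos) = W.card-witness (Level (σ , h)) (≤-trans 1≤ (≤-reflexive (sym (level-signed σ h)))) ∷ nonempty zs pos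
      totals : ∀ zs → sum (map (level ∘ proj₂) zs) ≡ W.total (map Level zs)
      totals [] = refl
      totals ((σ , h) ∷ zs) = cong₂ _+_ (sym (level-signed σ h)) (totals zs)
    ... | (p₁ ∷ p₂ ∷ ps) , qs , (m₁ ∷ m₂ ∷ pw) , pw′ , is =
      sf (subst (λ l → V.SumOf (map (signed B) l) V.0ᵛ) signs (subst (λ l → V.SumOf l V.0ᵛ) (signs≡ (h₁ ∷ h₂ ∷ hs) ls (p₁ ∷ p₂ ∷ ps) qs (m₁ ∷ m₂ ∷ pw) pw′)
        (lift-SumOf (p₁ ∷ p₂ ∷ ps ++ qs) 𝟘 H.0ᵛ is
          (subst (λ l → H.SumOf l H.0ᵛ) (sym (Listₚ.map-++ piece (p₁ ∷ p₂ ∷ ps) qs))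
            (H.SumOf-full-++ (map piece (p₁ ∷ p₂ ∷ ps)) (map piece qs)
              (H.SumOf-full (piece p₁) (piece p₂) (map piece ps) (ne (h₁ ∷ h₂ ∷ hs) _ (m₁ ∷ m₂ ∷ pw) (take-pos (h₁ ∷ h₂ ∷ hs) ls pos))
                (≤-trans (subst (λ u → p * p ^ r + u * p ^ r < sum (map proj₂ (h₁ ∷ h₂ ∷ hs))) (len≡ pw) big) (sizes (m₁ ∷ m₂ ∷ pw))))
              (ne ls qs pw′ (drop-pos (h₁ ∷ h₂ ∷ hs) ls pos)) H.0ᵛ)))))
      where
      Pos : Bool × ℕ → Set
      Pos z = (1 ≤ proj₂ z) × (1 ≤ level (proj₂ z))
      take-pos : ∀ hs ls → All Pos (hs ++ ls) → All Pos hs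
      take-pos []       ls _        = []
      take-pos (h ∷ hs) ls (x ∷ xs) = x ∷ take-pos hs ls xs
      drop-pos : ∀ hs ls → All Pos (hs ++ ls) → All Pos ls
      drop-pos []       ls xs       = xs
      drop-pos (h ∷ hs) ls (x ∷ xs) = drop-pos hs ls xs
      ne : ∀ zs ps → Pointwise Meets zs ps → All Pos zs → All H.Nonempty (map piece ps)
      ne [] [] [] [] = []
      ne ((σ , h) ∷ zs) ((τ , i) ∷ ps) ((_ , le) ∷ pw) ((1≤h , _) ∷ pos) =
        H.card-witness (piece (τ , i)) (≤-trans 1≤h (≤-trans le (≤-reflexive (sym (card-piece τ i))))) ∷ ne zs ps pw pos
      len≡ : ∀ {zs ps} → Pointwise Meets zs ps → length zs ≡ length (map piece ps)
      len≡ []       = refl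
      len≡ (_ ∷ pw) = cong suc (len≡ pw)
      sizes : ∀ {zs ps} → Pointwise Meets zs ps → sum (map proj₂ zs) ≤ H.total (map piece ps)
      sizes [] = z≤n
      sizes {(σ , h) ∷ zs} {(τ , i) ∷ ps} ((_ , le) ∷ pw) = +-mono-≤ (≤-trans le (≤-reflexive (sym (card-piece τ i)))) (sizes pw)
      signs≡ : ∀ hs ls ps qs → Pointwise Meets hs ps → Pointwise Meets ls qs → map (signed B ∘ proj₁) (ps ++ qs) ≡ map (signed B) (map proj₁ (hs ++ ls))
      signs≡ [] [] [] [] [] [] = refl
      signs≡ [] ((σ , h) ∷ ls) [] ((τ , i) ∷ qs) [] ((refl , _) ∷ pw′) = cong (signed B σ ∷_) (signs≡ [] ls [] qs [] pw′)
      signs≡ ((σ , h) ∷ hs) ls ((τ , i) ∷ ps) qs ((refl , _) ∷ pw) pw′ = cong (signed B σ ∷_) (signs≡ hs ls ps qs pw pw′)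

    -- Thresholds h₁ ∷ h₂ ∷ hs for the heavy positions and 1 for the t others.
    threshold-bound : ∀ (σs : List Bool) → ¬ V.SumOf (map (signed B) σs) V.0ᵛ → ∀ h₁ h₂ hs t → length σs ≡ 2 + length hs + t →
      All (λ h → (1 ≤ h) × (1 ≤ level h)) (h₁ ∷ h₂ ∷ hs) →
      p * p ^ r + length hs * p ^ r < h₁ + (h₂ + sum hs) →
      level h₁ + (level h₂ + sum (map level hs)) + t * level 1 ≤ p + (length hs + t)
    threshold-bound (σ₁ ∷ σ₂ ∷ σs) sf h₁ h₂ hs t len ((1≤h₁ , 1≤c₁) ∷ pos) big = ℕₚ.≮⇒≥ λ lt →
      heavy-light (σ₁ , h₁) (σ₂ , h₂) (heavy hs σs) (light hs σs) (σ₁ ∷ σ₂ ∷ σs)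
        (cong (λ l → σ₁ ∷ σ₂ ∷ l) (signs hs σs t len′)) sf
        ((1≤h₁ , 1≤c₁) ∷ All.head pos ∷ allPos hs σs (All.tail pos))
        (subst₂ (λ u v → p * p ^ r + u * p ^ r < h₁ + (h₂ + v)) (sym (len-heavy hs σs t len′)) (sym (sum-heavy hs σs t len′)) big)
        (≤-trans (s≤s (≤-reflexive (cong₂ _+_ (ℕₚ.*-identityʳ p) (trans (ℕₚ.*-identityʳ _) (len-all hs σs t len′)))))
          (≤-trans lt (≤-reflexive (trans (ℕₚ.+-assoc (level h₁) _ _) (cong (_+_ (level h₁))
            (trans (ℕₚ.+-assoc (level h₂) _ _) (cong (_+_ (level h₂)) (sum-all hs σs t len′))))))))
      where
      heavy light : List ℕ → List Bool → List (Bool × ℕ)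
      heavy (h ∷ hs) (σ ∷ σs) = (σ , h) ∷ heavy hs σs
      heavy _        _        = []
      light (h ∷ hs) (σ ∷ σs) = light hs σs
      light (h ∷ hs) []       = []
      light []       σs       = map (_, 1) σs
      len′ : length σs ≡ length hs + t
      len′ = ℕₚ.suc-injective (ℕₚ.suc-injective len)
      signs : ∀ hs σs t → length σs ≡ length hs + t → map proj₁ (heavy hs σs ++ light hs σs) ≡ σs
      signs [] [] t e = refl
      signs [] (σ ∷ σs) t e = cong (σ ∷_) (signs [] σs _ refl)
      signs (h ∷ hs) (σ ∷ σs) t e = cong (σ ∷_) (signs hs σs t (ℕₚ.suc-injective e))
      len-heavy : ∀ hs σs t → length σs ≡ length hs + t → length (heavy hs σs) ≡ length hs
      len-heavy [] [] t e = refl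
      len-heavy [] (σ ∷ σs) t e = refl
      len-heavy (h ∷ hs) (σ ∷ σs) t e = cong suc (len-heavy hs σs t (ℕₚ.suc-injective e))
      sum-heavy : ∀ hs σs t → length σs ≡ length hs + t → sum (map proj₂ (heavy hs σs)) ≡ sum hs
      sum-heavy [] [] t e = refl
      sum-heavy [] (σ ∷ σs) t e = refl
      sum-heavy (h ∷ hs) (σ ∷ σs) t e = cong (_+_ h) (sum-heavy hs σs t (ℕₚ.suc-injective e))
      len-all : ∀ hs σs t → length σs ≡ length hs + t → length (heavy hs σs ++ light hs σs) ≡ length hs + t
      len-all [] [] t e = e
      len-all [] (σ ∷ σs) t e = trans (cong suc (Listₚ.length-map (_, 1) σs)) e
      len-all (h ∷ hs) (σ ∷ σs) t e = cong suc (len-all hs σs t (ℕₚ.suc-injective e))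
      sum-all : ∀ hs σs t → length σs ≡ length hs + t → sum (map level hs) + t * level 1 ≡ sum (map (level ∘ proj₂) (heavy hs σs ++ light hs σs))
      sum-all [] [] t e = cong (_* level 1) (sym e)
      sum-all [] (σ ∷ σs) t e = trans (cong (_* level 1) (sym e)) (cong (_+_ (level 1)) (sum-all [] σs _ refl))
      sum-all (h ∷ hs) (σ ∷ σs) t e = trans (ℕₚ.+-assoc (level h) _ _) (cong (_+_ (level h)) (sum-all hs σs t (ℕₚ.suc-injective e)))
      allPos : ∀ hs σs → All (λ h → (1 ≤ h) × (1 ≤ level h)) hs → All (λ z → (1 ≤ proj₂ z) × (1 ≤ level (proj₂ z))) (heavy hs σs ++ light hs σs)
      allPos [] [] [] = []
      allPos [] (σ ∷ σs) [] = (s≤s z≤n , ≤-trans 1≤c₁ (level-anti 1≤h₁)) ∷ allPos [] σs []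
      allPos (h ∷ hs) [] (x ∷ xs) = []
      allPos (h ∷ hs) (σ ∷ σs) (x ∷ xs) = x ∷ allPos hs σs xs

    threshold-bound-const : ∀ (σs : List Bool) → ¬ V.SumOf (map (signed B) σs) V.0ᵛ → ∀ h d t → length σs ≡ 2 + d + t →
      1 ≤ h → 1 ≤ level h → p * p ^ r + d * p ^ r < (2 + d) * h →
      (2 + d) * level h + t * level 1 ≤ p + (d + t)
    threshold-bound-const σs sf h d t len 1≤h 1≤c big =
      subst₂ _≤_ (cong (_+ t * level 1) (trans (cong (λ u → level h + (level h + u)) (sum-rep level d)) refl))
        (cong (λ u → p + (u + t)) (Listₚ.length-replicate d))
        (threshold-bound σs sf h h (replicate d h) t (trans len (cong (λ u → 2 + u + t) (sym (Listₚ.length-replicate d))))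
          ((1≤h , 1≤c) ∷ (1≤h , 1≤c) ∷ allRep d)
          (subst₂ (λ u v → p * p ^ r + u * p ^ r < h + (h + v)) (sym (Listₚ.length-replicate d))
            (sym (trans (cong sum (sym (Listₚ.map-id (replicate d h)))) (sum-rep (λ x → x) d))) big))
      where
      sum-rep : ∀ (f : ℕ → ℕ) d → sum (map f (replicate d h)) ≡ d * f h
      sum-rep f zero    = refl
      sum-rep f (suc d) = cong (_+_ (f h)) (sum-rep f d)
      allRep : ∀ d → All (λ h → (1 ≤ h) × (1 ≤ level h)) (replicate d h)
      allRep zero    = []
      allRep (suc d) = (1≤h , 1≤c) ∷ allRep d

-- At most m + 1 nonempty slices

argmax : {A : Set} (E : Finite A) (f : A → ℕ) (N : ℕ) → (∀ x → f x ≤ N) → A → ∃[ x ] (∀ y → f y ≤ f x)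
argmax E f N bound x₀ = go N x₀ (m≤n+m N (f x₀))
  where
  open FiniteSet E
  go : ∀ n x → N ≤ f x + n → ∃[ x ] (∀ y → f y ≤ f x)
  go n x h with ∃? {λ y → f x < f y} (λ y → f x <? f y)
  ... | inj₂ none = x , λ y → ℕₚ.≮⇒≥ (none y)
  go zero    x h | inj₁ (y , lt) = ⊥-elim (<⇒≱ lt (≤-trans (bound y) (≤-trans h (≤-reflexive (ℕₚ.+-identityʳ _)))))
  go (suc n) x h | inj₁ (y , lt) = go n y (≤-trans h (≤-trans (≤-reflexive (ℕₚ.+-suc (f x) n)) (+-monoˡ-≤ n lt)))

-- In other words |x - a| = (a - x) + 2 max(x - a, 0). Summed over all slices the linear part
-- cancels, and the spread becomes twice the total excess over the mean.
∣-∣-split : ∀ x a → ℤ.∣ + x ℤ.- + a ∣ + x ≡ a + 2 * (x ∸ a)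
∣-∣-split x a with ℕₚ.≤-total x a
... | inj₁ x≤a = trans (cong (λ u → ℤ.∣ u ∣ + x) (ℤₚ.[+m]-[+n]≡m⊖n x a)) (trans (cong (_+ x) (ℤₚ.∣⊖∣-≤ x≤a))
                   (trans (ℕₚ.m∸n+n≡m x≤a) (sym (trans (cong (λ u → a + 2 * u) (ℕₚ.m≤n⇒m∸n≡0 x≤a)) (ℕₚ.+-identityʳ a)))))
... | inj₂ a≤x = trans (cong (λ u → ℤ.∣ u ∣ + x) (ℤₚ.[+m]-[+n]≡m⊖n x a)) (trans (cong (_+ x) (trans (ℤₚ.∣m⊖n∣≡∣n⊖m∣ x a) (ℤₚ.∣⊖∣-≤ a≤x)))
                   (trans (cong (_+_ (x ∸ a)) (sym (ℕₚ.m∸n+n≡m a≤x))) (lem (x ∸ a) a)))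
  where
  lem : ∀ d a → d + (d + a) ≡ a + 2 * d
  lem = solve-∀

module Dichotomy {p : ℕ} .{{_ : NonZero p}} (F : FieldOps p) (r : ℕ)
                 (B : Vec (Fin p) (2 + r) → Bool) (lam mu m : ℕ) where
  open PrimeField F
  open VectorSpace F
  open Tuples F
  open Slices r B
  open Spectral F (suc r) using (signed)

  private
    κ = lam + mu
    K = 5 + κ
    q = p ^ r
    N = p * q
    s = level 1
    a = count B (allVecs p (2 + r))

  module _ (p≡ : p ≡ K * m + 2 + lam) (m≥ : K + lam + 4 ≤ m) (σs : List Bool) (len : length σs ≡ K)
           (sf : ¬ V.SumOf (map (signed B) σs) V.0ᵛ) (mN≤a : m * N ≤ a) where

    private
      1≤p : 1 ≤ p
      1≤p = <⇒≤ 1<p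
      1≤q : 1 ≤ q
      1≤q = ℕₚ.m^n>0 p {{>-nonZero 1≤p}} r
      -- From 23 on, 10 p exceeds (p - 2) + 2 (4 p + 12), that is, `A₂` exceeds `A₅` plus twice
      -- `A₁`. This decides the final balance in `heavy-case`.
      p≥23 : 23 ≤ p
      p≥23 = ≤-trans (≤-trans (lem lam mu) (+-monoˡ-≤ (2 + lam) (*-monoʳ-≤ K m≥))) (≤-reflexive (trans (sym (ℕₚ.+-assoc (K * m) 2 lam)) (sym p≡)))
        where
        lem : ∀ lam mu → 23 ≤ (5 + (lam + mu)) * (5 + (lam + mu) + lam + 4) + (2 + lam)
        lem lam mu = linear 23 _ (24 + 20 * lam + 14 * mu + 2 * lam * lam + mu * mu + 3 * lam * mu) (z≤n {0}) (eq lam mu)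
          where
          eq : ∀ lam mu → 23 + 0 + (24 + 20 * lam + 14 * mu + 2 * lam * lam + mu * mu + 3 * lam * mu) ≡ (5 + (lam + mu)) * (5 + (lam + mu) + lam + 4)
            + (2 + lam) + 0
          eq = solve-∀
      p′ = p ∸ 23
      p≡′ : p ≡ 23 + p′
      p≡′ = sym (ℕₚ.m+[n∸m]≡n p≥23)
      w≤N : ∀ i → w i ≤ N
      w≤N i = ≤-trans (H.card-≤full (λ y → B (i ∷ y))) (≤-reflexive H.size)
      a≡ : a ≡ ℕΣ.∑ (allFin p) w
      a≡ = ∑-vec (suc r) _
      𝟙ₗ : ℕ → 𝔽 → ℕ
      𝟙ₗ h i = ℕΣ.𝟙 (does (h ≤? w i))

    -- Suppose there are m + 2 nonempty slices. The slice above N / 2 makes the levels just above N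
    -- / 2, (N + 2 q) / 4 and (N + 3 q) / 5 nonempty, and using 2, 4 or 5 heavy positions bounds
    -- them by m - 1, m and m + 1 slices. Summing the slice sizes by these layers falls short of the
    -- mass m N.
    heavy-case : ∀ i₀ → N < 2 * w i₀ → s ≤ 1 + m
    heavy-case i₀ big = ℕₚ.≮⇒≥ contradiction
      where
      h₂ = suc (N / 2)
      h₄ = suc ((N + 2 * q) / 4)
      h₅ = suc ((N + 3 * q) / 5)
      h₂≤w : h₂ ≤ w i₀
      h₂≤w = ℕₚ.≮⇒≥ λ lt → <⇒≱ big (≤-/ N 2 lt)
      h₄≤h₂ : h₄ ≤ h₂
      h₄≤h₂ = ℕₚ.≮⇒≥ λ lt → lem p′ q h₂ (≤-trans (≤-/ (N + 2 * q) 4 lt) (≤-reflexive (cong (λ u → u * q + 2 * q) p≡′)))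
        (subst (λ u → u * q < 2 * h₂) p≡′ (<-suc-/ N 2))
        where
        lem : ∀ p′ q h → 4 * h ≤ (23 + p′) * q + 2 * q → (23 + p′) * q < 2 * h → ⊥
        lem p′ q h h₁ h₂ = absurd-linear (1 + (21 + p′) * q) (+-mono-≤ h₁ (*-monoʳ-≤ 2 h₂)) (eq p′ q h)
          where
          eq : ∀ p′ q h → 4 * h + 2 * suc ((23 + p′) * q) ≡ (23 + p′) * q + 2 * q + 2 * (2 * h) + suc (1 + (21 + p′) * q)
          eq = solve-∀
      h₅≤h₄ : h₅ ≤ h₄
      h₅≤h₄ = ℕₚ.≮⇒≥ λ lt → lem p′ q h₄ (≤-trans (≤-/ (N + 3 * q) 5 lt) (≤-reflexive (cong (λ u → u * q + 3 * q) p≡′)))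
        (subst (λ u → u * q + 2 * q < 4 * h₄) p≡′ (<-suc-/ (N + 2 * q) 4))
        where
        lem : ∀ p′ q h → 5 * h ≤ (23 + p′) * q + 3 * q → (23 + p′) * q + 2 * q < 4 * h → ⊥
        lem p′ q h h₁ h₂ = absurd-linear (4 + (21 + p′) * q) (+-mono-≤ (*-monoʳ-≤ 4 h₁) (*-monoʳ-≤ 5 h₂)) (eq p′ q h)
          where
          eq : ∀ p′ q h → 4 * (5 * h) + 5 * suc ((23 + p′) * q + 2 * q) ≡ 4 * ((23 + p′) * q + 3 * q) + 5 * (4 * h) + suc (4 + (21 + p′) * q)
          eq = solve-∀
      h₄≤w = ≤-trans h₄≤h₂ h₂≤w
      h₅≤w = ≤-trans h₅≤h₄ h₄≤w
      c₂ = level h₂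
      c₄ = level h₄
      c₅ = level h₅
      open ≡-Reasoning
      b₂ : 2 * c₂ + (3 + κ) * s ≤ p + (3 + κ)
      b₂ = threshold-bound-const σs sf h₂ 0 (3 + κ) len (s≤s z≤n) (level-pos h₂≤w) (≤-trans (≤-reflexive (cong suc (ℕₚ.+-identityʳ N))) (<-suc-/ N 2))
      b₄ : 4 * c₄ + (1 + κ) * s ≤ p + (3 + κ)
      b₄ = threshold-bound-const σs sf h₄ 2 (1 + κ) len (s≤s z≤n) (level-pos h₄≤w) (<-suc-/ (N + 2 * q) 4)
      b₅ : 5 * c₅ + κ * s ≤ p + (3 + κ)
      b₅ = threshold-bound-const σs sf h₅ 3 κ len (s≤s z≤n) (level-pos h₅≤w) (<-suc-/ (N + 3 * q) 5)
      -- 20 is the least common multiple of 2, 4 and 5. In units of q, the sums A₁, A₁ + A₅, A₁ + A₅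
      -- + A₄ and A₁ + A₅ + A₄ + A₂ are 20 times the bounds (N + 3 q) / 5, (N + 2 q) / 4, N / 2 and
      -- N for slices between consecutive thresholds.
      A₂ = 230 + 10 * p′
      A₄ = 105 + 5 * p′
      A₅ = 21 + p′
      A₁ = 104 + 4 * p′
      pointwise : ∀ i → 20 * w i ≤ q * (A₂ * 𝟙ₗ h₂ i + (A₄ * 𝟙ₗ h₄ i + (A₅ * 𝟙ₗ h₅ i + A₁ * 𝟙ₗ 1 i)))
      pointwise i = aux (w i) (w≤N i) (h₂ ≤? w i) (h₄ ≤? w i) (h₅ ≤? w i) (1 ≤? w i)
        where
        rhs : ℕ → ℕ → ℕ → ℕ → ℕ
        rhs x y z t = q * (A₂ * x + (A₄ * y + (A₅ * z + A₁ * t)))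
        aux : ∀ v → v ≤ N → (d₂ : Dec (h₂ ≤ v)) (d₄ : Dec (h₄ ≤ v)) (d₅ : Dec (h₅ ≤ v)) (d₁ : Dec (1 ≤ v)) →
              20 * v ≤ rhs (ℕΣ.𝟙 (does d₂)) (ℕΣ.𝟙 (does d₄)) (ℕΣ.𝟙 (does d₅)) (ℕΣ.𝟙 (does d₁))
        aux v v≤N (yes y) (no n) d₅ d₁ = ⊥-elim (n (≤-trans h₄≤h₂ y))
        aux v v≤N d₂ (yes y) (no n) d₁ = ⊥-elim (n (≤-trans h₅≤h₄ y))
        aux v v≤N d₂ d₄ (yes y) (no n) = ⊥-elim (n (≤-trans (s≤s z≤n) y))
        aux v v≤N (yes _) (yes _) (yes _) (yes _) = ≤-trans (*-monoʳ-≤ 20 (≤-trans v≤N (≤-reflexive (cong (_* q) p≡′)))) (≤-reflexive (eq p′ q))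
          where
          eq : ∀ p′ q → 20 * ((23 + p′) * q) ≡ q * ((230 + 10 * p′) * 1 + ((105 + 5 * p′) * 1 + ((21 + p′) * 1 + (104 + 4 * p′) * 1)))
          eq = solve-∀
        aux v v≤N (no n₂) (yes _) (yes _) (yes _) = linear (20 * v) (rhs 0 1 1 1) 0
          (*-monoʳ-≤ 10 (≤-trans (≤-/ N 2 (≰⇒> n₂)) (≤-reflexive (cong (_* q) p≡′)))) (eq p′ q v)
          where
          eq : ∀ p′ q w → 20 * w + 10 * ((23 + p′) * q) + 0 ≡ q * ((230 + 10 * p′) * 0 + ((105 + 5 * p′) * 1 + ((21 + p′) * 1 + (104 + 4 * p′) * 1)))
            + 10 * (2 * w)
          eq = solve-∀
        aux v v≤N (no _) (no n₄) (yes _) (yes _) = linear (20 * v) (rhs 0 0 1 1) 0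
          (*-monoʳ-≤ 5 (≤-trans (≤-/ (N + 2 * q) 4 (≰⇒> n₄)) (≤-reflexive (cong (λ u → u * q + 2 * q) p≡′)))) (eq p′ q v)
          where
          eq : ∀ p′ q w → 20 * w + 5 * ((23 + p′) * q + 2 * q) + 0 ≡ q *
            ((230 + 10 * p′) * 0 + ((105 + 5 * p′) * 0 + ((21 + p′) * 1 + (104 + 4 * p′) * 1))) + 5 * (4 * w)
          eq = solve-∀
        aux v v≤N (no _) (no _) (no n₅) (yes _) = linear (20 * v) (rhs 0 0 0 1) 0
          (*-monoʳ-≤ 4 (≤-trans (≤-/ (N + 3 * q) 5 (≰⇒> n₅)) (≤-reflexive (cong (λ u → u * q + 3 * q) p≡′)))) (eq p′ q v)
          where
          eq : ∀ p′ q w → 20 * w + 4 * ((23 + p′) * q + 3 * q) + 0 ≡ q *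
            ((230 + 10 * p′) * 0 + ((105 + 5 * p′) * 0 + ((21 + p′) * 0 + (104 + 4 * p′) * 1))) + 4 * (5 * w)
          eq = solve-∀
        aux v v≤N (no _) (no _) (no _) (no n₁) = subst (λ u → 20 * u ≤ rhs 0 0 0 0) (sym (ℕₚ.n<1⇒n≡0 (≰⇒> n₁))) z≤n
      summed : 20 * a ≤ q * (A₂ * c₂ + (A₄ * c₄ + (A₅ * c₅ + A₁ * s)))
      summed = ≤-trans (≤-reflexive (trans (cong (20 *_) a≡) (sym (∑-*ˡ (allFin p) 20 w)))) (≤-trans (∑-mono (allFin p) pointwise) (≤-reflexive (begin
        ∑ (allFin p) (λ i → q * (A₂ * 𝟙ₗ h₂ i + (A₄ * 𝟙ₗ h₄ i + (A₅ * 𝟙ₗ h₅ i + A₁ * 𝟙ₗ 1 i))))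
          ≡⟨ ∑-*ˡ (allFin p) q _ ⟩
        q * ∑ (allFin p) (λ i → A₂ * 𝟙ₗ h₂ i + (A₄ * 𝟙ₗ h₄ i + (A₅ * 𝟙ₗ h₅ i + A₁ * 𝟙ₗ 1 i)))
          ≡⟨ cong (q *_) (trans (∑-+ (allFin p) (λ i → A₂ * 𝟙ₗ h₂ i) _)
            (cong₂ _+_ (∑-*ˡ (allFin p) A₂ (𝟙ₗ h₂)) (trans (∑-+ (allFin p) (λ i → A₄ * 𝟙ₗ h₄ i) _)
            (cong₂ _+_ (∑-*ˡ (allFin p) A₄ (𝟙ₗ h₄)) (trans (∑-+ (allFin p) (λ i → A₅ * 𝟙ₗ h₅ i) _)
            (cong₂ _+_ (∑-*ˡ (allFin p) A₅ (𝟙ₗ h₅)) (∑-*ˡ (allFin p) A₁ (𝟙ₗ 1)))))))) ⟩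
        q * (A₂ * c₂ + (A₄ * c₄ + (A₅ * c₅ + A₁ * s))) ∎)))
        where open ℕΣ
      contradiction : ¬ (1 + m < s)
      contradiction lt = final
        where
        e′ = s ∸ (2 + m)
        s≡ : s ≡ m + 2 + e′
        s≡ = trans (sym (ℕₚ.m+[n∸m]≡n lt)) (cong (_+ e′) (ℕₚ.+-comm 2 m))
        β₂ : c₂ + (1 + e′) ≤ m
        β₂ = ℕₚ.≮⇒≥ λ h → absurd-linear (mu + (1 + (lam + mu)) * e′) (+-mono-≤ (subst₂ (λ s p → 2 * c₂ + (3 + κ) * s ≤ p + (3 + κ)) s≡ p≡ b₂)
          (*-monoʳ-≤ 2 h)) (eq lam mu m e′ c₂)
          where
          eq : ∀ l u m e c → 2 * c + (3 + (l + u)) * (m + 2 + e) + 2 * suc m ≡ (5 + (l + u)) * m + 2 + l + (3 + (l + u)) + 2 * (c + (1 + e)) + suc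
            (u + (1 + (l + u)) * e)
          eq = solve-∀
        β₄ : c₄ ≤ m
        β₄ = ℕₚ.≮⇒≥ λ h → absurd-linear (mu + (1 + (lam + mu)) * e′) (+-mono-≤ (subst₂ (λ s p → 4 * c₄ + (1 + κ) * s ≤ p + (3 + κ)) s≡ p≡ b₄)
          (*-monoʳ-≤ 4 h)) (eq lam mu m e′ c₄)
          where
          eq : ∀ l u m e c → 4 * c + (1 + (l + u)) * (m + 2 + e) + 4 * suc m ≡ (5 + (l + u)) * m + 2 + l + (3 + (l + u)) + 4 * c + suc (u + (1 + (l + u)) * e)
          eq = solve-∀
        β₅ : c₅ ≤ m + 1
        β₅ = ℕₚ.≮⇒≥ λ h → absurd-linear (4 + mu + (lam + mu) * e′) (+-mono-≤ (subst₂ (λ s p → 5 * c₅ + κ * s ≤ p + (3 + κ)) s≡ p≡ b₅) (*-monoʳ-≤ 5 h))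
          (eq lam mu m e′ c₅)
          where
          eq : ∀ l u m e c → 5 * c + (l + u) * (m + 2 + e) + 5 * suc (m + 1) ≡ (5 + (l + u)) * m + 2 + l + (3 + (l + u)) + 5 * c + suc (4 + u + (l + u) * e)
          eq = solve-∀
        cancelled : 20 * (m * (23 + p′)) ≤ A₂ * c₂ + (A₄ * c₄ + (A₅ * c₅ + A₁ * (m + 2 + e′)))
        cancelled = ℕₚ.*-cancelˡ-≤ q {{>-nonZero 1≤q}} (≤-trans (≤-reflexive (eq q m (23 + p′)))
          (≤-trans (*-monoʳ-≤ 20 (subst (λ u → m * (u * q) ≤ a) p≡′ mN≤a)) (subst (λ s → 20 * a ≤ q * (A₂ * c₂ + (A₄ * c₄ + (A₅ * c₅ + A₁ * s)))) s≡ summed)))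
          where
          eq : ∀ q m p → q * (20 * (m * p)) ≡ 20 * (m * (p * q))
          eq = solve-∀
        final : ⊥
        final = absurd-linear (p′ + (126 + 6 * p′) * e′) (+-mono-≤ cancelled
          (+-mono-≤ (*-monoʳ-≤ A₂ β₂) (+-mono-≤ (*-monoʳ-≤ A₄ β₄) (*-monoʳ-≤ A₅ β₅)))) (eq p′ m e′ c₂ c₄ c₅)
          where
          eq : ∀ p m e x y z → 20 * (m * (23 + p)) + ((230 + 10 * p) * (x + (1 + e)) + ((105 + 5 * p) * y + (21 + p) * z))
               ≡ (230 + 10 * p) * x + ((105 + 5 * p) * y + ((21 + p) * z + (104 + 4 * p) * (m + 2 + e))) +
                 ((230 + 10 * p) * m + ((105 + 5 * p) * m + (21 + p) * (m + 1))) + suc (p + (126 + 6 * p) * e)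
          eq = solve-∀

    private
      -- K slices of total size above L have full sumset, and L / K is therefore the critical size
      -- for one slice.
      L = N + (3 + κ) * q
      hK = suc (L / K)
      cK = level hK

    module _ (large : p ^ suc r * p * ((K + lam + 4) * (K + 1)) ≤ K * ℕΣ.∑ (allFin p) (λ i → ℤ.∣ + p ℤ.* + w i ℤ.- + a ∣)) where

      private
        -- Few cosets above the mean, so the weights would be too evenly spread.
        too-even : ∀ X → (∀ i → K * (p * w i) ≤ p * L + p * X * 𝟙ₗ hK i) → X * cK + 2 * (K * a) ≤ 2 * (p * L) → ⊥
        -- K times the spread is at most 6 p (K + λ) N, whereas (K + λ + 4) (K + 1) = 6 (K + λ) + 24
        -- + (K + λ + 4) (K - 5).
        too-even X pw h = absurd-linear ((24 + (5 + (κ + lam) + 4) * κ) * (N * p) ∸ 1)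
            (+-mono-≤ (≤-trans large KD) (*-monoʳ-≤ (6 * p) Y≤))
            (trans (eq lam mu p q Y) (cong (_+_ (6 * p * Y + 6 * p * ((K + lam) * N))) (sym (ℕₚ.m+[n∸m]≡n pos))))
          where
          -- p K times the amount by which the mean slice lies below L / K.
          Y = p * L ∸ K * a
          Ka≤ : K * a ≤ p * L
          Ka≤ = ℕₚ.*-cancelˡ-≤ 2 (≤-trans (m≤n+m _ (X * cK)) h)
          Y+ : Y + K * a ≡ p * L
          Y+ = ℕₚ.m∸n+n≡m Ka≤
          pos : 1 ≤ (24 + (5 + (κ + lam) + 4) * κ) * (N * p)
          pos = *-mono-≤ {1} {24 + (5 + (κ + lam) + 4) * κ} (s≤s z≤n) (*-mono-≤ (*-mono-≤ 1≤p 1≤q) 1≤p)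
          XcK : X * cK ≤ 2 * Y
          XcK = linear (X * cK) (2 * Y) 0 (≤-trans h (≤-reflexive (cong (2 *_) (sym Y+)))) (eq′ (X * cK) Y (K * a))
            where
            eq′ : ∀ x y k → x + 2 * (y + k) + 0 ≡ 2 * y + (x + 2 * k)
            eq′ = solve-∀
          u : 𝔽 → ℕ
          u i = p * w i ∸ a
          Ku : ∀ i → K * u i ≤ Y + p * X * 𝟙ₗ hK i
          Ku i = ≤-trans (≤-reflexive (ℕₚ.*-distribˡ-∸ K (p * w i) a))
            (ℕₚ.m≤n+o⇒m∸n≤o (K * (p * w i)) (K * a) (≤-trans (pw i) (≤-reflexive
            (trans (cong (_+ p * X * 𝟙ₗ hK i) (trans (sym Y+) (ℕₚ.+-comm Y (K * a)))) (ℕₚ.+-assoc (K * a) Y _)))))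
          ∑u : K * ℕΣ.∑ (allFin p) u ≤ p * Y + p * X * cK
          ∑u = ≤-trans (≤-reflexive (sym (ℕΣ.∑-*ˡ (allFin p) K u))) (≤-trans (∑-mono (allFin p) Ku)
            (≤-reflexive (trans (ℕΣ.∑-+ (allFin p) (λ _ → Y) _) (cong₂ _+_ (∑-const Y) (ℕΣ.∑-*ˡ (allFin p) (p * X) (𝟙ₗ hK))))))
          D = ℕΣ.∑ (allFin p) (λ i → ℤ.∣ + p ℤ.* + w i ℤ.- + a ∣)
          D≡ : D ≡ 2 * ℕΣ.∑ (allFin p) u
          D≡ = ℕₚ.+-cancelʳ-≡ (p * a) D (2 * ℕΣ.∑ (allFin p) u) (begin
            D + p * a
              ≡⟨ cong (_+_ D) (trans (cong (p *_) a≡) (sym (∑-*ˡ (allFin p) p w))) ⟩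
            D + ∑ (allFin p) (λ i → p * w i)
              ≡⟨ sym (∑-+ (allFin p) _ _) ⟩
            ∑ (allFin p) (λ i → ℤ.∣ + p ℤ.* + w i ℤ.- + a ∣ + p * w i)
              ≡⟨ ∑-cong (allFin p) (λ i → trans (cong (λ v → ℤ.∣ v ℤ.- + a ∣ + p * w i) (sym (ℤₚ.pos-* p (w i)))) (∣-∣-split (p * w i) a)) ⟩
            ∑ (allFin p) (λ i → a + 2 * u i)
              ≡⟨ trans (∑-+ (allFin p) (λ _ → a) _) (cong₂ _+_ (∑-const a) (∑-*ˡ (allFin p) 2 u)) ⟩
            p * a + 2 * ∑ (allFin p) u
              ≡⟨ ℕₚ.+-comm (p * a) _ ⟩
            2 * ∑ (allFin p) u + p * a ∎)
            where
            open ≡-Reasoning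
            open ℕΣ
          KD : K * D ≤ 6 * p * Y
          KD = ≤-trans (≤-reflexive (trans (cong (K *_) D≡) (eq₁ K (ℕΣ.∑ (allFin p) u))))
            (linear (2 * (K * ℕΣ.∑ (allFin p) u)) (6 * p * Y) 0 (+-mono-≤ (*-monoʳ-≤ 2 ∑u) (*-monoʳ-≤ (2 * p) XcK)) (eq₂ (K * ℕΣ.∑ (allFin p) u) p Y X cK))
            where
            eq₁ : ∀ K u → K * (2 * u) ≡ 2 * (K * u)
            eq₁ = solve-∀
            eq₂ : ∀ k p y x c → 2 * k + (2 * (p * y + p * x * c) + 2 * p * (2 * y)) + 0 ≡ 6 * p * y + (2 * k + 2 * p * (x * c))
            eq₂ = solve-∀
          Y≤ : Y ≤ (K + lam) * N
          Y≤ = linear Y ((K + lam) * N) 0 (+-mono-≤ (≤-reflexive Y+) (*-monoʳ-≤ K mN≤a)) expand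
            where
            e₁ : ∀ p q l u → p * (p * q + (3 + (l + u)) * q) ≡ p * (p * q) + (3 + (l + u)) * (p * q)
            e₁ = solve-∀
            e₂ : ∀ m M Y l u Z → Y + (((5 + (l + u)) * m + 2 + l) * M + (3 + (l + u)) * M + Z) + 0 ≡ (5 + (l + u) + l) * M + (Y + Z + (5 + (l + u)) * (m * M))
            e₂ = solve-∀
            expand : Y + (p * (p * q + (3 + κ) * q) + K * a) + 0 ≡ (K + lam) * N + (Y + K * a + K * (m * N))
            expand = trans (cong (λ v → Y + (v + K * a) + 0) (trans (e₁ p q lam mu) (cong (λ v → v * N + (3 + κ) * N) p≡))) (e₂ m N Y lam mu (K * a))
          eq : ∀ l u p q Y → p * q * p * ((5 + (l + u) + l + 4) * (5 + (l + u) + 1)) + 6 * p * Y ≡ 6 * p * Y + 6 * p * ((5 + (l + u) + l) * (p * q)) +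
            (24 + (5 + (l + u + l) + 4) * (l + u)) * (p * q * p)
          eq = solve-∀

      -- Let f be the largest slice. The threshold hK in all positions shows that at most m + 1
      -- slices reach hK, and f in two positions with h′ in the others bounds the slices that reach
      -- h′. A piecewise bound for w through these two levels then gives X cK ≤ 2 Y, as `too-even`
      -- requires.
      light-case : ¬ (∀ i → 2 * w i ≤ N)
      light-case small with argmax (Fin-finite p) w N w≤N 𝟘
      ... | i₁ , max with K * w i₁ ≤? L
      ... | yes KF≤L = too-even 0
              (λ i → ≤-trans (≤-reflexive (eq K p (w i))) (≤-trans (*-monoʳ-≤ p (≤-trans (*-monoʳ-≤ K (max i)) KF≤L)) (m≤m+n _ _)))
              (*-monoʳ-≤ 2 (≤-trans (≤-reflexive (trans (cong (K *_) a≡) (sym (ℕΣ.∑-*ˡ (allFin p) K w))))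
                (≤-trans (∑-mono (allFin p) (λ i → ≤-trans (*-monoʳ-≤ K (max i)) KF≤L)) (≤-reflexive (∑-const L)))))
        where
        eq : ∀ K p w → K * (p * w) ≡ p * (K * w)
        eq = solve-∀
      ... | no KF≰L = too-even X pointwise₁ bound
        where
        f = w i₁
        X = K * f ∸ L
        KF≡ : X + L ≡ K * f
        KF≡ = ℕₚ.m∸n+n≡m (<⇒≤ (≰⇒> KF≰L))
        2f≤L : 2 * f ≤ L
        2f≤L = ≤-trans (small i₁) (m≤m+n N _)
        -- The least size with which K - 2 slices complete two slices of size f to a full sumset.
        h′ = suc ((L ∸ 2 * f) / (3 + κ))
        c′ = level h′
        hK≤f : hK ≤ f
        hK≤f = ℕₚ.≮⇒≥ λ lt → KF≰L (≤-/ L K lt)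
        h′-spec : ∀ {x} → L < 2 * f + (3 + κ) * x → h′ ≤ x
        h′-spec {x} lt = ℕₚ.≮⇒≥ λ lt′ → <⇒≱ lt (≤-trans (+-monoʳ-≤ (2 * f) (≤-/ (L ∸ 2 * f) (3 + κ) lt′)) (≤-reflexive (ℕₚ.m+[n∸m]≡n 2f≤L)))
        h′≤ : ∀ {x} → x ≤ f → hK ≤ x → h′ ≤ x
        h′≤ {x} x≤f hK≤x = h′-spec (≤-trans (<-suc-/ L K) (≤-trans (*-monoʳ-≤ K hK≤x)
          (≤-trans (≤-reflexive (eq κ x)) (+-monoˡ-≤ ((3 + κ) * x) (*-monoʳ-≤ 2 x≤f)))))
          where
          eq : ∀ κ x → (5 + κ) * x ≡ 2 * x + (3 + κ) * x
          eq = solve-∀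
        h′≤f : h′ ≤ f
        h′≤f = h′≤ ≤-refl hK≤f
        1≤f : 1 ≤ f
        1≤f = ≤-trans (s≤s z≤n) hK≤f
        cK≤ : cK ≤ m + 1
        cK≤ = ℕₚ.≮⇒≥ λ h → absurd-linear (4 + mu) (+-mono-≤ (subst (λ p → K * cK + 0 * s ≤ p + (3 + κ + 0)) p≡
                (threshold-bound-const σs sf hK (3 + κ) 0 (trans len (sym (ℕₚ.+-identityʳ K))) (s≤s z≤n) (level-pos hK≤f) (<-suc-/ L K)))
                  (*-monoʳ-≤ K h)) (eq lam mu m cK s)
          where
          eq : ∀ l u m c s → (5 + (l + u)) * c + 0 * s + (5 + (l + u)) * suc (m + 1) ≡ (5 + (l + u)) * m + 2 + l + (3 + (l + u) + 0) + (5 + (l + u)) *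
            c + suc (4 + u)
          eq = solve-∀
        c′-bound : (3 + κ) * c′ + 2 ≤ p + (3 + κ)
        c′-bound = ≤-trans (≤-trans (≤-reflexive (eq ((3 + κ) * c′))) (+-monoˡ-≤ ((3 + κ) * c′)
          (+-mono-≤ (level-pos {f} {i₁} ≤-refl) (level-pos {f} {i₁} ≤-refl))))
            (≤-trans (≤-reflexive (eq₂ (level f) ((3 + κ) * c′) s)) (subst₂ (λ u v → level f + (level f + u) + 0 * s ≤ p + (v + 0))
              (sum-rep level (3 + κ)) (Listₚ.length-replicate (3 + κ))
              (threshold-bound σs sf f f (replicate (3 + κ) h′) 0 (trans len (sym (trans (ℕₚ.+-identityʳ _) (cong (_+_ 2) (Listₚ.length-replicate (3 + κ))))))
                ((1≤f , level-pos {f} {i₁} ≤-refl) ∷ (1≤f , level-pos {f} {i₁} ≤-refl) ∷ allRep (3 + κ))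
                (subst₂ (λ u v → N + u * q < f + (f + v)) (sym (Listₚ.length-replicate (3 + κ)))
                  (sym (trans (cong sum (sym (Listₚ.map-id (replicate (3 + κ) h′)))) (sum-rep (λ x → x) (3 + κ))))
                  (≤-trans big (≤-reflexive (eq₃ f ((3 + κ) * h′))))))
              ∙′ ≤-reflexive (cong (_+_ p) (ℕₚ.+-identityʳ (3 + κ)))))
          where
          _∙′_ = ≤-trans
          eq : ∀ x → x + 2 ≡ 1 + 1 + x
          eq = solve-∀
          eq₂ : ∀ f x s → f + f + x ≡ f + (f + x) + 0 * s
          eq₂ = solve-∀
          eq₃ : ∀ f x → 2 * f + x ≡ f + (f + x)
          eq₃ = solve-∀
          big : L < 2 * f + (3 + κ) * h′
          big = ≤-trans (s≤s (≤-reflexive (sym (ℕₚ.m+[n∸m]≡n 2f≤L)))) (≤-trans (≤-reflexive (sym (ℕₚ.+-suc (2 * f) _)))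
            (+-monoʳ-≤ (2 * f) (<-suc-/ (L ∸ 2 * f) (3 + κ))))
          sum-rep : ∀ (g : ℕ → ℕ) d → sum (map g (replicate d h′)) ≡ d * g h′
          sum-rep g zero    = refl
          sum-rep g (suc d) = cong (_+_ (g h′)) (sum-rep g d)
          allRep : ∀ d → All (λ h → (1 ≤ h) × (1 ≤ level h)) (replicate d h′)
          allRep zero    = []
          allRep (suc d) = (s≤s z≤n , level-pos h′≤f) ∷ allRep d
        -- Substituting m = 3 + m₃ makes the slack below a polynomial with nonnegative coefficients.
        m₃ = m ∸ 3
        m≡₃ : m ≡ 3 + m₃
        m≡₃ = sym (ℕₚ.m+[n∸m]≡n (≤-trans (≤-trans (s≤s (s≤s (s≤s z≤n))) (m≤m+n (K + lam) 4)) m≥))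
        -- The combination of the two counts that makes `summed`, doubled, collapse to `bound`.
        density : 4 * c′ + 3 * (3 + κ) * cK ≤ 4 * p
        density = ℕₚ.*-cancelˡ-≤ (3 + κ) (linear ((3 + κ) * (4 * c′ + 3 * (3 + κ) * cK)) ((3 + κ) * (4 * p)) slack
                    (+-mono-≤ (*-monoʳ-≤ 4 c′-bound) (+-mono-≤ (*-monoʳ-≤ (3 * (3 + κ) * (3 + κ)) (subst (λ m → cK ≤ m + 1) m≡₃ cK≤))
                      (≤-reflexive (cong ((8 + 4 * κ) *_) (sym (trans p≡ (cong (λ m → K * m + 2 + lam) m≡₃)))))))
                    (eq lam mu m₃ c′ cK p))
          where
          slack = 24 + 16 * κ + (13 + 10 * κ + κ * κ) * m₃ + 4 * (2 + κ) * lam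
          eq : ∀ l u m c d p → (3 + (l + u)) * (4 * c + 3 * (3 + (l + u)) * d) +
            (4 * (p + (3 + (l + u))) + (3 * (3 + (l + u)) * (3 + (l + u)) * (3 + m + 1) + (8 + 4 * (l + u)) * p)) +
            (24 + 16 * (l + u) + (13 + 10 * (l + u) + (l + u) * (l + u)) * m + 4 * (2 + (l + u)) * l)
               ≡ (3 + (l + u)) * (4 * p) + (4 * ((3 + (l + u)) * c + 2) +
                 (3 * (3 + (l + u)) * (3 + (l + u)) * d + (8 + 4 * (l + u)) * ((5 + (l + u)) * (3 + m) + 2 + l)))
          eq = solve-∀
        pointwise₁ : ∀ i → K * (p * w i) ≤ p * L + p * X * 𝟙ₗ hK i
        pointwise₁ i = aux (w i) (max i) (hK ≤? w i)
          where
          eq₁ : ∀ K p w → K * (p * w) ≡ p * (K * w)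
          eq₁ = solve-∀
          eq₂ : ∀ p X L → p * (X + L) ≡ p * L + p * X * 1
          eq₂ = solve-∀
          aux : ∀ v → v ≤ f → (d : Dec (hK ≤ v)) → K * (p * v) ≤ p * L + p * X * ℕΣ.𝟙 (does d)
          aux v v≤f (yes _) = ≤-trans (≤-reflexive (eq₁ K p v)) (≤-trans (*-monoʳ-≤ p (≤-trans (*-monoʳ-≤ K v≤f) (≤-reflexive (sym KF≡))))
            (≤-reflexive (eq₂ p X L)))
          aux v v≤f (no n)  = ≤-trans (≤-reflexive (eq₁ K p v)) (≤-trans (*-monoʳ-≤ p (≤-/ L K (≰⇒> n))) (m≤m+n (p * L) _))
        -- Below h′ one has (K - 2) w ≤ L - 2 f, and K f = X + L turns this into a saving of 2 X,
        -- which slices reaching h′ pay back.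
        pointwise₂ : ∀ i → K * (3 + κ) * w i + 2 * X ≤ (3 + κ) * L + (2 * X * 𝟙ₗ h′ i + (3 + κ) * X * 𝟙ₗ hK i)
        pointwise₂ i = aux (w i) (max i) (hK ≤? w i) (h′ ≤? w i)
          where
          lhs : ℕ → ℕ
          lhs v = K * (3 + κ) * v + 2 * X
          rhs : ℕ → ℕ → ℕ
          rhs x y = (3 + κ) * L + (2 * X * x + (3 + κ) * X * y)
          aux : ∀ v → v ≤ f → (d : Dec (hK ≤ v)) (d′ : Dec (h′ ≤ v)) → lhs v ≤ rhs (ℕΣ.𝟙 (does d′)) (ℕΣ.𝟙 (does d))
          aux v v≤f (yes y) (no n) = ⊥-elim (n (h′≤ v≤f y))
          aux v v≤f (yes _) (yes _) = linear (lhs v) (rhs 1 1) 0 (*-monoʳ-≤ (3 + κ) (≤-trans (*-monoʳ-≤ K v≤f) (≤-reflexive (sym KF≡)))) (eq κ v X L)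
            where
            eq : ∀ κ w X L → (5 + κ) * (3 + κ) * w + 2 * X + (3 + κ) * (X + L) + 0 ≡ (3 + κ) * L + (2 * X * 1 + (3 + κ) * X * 1) + (3 + κ) * ((5 + κ) * w)
            eq = solve-∀
          aux v v≤f (no n) (yes _) = linear (lhs v) (rhs 1 0) 0 (*-monoʳ-≤ (3 + κ) (≤-/ L K (≰⇒> n))) (eq κ v X L)
            where
            eq : ∀ κ w X L → (5 + κ) * (3 + κ) * w + 2 * X + (3 + κ) * L + 0 ≡ (3 + κ) * L + (2 * X * 1 + (3 + κ) * X * 0) + (3 + κ) * ((5 + κ) * w)
            eq = solve-∀
          aux v v≤f (no _) (no n) = linear (lhs v) (rhs 0 0) 0 (+-mono-≤
            (*-monoʳ-≤ K (≤-trans (+-monoʳ-≤ (2 * f) (≤-/ (L ∸ 2 * f) (3 + κ) (≰⇒> n))) (≤-reflexive (ℕₚ.m+[n∸m]≡n 2f≤L))))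
            (*-monoʳ-≤ 2 (≤-reflexive KF≡))) (eq κ v X L f)
            where
            eq : ∀ κ w X L f → (5 + κ) * (3 + κ) * w + 2 * X + ((5 + κ) * L + 2 * ((5 + κ) * f)) + 0 ≡ (3 + κ) * L + (2 * X * 0 + (3 + κ) * X * 0) +
              ((5 + κ) * (2 * f + (3 + κ) * w) + 2 * (X + L))
            eq = solve-∀
        summed : K * (3 + κ) * a + p * (2 * X) ≤ p * ((3 + κ) * L) + (2 * X * c′ + (3 + κ) * X * cK)
        summed = subst₂ _≤_
          (trans (∑-+ (allFin p) (λ i → K * (3 + κ) * w i) (λ _ → 2 * X))
            (cong₂ _+_ (trans (∑-*ˡ (allFin p) (K * (3 + κ)) w) (cong (K * (3 + κ) *_) (sym a≡))) (∑-const (2 * X))))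
          (trans (∑-+ (allFin p) (λ _ → (3 + κ) * L) _) (cong₂ _+_ (∑-const ((3 + κ) * L))
            (trans (∑-+ (allFin p) (λ i → 2 * X * 𝟙ₗ h′ i) (λ i → (3 + κ) * X * 𝟙ₗ hK i))
            (cong₂ _+_ (∑-*ˡ (allFin p) (2 * X) (𝟙ₗ h′)) (∑-*ˡ (allFin p) ((3 + κ) * X) (𝟙ₗ hK))))))
          (∑-mono (allFin p) pointwise₂)
          where open ℕΣ
        bound : X * cK + 2 * (K * a) ≤ 2 * (p * L)
        bound = ℕₚ.*-cancelˡ-≤ (3 + κ) (linear ((3 + κ) * (X * cK + 2 * (K * a))) ((3 + κ) * (2 * (p * L))) 0
          (+-mono-≤ (*-monoʳ-≤ 2 summed) (*-monoʳ-≤ X density)) (eq κ X cK c′ a p L))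
          where
          eq : ∀ κ X d c a p L → (3 + κ) * (X * d + 2 * ((5 + κ) * a)) + (2 * (p * ((3 + κ) * L) + (2 * X * c + (3 + κ) * X * d)) + X * (4 * p)) + 0
               ≡ (3 + κ) * (2 * (p * L)) + (2 * ((5 + κ) * (3 + κ) * a + p * (2 * X)) + X * (4 * c + 3 * (3 + κ) * d))
          eq = solve-∀

      support-bound : s ≤ 1 + m
      support-bound with W.∃? {λ i → N < 2 * w i} (λ i → N <? 2 * w i)
      ... | inj₁ (i , big) = heavy-case i big
      ... | inj₂ none = ⊥-elim (light-case λ i → ℕₚ.≮⇒≥ (none i))

-- Differences in an interval with one or two holes

avoid₂ : ∀ a b → ∃[ x ] (1 ≤ x) × (x ≤ 3) × (x ≢ a) × (x ≢ b)
avoid₂ a b with 1 ℕₚ.≟ a | 1 ℕₚ.≟ b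
... | no p | no q = 1 , s≤s z≤n , s≤s z≤n , p , q
... | yes refl | _ with 2 ℕₚ.≟ b
...   | no q = 2 , s≤s z≤n , s≤s (s≤s z≤n) , (λ ()) , q
...   | yes refl = 3 , s≤s z≤n , ≤-refl , (λ ()) , (λ ())
avoid₂ a b | no p | yes refl with 2 ℕₚ.≟ a
...   | no q = 2 , s≤s z≤n , s≤s (s≤s z≤n) , q , (λ ())
...   | yes refl = 3 , s≤s z≤n , ≤-refl , (λ ()) , (λ ())

least : ∀ (P : ℕ → Bool) n → (∃[ i ] (i < n) × (P i ≡ true) × (∀ j → j < i → P j ≡ false)) ⊎ (∀ j → j < n → P j ≡ false)
least P zero = inj₂ λ j ()
least P (suc n) with least P n
... | inj₁ (i , i< , e , h) = inj₁ (i , ≤-trans i< (n≤1+n n) , e , h)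
... | inj₂ none with P n in eq
...   | true  = inj₁ (n , ≤-refl , eq , none)
...   | false = inj₂ λ j j< → case-≤ j (ℕₚ.m≤n⇒m<n∨m≡n (ℕₚ.≤-pred j<))
  where
  case-≤ : ∀ j → (j < n) ⊎ (j ≡ n) → P j ≡ false
  case-≤ j (inj₁ lt)   = none j lt
  case-≤ j (inj₂ refl) = eq

greatest : ∀ (P : ℕ → Bool) n → (∃[ i ] (i < n) × (P i ≡ true) × (∀ j → i < j → j < n → P j ≡ false)) ⊎ (∀ j → j < n → P j ≡ false)
greatest P zero = inj₂ λ j ()
greatest P (suc n) with P n in eq
... | true  = inj₁ (n , ≤-refl , eq , λ j n<j j≤n → ⊥-elim (<⇒≱ n<j (ℕₚ.≤-pred j≤n)))
... | false with greatest P n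
...   | inj₁ (i , i< , e , h) = inj₁ (i , ≤-trans i< (n≤1+n n) , e , λ j i<j j< → case-≤ j i<j (ℕₚ.m≤n⇒m<n∨m≡n (ℕₚ.≤-pred j<)))
  where
  case-≤ : ∀ j → i < j → (j < n) ⊎ (j ≡ n) → P j ≡ false
  case-≤ j i<j (inj₁ lt)   = h j i<j lt
  case-≤ j i<j (inj₂ refl) = eq
...   | inj₂ none = inj₂ λ j j< → case-≤ j (ℕₚ.m≤n⇒m<n∨m≡n (ℕₚ.≤-pred j<))
  where
  case-≤ : ∀ j → (j < n) ⊎ (j ≡ n) → P j ≡ false
  case-≤ j (inj₁ lt)   = none j lt
  case-≤ j (inj₂ refl) = eq

-- D is the difference of 0 and D or of M - D and M, unless the hole is the midpoint D = M - D. In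
-- that case 1 and D + 1 are present.
difference₁ : ∀ (P : ℕ → Bool) M u → 4 ≤ M → P 0 ≡ true → P M ≡ true → (∀ i → i ≤ M → i ≢ u → P i ≡ true) →
              ∀ D → D ≤ M → ∃[ x ] (P x ≡ true) × (P (x + D) ≡ true)
difference₁ P M u M≥4 P0 PM ok D D≤M with P D in eqD
... | true  = 0 , P0 , eqD
... | false with P (M ∸ D) in eqM
...   | true  = M ∸ D , eqM , trans (cong P (ℕₚ.m∸n+n≡m D≤M)) PM
...   | false = 1 , ok 1 (≤-trans (s≤s z≤n) M≥4) 1≢u , ok (suc D) D<M (λ e → ℕₚ.1+n≢n (trans e (sym D≡u)))
  where
  bad : ∀ i → i ≤ M → P i ≡ false → i ≡ u
  bad i i≤ e with i ℕₚ.≟ u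
  ... | yes h = h
  ... | no  h = ⊥-elim (true≢false (ok i i≤ h) e)
  D≡u : D ≡ u
  D≡u = bad D D≤M eqD
  2D≡M : D + D ≡ M
  2D≡M = trans (cong (_+ D) (trans D≡u (sym (bad (M ∸ D) (ℕₚ.m∸n≤m M D) eqM)))) (ℕₚ.m∸n+n≡m D≤M)
  D≥2 : 2 ≤ D
  D≥2 = ℕₚ.≮⇒≥ λ lt → <⇒≱ (≤-trans (≤-trans (s≤s (+-mono-≤ (ℕₚ.≤-pred lt) (ℕₚ.≤-pred lt))) (s≤s (s≤s (s≤s z≤n)))) M≥4) (≤-reflexive (sym 2D≡M))
  1≢u : 1 ≢ u
  1≢u e = <⇒≱ D≥2 (≤-reflexive (trans D≡u (sym e)))
  D<M : suc D ≤ M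
  D<M = ≤-trans (+-monoˡ-≤ D (<⇒≤ D≥2)) (≤-reflexive 2D≡M)

-- If D and M - D are both missing, they are the two holes, or they coincide in the midpoint. In
-- either case some x among 1, 2, 3 has x and x + D present. The difference M - 1 is lost when the
-- holes are 1 and M - 1, hence the restriction on D.
difference₂ : ∀ (P : ℕ → Bool) M u v → 9 ≤ M → P 0 ≡ true → P M ≡ true → (∀ i → i ≤ M → i ≢ u → i ≢ v → P i ≡ true) →
              ∀ D → 2 + D ≤ M → ∃[ x ] (P x ≡ true) × (P (x + D) ≡ true)
difference₂ P M u v M≥9 P0 PM ok D D≤M with P D in eqD
... | true  = 0 , P0 , eqD
... | false with P (M ∸ D) in eqM
...   | true  = M ∸ D , eqM , trans (cong P (ℕₚ.m∸n+n≡m (≤-trans (m≤n+m D 2) D≤M))) PM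
...   | false = go (bad D (≤-trans (m≤n+m D 2) D≤M) eqD) (bad (M ∸ D) (ℕₚ.m∸n≤m M D) eqM)
  where
  D≤ : D ≤ M
  D≤ = ≤-trans (m≤n+m D 2) D≤M
  M-D : M ∸ D + D ≡ M
  M-D = ℕₚ.m∸n+n≡m D≤
  bad : ∀ i → i ≤ M → P i ≡ false → (i ≡ u) ⊎ (i ≡ v)
  bad i i≤ e with i ℕₚ.≟ u | i ℕₚ.≟ v
  ... | yes h | _ = inj₁ h
  ... | no _ | yes h = inj₂ h
  ... | no h | no h′ = ⊥-elim (true≢false (ok i i≤ h h′) e)
  Result = ∃[ x ] (P x ≡ true) × (P (x + D) ≡ true)
  -- the holes are D and M - D
  opposite : (∀ i → i ≤ M → i ≢ D → i ≢ M ∸ D → P i ≡ true) → Result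
  opposite ok′ with 4 ≤? M ∸ D
  ... | yes big with avoid₂ D (M ∸ D ∸ D)
  ...   | x , 1≤x , x≤3 , x≢D , x≢ = x , ok′ x (≤-trans x≤3 (≤-trans (s≤s (s≤s (s≤s z≤n))) M≥9)) x≢D (λ e → <⇒≱ big (≤-trans (≤-reflexive (sym e)) x≤3)) ,
          ok′ (x + D) (≤-trans (+-monoˡ-≤ D (≤-trans x≤3 (<⇒≤ big))) (≤-reflexive M-D)) (λ e → <⇒≱ (+-monoˡ-≤ D 1≤x) (≤-reflexive e))
            (λ e → x≢ (trans (sym (ℕₚ.m+n∸n≡m x D)) (cong (_∸ D) e)))
  opposite ok′ | no small = 1 , ok′ 1 (≤-trans (s≤s z≤n) M≥9) (λ e → <⇒≱ D≥6 (≤-trans (≤-reflexive (sym e)) (s≤s z≤n)))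
    (λ e → <⇒≱ (+-cancelʳ-≤ D 2 (M ∸ D) (≤-trans D≤M (≤-reflexive (sym M-D)))) (≤-reflexive (sym e))) ,
          ok′ (suc D) (≤-trans (n≤1+n _) D≤M) (λ e → ℕₚ.1+n≢n e) (λ e → <⇒≱ (≤-trans (ℕₚ.≰⇒> small) (≤-trans (s≤s (s≤s (s≤s (s≤s z≤n)))) D≥6))
            (≤-trans (n≤1+n D) (≤-reflexive e)))
    where
    D≥6 : 6 ≤ D
    D≥6 = +-cancelˡ-≤ 3 6 D (≤-trans M≥9 (≤-trans (≤-reflexive (sym M-D)) (+-monoˡ-≤ D (ℕₚ.≤-pred (≰⇒> small)))))
  -- the hole D = M - D is the midpoint, and y is the other one
  middle : ∀ y → D ≡ M ∸ D → (∀ i → i ≤ M → i ≢ D → i ≢ y → P i ≡ true) → Result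
  middle y e ok′ with avoid₂ y (y ∸ D)
  ... | x , 1≤x , x≤3 , x≢y , x≢ = x , ok′ x (≤-trans x≤3 (≤-trans (s≤s (s≤s (s≤s z≤n))) M≥9)) (λ x≡ → <⇒≱ D≥4 (≤-trans (≤-reflexive (sym x≡)) x≤3)) x≢y ,
        ok′ (x + D) (≤-trans (+-monoˡ-≤ D (≤-trans x≤3 (≤-trans (<⇒≤ D≥4) (≤-reflexive e)))) (≤-reflexive M-D))
          (λ e′ → <⇒≱ (+-monoˡ-≤ D 1≤x) (≤-reflexive e′)) (λ e′ → x≢ (trans (sym (ℕₚ.m+n∸n≡m x D)) (cong (_∸ D) e′)))
    where
    D≥4 : 4 ≤ D
    D≥4 = ℕₚ.≮⇒≥ λ lt → <⇒≱ (≤-trans (s≤s (+-mono-≤ (ℕₚ.≤-pred lt) (ℕₚ.≤-pred lt))) (≤-trans (s≤s (s≤s (s≤s (s≤s (s≤s (s≤s (s≤s z≤n))))))) M≥9))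
      (≤-reflexive (trans (sym M-D) (cong (_+ D) (sym e))))
  go : (D ≡ u) ⊎ (D ≡ v) → (M ∸ D ≡ u) ⊎ (M ∸ D ≡ v) → Result
  go (inj₁ e) (inj₁ e′) = middle v (trans e (sym e′)) λ i i≤ n n′ → ok i i≤ (λ z → n (trans z (sym e))) n′
  go (inj₁ e) (inj₂ e′) = opposite λ i i≤ n n′ → ok i i≤ (λ z → n (trans z (sym e))) (λ z → n′ (trans z (sym e′)))
  go (inj₂ e) (inj₁ e′) = opposite λ i i≤ n n′ → ok i i≤ (λ z → n′ (trans z (sym e′))) (λ z → n (trans z (sym e)))
  go (inj₂ e) (inj₂ e′) = middle u (trans e (sym e′)) λ i i≤ n n′ → ok i i≤ n′ (λ z → n (trans z (sym e)))

-- Intervals covered by sums of signed sets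

module LineStructure {p : ℕ} .{{_ : NonZero p}} (F : FieldOps p) where
  open PrimeField F
  open PrimeLine F
  open Tuples F using (flip; card-flip)
  open 𝔽-Solver using (solve; _:+_; _:*_; _:-_; :-_; _:=_; con)

  sg : (𝔽 → Bool) → Bool → 𝔽 → Bool
  sg S σ x = S (flip σ x)

  -- The parameter L is the length and not the number L + 1 of elements, so that lengths add under
  -- sums.
  Cov : List (𝔽 → Bool) → 𝔽 → ℕ → Set
  Cov Xs c L = ∀ i → i ≤ L → SumOf Xs (c ⊞ em i)

  em-∸ : ∀ {i j} → j ≤ i → em (i ∸ j) ≡ em i ⊟ em j
  em-∸ {i} {j} h = trans (sym (add-sub (em (i ∸ j)) (em j))) (cong (_⊟ em j) (trans (sym (em-+ (i ∸ j) j)) (cong em (ℕₚ.m∸n+n≡m h))))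

  -- Two translates of an interval of L + 1 elements leave no gap if they are at most L + 1 apart.
  cov-step : ∀ X {Xs c L a H} → X a ≡ true → X (a ⊞ em H) ≡ true → H ≤ suc L → Cov Xs c L → Cov (X ∷ Xs) (a ⊞ c) (L + H)
  cov-step X {Xs} {c} {L} {a} {H} ea eH H≤ cov i i≤ with i ≤? L
  ... | yes i≤L = a , ea , subst (SumOf Xs) (solve 3 (λ a c i → c :+ i := a :+ c :+ i :- a) refl a c (em i)) (cov i i≤L)
  ... | no  i>L = a ⊞ em H , eH , subst (SumOf Xs)
      (trans (cong (c ⊞_) (em-∸ (≤-trans H≤ (≰⇒> i>L)))) (solve 4 (λ a c i h → c :+ (i :- h) := a :+ c :+ i :- (a :+ h)) refl a c (em i) (em H)))
      (cov (i ∸ H) (ℕₚ.m≤n+o⇒m∸n≤o i H (≤-trans i≤ (≤-reflexive (ℕₚ.+-comm L H)))))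

  -- Reflection exchanges the ends of the pair a, a + H; this is the end at which the signed pair
  -- starts.
  base : 𝔽 → ℕ → Bool → 𝔽
  base a H true  = a
  base a H false = ⊖ (a ⊞ em H)

  bases : 𝔽 → ℕ → List Bool → 𝔽
  bases a H []       = 𝟘
  bases a H (σ ∷ σs) = base a H σ ⊞ bases a H σs

  cov-signs : ∀ S {Xs c L a H} σs → S a ≡ true → S (a ⊞ em H) ≡ true → H ≤ suc L → Cov Xs c L →
              Cov (map (sg S) σs ++ Xs) (bases a H σs ⊞ c) (L + length σs * H)
  cov-signs S {Xs} {c} {L} [] ea eH H≤ cov i i≤ = subst (λ u → SumOf Xs (u ⊞ em i)) (sym (⊞-identityˡ c)) (cov i (≤-trans i≤ (≤-reflexive (ℕₚ.+-identityʳ L))))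
  cov-signs S {Xs} {c} {L} {a} {H} (σ ∷ σs) ea eH H≤ cov =
    λ i i≤ → subst (λ u → SumOf (map (sg S) (σ ∷ σs) ++ Xs) (u ⊞ em i)) (sym (⊞-assoc (base a H σ) _ c))
      (cov-step (sg S σ) (lo σ) (hi σ) (≤-trans H≤ (s≤s (m≤m+n L _))) (cov-signs S σs ea eH H≤ cov) i (≤-trans i≤ (≤-reflexive (lem L H (length σs)))))
    where
    lem : ∀ L H n → L + (H + n * H) ≡ L + n * H + H
    lem = solve-∀
    lo : ∀ σ → sg S σ (base a H σ) ≡ true
    lo true  = ea
    lo false = trans (cong S (⊖-involutive _)) eH
    hi : ∀ σ → sg S σ (base a H σ ⊞ em H) ≡ true
    hi true  = eH
    hi false = trans (cong S (solve 2 (λ a h → :- (:- (a :+ h) :+ h) := a) refl a (em H))) ea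

  cov-all : ∀ {Xs c L} → p ≤ suc L → Cov Xs c L → ∀ z → SumOf Xs z
  cov-all {Xs} {c} {L} p≤ cov z = subst (SumOf Xs) (trans (cong (c ⊞_) (em-toℕ (z ⊟ c))) (solve 2 (λ c z → c :+ (z :- c) := z) refl c z))
    (cov (toℕ (z ⊟ c)) (ℕₚ.≤-pred (≤-trans (Finₚ.toℕ<n (z ⊟ c)) p≤)))

  cov-difference : ∀ S M → (∀ D → D ≤ M → ∃[ x ] (S x ≡ true) × (S (x ⊞ em D) ≡ true)) →
                   Cov (sg S true ∷ sg S false ∷ []) (⊖ em M) (M + M)
  cov-difference S M diff i i≤ with i ≤? M
  ... | yes i≤M = let x , ex , ey = diff (M ∸ i) (ℕₚ.m∸n≤m M i) in
        x , ex , ⊖ (x ⊞ em (M ∸ i)) , trans (cong S (⊖-involutive _)) ey ,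
        trans (cong (λ u → ⊖ em M ⊞ em i ⊟ x ⊟ ⊖ (x ⊞ u)) (em-∸ i≤M)) (solve 3 (λ m i x → (:- m) :+ i :- x :- (:- (x :+ (m :- i))) := con (+ 0)) refl
          (em M) (em i) x)
  ... | no i>M = let x , ex , ey = diff (i ∸ M) (ℕₚ.m≤n+o⇒m∸n≤o i M i≤) in
        x ⊞ em (i ∸ M) , ey , ⊖ x , trans (cong S (⊖-involutive _)) ex ,
        trans (cong (λ u → ⊖ em M ⊞ em i ⊟ (x ⊞ u) ⊟ ⊖ x) (em-∸ (<⇒≤ (≰⇒> i>M))))
          (solve 3 (λ m i x → (:- m) :+ i :- (x :+ (i :- m)) :- (:- x) := con (+ 0)) refl (em M) (em i) x)

  scale : 𝔽 → (𝔽 → Bool) → 𝔽 → Bool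
  scale d S z = S (d ⊠ z)

  scale-SumOf : ∀ d S σs z → SumOf (map (sg (scale d S)) σs) z → SumOf (map (sg S) σs) (d ⊠ z)
  scale-SumOf d S [] z e = trans (cong (d ⊠_) e) (⊠-zeroʳ d)
  scale-SumOf d S (σ ∷ σs) z (x , ex , s) = d ⊠ x , trans (cong S (comm σ x)) ex ,
    subst (SumOf (map (sg S) σs)) (solve 3 (λ d z x → d :* (z :- x) := d :* z :- d :* x) refl d z x) (scale-SumOf d S σs (z ⊟ x) s)
    where
    comm : ∀ σ x → flip σ (d ⊠ x) ≡ d ⊠ flip σ x
    comm true  x = refl
    comm false x = solve 2 (λ d x → :- (d :* x) := d :* (:- x)) refl d x

  unscale : ∀ d → d ≢ 𝟘 → ∃[ d⁻ ] (∀ x → d ⊠ (d⁻ ⊠ x) ≡ x) × (∀ x → d⁻ ⊠ (d ⊠ x) ≡ x)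
  unscale d d≢0 = let d⁻ , e = inverse d d≢0 in d⁻ ,
    (λ x → trans (solve 3 (λ d w x → d :* (w :* x) := (w :* d) :* x) refl d d⁻ x) (trans (cong (_⊠ x) e) (⊠-identityˡ x))) ,
    (λ x → trans (sym (⊠-assoc d⁻ d x)) (trans (cong (_⊠ x) e) (⊠-identityˡ x)))

  scale-card : ∀ d S → d ≢ 𝟘 → # (scale d S) ≡ # S
  scale-card d S d≢0 = let d⁻ , e₁ , e₂ = unscale d d≢0 in card-bijection (d ⊠_) (d⁻ ⊠_) e₁ e₂ S

  neg-near : ∀ Y → Near (neg Y) → Near Y
  neg-near Y (d , d≢0 , le) = ⊖ d , (λ e → d≢0 (trans (sym (⊖-involutive d)) (trans (cong ⊖_ e) -ᵛ-0))) ,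
    ≤-trans (≤-reflexive (trans (sym (card-neg (Y ∪ shift (⊖ d) Y))) (card-cong λ x → cong (λ u → Y (⊖ x) Data.Bool.∨ Y u)
      (solve 2 (λ x d → :- x :- (:- d) := :- (x :- d)) refl x d))))
      (≤-trans le (≤-reflexive (cong suc (card-neg Y))))

  near-interval : ∀ Y → Near Y → 1 ≤ # Y → # Y < p → ∃[ d ] (d ≢ 𝟘) × ∃[ a ] (∀ x → scale d Y x ≡ interval a (# Y) x)
  near-interval Y (d , d≢0 , le) Y≥1 Y<p = let d⁻ , e₁ , e₂ = unscale d d≢0
                                               c = scale-card d Y d≢0
                                               a , h = near₁⇒interval (scale d Y) (≤-trans Y≥1 (≤-reflexive (sym c))) (≤-trans (s≤s (≤-reflexive c)) Y<p)
                                                 (≤-trans (≤-reflexive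
                                                   (trans (card-cong λ x → cong (λ u → Y (d ⊠ x) Data.Bool.∨ Y u)
                                                   (solve 2 (λ d x → d :* (x :- con (+ 1)) := d :* x :- d) refl d x)) (scale-card d (Y ∪ shift d Y) d≢0)))
                                                   (≤-trans le (≤-reflexive (cong suc (sym c)))))
                                           in d , d≢0 , a , λ x → trans (h x) (cong (λ L → interval a L x) c)

  -- For summands that are not progressions nothing is lost, where Kneser's inequality loses 1 at
  -- each addition, until at most one element is missing.
  vosper-chain : ∀ Y Ys → All (λ Y → (2 ≤ # Y) × ¬ Near Y) (Y ∷ Ys) → (p ≤ 1 + # (⨁ (Y ∷ Ys))) ⊎ (total (Y ∷ Ys) ≤ # (⨁ (Y ∷ Ys)))
  vosper-chain Y [] _ = inj₂ (≤-trans (≤-reflexive (ℕₚ.+-identityʳ _)) (card-⊕ˡ Y (⨁ []) {𝟘} (δ-refl 𝟘)))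
  vosper-chain Y (Y′ ∷ Ys) ((Y≥2 , nn) ∷ hs) with vosper-chain Y′ Ys hs
  ... | inj₁ h = inj₁ (≤-trans h (s≤s (card-⊕ʳ Y (⨁ (Y′ ∷ Ys)) (proj₂ (card-witness Y (≤-trans (s≤s z≤n) Y≥2))))))
  ... | inj₂ h with 2 + # (⨁ (Y ∷ Y′ ∷ Ys)) ≤? p
  ...   | no  n = inj₁ (ℕₚ.≤-pred (≰⇒> n))
  ...   | yes y = inj₂ (≤-trans (+-monoʳ-≤ (# Y) h) (≤-trans (≤-reflexive (ℕₚ.+-comm (# Y) (# X)))
            (≤-trans (vosper X Y X≥2 Y≥2 nn (≤-trans (s≤s (s≤s c)) y)) c)))
    where
    X = ⨁ (Y′ ∷ Ys)
    c : # (X ⊕ Y) ≤ # (Y ⊕ X)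
    c = card-mono (⊕-comm X Y)
    X≥2 : 2 ≤ # X
    X≥2 = ≤-trans (≤-trans (proj₁ (All.head hs)) (m≤m+n _ _)) h

  vosper-full : ∀ Ys → All (λ Y → (2 ≤ # Y) × ¬ Near Y) Ys → p < total Ys → ∀ z → SumOf Ys z
  vosper-full [] _ ()
  vosper-full (Y ∷ []) _ big = ⊥-elim (<⇒≱ big (≤-trans (≤-reflexive (ℕₚ.+-identityʳ (# Y))) (#≤p Y)))
  vosper-full (Y ∷ Y′ ∷ Ys) ((Y≥2 , nn) ∷ hs) big z = ⨁⇒SumOf (Y ∷ Y′ ∷ Ys) (pigeonhole Y (⨁ (Y′ ∷ Ys)) (≤-trans (s≤s (≤-reflexive #full)) enough) z)
    where
    enough : p < # Y + # (⨁ (Y′ ∷ Ys))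
    enough with vosper-chain Y′ Ys hs
    -- One element may be missing from the partial sumset, and a last summand with two elements
    -- makes up for it.
    ... | inj₁ h = ≤-trans (s≤s h) (+-monoˡ-≤ (# (⨁ (Y′ ∷ Ys))) Y≥2)
    ... | inj₂ h = ≤-trans big (+-monoʳ-≤ (# Y) h)

  interval-exclude : ∀ S a L n → S ⊆ interval a L → (∀ i → n ≤ i → i < L → S (a ⊞ em i) ≡ false) → L ≤ p → n ≤ p → S ⊆ interval a n
  interval-exclude S a L n sub out L≤p n≤p x ex with interval-elim {a} {L} {x} (sub x ex)
  ... | i , i<L , e with i <? n
  ...   | yes i<n = trans (cong (interval a n) e) (interval-intro {a} {n} {i} n≤p i<n)
  ...   | no  i≥n = ⊥-elim (true≢false (trans (cong S (sym e)) ex) (out i (≮⇒≥ i≥n) i<L))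

  interval-shift : ∀ S a L n → S ⊆ interval a (n + L) → (∀ i → i < n → S (a ⊞ em i) ≡ false) → L ≤ p → S ⊆ interval (a ⊞ em n) L
  interval-shift S a L n sub out L≤p x ex with interval-elim {a} {n + L} {x} (sub x ex)
  ... | i , i< , e with i <? n
  ...   | yes i<n = ⊥-elim (true≢false (trans (cong S (sym e)) ex) (out i i<n))
  ...   | no  i≥n = trans (cong (interval (a ⊞ em n) L) (trans e (trans (cong (λ j → a ⊞ em j) (sym (ℕₚ.m+[n∸m]≡n (≮⇒≥ i≥n))))
    (trans (cong (a ⊞_) (em-+ n (i ∸ n))) (sym (⊞-assoc a _ _))))))
                          (interval-intro {a ⊞ em n} {L} {i ∸ n} L≤p (+-cancelˡ-≤ n _ _
                            (≤-trans (≤-reflexive (trans (ℕₚ.+-suc n _) (cong suc (ℕₚ.m+[n∸m]≡n (≮⇒≥ i≥n))))) i<)))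

  two-elements : ∀ E e₁ e₂ → # E ≤ 2 → E e₁ ≡ true → E e₂ ≡ true → e₁ ≢ e₂ → ∀ x → E x ≡ true → (x ≡ e₁) ⊎ (x ≡ e₂)
  two-elements E e₁ e₂ h m₁ m₂ ne x ex with x ≟ e₁ | x ≟ e₂
  ... | yes e | _ = inj₁ e
  ... | no _ | yes e = inj₂ e
  ... | no n₁ | no n₂ = ⊥-elim (<⇒≱ (≤-trans three (card-mono sub)) h)
    where
    D₁ = λ y → δ y e₁
    D₂ = λ y → δ y e₂
    D₃ = λ y → δ y x
    disjoint : ∀ a b → a ≢ b → # ((λ y → δ y a) ∩ (λ y → δ y b)) ≡ 0
    disjoint a b ne = trans (card-cong λ y → ¬true⇒false λ e → ne (trans (sym (δ-≡ {y} {a} (proj₁ (∧-elim {δ y a} e))))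
      (δ-≡ {y} {b} (proj₂ (∧-elim {δ y a} e))))) (ℕΣ.∑-zero elems)
    u₂ : # (D₁ ∪ D₂) ≡ 2
    u₂ = trans (sym (ℕₚ.+-identityʳ _)) (trans (cong (_+_ (# (D₁ ∪ D₂))) (sym (disjoint e₁ e₂ ne)))
      (trans (card-∪∩ D₁ D₂) (cong₂ _+_ (card-singleton e₁) (card-singleton e₂))))
    i₃ : # ((D₁ ∪ D₂) ∩ D₃) ≡ 0
    i₃ = trans (card-cong λ y → ¬true⇒false λ e → no-both y (proj₁ (∧-elim {(D₁ ∪ D₂) y} e)) (δ-≡ {y} {x} (proj₂ (∧-elim {(D₁ ∪ D₂) y} e)))) (ℕΣ.∑-zero elems)
      where
      no-both : ∀ y → (D₁ ∪ D₂) y ≡ true → y ≡ x → ⊥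
      no-both y h refl with ∨-elim {δ y e₁} h
      ... | inj₁ e = n₁ (δ-≡ e)
      ... | inj₂ e = n₂ (δ-≡ e)
    three : 3 ≤ # ((D₁ ∪ D₂) ∪ D₃)
    three = ≤-reflexive (sym (trans (sym (ℕₚ.+-identityʳ _)) (trans (cong (_+_ (# ((D₁ ∪ D₂) ∪ D₃))) (sym i₃))
      (trans (card-∪∩ (D₁ ∪ D₂) D₃) (cong₂ _+_ u₂ (card-singleton x))))))
    sub : ((D₁ ∪ D₂) ∪ D₃) ⊆ E
    sub y h with ∨-elim {(D₁ ∪ D₂) y} h
    ... | inj₂ e = trans (cong E (δ-≡ {y} {x} e)) ex
    ... | inj₁ h′ with ∨-elim {δ y e₁} h′
    ... | inj₁ e = trans (cong E (δ-≡ {y} {e₁} e)) m₁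
    ... | inj₂ e = trans (cong E (δ-≡ {y} {e₂} e)) m₂

  -- The ends of the new interval belong to S, which is what the covering steps need.
  hull : ∀ S a L → S ⊆ interval a L → L ≤ p → Nonempty S →
         ∃[ b ] ∃[ H ] (H < L) × (S b ≡ true) × (S (b ⊞ em H) ≡ true) × (S ⊆ interval b (suc H))
  hull S a L sub L≤p (s₀ , es₀) = aux (least P L) (greatest P L)
    where
    P : ℕ → Bool
    P i = S (a ⊞ em i)
    Result = ∃[ b ] ∃[ H ] (H < L) × (S b ≡ true) × (S (b ⊞ em H) ≡ true) × (S ⊆ interval b (suc H))
    absurd : ¬ (∀ j → j < L → P j ≡ false)
    absurd none = let i , i< , e = interval-elim {a} {L} (sub s₀ es₀) in true≢false (trans (cong S (sym e)) es₀) (none i i<)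
    aux : (∃[ i ] (i < L) × (P i ≡ true) × (∀ j → j < i → P j ≡ false)) ⊎ (∀ j → j < L → P j ≡ false) →
          (∃[ i ] (i < L) × (P i ≡ true) × (∀ j → i < j → j < L → P j ≡ false)) ⊎ (∀ j → j < L → P j ≡ false) → Result
    aux (inj₂ none) _ = ⊥-elim (absurd none)
    aux (inj₁ _) (inj₂ none) = ⊥-elim (absurd none)
    aux (inj₁ (i₀ , i₀< , e₀ , below)) (inj₁ (i₁ , i₁< , e₁ , above)) =
      a ⊞ em i₀ , H , ≤-trans (s≤s (ℕₚ.m∸n≤m i₁ i₀)) i₁< , e₀ ,
      trans (cong S (trans (⊞-assoc a _ _) (cong (a ⊞_) (trans (sym (em-+ i₀ H)) (cong em H≡))))) e₁ ,
      interval-shift S a (suc H) i₀ (subst (λ n → S ⊆ interval a n) (sym (trans (ℕₚ.+-suc i₀ H) (cong suc H≡)))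
        (interval-exclude S a L (suc i₁) sub above L≤p (≤-trans i₁< L≤p))) below (≤-trans (s≤s (ℕₚ.m∸n≤m i₁ i₀)) (≤-trans i₁< L≤p))
      where
      H = i₁ ∸ i₀
      H≡ : i₀ + H ≡ i₁
      H≡ = ℕₚ.m+[n∸m]≡n (ℕₚ.≮⇒≥ λ lt → true≢false e₁ (below i₁ lt))

  interval-mono : ∀ {a L L′} → L ≤ L′ → interval a L ⊆ interval a L′
  interval-mono {a} {L} {L′} le x e = does-intro (toℕ (x ⊟ a) <? L′) (≤-trans (does-true (toℕ (x ⊟ a) <? L) e) le)

-- Sum-free sets of m elements on the line

signs : ℕ → ℕ → List Bool
signs k l = replicate k true ++ replicate l false

module _ (k l : ℕ) where

  -- The signs that remain when one + and one - (`rest±`) or two + (`rest₊`) are set aside for a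
  -- block from which the interval of sums is grown.
  rest± rest₊ : List Bool
  rest± = replicate (suc k) true ++ replicate l false
  rest₊ = replicate k true ++ replicate (suc l) false

  signs-± : rest± ++ (true ∷ false ∷ []) ↭ signs (2 + k) (suc l)
  signs-± = ↭-trans (↭ₚ.++-comm rest± (true ∷ false ∷ [])) (prep true (↭-sym (↭ₚ.shift false (replicate (suc k) true) (replicate l false))))

  signs-₊ : rest₊ ++ (true ∷ true ∷ []) ↭ signs (2 + k) (suc l)
  signs-₊ = ↭ₚ.++-comm rest₊ (true ∷ true ∷ [])

  length-± : length rest± ≡ suc k + l
  length-± = trans (Listₚ.length-++ (replicate (suc k) true)) (cong₂ _+_ (Listₚ.length-replicate (suc k)) (Listₚ.length-replicate l))

  length-₊ : length rest₊ ≡ k + suc l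
  length-₊ = trans (Listₚ.length-++ (replicate k true)) (cong₂ _+_ (Listₚ.length-replicate k) (Listₚ.length-replicate (suc l)))

-- k and l stand for k - 2 and ℓ - 1 of the theorem, lam for λ, and mu for
-- k + ℓ - 5 - λ.
record Parameters (p : ℕ) : Set where
  field
    k l lam mu m : ℕ
    l<k : suc l < 2 + k
    K≡  : 2 + k + suc l ≡ 5 + (lam + mu)
    p≡  : p ≡ (5 + (lam + mu)) * m + 2 + lam
    m≥  : 5 + (lam + mu) + lam + 4 ≤ m

  κ : ℕ
  κ = lam + mu

  m≥9 : 9 ≤ m
  m≥9 = ≤-trans (linear 9 (5 + κ + lam + 4) (κ + lam) (z≤n {0}) (lem κ lam)) m≥
    where
    lem : ∀ κ l → 9 + 0 + (κ + l) ≡ 5 + κ + l + 4 + 0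
    lem = solve-∀

  m+2≤p : 2 + m ≤ p
  m+2≤p = subst (2 + m ≤_) (sym p≡) (linear (2 + m) ((5 + κ) * m + 2 + lam) ((4 + κ) * m + lam) (z≤n {0}) (lem κ m lam))
    where
    lem : ∀ κ m l → 2 + m + 0 + ((4 + κ) * m + l) ≡ (5 + κ) * m + 2 + l + 0
    lem = solve-∀

  m₁ : ℕ
  m₁ = m ∸ 1

  m₁≡ : suc m₁ ≡ m
  m₁≡ = ℕₚ.m+[n∸m]≡n (≤-trans (s≤s z≤n) m≥9)

module SumFreeLine {p : ℕ} .{{_ : NonZero p}} (F : FieldOps p) (Π : Parameters p) where
  open Parameters Π
  open PrimeField F
  open PrimeLine F
  open Tuples F using (flip; card-flip)
  open LineStructure F
  open 𝔽-Solver using (solve; _:+_; _:*_; _:-_; :-_; _:=_; con)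

  Σs : List Bool
  Σs = signs (2 + k) (suc l)

  Free : (𝔽 → Bool) → Set
  Free S = ¬ SumOf (map (sg S) Σs) 𝟘

  ¬free : ∀ S → Free S → ∀ τs → τs ↭ Σs → ¬ SumOf (map (sg S) τs) 𝟘
  ¬free S fr τs π s = fr (SumOf-↭ (↭ₚ.map⁺ (sg S) π) s)

  scale-free : ∀ d S → Free S → Free (scale d S)
  scale-free d S fr s = fr (subst (SumOf (map (sg S) Σs)) (⊠-zeroʳ d) (scale-SumOf d S Σs 𝟘 s))

  -- Endpoints at distance H in every remaining position, on top of a block
  -- of length L + 1 in the positions + and -.
  ¬free-± : ∀ S {c L a H} → Free S → Cov (sg S true ∷ sg S false ∷ []) c L → S a ≡ true → S (a ⊞ em H) ≡ true → H ≤ suc L →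
            ¬ (p ≤ suc (L + (3 + κ) * H))
  ¬free-± S {c} {L} {a} {H} fr cov ea eH H≤ big = ¬free S fr (rest± k l ++ (true ∷ false ∷ [])) (signs-± k l)
    (subst (λ l → SumOf l 𝟘) (sym (Listₚ.map-++ (sg S) (rest± k l) (true ∷ false ∷ [])))
      (cov-all {L = L + length (rest± k l) * H} (≤-trans big (s≤s (+-monoʳ-≤ L (*-monoˡ-≤ H (≤-reflexive (sym len))))))
        (cov-signs S (rest± k l) ea eH H≤ cov) 𝟘))
    where
    len : length (rest± k l) ≡ 3 + κ
    len = trans (length-± k l) (ℕₚ.suc-injective (ℕₚ.suc-injective (trans (cong suc (cong suc (sym (ℕₚ.+-suc k l)))) K≡)))

  ¬free-₊ : ∀ S {c L a H} → Free S → Cov (sg S true ∷ sg S true ∷ []) c L → S a ≡ true → S (a ⊞ em H) ≡ true → H ≤ suc L →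
            ¬ (p ≤ suc (L + (3 + κ) * H))
  ¬free-₊ S {c} {L} {a} {H} fr cov ea eH H≤ big = ¬free S fr (rest₊ k l ++ (true ∷ true ∷ [])) (signs-₊ k l)
    (subst (λ l → SumOf l 𝟘) (sym (Listₚ.map-++ (sg S) (rest₊ k l) (true ∷ true ∷ [])))
      (cov-all {L = L + length (rest₊ k l) * H} (≤-trans big (s≤s (+-monoʳ-≤ L (*-monoˡ-≤ H (≤-reflexive (sym len))))))
        (cov-signs S (rest₊ k l) ea eH H≤ cov) 𝟘))
    where
    len : length (rest₊ k l) ≡ 3 + κ
    len = trans (length-₊ k l) (ℕₚ.suc-injective (ℕₚ.suc-injective K≡))

  module _ (S : 𝔽 → Bool) (S≡m : # S ≡ m) (fr : Free S) where

    private
      S≥2 : 2 ≤ # S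
      S≥2 = ≤-trans (≤-trans (s≤s (s≤s z≤n)) m≥9) (≤-reflexive (sym S≡m))
      Target = ∃[ d ] (d ≢ 𝟘) × ∃[ a ] (scale d S ⊆ interval a (suc m))

      -- Taking summands two at a time exploits |S ⊕ S| ≥ 2 m + 2 once per pair. An odd number of
      -- summands leaves one single set over.
      pairs : (𝔽 → Bool) → ℕ → List (𝔽 → Bool)
      pairs X zero          = []
      pairs X (suc zero)    = X ∷ []
      pairs X (suc (suc n)) = (X ⊕ X) ∷ pairs X n

      pairs-SumOf : ∀ X n Zs z → SumOf (pairs X n ++ Zs) z → SumOf (replicate n X ++ Zs) z
      pairs-SumOf X zero Zs z s = s
      pairs-SumOf X (suc zero) Zs z s = s
      pairs-SumOf X (suc (suc n)) Zs z (y , ey , s) = let x , ex , e = ⊕-elim X X ey in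
        x , ex , (y ⊟ x) , e , subst (SumOf (replicate n X ++ Zs)) (solve 3 (λ z x y → z :- y := z :- x :- (y :- x)) refl z x y) (pairs-SumOf X n Zs (z ⊟ y) s)

      SumOf-++-mono : ∀ Xs Ys Zs → (∀ z → SumOf Ys z → SumOf Zs z) → ∀ z → SumOf (Xs ++ Ys) z → SumOf (Xs ++ Zs) z
      SumOf-++-mono [] Ys Zs h z s = h z s
      SumOf-++-mono (X ∷ Xs) Ys Zs h z (x , ex , s) = x , ex , SumOf-++-mono Xs Ys Zs h (z ⊟ x) s

      pairs-total : ∀ X n → # X ≡ m → 2 * m + 2 ≤ # (X ⊕ X) → n * m + n ≤ total (pairs X n) + 1
      pairs-total X zero eX h = z≤n
      pairs-total X (suc zero) eX h = ≤-reflexive (trans (cong (_+ 1) (ℕₚ.+-identityʳ m)) (cong (_+ 1) (sym (trans (ℕₚ.+-identityʳ (# X)) eX))))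
      pairs-total X (suc (suc n)) eX h = linear ((2 + n) * m + (2 + n)) (# (X ⊕ X) + total (pairs X n) + 1) 0 (+-mono-≤ h (pairs-total X n eX h))
        (lem m n (# (X ⊕ X)) (total (pairs X n)))
        where
        lem : ∀ m n x t → (2 + n) * m + (2 + n) + (x + (t + 1)) + 0 ≡ x + t + 1 + (2 * m + 2 + (n * m + n))
        lem = solve-∀

      -- The paired summands have total size at least K m + K - 2, which exceeds p because K ≥ λ +
      -- 5, and by Vosper's theorem nothing of it is lost.
      doubling-not-near : ¬ Near S → 2 * m + 2 ≤ # (S ⊕ S) → ¬ Near (S ⊕ S) → ⊥
      doubling-not-near nn big nn₂ = fr (subst (λ L → SumOf L 𝟘) (sym unfold)
          (SumOf-++-mono (replicate (2 + k) S) (pairs S⁻ (suc l)) (replicate (suc l) S⁻)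
            (λ z s → subst (λ L → SumOf L z) (Listₚ.++-identityʳ _) (pairs-SumOf S⁻ (suc l) [] z (subst (λ L → SumOf L z) (sym (Listₚ.++-identityʳ _)) s))) 𝟘
            (pairs-SumOf S (2 + k) (pairs S⁻ (suc l)) 𝟘 full-sum)))
        where
        S⁻ = neg S
        S⁻≡m : # S⁻ ≡ m
        S⁻≡m = trans (card-neg S) S≡m
        unfold : map (sg S) Σs ≡ replicate (2 + k) S ++ replicate (suc l) S⁻
        unfold = trans (Listₚ.map-++ (sg S) (replicate (2 + k) true) (replicate (suc l) false))
          (cong₂ _++_ (Listₚ.map-replicate (sg S) (2 + k) true) (Listₚ.map-replicate (sg S) (suc l) false))
        neg-⊕ : ∀ z → (S⁻ ⊕ S⁻) z ≡ neg (S ⊕ S) z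
        neg-⊕ z = bool-ext
            (λ e → let x , ex , ey = ⊕-elim S⁻ S⁻ {z} e in trans (cong (S ⊕ S) (solve 2 (λ z x → :- z := :- x :+ (:- (z :- x))) refl z x)) (⊕-intro S S ex ey))
            (λ e → let x , ex , ey = ⊕-elim S S {⊖ z} e in ⊕-intro′ S⁻ S⁻ {⊖ x} {z} (trans (cong S (⊖-involutive x)) ex) (trans (cong S (solve 2 (λ z x → :- (z :- (:- x)) := :- z :- x) refl z x)) ey))
        card⁻ : # (S⁻ ⊕ S⁻) ≡ # (S ⊕ S)
        card⁻ = trans (card-cong neg-⊕) (card-neg (S ⊕ S))
        near⁻ : Near (S⁻ ⊕ S⁻) → Near (S ⊕ S)
        near⁻ (d , d≢0 , le) = neg-near (S ⊕ S) (d , d≢0 , ≤-trans (≤-reflexive (card-cong λ x → cong₂ _∨_ (sym (neg-⊕ x)) (sym (neg-⊕ (x ⊟ d)))))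
          (≤-trans le (≤-reflexive (cong suc (card-cong neg-⊕)))))
        SS≥2 : 2 ≤ # (S ⊕ S)
        SS≥2 = ≤-trans (m≤n+m 2 (2 * m)) big
        Good : (𝔽 → Bool) → Set
        Good Y = (2 ≤ # Y) × ¬ Near Y
        goodPairs : ∀ X n → Good X → Good (X ⊕ X) → All Good (pairs X n)
        goodPairs X zero g₁ g₂ = []
        goodPairs X (suc zero) g₁ g₂ = g₁ ∷ []
        goodPairs X (suc (suc n)) g₁ g₂ = g₂ ∷ goodPairs X n g₁ g₂
        allGood : All Good (pairs S (2 + k) ++ pairs S⁻ (suc l))
        allGood = Allₚ.++⁺ (goodPairs S (2 + k) (S≥2 , nn) (SS≥2 , nn₂))
          (goodPairs S⁻ (suc l) (≤-trans S≥2 (≤-reflexive (sym (card-neg S))) , nn ∘ neg-near S) (≤-trans SS≥2 (≤-reflexive (sym card⁻)) , nn₂ ∘ near⁻))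
        total-++ : ∀ Xs Ys → total (Xs ++ Ys) ≡ total Xs + total Ys
        total-++ []       Ys = refl
        total-++ (X ∷ Xs) Ys = trans (cong (_+_ (# X)) (total-++ Xs Ys)) (sym (ℕₚ.+-assoc (# X) _ _))
        large : p < total (pairs S (2 + k) ++ pairs S⁻ (suc l))
        large = ≤-trans (linear (suc p) (total (pairs S (2 + k)) + total (pairs S⁻ (suc l))) mu
            (+-mono-≤ (pairs-total S (2 + k) S≡m big) (+-mono-≤ (pairs-total S⁻ (suc l) S⁻≡m (≤-trans big (≤-reflexive (sym card⁻)))) (≤-reflexive p≡)))
            (trans (lem₁ p (total (pairs S (2 + k))) (total (pairs S⁻ (suc l))) lam mu m)
              (trans (cong (λ K → K * m + K + (total (pairs S (2 + k)) + total (pairs S⁻ (suc l))) + p) (sym K≡))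
              (lem₂ k l m (total (pairs S (2 + k))) (total (pairs S⁻ (suc l))) p))))
            (≤-reflexive (sym (total-++ (pairs S (2 + k)) (pairs S⁻ (suc l)))))
          where
          lem₁ : ∀ p t u l v m → suc p + (t + 1 + (u + 1 + ((5 + (l + v)) * m + 2 + l))) + v ≡ (5 + (l + v)) * m + (5 + (l + v)) + (t + u) + p
          lem₁ = solve-∀
          lem₂ : ∀ k l m t u p → (2 + k + suc l) * m + (2 + k + suc l) + (t + u) + p ≡ t + u + ((2 + k) * m + (2 + k) + ((suc l) * m + (suc l) + p))
          lem₂ = solve-∀
        full-sum : SumOf (pairs S (2 + k) ++ pairs S⁻ (suc l)) 𝟘
        full-sum = vosper-full (pairs S (2 + k) ++ pairs S⁻ (suc l)) allGood large 𝟘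

      -- If 2S is an interval then S lies in one too, and its two extreme
      -- elements H ≥ m + 1 apart extend 2S to everything.
      doubling-near : 2 * m + 2 ≤ # (S ⊕ S) → Near (S ⊕ S) → # (S ⊕ S) < p → Target
      doubling-near big near SS<p =
        let d , d≢0 , c , isI = near-interval (S ⊕ S) near (≤-trans (≤-trans (s≤s z≤n) (m≤n+m 2 (2 * m))) big) SS<p
            s₀ , es₀ = card-witness (scale d S) (≤-trans (≤-trans (s≤s z≤n) S≥2) (≤-reflexive (sym (scale-card d S d≢0))))
        in extend d d≢0 c (# (S ⊕ S)) isI (<⇒≤ SS<p) big s₀ es₀
        where
        extend : ∀ d → d ≢ 𝟘 → ∀ c L → (∀ x → scale d (S ⊕ S) x ≡ interval c L x) → L ≤ p → 2 * m + 2 ≤ L → ∀ s₀ → scale d S s₀ ≡ true → Target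
        extend d d≢0 c zero isI L≤p L≥ s₀ es₀ = ⊥-elim (<⇒≱ (≤-trans (s≤s z≤n) (m≤n+m 2 (2 * m))) L≥)
        extend d d≢0 c (suc L₁) isI L≤p L≥ s₀ es₀ =
          let b , H , H< , eb , eH , sub = hull S′ (c ⊟ s₀) L S′⊆ L≤p (s₀ , es₀) in decide b H H< eb eH sub (H ≤? m)
          where
          L = suc L₁
          S′ = scale d S
          S′⊆ : S′ ⊆ interval (c ⊟ s₀) L
          S′⊆ x ex = trans (cong (λ u → does (toℕ u <? L)) (solve 3 (λ x c s → x :- (c :- s) := x :+ s :- c) refl x c s₀))
            (trans (sym (isI (x ⊞ s₀))) (trans (cong (S ⊕ S) (⊠-distribˡ d x s₀)) (⊕-intro S S ex es₀)))
          cov : Cov (sg S′ true ∷ sg S′ true ∷ []) c L₁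
          cov i i≤ = let d⁻ , e₁ , _ = unscale d d≢0
                         y , ey , e = ⊕-elim S S (trans (isI (c ⊞ em i)) (interval-intro {c} {L} {i} L≤p (s≤s i≤)))
                     in d⁻ ⊠ y , trans (cong S (e₁ y)) ey , (c ⊞ em i ⊟ d⁻ ⊠ y) ,
                        trans (cong S (trans (solve 3 (λ d z w → d :* (z :- w) := d :* z :- d :* w) refl d (c ⊞ em i) (d⁻ ⊠ y))
                          (cong (d ⊠ (c ⊞ em i) ⊟_) (e₁ y)))) e ,
                        -ᵛ-inverseʳ _
          decide : ∀ b H → H < L → S′ b ≡ true → S′ (b ⊞ em H) ≡ true → S′ ⊆ interval b (suc H) → Dec (H ≤ m) → Target
          decide b H H< eb eH sub (yes H≤m) = d , d≢0 , b , λ x ex → interval-mono {b} (s≤s H≤m) x (sub x ex)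
          decide b H H< eb eH sub (no H>m) = ⊥-elim (¬free-₊ S′ (scale-free d S fr) cov eb eH (<⇒≤ H<) enough)
            where
            lem : ∀ l u m L H → (5 + (l + u)) * m + 2 + l + (L + (3 + (l + u)) * H) + (3 + u) ≡ L + (3 + (l + u)) * H + (2 * m + 2 + (3 + (l + u)) * suc m)
            lem = solve-∀
            enough : p ≤ suc (L₁ + (3 + κ) * H)
            enough = subst (_≤ suc (L₁ + (3 + κ) * H)) (sym p≡) (linear ((5 + κ) * m + 2 + lam) (L + (3 + κ) * H) (3 + mu)
              (+-mono-≤ L≥ (*-monoʳ-≤ (3 + κ) (≰⇒> H>m))) (lem lam mu m L H))

      -- S misses two places of an interval of m + 2. If both ends belong to S, all differences up
      -- to m - 1 occur, and with ends m + 1 apart in the other K - 2 positions there are 2 (m - 1)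
      -- + 1 + (K - 2) (m + 1) = K m + K - 3 consecutive sums. This is at least p since λ ≤ K - 5.
      small-doubling : ∀ a d → (∀ x → S x ≡ true → ∃[ i ] (i < 2 + m) × (x ≡ a ⊞ em i ⊠ d)) → Target
      small-doubling a d cover = result
        where
        d≢0 : d ≢ 𝟘
        d≢0 d≡0 = <⇒≱ S≥2 (card-≤1 S λ x y ex ey → trans (at x ex) (sym (at y ey)))
          where
          at : ∀ x → S x ≡ true → x ≡ a
          at x ex = let i , _ , e = cover x ex in trans e (trans (cong (λ u → a ⊞ em i ⊠ u) d≡0) (trans (cong (a ⊞_) (⊠-zeroʳ (em i))) (⊞-identityʳ a)))
        d⁻ = proj₁ (unscale d d≢0)
        S′ = scale d S
        a′ = d⁻ ⊠ a
        S′⊆ : S′ ⊆ interval a′ (2 + m)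
        S′⊆ z ez = let i , i< , e = cover (d ⊠ z) ez in
          trans (cong (interval a′ (2 + m)) (trans (sym (proj₂ (proj₂ (unscale d d≢0)) z)) (trans (cong (d⁻ ⊠_) e)
             (trans (solve 4 (λ w a i d → w :* (a :+ i :* d) := w :* a :+ w :* (d :* i)) refl d⁻ a (em i) d)
               (cong (a′ ⊞_) (proj₂ (proj₂ (unscale d d≢0)) (em i)))))))
            (interval-intro {a′} {2 + m} {i} m+2≤p i<)
        S′≡m : # S′ ≡ m
        S′≡m = trans (scale-card d S d≢0) S≡m
        I = interval a′ (2 + m)
        E = I ∖ S′
        P = λ i → S′ (a′ ⊞ em i)
        E≡2 : # E ≡ 2
        E≡2 = ℕₚ.+-cancelʳ-≡ m (# E) 2 (trans (cong (_+_ (# E)) (sym I∩S′)) (trans (card-∖ I S′) (interval-card a′ (2 + m) m+2≤p)))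
          where
          I∩S′ : # (I ∩ S′) ≡ m
          I∩S′ = trans (card-cong λ x → ∩-sub x (S′ x) refl) S′≡m
            where
            ∩-sub : ∀ x b → S′ x ≡ b → I x ∧ b ≡ b
            ∩-sub x true  e = ∧-intro (S′⊆ x e) refl
            ∩-sub x false e = ∧-zeroʳ (I x)
        holes : ∀ x₁ x₂ → E x₁ ≡ true → E x₂ ≡ true → x₁ ≢ x₂ → P 0 ≡ true → P (suc m) ≡ true → ⊥
        holes x₁ x₂ m₁ m₂ x₁≢x₂ e₀ e₁ = ¬free-± S′ (scale-free d S fr) (cov-difference S′ (m ∸ 1) diff) (trans (cong S′ (sym (⊞-identityʳ a′))) e₀) e₁ H≤ enough
          where
          u = toℕ (x₁ ⊟ a′)
          v = toℕ (x₂ ⊟ a′)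
          idx : ∀ i → i ≤ suc m → toℕ (a′ ⊞ em i ⊟ a′) ≡ i
          idx i i≤ = trans (cong toℕ (add-sub′ a′ (em i))) (toℕ-em-< (≤-trans (s≤s i≤) m+2≤p))
          ok : ∀ i → i ≤ suc m → i ≢ u → i ≢ v → P i ≡ true
          ok i i≤ i≢u i≢v = case (bool-cases (P i))
            where
            clash : (a′ ⊞ em i ≡ x₁) ⊎ (a′ ⊞ em i ≡ x₂) → ⊥
            clash (inj₁ e) = i≢u (trans (sym (idx i i≤)) (cong (λ x → toℕ (x ⊟ a′)) e))
            clash (inj₂ e) = i≢v (trans (sym (idx i i≤)) (cong (λ x → toℕ (x ⊟ a′)) e))
            case : (P i ≡ true) ⊎ (P i ≡ false) → P i ≡ true
            case (inj₁ e) = e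
            case (inj₂ e) = ⊥-elim (clash (two-elements E x₁ x₂ (≤-reflexive E≡2) m₁ m₂ x₁≢x₂ (a′ ⊞ em i)
              (∧-intro (interval-intro {a′} {2 + m} {i} m+2≤p (s≤s i≤)) (cong not e))))
          diff : ∀ D → D ≤ m ∸ 1 → ∃[ x ] (S′ x ≡ true) × (S′ (x ⊞ em D) ≡ true)
          diff D D≤ = let x , ex , ey = difference₂ P (suc m) u v (≤-trans m≥9 (n≤1+n m)) e₀ e₁ ok D (s≤s (≤-trans (s≤s D≤) (≤-reflexive m₁≡)))
                      in a′ ⊞ em x , ex , trans (cong S′ (trans (⊞-assoc a′ _ _) (cong (a′ ⊞_) (sym (em-+ x D))))) ey
          H≤ : suc m ≤ suc (m ∸ 1 + (m ∸ 1))
          H≤ = s≤s (≤-trans (≤-reflexive (sym m₁≡)) (≤-trans (≤-reflexive (ℕₚ.+-comm 1 (m ∸ 1)))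
            (+-monoʳ-≤ (m ∸ 1) (≤-trans (s≤s z≤n) (ℕₚ.≤-pred (≤-trans m≥9 (≤-reflexive (sym m₁≡))))))))
          enough : p ≤ suc (m ∸ 1 + (m ∸ 1) + (3 + κ) * suc m)
          enough = subst₂ (λ q n → q ≤ suc (m ∸ 1 + (m ∸ 1) + (3 + κ) * suc n)) (sym (trans p≡ (cong (λ n → (5 + κ) * n + 2 + lam) (sym m₁≡)))) m₁≡
              (linear ((5 + κ) * suc (m ∸ 1) + 2 + lam) (suc (m ∸ 1 + (m ∸ 1) + (3 + κ) * suc (suc (m ∸ 1)))) mu (z≤n {0}) (lem lam mu (m ∸ 1)))
            where
            lem : ∀ l u n → (5 + (l + u)) * suc n + 2 + l + 0 + u ≡ suc (n + n + (3 + (l + u)) * suc (suc n)) + 0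
            lem = solve-∀

        result : Target
        result = aux (bool-cases (P 0)) (bool-cases (P (suc m)))
          where
          aux : (P 0 ≡ true) ⊎ (P 0 ≡ false) → (P (suc m) ≡ true) ⊎ (P (suc m) ≡ false) → Target
          aux (inj₂ e₀) _ = d , d≢0 , a′ ⊞ em 1 , interval-shift S′ a′ (suc m) 1 S′⊆ (λ { zero _ → e₀ ; (suc i) (s≤s ()) }) (<⇒≤ m+2≤p)
          aux (inj₁ _) (inj₂ e₁) = d , d≢0 , a′ , interval-exclude S′ a′ (2 + m) (suc m) S′⊆
            (λ i m<i i< → trans (cong P (ℕₚ.≤-antisym (ℕₚ.≤-pred i<) m<i)) e₁) m+2≤p (<⇒≤ m+2≤p)
          aux (inj₁ e₀) (inj₁ e₁) = let x₁ , m₁ = card-witness E (≤-trans (s≤s z≤n) (≤-reflexive (sym E≡2)))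
                                        x₂ , m₂ , ne = second E {x₁} (≤-reflexive (sym E≡2))
                                    in ⊥-elim (holes x₁ x₂ m₁ m₂ (λ e → ne (sym e)) e₀ e₁)

    progression : (# (S ⊕ S) ≤ 2 * m + 1 → ∃[ a ] ∃[ d ] (∀ x → S x ≡ true → ∃[ i ] (i < # (S ⊕ S) ∸ # S + 1) × (x ≡ a ⊞ em i ⊠ d))) → Target
    progression cover = aux (near? S) (# (S ⊕ S) ≤? 2 * m + 1) (near? (S ⊕ S)) (# (S ⊕ S) <? p)
      where
      full₂ : ¬ (# (S ⊕ S) < p) → ∀ z → SumOf (S ∷ S ∷ []) z
      full₂ ge z = let x , ex , ey = ⊕-elim S S (⊆-full (S ⊕ S) (≤-trans (≤-reflexive #full) (≮⇒≥ ge)) z) in x , ex , (z ⊟ x) , ey , -ᵛ-inverseʳ _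
      nonempty : All Nonempty (map (sg S) (rest₊ k l))
      nonempty = Allₚ.map⁺ (All.universal (λ σ → card-witness (sg S σ) (≤-trans (≤-trans (s≤s z≤n) S≥2) (≤-reflexive (sym (card-flip σ S))))) (rest₊ k l))
      bound : # (S ⊕ S) ≤ 2 * m + 1 → # (S ⊕ S) ∸ # S + 1 ≤ 2 + m
      bound small = ≤-trans (+-monoˡ-≤ 1 (ℕₚ.m≤n+o⇒m∸n≤o (# (S ⊕ S)) (# S)
        (≤-trans small (≤-trans (≤-reflexive (lem m)) (≤-reflexive (cong (_+ (m + 1)) (sym S≡m))))))) (≤-reflexive (lem′ m))
        where
        lem : ∀ m → 2 * m + 1 ≡ m + (m + 1)
        lem = solve-∀
        lem′ : ∀ m → m + 1 + 1 ≡ 2 + m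
        lem′ = solve-∀
      2m+2≤ : ¬ (# (S ⊕ S) ≤ 2 * m + 1) → 2 * m + 2 ≤ # (S ⊕ S)
      2m+2≤ large = ≤-trans (≤-reflexive (ℕₚ.+-suc (2 * m) 1)) (≰⇒> large)
      aux : Near S ⊎ ¬ Near S → Dec (# (S ⊕ S) ≤ 2 * m + 1) → Near (S ⊕ S) ⊎ ¬ Near (S ⊕ S) → Dec (# (S ⊕ S) < p) → Target
      aux (inj₁ near) _ _ _ = let d , d≢0 , a , h = near-interval S near (≤-trans (s≤s z≤n) S≥2) (≤-trans (s≤s (≤-reflexive S≡m)) (≤-trans (n≤1+n _) m+2≤p))
                      in d , d≢0 , a , λ x ex → does-intro (_ <? suc m) (≤-trans (does-true (_ <? # S) (trans (sym (h x)) ex)) (≤-trans (≤-reflexive S≡m) (n≤1+n m)))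
      aux (inj₂ _) (yes small) _ _ = let a , d , h = cover small in small-doubling a d λ x ex → let i , i< , e = h x ex in i , ≤-trans i< (bound small) , e
      aux (inj₂ nn) (no large) (inj₂ nn₂) _ = ⊥-elim (doubling-not-near nn (2m+2≤ large) nn₂)
      aux (inj₂ _) (no large) (inj₁ near) (yes lt) = doubling-near (2m+2≤ large) near lt
      aux (inj₂ _) (no _) (inj₁ _) (no ge) = ⊥-elim (¬free S fr (true ∷ true ∷ rest₊ k l) ↭-refl
        (SumOf-full-++ (S ∷ S ∷ []) (map (sg S) (rest₊ k l)) (full₂ ge) nonempty 𝟘))

-- Slice sizes as weights on the line

module WeightClassification {p : ℕ} .{{_ : NonZero p}} (F : FieldOps p) (Π : Parameters p)
                   (N : ℕ) (N≥1 : 1 ≤ N) (N-odd : ∀ x → x + x ≢ N) where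
  open Parameters Π
  open PrimeField F
  open PrimeLine F
  open Tuples F using (flip; card-flip; IdxSum)
  open LineStructure F
  open SumFreeLine F Π
  open 𝔽-Solver using (solve; _:+_; _:*_; _:-_; :-_; _:=_; con)
  open ℕΣ using (∑; 𝟙)

  supp : (𝔽 → ℕ) → 𝔽 → Bool
  supp w i = does (1 ≤? w i)

  Covers : Set
  Covers = ∀ S → # S ≡ m → # (S ⊕ S) ≤ 2 * m + 1 → ∃[ a ] ∃[ d ] (∀ x → S x ≡ true → ∃[ i ] (i < # (S ⊕ S) ∸ # S + 1) × (x ≡ a ⊞ em i ⊠ d))

  -- What the analysis on the line keeps of A: its slice sizes, and sum-freeness in a form that can
  -- be read off from them.
  record Weighted (w : 𝔽 → ℕ) : Set where
    field
      w≤N  : ∀ i → w i ≤ N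
      mass : m * N ≤ ∑ elems w
      few  : # (supp w) ≤ suc m
      -- two slices whose sizes add up to more than N have full sumset
      pair : ∀ σ₁ i₁ σ₂ i₂ ps → (σ₁ ∷ σ₂ ∷ map proj₁ ps) ↭ Σs → N < w (flip σ₁ i₁) + w (flip σ₂ i₂) →
             All (λ z → 1 ≤ w (flip (proj₁ z) (proj₂ z))) ps → ¬ IdxSum ((σ₁ , i₁) ∷ (σ₂ , i₂) ∷ ps) 𝟘

  flip-⊠ : ∀ d σ i → flip σ (d ⊠ i) ≡ d ⊠ flip σ i
  flip-⊠ d true  i = refl
  flip-⊠ d false i = solve 2 (λ d x → :- (d :* x) := d :* (:- x)) refl d i

  rescale : ∀ {w} d → d ≢ 𝟘 → Weighted w → Weighted (λ i → w (d ⊠ i))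
  rescale {w} d d≢0 W = record
    { w≤N = λ i → w≤N (d ⊠ i)
    ; mass = ≤-trans mass (≤-reflexive (sym (∑-bijection (d ⊠_) (d⁻ ⊠_) e₁ e₂ w)))
    ; few = ≤-trans (≤-reflexive (scale-card d (supp w) d≢0)) few
    ; pair = λ σ₁ i₁ σ₂ i₂ ps π big pos s → pair σ₁ (d ⊠ i₁) σ₂ (d ⊠ i₂) (map (λ z → proj₁ z , d ⊠ proj₂ z) ps)
        (subst (λ L → (σ₁ ∷ σ₂ ∷ L) ↭ Σs) (trans (Listₚ.map-cong (λ _ → refl) ps) (Listₚ.map-∘ ps)) π)
        (subst₂ (λ u v → N < w u + w v) (sym (flip-⊠ d σ₁ i₁)) (sym (flip-⊠ d σ₂ i₂)) big)
        (Allₚ.map⁺ (All.map (λ {z} → subst (λ u → 1 ≤ w u) (sym (flip-⊠ d (proj₁ z) (proj₂ z)))) pos))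
        (subst (λ z → IdxSum (map (λ z → proj₁ z , d ⊠ proj₂ z) ((σ₁ , i₁) ∷ (σ₂ , i₂) ∷ ps)) z) (⊠-zeroʳ d) (scale-Idx ((σ₁ , i₁) ∷ (σ₂ , i₂) ∷ ps) 𝟘 s))
    }
    where
    open Weighted W
    d⁻ = proj₁ (unscale d d≢0)
    e₁ = proj₁ (proj₂ (unscale d d≢0))
    e₂ = proj₂ (proj₂ (unscale d d≢0))
    scale-Idx : ∀ ps z → IdxSum ps z → IdxSum (map (λ z → proj₁ z , d ⊠ proj₂ z) ps) (d ⊠ z)
    scale-Idx [] z e = trans (cong (d ⊠_) e) (⊠-zeroʳ d)
    scale-Idx ((σ , i) ∷ ps) z s = subst (IdxSum (map (λ z → proj₁ z , d ⊠ proj₂ z) ps))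
      (solve 3 (λ d z x → d :* (z :- x) := d :* z :- d :* x) refl d z i) (scale-Idx ps (z ⊟ i) s)

  ∑-≥₂ : ∀ (f : 𝔽 → ℕ) a b → a ≢ b → f a + f b ≤ ∑ elems f
  ∑-≥₂ f a b a≢b = ≤-trans (≤-reflexive (sym (trans (∑-+′ _ _) (cong₂ _+_ (∑-δ a f) (∑-δ b f))))) (∑-mono elems λ x → aux x (x ≟ a) (x ≟ b))
    where
    ∑-+′ = ℕΣ.∑-+ elems
    aux : ∀ x (d : Dec (x ≡ a)) (d′ : Dec (x ≡ b)) → 𝟙 (does d) * f x + 𝟙 (does d′) * f x ≤ f x
    aux x (yes e) (yes e′) = ⊥-elim (a≢b (trans (sym e) e′))
    aux x (yes _) (no _) = ≤-reflexive (trans (ℕₚ.+-identityʳ _) (ℕₚ.*-identityˡ (f x)))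
    aux x (no _) (yes _) = ≤-reflexive (ℕₚ.*-identityˡ (f x))
    aux x (no _) (no _) = z≤n

  ∑-≥₃ : ∀ (f : 𝔽 → ℕ) a b c → a ≢ b → a ≢ c → b ≢ c → f a + (f b + f c) ≤ ∑ elems f
  ∑-≥₃ f a b c a≢b a≢c b≢c = ≤-trans (≤-reflexive (sym (trans (∑-+′ _ _) (cong₂ _+_ (∑-δ a f) (trans (∑-+′ _ _) (cong₂ _+_ (∑-δ b f) (∑-δ c f)))))))
    (∑-mono elems λ x → aux x (x ≟ a) (x ≟ b) (x ≟ c))
    where
    ∑-+′ = ℕΣ.∑-+ elems
    aux : ∀ x (d : Dec (x ≡ a)) (d′ : Dec (x ≡ b)) (d″ : Dec (x ≡ c)) → 𝟙 (does d) * f x + (𝟙 (does d′) * f x + 𝟙 (does d″) * f x) ≤ f x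
    aux x (yes e) (yes e′) _ = ⊥-elim (a≢b (trans (sym e) e′))
    aux x (yes e) _ (yes e′) = ⊥-elim (a≢c (trans (sym e) e′))
    aux x _ (yes e) (yes e′) = ⊥-elim (b≢c (trans (sym e) e′))
    aux x (yes _) (no _) (no _) = ≤-reflexive (trans (ℕₚ.+-identityʳ _) (ℕₚ.*-identityˡ (f x)))
    aux x (no _) (yes _) (no _) = ≤-reflexive (trans (ℕₚ.+-identityʳ _) (ℕₚ.*-identityˡ (f x)))
    aux x (no _) (no _) (yes _) = ≤-reflexive (ℕₚ.*-identityˡ (f x))
    aux x (no _) (no _) (no _) = z≤n

  module Analysis (w : 𝔽 → ℕ) (W : Weighted w) where
    open Weighted W

    S : 𝔽 → Bool
    S = supp w

    S⇒1≤ : ∀ {i} → S i ≡ true → 1 ≤ w i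
    S⇒1≤ {i} = does-true (1 ≤? w i)

    Heavy : (𝔽 → Bool) → Set
    Heavy S′ = (S′ ⊆ S) × (∀ i j → S′ i ≡ true → S′ j ≡ true → N < w i + w j)

    ¬pair : ∀ S′ → Heavy S′ → ∀ σ₁ σ₂ τs → (σ₁ ∷ σ₂ ∷ τs) ↭ Σs → ¬ SumOf (sg S′ σ₁ ∷ sg S′ σ₂ ∷ map (sg S) τs) 𝟘
    ¬pair S′ (_ , heavy) σ₁ σ₂ τs π (i₁ , e₁ , i₂ , e₂ , s) =
      let ps , sgn , pos , is = go τs _ s
      in pair σ₁ i₁ σ₂ i₂ ps (subst (λ L → (σ₁ ∷ σ₂ ∷ L) ↭ Σs) (sym sgn) π) (heavy _ _ e₁ e₂) pos is
      where
      go : ∀ τs z → SumOf (map (sg S) τs) z → ∃[ ps ] (map proj₁ ps ≡ τs) × All (λ z → 1 ≤ w (flip (proj₁ z) (proj₂ z))) ps × IdxSum ps z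
      go [] z e = [] , refl , [] , e
      go (τ ∷ τs) z (i , ei , s) = let ps , e , pos , is = go τs (z ⊟ i) s in (τ , i) ∷ ps , cong (τ ∷_) e , S⇒1≤ ei ∷ pos , is

    ¬pair-± : ∀ S′ → Heavy S′ → ¬ SumOf (map (sg S) (rest± k l) ++ (sg S′ true ∷ sg S′ false ∷ [])) 𝟘
    ¬pair-± S′ hv s = ¬pair S′ hv true false (rest± k l) (↭-trans (↭ₚ.++-comm (true ∷ false ∷ []) (rest± k l)) (signs-± k l))
      (SumOf-↭ (↭ₚ.++-comm (map (sg S) (rest± k l)) (sg S′ true ∷ sg S′ false ∷ [])) s)

    SumOf-mono : ∀ {A B : 𝔽 → Bool} → A ⊆ B → ∀ τs Xs z → SumOf (map (sg A) τs ++ Xs) z → SumOf (map (sg B) τs ++ Xs) z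
    SumOf-mono h [] Xs z s = s
    SumOf-mono h (τ ∷ τs) Xs z (x , ex , s) = x , h _ ex , SumOf-mono h τs Xs (z ⊟ x) s

    heavy-free : ∀ S′ → Heavy S′ → Free S′
    heavy-free S′ hv@(sub , _) s = ¬pair S′ hv true true (rest₊ k l) ↭-refl
      (let x , ex , y , ey , s′ = s in x , ex , y , ey , subst (λ L → SumOf L _) (Listₚ.++-identityʳ _) (SumOf-mono sub (rest₊ k l) [] _ (subst (λ L → SumOf L _) (sym (Listₚ.++-identityʳ _)) s′)))

    Kind : (𝔽 → Bool) → Set
    Kind S′ = ((∀ x → S x ≡ S′ x) × (∀ x → S x ≡ true → w x ≡ N)) ⊎ (∃[ i₀ ] (S i₀ ≡ true) × (S′ i₀ ≡ false) × (∀ x → S x ≡ true → (S′ x ≡ true) ⊎ (x ≡ i₀)))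

    private
      deficit : 𝔽 → ℕ
      deficit i = 𝟙 (S i) * (N ∸ w i)

      deficit-sum : ∑ elems deficit + ∑ elems w ≡ # S * N
      deficit-sum = trans (sym (ℕΣ.∑-+ elems deficit w)) (trans (ℕΣ.∑-cong elems (λ i → aux i (1 ≤? w i))) (ℕΣ.∑-*ʳ elems N (λ i → 𝟙 (S i))))
        where
        aux : ∀ i (d : Dec (1 ≤ w i)) → 𝟙 (does d) * (N ∸ w i) + w i ≡ 𝟙 (does d) * N
        aux i (yes _) = trans (cong (_+ w i) (ℕₚ.*-identityˡ _)) (trans (ℕₚ.m∸n+n≡m (w≤N i)) (sym (ℕₚ.*-identityˡ N)))
        aux i (no n) = ℕₚ.n<1⇒n≡0 (≰⇒> n)

      deficit-S : ∀ {i} → S i ≡ true → deficit i ≡ N ∸ w i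
      deficit-S {i} e = trans (cong (λ b → 𝟙 b * (N ∸ w i)) e) (ℕₚ.*-identityˡ _)

      mN≤ : m * N ≤ # S * N
      mN≤ = ≤-trans mass (≤-trans (m≤n+m _ (∑ elems deficit)) (≤-reflexive deficit-sum))

      m≤s : m ≤ # S
      m≤s = ℕₚ.*-cancelʳ-≤ m (# S) N {{>-nonZero N≥1}} mN≤

      1≤s : 1 ≤ # S
      1≤s = ≤-trans (≤-trans (s≤s z≤n) m≥) m≤s

      core-equal : # S ≡ m → ∃[ S′ ] (# S′ ≡ m) × Heavy S′ × Kind S′
      core-equal e = S , e , ((λ _ h → h) , λ i j hi hj → subst₂ (λ u v → N < u + v) (sym (full-weight i hi)) (sym (full-weight j hj))
        (≤-trans (≤-reflexive (ℕₚ.+-comm 1 N)) (+-monoʳ-≤ N N≥1))) ,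
          inj₁ ((λ _ → refl) , full-weight)
        where
        zero-deficit : ∑ elems deficit ≡ 0
        zero-deficit = ℕₚ.n≤0⇒n≡0 (+-cancelʳ-≤ (∑ elems w) _ 0 (≤-trans (≤-reflexive (trans deficit-sum (cong (_* N) e))) mass))
        full-weight : ∀ x → S x ≡ true → w x ≡ N
        full-weight x ex = ℕₚ.≤-antisym (w≤N x) (ℕₚ.m∸n≡0⇒m≤n (trans (sym (deficit-S ex))
          (ℕₚ.n≤0⇒n≡0 (≤-trans (≤-trans (≤-reflexive (sym (∑-δ x deficit)))
          (∑-mono elems λ y → ≤-trans (*-monoˡ-≤ (deficit y) (ind≤1 (δ y x))) (≤-reflexive (ℕₚ.*-identityˡ (deficit y))))) (≤-reflexive zero-deficit)))))
          where
          ind≤1 : ∀ b → 𝟙 b ≤ 1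
          ind≤1 true  = ≤-refl
          ind≤1 false = z≤n

      -- The deficits N - w over the m + 1 indices add up to at most N, and an index of largest
      -- deficit is dropped. If w(i) + w(j) ≤ N for two other indices, their deficits use up all of
      -- N, so the dropped index has deficit 0, and then so have i and j. For i = j the deficit
      -- would be exactly N / 2, but N is odd.
      core-extra : # S ≡ suc m → ∃[ S′ ] (# S′ ≡ m) × Heavy S′ × Kind S′
      core-extra e = build (argmax (Fin-finite p) f (suc N) f≤ 𝟘)
        where
        f : 𝔽 → ℕ
        -- The successor keeps indices outside the support, where f is 0, from being chosen when
        -- every deficit vanishes.
        f i = 𝟙 (S i) * suc (N ∸ w i)
        f≤ : ∀ i → f i ≤ suc N
        f≤ i = ≤-trans (aux (S i)) (s≤s (ℕₚ.m∸n≤m N (w i)))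
          where
          aux : ∀ b → 𝟙 b * suc (N ∸ w i) ≤ suc (N ∸ w i)
          aux true  = ≤-reflexive (ℕₚ.*-identityˡ _)
          aux false = z≤n
        f-S : ∀ {i} → S i ≡ true → f i ≡ suc (N ∸ w i)
        f-S {i} h = trans (cong (λ b → 𝟙 b * suc (N ∸ w i)) h) (ℕₚ.*-identityˡ _)
        total-deficit : ∑ elems deficit ≤ N
        total-deficit = +-cancelʳ-≤ (m * N) _ N (≤-trans (+-monoʳ-≤ (∑ elems deficit) mass) (≤-reflexive (trans deficit-sum (cong (_* N) e))))
        build : (∃[ x ] (∀ y → f y ≤ f x)) → ∃[ S′ ] (# S′ ≡ m) × Heavy S′ × Kind S′
        build (i₀ , top) = S′ , S′≡m , ((λ x h → proj₁ (∧-elim h)) , heavy) , inj₂ (i₀ , Si₀ , S′i₀ , split)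
          where
          S′ : 𝔽 → Bool
          S′ x = S x ∧ not (δ x i₀)
          some : ∃[ x ] S x ≡ true
          some = card-witness S 1≤s
          Si₀ : S i₀ ≡ true
          Si₀ = aux (bool-cases (S i₀))
            where
            aux : (S i₀ ≡ true) ⊎ (S i₀ ≡ false) → S i₀ ≡ true
            aux (inj₁ h) = h
            aux (inj₂ h) = ⊥-elim (<⇒≱ (≤-trans (s≤s z≤n) (≤-reflexive (sym (f-S (proj₂ some)))))
              (≤-trans (top (proj₁ some)) (≤-reflexive (cong (λ b → 𝟙 b * suc (N ∸ w i₀)) h))))
          S′i₀ : S′ i₀ ≡ false
          S′i₀ = trans (cong (λ b → S i₀ ∧ not b) (δ-refl i₀)) (trans (cong (_∧ false) Si₀) refl)
          not-i₀ : ∀ {x} → S′ x ≡ true → x ≢ i₀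
          not-i₀ h refl = true≢false h S′i₀
          split : ∀ x → S x ≡ true → (S′ x ≡ true) ⊎ (x ≡ i₀)
          split x ex = aux (x ≟ i₀)
            where
            aux : Dec (x ≡ i₀) → (S′ x ≡ true) ⊎ (x ≡ i₀)
            aux (yes h) = inj₂ h
            aux (no h)  = inj₁ (∧-intro ex (cong not (dec-false (x ≟ i₀) h)))
          S′≡m : # S′ ≡ m
          S′≡m = ℕₚ.+-cancelʳ-≡ 1 (# S′) m (trans (cong (_+_ (# S′)) (sym one)) (trans (card-∖ S (λ x → δ x i₀)) (trans e (ℕₚ.+-comm 1 m))))
            where
            one : # (S ∩ (λ x → δ x i₀)) ≡ 1
            one = trans (card-cong λ x → aux x (x ≟ i₀)) (card-singleton i₀)
              where
              aux : ∀ x (d : Dec (x ≡ i₀)) → S x ∧ does d ≡ does d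
              aux x (yes refl) = trans (cong (_∧ true) Si₀) refl
              aux x (no _) = aux₂ (S x)
                where
                aux₂ : ∀ b → b ∧ false ≡ false
                aux₂ true  = refl
                aux₂ false = refl
          D : 𝔽 → ℕ
          D x = N ∸ w x
          D+w : ∀ x → D x + w x ≡ N
          D+w x = ℕₚ.m∸n+n≡m (w≤N x)
          D≤ : ∀ {x} → S x ≡ true → D x ≤ D i₀
          D≤ h = ℕₚ.≤-pred (subst₂ _≤_ (f-S h) (f-S Si₀) (top _))
          heavy : ∀ i j → S′ i ≡ true → S′ j ≡ true → N < w i + w j
          heavy i j hi hj = ℕₚ.≰⇒> (aux (i ≟ j))
            where
            Si = proj₁ (∧-elim {S i} hi)
            Sj = proj₁ (∧-elim {S j} hj)
            aux : Dec (i ≡ j) → w i + w j ≤ N → ⊥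
            aux (yes refl) le = N-odd (D i) (ℕₚ.≤-antisym twice (arith (D i) (w i) N (D+w i) le))
              where
              arith : ∀ d w N → d + w ≡ N → w + w ≤ N → N ≤ d + d
              arith d w N refl h = linear (d + w) (d + d) 0 h (eq d w)
                where
                eq : ∀ d w → d + w + (d + w) + 0 ≡ d + d + (w + w)
                eq = solve-∀
              twice : D i + D i ≤ N
              twice = ≤-trans (+-monoʳ-≤ (D i) (D≤ Si)) (≤-trans (≤-reflexive (sym (cong₂ _+_ (deficit-S Si) (deficit-S Si₀))))
                (≤-trans (∑-≥₂ deficit i i₀ (not-i₀ hi)) total-deficit))
            aux (no i≢j) le = arith (D i) (D j) (D i₀) (w i) (w j) N (D+w i) (D+w j) le N≥1 (D≤ Si) (D≤ Sj)
                (≤-trans (≤-reflexive (sym (cong₂ _+_ (deficit-S Si) (cong₂ _+_ (deficit-S Sj) (deficit-S Si₀)))))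
                  (≤-trans (∑-≥₃ deficit i j i₀ i≢j (not-i₀ hi) (not-i₀ hj)) total-deficit))
              where
              arith : ∀ di dj d₀ wi wj N → di + wi ≡ N → dj + wj ≡ N → wi + wj ≤ N → 1 ≤ N → di ≤ d₀ → dj ≤ d₀ → di + (dj + d₀) ≤ N → ⊥
              arith di dj d₀ wi wj N e₁ e₂ h₁ h₂ h₃ h₄ h₅ = absurd-linear 0
                (+-mono-≤ (+-mono-≤ (≤-reflexive (sym (cong₂ _+_ e₁ e₂))) (≤-reflexive (sym (cong₂ _+_ e₁ e₂))))
                  (+-mono-≤ (+-mono-≤ (+-mono-≤ h₁ h₁) (+-mono-≤ h₁ h₂))
                  (+-mono-≤ (+-mono-≤ h₃ h₄) (+-mono-≤ h₅ (+-mono-≤ h₅ (≤-reflexive (sym (cong₂ _+_ e₁ e₂))))))))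
                (eq di dj d₀ wi wj N)
                where
                eq : ∀ di dj d₀ wi wj N → N + N + (N + N) + (wi + wj + (wi + wj) + (wi + wj + 1) + (di + dj + (di + (dj + d₀) + (di + (dj + d₀) + (N + N)))))
                     ≡ di + wi + (dj + wj) + (di + wi + (dj + wj)) + (N + N + (N + N) + (d₀ + d₀ + (N + (N + (di + wi + (dj + wj)))))) + 1
                eq = solve-∀

    core : ∃[ S′ ] (# S′ ≡ m) × Heavy S′ × Kind S′
    core = aux (ℕₚ.m≤n⇒m<n∨m≡n few)
      where
      aux : (# S < suc m) ⊎ (# S ≡ suc m) → ∃[ S′ ] (# S′ ≡ m) × Heavy S′ × Kind S′
      aux (inj₁ lt) = core-equal (ℕₚ.≤-antisym (ℕₚ.≤-pred lt) m≤s)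
      aux (inj₂ e)  = core-extra e

-- The possible supports

module Outcomes {p : ℕ} .{{_ : NonZero p}} (F : FieldOps p) (Π : Parameters p)
                   (N : ℕ) (N≥1 : 1 ≤ N) (N-odd : ∀ x → x + x ≢ N) where
  open Parameters Π
  open PrimeField F
  open PrimeLine F
  open Tuples F using (flip; card-flip; IdxSum)
  open LineStructure F
  open SumFreeLine F Π
  open WeightClassification F Π N N≥1 N-odd
  open 𝔽-Solver using (solve; _:+_; _:*_; _:-_; :-_; _:=_; con)

  -- The equation makes -(1 + j) the top of k[a, a+m] - ℓ[a, a+m]. As λ + 1 residues lie outside
  -- that interval of sums, j ranges up to λ.
  Contained : (𝔽 → ℕ) → Set
  Contained w = ∃[ a ] ∃[ j ] (j ≤ lam) × (supp w ⊆ interval a (suc m)) × (em (2 + k) ⊠ a ⊟ em (suc l) ⊠ a ≡ ⊖ em ((2 + k) * m + 1 + j))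

  FullInterval : (𝔽 → ℕ) → Set
  FullInterval w = ∃[ a ] ∃[ j ] (j ≤ 5 + κ + lam) × (∀ x → supp w x ≡ interval a m x) × (∀ x → supp w x ≡ true → w x ≡ N) ×
                   (em (2 + k) ⊠ a ⊟ em (suc l) ⊠ a ≡ ⊖ em ((2 + k) * (m ∸ 1) + 1 + j))

  -- The boundary cases with ℓ = 1 in which 0 is an extreme element of k[a, a+m] - ℓ[a, a+m]: the
  -- top one for `Partial₁`, the bottom one for `Partial₂`.
  Partial₁ Partial₂ : (𝔽 → ℕ) → Set
  Partial₁ w = (l ≡ 0) × ∃[ a ] (supp w ⊆ interval a (suc m)) × (supp w a ≡ true) × (supp w (a ⊞ em m) ≡ true) × (em (2 + k) ⊠ (a ⊞ em m) ≡ a)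
  Partial₂ w = (l ≡ 0) × ∃[ a ] (supp w ⊆ interval a (suc m)) × (supp w a ≡ true) × (supp w (a ⊞ em m) ≡ true) × (em (2 + k) ⊠ a ≡ a ⊞ em m)

  Outcome : (𝔽 → ℕ) → Set
  Outcome w = Contained w ⊎ FullInterval w ⊎ Partial₁ w ⊎ Partial₂ w

  private
    bases-true : ∀ b h n τs → bases b h (replicate n true ++ τs) ≡ em n ⊠ b ⊞ bases b h τs
    bases-true b h zero τs = solve 2 (λ b x → x := con (+ 0) :* b :+ x) refl b (bases b h τs)
    bases-true b h (suc n) τs = trans (cong (b ⊞_) (bases-true b h n τs))
      (trans (solve 3 (λ b n x → b :+ (n :* b :+ x) := (con (+ 1) :+ n) :* b :+ x) refl b (em n) (bases b h τs))
      (cong (λ u → u ⊠ b ⊞ bases b h τs) (sym (em-+ 1 n))))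

    bases-false : ∀ b h n → bases b h (replicate n false) ≡ ⊖ (em n ⊠ (b ⊞ em h))
    bases-false b h zero = solve 1 (λ x → con (+ 0) := :- (con (+ 0) :* x)) refl (b ⊞ em h)
    bases-false b h (suc n) = trans (cong (⊖ (b ⊞ em h) ⊞_) (bases-false b h n))
      (trans (solve 2 (λ n x → :- x :+ (:- (n :* x)) := :- ((con (+ 1) :+ n) :* x)) refl (em n) (b ⊞ em h)) (cong (λ u → ⊖ (u ⊠ (b ⊞ em h))) (sym (em-+ 1 n))))

    -- the least element k b - l (b + h) of the hull of kS - lS
    bottom : 𝔽 → ℕ → 𝔽
    bottom b h = em (2 + k) ⊠ b ⊟ em (suc l) ⊠ (b ⊞ em h)

    bases-± : ∀ b h → bases b h (rest± k l) ≡ bottom b h ⊞ em h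
    bases-± b h = trans (bases-true b h (suc k) (replicate l false)) (trans (cong (em (suc k) ⊠ b ⊞_) (bases-false b h l))
      (sym (trans (cong₂ (λ u v → u ⊠ b ⊟ v ⊠ (b ⊞ em h) ⊞ em h) (em-+ 1 (suc k)) (em-+ 1 l))
        (solve 4 (λ K L b h → (con (+ 1) :+ K) :* b :- (con (+ 1) :+ L) :* (b :+ h) :+ h := K :* b :+ (:- (L :* (b :+ h)))) refl (em (suc k)) (em l) b
          (em h)))))

    -- Counted upwards from the bottom, 0 comes at a distance t > K h, and j is t - K h - 1.
    gap-equation : ∀ b h → (∀ i → i ≤ (5 + κ) * h → bottom b h ⊞ em i ≢ 𝟘) →
      ∃[ j ] ((5 + κ) * h + 1 + j < p) × (em (2 + k) ⊠ b ⊟ em (suc l) ⊠ b ≡ ⊖ em ((2 + k) * h + 1 + j))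
    gap-equation b h avoid = j , ≤-trans (s≤s (≤-reflexive L+j)) (Finₚ.toℕ<n (⊖ bottom b h)) , eq
      where
      t = toℕ (⊖ bottom b h)
      L = (5 + κ) * h
      L<t : L < t
      L<t = ℕₚ.≰⇒> λ t≤L → avoid t t≤L (trans (cong (bottom b h ⊞_) (em-toℕ (⊖ bottom b h))) (⊖-inverseʳ (bottom b h)))
      j = t ∸ suc L
      L+j : L + 1 + j ≡ t
      L+j = trans (cong (_+ j) (ℕₚ.+-comm L 1)) (ℕₚ.m+[n∸m]≡n L<t)
      eq : em (2 + k) ⊠ b ⊟ em (suc l) ⊠ b ≡ ⊖ em ((2 + k) * h + 1 + j)
      eq = begin
        em (2 + k) ⊠ b ⊟ em (suc l) ⊠ b
          ≡⟨ solve 4 (λ K L b h → K :* b :- L :* b := L :* h :- (:- (K :* b :- L :* (b :+ h)))) refl (em (2 + k)) (em (suc l)) b (em h) ⟩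
        em (suc l) ⊠ em h ⊟ ⊖ bottom b h
          ≡⟨ cong (em (suc l) ⊠ em h ⊟_) (trans (sym (em-toℕ (⊖ bottom b h)))
            (cong em (trans (sym L+j) (trans (cong (λ K → K * h + 1 + j) (sym K≡)) (lem k l h j))))) ⟩
        em (suc l) ⊠ em h ⊟ em (suc l * h + ((2 + k) * h + 1 + j))
          ≡⟨ cong₂ _⊟_ (sym (em-* (suc l) h)) (em-+ (suc l * h) _) ⟩
        em (suc l * h) ⊟ (em (suc l * h) ⊞ em ((2 + k) * h + 1 + j))
          ≡⟨ solve 2 (λ x y → x :- (x :+ y) := :- y) refl (em (suc l * h)) (em ((2 + k) * h + 1 + j)) ⟩
        ⊖ em ((2 + k) * h + 1 + j) ∎
        where
        open ≡-Reasoning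
        lem : ∀ k l h j → (2 + k + suc l) * h + 1 + j ≡ suc l * h + ((2 + k) * h + 1 + j)
        lem = solve-∀

  module _ (w : 𝔽 → ℕ) (W : Weighted w) where
    open Weighted W
    open Analysis w W

    private
      -- The two heavy positions, one + and one -, are filled with differences of S′ and give the
      -- interval [-h, h]. The other K - 2 positions only contribute pairs of points.
      module Block (S′ : 𝔽 → Bool) (hv : Heavy S′) (b : 𝔽) (h : ℕ)
                   (lo : S′ b ≡ true) (hi : S′ (b ⊞ em h) ≡ true)
                   (diff : ∀ D → D ≤ h → ∃[ x ] (S′ x ≡ true) × (S′ (x ⊞ em D) ≡ true)) where

        block : Cov (sg S′ true ∷ sg S′ false ∷ []) (⊖ em h) (h + h)
        block = cov-difference S′ h diff

        length-rest : length (rest± k l) ≡ 3 + κ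
        length-rest = trans (length-± k l) (ℕₚ.suc-injective (ℕₚ.suc-injective (trans (cong suc (cong suc (sym (ℕₚ.+-suc k l)))) K≡)))

        equation : ∃[ j ] ((5 + κ) * h + 1 + j < p) × (em (2 + k) ⊠ b ⊟ em (suc l) ⊠ b ≡ ⊖ em ((2 + k) * h + 1 + j))
        equation = gap-equation b h λ i i≤ e → ¬pair-± S′ hv (SumOf-mono (proj₁ hv) (rest± k l) (sg S′ true ∷ sg S′ false ∷ []) 𝟘
            (subst (SumOf (map (sg S′) (rest± k l) ++ (sg S′ true ∷ sg S′ false ∷ []))) (trans (cong (_⊞ em i) start) e)
              (cov-signs S′ (rest± k l) lo hi (≤-trans (m≤m+n h h) (n≤1+n _)) block i
                (≤-trans i≤ (≤-reflexive (trans (lem κ h) (cong (λ n → h + h + n * h) (sym length-rest))))))))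
          where
          lem : ∀ κ h → (5 + κ) * h ≡ h + h + (3 + κ) * h
          lem = solve-∀
          start : bases b h (rest± k l) ⊞ ⊖ em h ≡ bottom b h
          start = trans (cong (_⊞ ⊖ em h) (bases-± b h)) (add-sub (bottom b h) (em h))

        extend-all : ∀ y H → S y ≡ true → S (y ⊞ em H) ≡ true → H ≤ suc (h + h) → ¬ (p ≤ suc (h + h + (3 + κ) * H))
        extend-all y H ey eH H≤ big = ¬pair-± S′ hv (cov-all {L = h + h + length (rest± k l) * H}
          (≤-trans big (s≤s (+-monoʳ-≤ (h + h) (*-monoˡ-≤ H (≤-reflexive (sym length-rest)))))) (cov-signs S (rest± k l) ey eH H≤ block) 𝟘)

        -- A single position uses the wide pair y, y + H. It is added last, when the interval is
        -- already long enough for H up to (K - 1) h + 1.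
        extend-once : ∀ y H → S y ≡ true → S (y ⊞ em H) ≡ true → H ≤ suc ((4 + κ) * h) → ¬ (p ≤ suc ((4 + κ) * h + H))
        extend-once y H ey eH H≤ big = ¬pair-± S′ hv (mono (cov-all big (cov-step (sg S true) ey eH H≤ inner) 𝟘))
          where
          τs = replicate k true ++ replicate l false
          length-τs : length τs ≡ 2 + κ
          length-τs = ℕₚ.suc-injective length-rest
          inner : Cov (map (sg S′) τs ++ (sg S′ true ∷ sg S′ false ∷ [])) (bases b h τs ⊞ ⊖ em h) ((4 + κ) * h)
          inner i i≤ = cov-signs S′ τs lo hi (≤-trans (m≤m+n h h) (n≤1+n _)) block i
            (≤-trans i≤ (≤-reflexive (trans (lem κ h) (cong (λ n → h + h + n * h) (sym length-τs)))))
            where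
            lem : ∀ κ h → (4 + κ) * h ≡ h + h + (2 + κ) * h
            lem = solve-∀
          mono : SumOf (sg S true ∷ map (sg S′) τs ++ (sg S′ true ∷ sg S′ false ∷ [])) 𝟘 → SumOf (map (sg S) (rest± k l) ++ (sg S′ true ∷ sg S′ false ∷ [])) 𝟘
          mono (x , ex , s) = x , ex , SumOf-mono (proj₁ hv) τs (sg S′ true ∷ sg S′ false ∷ []) (𝟘 ⊟ x) s

        -- A further element of S at distance at least υ from the block fills
        -- the gap of length γ.
        far : ∀ x γ υ → S x ≡ true → p ≡ (5 + κ) * h + 1 + γ → γ ≤ (3 + κ) * υ → γ ≤ h + 2 →
              h + υ ≤ toℕ (x ⊟ b) → toℕ (x ⊟ b) + υ ≤ p → ⊥
        far x γ υ ex pγ γ≤ γ≤h ht tp = decide (t ≤? suc (h + h)) (h + u′ ≤? suc (h + h)) (t ≤? suc ((4 + κ) * h))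
          where
          t = toℕ (x ⊟ b)
          u′ = p ∸ t
          t≤p : t ≤ p
          t≤p = <⇒≤ (Finₚ.toℕ<n (x ⊟ b))
          u′+t : u′ + t ≡ p
          u′+t = ℕₚ.m∸n+n≡m t≤p
          Sb = proj₁ hv b lo
          Sbh = proj₁ hv _ hi
          x≡ : b ⊞ em t ≡ x
          x≡ = trans (cong (b ⊞_) (em-toℕ (x ⊟ b))) (solve 2 (λ b x → b :+ (x :- b) := x) refl b x)
          eF : S (b ⊞ em t) ≡ true
          eF = trans (cong S x≡) ex
          wrap : x ⊞ em (h + u′) ≡ b ⊞ em h
          wrap = trans (cong (_⊞ em (h + u′)) (sym x≡)) (trans (⊞-assoc b (em t) (em (h + u′)))
            (trans (cong (b ⊞_) (trans (sym (em-+ t (h + u′))) (trans (cong em (trans (lem t h u′) (cong (_+_ h) u′+t)))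
            (trans (em-+ h p) (cong (em h ⊞_) em-p))))) (cong (b ⊞_) (⊞-identityʳ (em h)))))
            where
            lem : ∀ t h u → t + (h + u) ≡ h + (u + t)
            lem = solve-∀
          eB : S (x ⊞ em (h + u′)) ≡ true
          eB = trans (cong S wrap) Sbh
          υ≤u′ : υ ≤ u′
          υ≤u′ = +-cancelʳ-≤ t υ u′ (≤-trans (≤-reflexive (ℕₚ.+-comm υ t)) (≤-trans tp (≤-reflexive (sym u′+t))))
          enough-all : ∀ H → h + υ ≤ H → p ≤ suc (h + h + (3 + κ) * H)
          enough-all H hH = subst (_≤ suc (h + h + (3 + κ) * H)) (sym pγ)
            (linear ((5 + κ) * h + 1 + γ) (suc (h + h + (3 + κ) * H)) 0 (+-mono-≤ γ≤ (*-monoʳ-≤ (3 + κ) hH)) (lem κ h γ υ H))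
            where
            lem : ∀ κ h g u H → (5 + κ) * h + 1 + g + ((3 + κ) * u + (3 + κ) * H) + 0 ≡ suc (h + h + (3 + κ) * H) + (g + (3 + κ) * (h + u))
            lem = solve-∀
          enough-once : ∀ H → suc (h + h) < H → p ≤ suc ((4 + κ) * h + H)
          enough-once H hH = subst (_≤ suc ((4 + κ) * h + H)) (sym pγ) (linear ((5 + κ) * h + 1 + γ) (suc ((4 + κ) * h + H)) 0 (+-mono-≤ γ≤h hH) (lem κ h γ H))
            where
            lem : ∀ κ h g H → (5 + κ) * h + 1 + g + (h + 2 + H) + 0 ≡ suc ((4 + κ) * h + H) + (g + suc (suc (h + h)))
            lem = solve-∀
          back : suc ((4 + κ) * h) < t → h + u′ ≤ suc ((4 + κ) * h)
          back lt = linear (h + u′) (suc ((4 + κ) * h)) ((1 + κ) * h) (+-mono-≤ lt (+-mono-≤ (≤-reflexive (trans u′+t pγ)) γ≤h)) (lem κ h u′ t γ)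
            where
            lem : ∀ κ h u t g → h + u + (t + ((5 + κ) * h + 1 + g + (h + 2))) + (1 + κ) * h ≡ suc ((4 + κ) * h) + (suc (suc ((4 + κ) * h)) + (u + t + g))
            lem = solve-∀
          -- x is joined to b, at distance t, or around the circle to b + h, at distance h + u′. A
          -- distance of at most 2 h + 1 can be used in all remaining positions, a longer one only
          -- once, as the last step.
          decide : Dec (t ≤ suc (h + h)) → Dec (h + u′ ≤ suc (h + h)) → Dec (t ≤ suc ((4 + κ) * h)) → ⊥
          decide (yes t≤) _ _ = extend-all b t Sb eF t≤ (enough-all t ht)
          decide (no _) (yes u≤) _ = extend-all x (h + u′) ex eB u≤ (enough-all (h + u′) (+-monoʳ-≤ h υ≤u′))
          decide (no t>) (no _) (yes t≤) = extend-once b t Sb eF t≤ (enough-once t (≰⇒> t>))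
          decide (no _) (no u>) (no t>) = extend-once x (h + u′) ex eB (back (≰⇒> t>)) (enough-once (h + u′) (≰⇒> u>))

      j-bound : ∀ h γ j → p ≡ (5 + κ) * h + 1 + suc γ → (5 + κ) * h + 1 + j < p → j ≤ γ
      j-bound h γ j e lt = ℕₚ.≤-pred (+-cancelˡ-≤ ((5 + κ) * h + 1) _ _ (≤-trans (≤-reflexive (ℕₚ.+-suc ((5 + κ) * h + 1) j)) (≤-trans lt (≤-reflexive e))))

      γ-m : p ≡ (5 + κ) * m + 1 + suc lam
      γ-m = trans p≡ (lem ((5 + κ) * m) lam)
        where
        lem : ∀ x l → x + 2 + l ≡ x + 1 + suc l
        lem = solve-∀

      -- Shortening the block from m to m - 1 widens the gap from λ + 1 to K + λ + 1.
      γ-m₁ : p ≡ (5 + κ) * m₁ + 1 + suc (5 + κ + lam)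
      γ-m₁ = trans p≡ (trans (cong (λ n → (5 + κ) * n + 2 + lam) (sym m₁≡)) (lem κ m₁ lam))
        where
        lem : ∀ κ n l → (5 + κ) * suc n + 2 + l ≡ (5 + κ) * n + 1 + suc (5 + κ + l)
        lem = solve-∀

      γ-m₁≤ : suc (5 + κ + lam) ≤ (3 + κ) * 2
      γ-m₁≤ = linear (suc (5 + κ + lam)) ((3 + κ) * 2) mu (z≤n {0}) (lem lam mu)
        where
        lem : ∀ l u → suc (5 + (l + u) + l) + 0 + u ≡ (3 + (l + u)) * 2 + 0
        lem = solve-∀

      γ-m₁≤h : suc (5 + κ + lam) ≤ m₁ + 2
      γ-m₁≤h = ℕₚ.≤-pred (≤-trans (linear (2 + (5 + κ + lam)) (m + 2) 4 m≥ (lem (5 + κ + lam) m)) (≤-reflexive (cong (_+ 2) (sym m₁≡))))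
        where
        lem : ∀ x m → 2 + x + m + 4 ≡ m + 2 + (x + 4)
        lem = solve-∀

      ⊆-with : ∀ {S′ i₀ I} → S′ ⊆ I → I i₀ ≡ true → (∀ x → S x ≡ true → (S′ x ≡ true) ⊎ (x ≡ i₀)) → S ⊆ I
      ⊆-with {S′} {i₀} {I} sub e split x ex = aux (split x ex)
        where
        aux : (S′ x ≡ true) ⊎ (x ≡ i₀) → I x ≡ true
        aux (inj₁ h) = sub x h
        aux (inj₂ h) = trans (cong I h) e

      -- With one interior hole, S′ still has all differences up to m and acts like the whole
      -- interval [a, a+m]. An index of S outside that interval is excluded by `far`.
      interior : ∀ S′ → Heavy S′ → Kind S′ → ∀ a u → S′ ⊆ interval a (suc m) → 1 ≤ u → u < m → (∀ i → i ≤ m → i ≢ u → S′ (a ⊞ em i) ≡ true) → Outcome w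
      interior S′ hv kind a u sub 1≤u u<m ok = finish kind
        where
        P : ℕ → Bool
        P i = S′ (a ⊞ em i)
        P0 : P 0 ≡ true
        P0 = ok 0 z≤n (λ e → <⇒≱ 1≤u (≤-reflexive (sym e)))
        Pm : P m ≡ true
        Pm = ok m ≤-refl (λ e → <⇒≱ u<m (≤-reflexive e))
        diff : ∀ D → D ≤ m → ∃[ x ] (S′ x ≡ true) × (S′ (x ⊞ em D) ≡ true)
        diff D D≤ = let x , ex , ey = difference₁ P m u (≤-trans (s≤s (s≤s (s≤s (s≤s z≤n)))) m≥9) P0 Pm ok D D≤
                    in a ⊞ em x , ex , trans (cong S′ (trans (⊞-assoc a _ _) (cong (a ⊞_) (sym (em-+ x D))))) ey
        open Block S′ hv a m (trans (cong S′ (sym (⊞-identityʳ a))) P0) Pm diff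
        contained : S ⊆ interval a (suc m) → Outcome w
        contained S⊆ = let j , lt , e = equation in inj₁ (a , j , j-bound m lam j γ-m lt , S⊆ , e)
        finish : Kind S′ → Outcome w
        finish (inj₁ (same , _)) = contained λ x ex → sub x (trans (sym (same x)) ex)
        finish (inj₂ (i₀ , Si₀ , _ , split)) = aux (toℕ (i₀ ⊟ a) <? suc m)
          where
          aux : Dec (toℕ (i₀ ⊟ a) < suc m) → Outcome w
          aux (yes lt) = contained (⊆-with {S′} {i₀} {interval a (suc m)} sub (does-intro (_ <? suc m) lt) split)
          aux (no ge) = ⊥-elim (far i₀ (suc lam) 1 Si₀ γ-m
              (linear (suc lam) ((3 + κ) * 1) (2 + mu) (z≤n {0}) (lem₁ lam mu))
              (≤-trans (linear (suc lam) (5 + κ + lam + 4 + 2) (10 + κ) (z≤n {0}) (lem₂ κ lam)) (+-monoˡ-≤ 2 m≥))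
              (≤-trans (≤-reflexive (ℕₚ.+-comm m 1)) (≮⇒≥ ge)) (≤-trans (≤-reflexive (ℕₚ.+-comm _ 1)) (Finₚ.toℕ<n (i₀ ⊟ a))))
            where
            lem₁ : ∀ l u → suc l + 0 + (2 + u) ≡ (3 + (l + u)) * 1 + 0
            lem₁ = solve-∀
            lem₂ : ∀ κ l → suc l + 0 + (10 + κ) ≡ 5 + κ + l + 4 + 2 + 0
            lem₂ = solve-∀

      -- S = [b, b + m] and S′ = S ∖ {x} with x an endpoint.
      tight : ∀ S′ → Heavy S′ → ∀ b c x → S ⊆ interval b (suc m) → S b ≡ true → S (b ⊞ em m) ≡ true →
              (∀ D → D ≤ m₁ → ∃[ y ] (S′ y ≡ true) × (S′ (y ⊞ em D) ≡ true)) → S′ c ≡ true → S′ (c ⊞ em m₁) ≡ true →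
              ((x ≡ b) × (S′ (b ⊞ em m) ≡ true)) ⊎ ((x ≡ b ⊞ em m) × (S′ b ≡ true)) → Outcome w
      tight S′ hv b c x S⊆ Sb Sbm diff S′c S′cm end = aux (bottom b m ≟ 𝟘) ((bottom b m ⊞ em ((5 + κ) * m)) ≟ 𝟘)
        where
        open Block S′ hv c m₁ S′c S′cm diff
        start : bases b m (rest± k l) ⊞ ⊖ em m₁ ≡ bottom b m ⊞ em 1
        start = trans (cong₂ (λ u v → u ⊞ ⊖ v) (bases-± b m) refl) (trans (cong (λ n → bottom b m ⊞ em n ⊞ ⊖ em m₁) (sym m₁≡))
          (trans (cong (λ v → bottom b m ⊞ v ⊞ ⊖ em m₁) (em-+ 1 m₁)) (solve 3 (λ c o n → c :+ (o :+ n) :+ (:- n) := c :+ o) refl (bottom b m) (em 1) (em m₁))))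
        -- The two heavy positions yield [-(m-1), m-1] in place of [-m, m]. Only the two extreme
        -- values of the full range, at offsets 0 and K m, escape.
        inside : ∀ i → i ≤ m₁ + m₁ + (3 + κ) * m → bottom b m ⊞ em (suc i) ≢ 𝟘
        inside i i≤ e = ¬pair-± S′ hv (subst (SumOf (map (sg S) (rest± k l) ++ (sg S′ true ∷ sg S′ false ∷ [])))
          (trans (cong (_⊞ em i) start) (trans (⊞-assoc (bottom b m) (em 1) (em i)) (trans (cong (bottom b m ⊞_) (sym (em-+ 1 i))) e)))
          (cov-signs S (rest± k l) Sb Sbm m≤ block i (≤-trans i≤ (≤-reflexive (cong (λ n → m₁ + m₁ + n * m) (sym length-rest))))))
          where
          m≤ : m ≤ suc (m₁ + m₁)
          m≤ = ≤-trans (≤-reflexive (sym m₁≡)) (s≤s (m≤m+n m₁ m₁))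
        S′⊆S = proj₁ hv
        replicate-SumOf : ∀ y τ n z → S (flip τ y) ≡ true → z ≡ em n ⊠ y → SumOf (map (sg S) (replicate n τ)) z
        replicate-SumOf y τ zero z ey e = trans e (solve 1 (λ y → con (+ 0) :* y := con (+ 0)) refl y)
        replicate-SumOf y τ (suc n) z ey e = y , ey , replicate-SumOf y τ n (z ⊟ y) ey
          (trans (cong (_⊟ y) (trans e (cong (_⊠ y) (em-+ 1 n)))) (solve 2 (λ n y → (con (+ 1) :+ n) :* y :- y := n :* y) refl (em n) y))
        both-SumOf : ∀ y y′ n n′ z → S y ≡ true → S (⊖ y′) ≡ true → z ≡ em n ⊠ y ⊞ em n′ ⊠ y′ → SumOf (map (sg S) (replicate n true ++ replicate n′ false)) z
        both-SumOf y y′ zero n′ z ey ey′ e = replicate-SumOf y′ false n′ z ey′ (trans e (solve 2 (λ y x → con (+ 0) :* y :+ x := x) refl y (em n′ ⊠ y′)))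
        both-SumOf y y′ (suc n) n′ z ey ey′ e = y , ey , both-SumOf y y′ n n′ (z ⊟ y) ey ey′
          (trans (cong (_⊟ y) (trans e (cong (λ u → u ⊠ y ⊞ em n′ ⊠ y′) (em-+ 1 n))))
          (solve 3 (λ n y x → (con (+ 1) :+ n) :* y :+ x :- y := n :* y :+ x) refl (em n) y (em n′ ⊠ y′)))
        -- k y = l y′ is impossible if y, or if y′ and l ≥ 2, is heavy
        heavy-plus : ∀ y y′ → S′ y ≡ true → S y′ ≡ true → em (2 + k) ⊠ y ≢ em (suc l) ⊠ y′
        heavy-plus y y′ hy sy′ e = ¬pair S′ hv true true (rest₊ k l) ↭-refl
          (y , hy , y , hy , both-SumOf y (⊖ y′) k (suc l) (𝟘 ⊟ y ⊟ y) (S′⊆S y hy) (trans (cong S (⊖-involutive y′)) sy′)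
          (trans (solve 3 (λ k y x → con (+ 0) :- y :- y := k :* y :+ (:- ((con (+ 1) :+ (con (+ 1) :+ k)) :* y))) refl (em k) y y′)
            (cong (em k ⊠ y ⊞_) (trans (cong ⊖_ (trans (cong (_⊠ y) (trans (cong (𝟙ᶠ ⊞_) (sym (em-+ 1 k))) (sym (em-+ 1 (suc k))))) e))
              (solve 2 (λ L x → :- (L :* x) := L :* (:- x)) refl (em (suc l)) y′)))))
        heavy-minus : ∀ y y′ → S y ≡ true → S′ y′ ≡ true → em (2 + k) ⊠ y ≡ em (suc l) ⊠ y′ → l ≡ 0
        heavy-minus y y′ sy hy′ e = go l refl
          where
          go : ∀ l′ → l ≡ l′ → l ≡ 0
          go zero     e₀ = e₀
          go (suc l′) e₀ = ⊥-elim (¬pair S′ hv false false (replicate (2 + k) true ++ replicate l′ false) perm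
              (⊖ y′ , trans (cong S′ (⊖-involutive y′)) hy′ , ⊖ y′ , trans (cong S′ (⊖-involutive y′)) hy′ ,
                both-SumOf y (⊖ y′) (2 + k) l′ (𝟘 ⊟ ⊖ y′ ⊟ ⊖ y′) sy (trans (cong S (⊖-involutive y′)) (S′⊆S y′ hy′))
                  (trans (solve 2 (λ L x → con (+ 0) :- (:- x) :- (:- x) := (con (+ 1) :+ (con (+ 1) :+ L)) :* x :+ L :* (:- x)) refl (em l′) y′)
                    (cong (_⊞ em l′ ⊠ ⊖ y′) (trans (cong (_⊠ y′) (trans (trans (cong (𝟙ᶠ ⊞_) (sym (em-+ 1 l′))) (sym (em-+ 1 (suc l′))))
                      (cong (λ n → em (suc n)) (sym e₀)))) (sym e))))))
            where
            perm : (false ∷ false ∷ replicate (2 + k) true ++ replicate l′ false) ↭ Σs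
            perm = ↭-trans (prep false (↭-sym (↭ₚ.shift false (replicate (2 + k) true) (replicate l′ false))))
              (↭-trans (↭-sym (↭ₚ.shift false (replicate (2 + k) true) (false ∷ replicate l′ false)))
              (subst (λ n → (replicate (2 + k) true ++ false ∷ false ∷ replicate l′ false) ↭ (replicate (2 + k) true ++ false ∷ replicate n false))
              (sym e₀) ↭-refl))
        -- The bottom value uses b in all k positive positions and b + m in all ℓ negative ones. The
        -- heavy end may occur only once among them; as k ≥ 2 it is b + m, and ℓ = 1. `tops` is the
        -- mirror image.
        ends : ((x ≡ b) × (S′ (b ⊞ em m) ≡ true)) ⊎ ((x ≡ b ⊞ em m) × (S′ b ≡ true)) → bottom b m ≡ 𝟘 → Outcome w
        ends (inj₁ (_ , hbm)) e = let l≡0 = heavy-minus b (b ⊞ em m) Sb hbm (sub-≡ e) in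
          inj₂ (inj₂ (inj₂ (l≡0 , b , S⊆ , Sb , Sbm , trans (sub-≡ e) (trans (cong (λ n → em (suc n) ⊠ (b ⊞ em m)) l≡0) (⊠-identityˡ _)))))
        ends (inj₂ (_ , hb)) e = ⊥-elim (heavy-plus b (b ⊞ em m) hb Sbm (sub-≡ e))
        top≡ : bottom b m ⊞ em ((5 + κ) * m) ≡ em (2 + k) ⊠ (b ⊞ em m) ⊟ em (suc l) ⊠ b
        top≡ = trans (cong (bottom b m ⊞_) (trans (cong (λ K → em (K * m)) (sym K≡)) (trans (em-* (2 + k + suc l) m) (cong (_⊠ em m) (em-+ (2 + k) (suc l))))))
          (solve 4 (λ K L b m → K :* b :- L :* (b :+ m) :+ (K :+ L) :* m := K :* (b :+ m) :- L :* b) refl (em (2 + k)) (em (suc l)) b (em m))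
        tops : ((x ≡ b) × (S′ (b ⊞ em m) ≡ true)) ⊎ ((x ≡ b ⊞ em m) × (S′ b ≡ true)) → bottom b m ⊞ em ((5 + κ) * m) ≡ 𝟘 → Outcome w
        tops (inj₁ (_ , hbm)) e = ⊥-elim (heavy-plus (b ⊞ em m) b hbm Sb (sub-≡ (trans (sym top≡) e)))
        tops (inj₂ (_ , hb)) e = let e′ = sub-≡ (trans (sym top≡) e)
                                     l≡0 = heavy-minus (b ⊞ em m) b Sbm hb e′ in
          inj₂ (inj₂ (inj₁ (l≡0 , b , S⊆ , Sb , Sbm , trans e′ (trans (cong (λ n → em (suc n) ⊠ b) l≡0) (⊠-identityˡ b)))))
        aux : Dec (bottom b m ≡ 𝟘) → Dec (bottom b m ⊞ em ((5 + κ) * m) ≡ 𝟘) → Outcome w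
        aux (yes e) _ = ends end e
        aux (no _) (yes e) = tops end e
        aux (no n₀) (no n₁) = let j , lt , e = gap-equation b m avoid in inj₁ (b , j , j-bound m lam j γ-m lt , S⊆ , e)
          where
          avoid : ∀ i → i ≤ (5 + κ) * m → bottom b m ⊞ em i ≢ 𝟘
          avoid zero i≤ e = n₀ (trans (sym (⊞-identityʳ _)) e)
          avoid (suc i) i≤ = split (ℕₚ.m≤n⇒m<n∨m≡n i≤)
            where
            split : (suc i < (5 + κ) * m) ⊎ (suc i ≡ (5 + κ) * m) → bottom b m ⊞ em (suc i) ≢ 𝟘
            split (inj₂ e) = λ e′ → n₁ (trans (cong (λ n → bottom b m ⊞ em n) (sym e)) e′)
            split (inj₁ lt) = inside i (linear i (m₁ + m₁ + (3 + κ) * m) 0 (+-mono-≤ lt (≤-reflexive (cong₂ _+_ (sym m₁≡) (sym m₁≡)))) (lem κ m m₁ i))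
              where
              lem : ∀ κ m n i → i + ((5 + κ) * m + (suc n + suc n)) + 0 ≡ n + n + (3 + κ) * m + (suc (suc i) + (m + m))
              lem = solve-∀

      -- S′ is an interval of m places. A further index adjacent to it leads to `tight`. Any other
      -- one is at distance at least 2 on both sides, enough for `far` in spite of the wider gap.
      exact : ∀ S′ → Heavy S′ → Kind S′ → ∀ b → (∀ x → S′ x ≡ interval b m x) → Outcome w
      exact S′ hv kind b isI = finish kind
        where
        m≤p : m ≤ p
        m≤p = ≤-trans (≤-trans (n≤1+n m) (n≤1+n _)) m+2≤p
        at : ∀ i → i < m → S′ (b ⊞ em i) ≡ true
        at i i<m = trans (isI (b ⊞ em i)) (interval-intro {b} {m} {i} m≤p i<m)
        at₀ : S′ b ≡ true
        at₀ = trans (cong S′ (sym (⊞-identityʳ b))) (at 0 (≤-trans (s≤s z≤n) m≥9))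
        at₁ : S′ (b ⊞ em m₁) ≡ true
        at₁ = at m₁ (≤-reflexive m₁≡)
        diff : ∀ D → D ≤ m₁ → ∃[ x ] (S′ x ≡ true) × (S′ (x ⊞ em D) ≡ true)
        diff D D≤ = b , at₀ , at D (≤-trans (s≤s D≤) (≤-reflexive m₁≡))
        open Block S′ hv b m₁ at₀ at₁ diff
        S′⊆ : S′ ⊆ interval b m
        S′⊆ x ex = trans (sym (isI x)) ex
        finish : Kind S′ → Outcome w
        finish (inj₁ (same , full)) = let j , lt , e = equation in
          inj₂ (inj₁ (b , j , j-bound m₁ (5 + κ + lam) j γ-m₁ lt , (λ x → trans (same x) (isI x)) , full , e))
        finish (inj₂ (x , Sx , S′x , split)) = aux (t <? m) (t ℕₚ.≟ m) (suc t ℕₚ.≟ p)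
          where
          t = toℕ (x ⊟ b)
          x≡ : b ⊞ em t ≡ x
          x≡ = trans (cong (b ⊞_) (em-toℕ (x ⊟ b))) (solve 2 (λ b x → b :+ (x :- b) := x) refl b x)
          aux : Dec (t < m) → Dec (t ≡ m) → Dec (suc t ≡ p) → Outcome w
          aux (yes lt) _ _ = ⊥-elim (true≢false (trans (cong S′ (sym x≡)) (at t lt)) S′x)
          aux (no _) (yes t≡m) _ = tight S′ hv b b x
              (⊆-with {S′} {x} {interval b (suc m)} (λ y ey → interval-mono {b} (n≤1+n m) y (S′⊆ y ey)) (does-intro (_ <? suc m) (s≤s (≤-reflexive t≡m))) split)
              (proj₁ hv b at₀) (trans (cong S (trans (cong (λ n → b ⊞ em n) (sym t≡m)) x≡)) Sx) diff at₀ at₁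
              (inj₂ (trans (sym x≡) (cong (λ n → b ⊞ em n) t≡m) , at₀))
          aux (no _) (no _) (yes t≡) = tight S′ hv b′ b x
              (⊆-with {S′} {x} {interval b′ (suc m)} sub-b′ (trans (cong (interval b′ (suc m)) (trans x≡b′ (sym (⊞-identityʳ b′))))
                (interval-intro {b′} {suc m} {0} (≤-trans (n≤1+n _) m+2≤p) (s≤s z≤n))) split)
              (trans (cong S (sym x≡b′)) Sx) (trans (cong S (sym up)) (proj₁ hv _ at₁)) diff at₀ at₁
              (inj₁ (x≡b′ , trans (cong S′ (sym up)) at₁))
            where
            b′ = b ⊟ em 1
            x≡b′ : x ≡ b′
            x≡b′ = trans (sym x≡) (trans (solve 3 (λ b t o → b :+ t := b :- o :+ (o :+ t)) refl b (em t) (em 1))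
              (trans (cong (b′ ⊞_) (trans (sym (em-+ 1 t)) (trans (cong em t≡) em-p))) (⊞-identityʳ b′)))
            up : b ⊞ em m₁ ≡ b′ ⊞ em m
            up = trans (solve 3 (λ b o n → b :+ n := b :- o :+ (o :+ n)) refl b (em 1) (em m₁)) (cong (b′ ⊞_) (trans (sym (em-+ 1 m₁)) (cong em m₁≡)))
            sub-b′ : S′ ⊆ interval b′ (suc m)
            sub-b′ y ey = let i , i< , e = interval-elim {b} {m} (S′⊆ y ey) in
              trans (cong (interval b′ (suc m)) (trans e (trans (solve 3 (λ b o n → b :+ n := b :- o :+ (o :+ n)) refl b (em 1) (em i))
                (cong (b′ ⊞_) (sym (em-+ 1 i)))))) (interval-intro {b′} {suc m} {suc i} (≤-trans (n≤1+n _) m+2≤p) (s≤s i<))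
          aux (no t≥) (no t≢m) (no t≢p) = ⊥-elim (far x (suc (5 + κ + lam)) 2 Sx γ-m₁ γ-m₁≤ γ-m₁≤h
              (≤-trans (≤-reflexive (trans (ℕₚ.+-comm m₁ 2) (cong suc m₁≡))) (ℕₚ.≤∧≢⇒< (≮⇒≥ t≥) (λ e → t≢m (sym e))))
              (≤-trans (≤-reflexive (ℕₚ.+-comm t 2)) (ℕₚ.≤∧≢⇒< (Finₚ.toℕ<n (x ⊟ b)) t≢p)))

    analyse : ∀ S′ → # S′ ≡ m → Heavy S′ → Kind S′ → ∀ a → S′ ⊆ interval a (suc m) → Outcome w
    analyse S′ S′≡m hv kind a sub = let e , he = card-witness E (≤-reflexive (sym E≡1)) in located e he
      where
      I = interval a (suc m)
      E = I ∖ S′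
      m+1≤p : suc m ≤ p
      m+1≤p = ≤-trans (n≤1+n _) m+2≤p
      E≡1 : # E ≡ 1
      E≡1 = ℕₚ.+-cancelʳ-≡ m (# E) 1 (trans (cong (_+_ (# E)) (sym I∩S′)) (trans (card-∖ I S′) (interval-card a (suc m) m+1≤p)))
        where
        I∩S′ : # (I ∩ S′) ≡ m
        I∩S′ = trans (card-cong λ x → ∩-sub x (S′ x) refl) S′≡m
          where
          drop : ∀ b → b ∧ false ≡ false
          drop true  = refl
          drop false = refl
          ∩-sub : ∀ x b → S′ x ≡ b → I x ∧ b ≡ b
          ∩-sub x true  e = ∧-intro (sub x e) refl
          ∩-sub x false e = drop (I x)
      located : ∀ e → E e ≡ true → Outcome w
      located e he = aux (u ℕₚ.≟ 0) (u ℕₚ.≟ m)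
        where
        u = toℕ (e ⊟ a)
        u<sm : u < suc m
        u<sm = does-true (u <? suc m) (proj₁ (∧-elim {I e} he))
        S′e : S′ (a ⊞ em u) ≡ false
        S′e = trans (cong S′ (trans (cong (a ⊞_) (em-toℕ (e ⊟ a))) (solve 2 (λ a e → a :+ (e :- a) := e) refl a e))) (not-true (proj₂ (∧-elim {I e} he)))
        ok : ∀ i → i ≤ m → i ≢ u → S′ (a ⊞ em i) ≡ true
        ok i i≤ i≢u = pick (bool-cases (S′ (a ⊞ em i)))
          where
          pick : (S′ (a ⊞ em i) ≡ true) ⊎ (S′ (a ⊞ em i) ≡ false) → S′ (a ⊞ em i) ≡ true
          pick (inj₁ h) = h
          pick (inj₂ h) = ⊥-elim (<⇒≱ (≤-trans two (card-mono both)) (≤-reflexive E≡1))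
            where
            D₁ = λ y → δ y (a ⊞ em i)
            D₂ = λ y → δ y e
            ne : a ⊞ em i ≢ e
            ne h′ = i≢u (trans (sym (trans (cong toℕ (add-sub′ a (em i))) (toℕ-em-< (≤-trans (s≤s i≤) m+1≤p)))) (cong (λ y → toℕ (y ⊟ a)) h′))
            both : (D₁ ∪ D₂) ⊆ E
            both y hy = case (∨-elim {δ y (a ⊞ em i)} hy)
              where
              case : (δ y (a ⊞ em i) ≡ true) ⊎ (δ y e ≡ true) → E y ≡ true
              case (inj₁ h′) = trans (cong E (δ-≡ {y} {a ⊞ em i} h′)) (∧-intro (interval-intro {a} {suc m} {i} m+1≤p (s≤s i≤)) (cong not h))
              case (inj₂ h′) = trans (cong E (δ-≡ {y} {e} h′)) he
            two : 2 ≤ # (D₁ ∪ D₂)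
            two = ≤-reflexive (sym (trans (sym (ℕₚ.+-identityʳ _)) (trans (cong (_+_ (# (D₁ ∪ D₂))) (sym none))
              (trans (card-∪∩ D₁ D₂) (cong₂ _+_ (card-singleton (a ⊞ em i)) (card-singleton e))))))
              where
              none : # (D₁ ∩ D₂) ≡ 0
              none = trans (card-cong λ y → ¬true⇒false λ h′ → ne (trans (sym (δ-≡ {y} {a ⊞ em i} (proj₁ (∧-elim {D₁ y} h′))))
                (δ-≡ {y} {e} (proj₂ (∧-elim {D₁ y} h′))))) (ℕΣ.∑-zero elems)
        m≤p : m ≤ p
        m≤p = <⇒≤ m+1≤p
        same : ∀ b → S′ ⊆ interval b m → ∀ x → S′ x ≡ interval b m x
        same b sub′ x = bool-ext (sub′ x) (⊆-antisym-card S′ (interval b m) sub′ (≤-reflexive (trans (interval-card b m m≤p) (sym S′≡m))) x)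
        aux : Dec (u ≡ 0) → Dec (u ≡ m) → Outcome w
        aux (yes u≡0) _ = exact S′ hv kind (a ⊞ em 1) (same _ (interval-shift S′ a m 1 sub
          (λ { zero _ → trans (cong (λ n → S′ (a ⊞ em n)) (sym u≡0)) S′e ; (suc i) (s≤s ()) }) m≤p))
        aux (no _) (yes u≡m) = exact S′ hv kind a (same _ (interval-exclude S′ a (suc m) m sub
          (λ i m≤i i< → trans (cong (λ n → S′ (a ⊞ em n)) (trans (ℕₚ.≤-antisym (ℕₚ.≤-pred i<) m≤i) (sym u≡m))) S′e) m+1≤p m≤p))
        aux (no u≢0) (no u≢m) = interior S′ hv kind a u sub (ℕₚ.n≢0⇒n>0 u≢0) (ℕₚ.≤∧≢⇒< (ℕₚ.≤-pred u<sm) u≢m) ok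

-- Reflection of the line exchanges j and λ - j, so one of the two lies in the range demanded of the
-- extremal cuboids.
half-bound : ∀ lam j → ¬ (j ≤ ⌈ suc lam /2⌉ ∸ 1) → lam ∸ j ≤ ⌈ suc lam /2⌉ ∸ 1
half-bound lam j h = ℕₚ.m≤n+o⇒m∸n≤o lam j (≤-trans (≤-reflexive (sym (ℕₚ.⌊n/2⌋+⌈n/2⌉≡n lam)))
  (≤-trans (+-monoʳ-≤ ⌊ lam /2⌋ (≤-trans (ℕₚ.⌊n/2⌋-mono (n≤1+n (suc lam))) (≰⇒> h))) (≤-reflexive (ℕₚ.+-comm ⌊ lam /2⌋ j))))

-- Normalisation by reflection and dilation

module FinalOutcomes {p : ℕ} .{{_ : NonZero p}} (F : FieldOps p) (Π : Parameters p)
                   (N : ℕ) (N≥1 : 1 ≤ N) (N-odd : ∀ x → x + x ≢ N) where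
  open Parameters Π
  open PrimeField F
  open PrimeLine F
  open LineStructure F
  open SumFreeLine F Π
  open WeightClassification F Π N N≥1 N-odd
  open Outcomes F Π N N≥1 N-odd
  open 𝔽-Solver using (solve; _:+_; _:*_; _:-_; :-_; _:=_; con)

  SmallContained : (𝔽 → ℕ) → Set
  SmallContained w = ∃[ a ] ∃[ j ] (j ≤ ⌈ suc lam /2⌉ ∸ 1) × (supp w ⊆ interval a (suc m)) × (em (2 + k) ⊠ a ⊟ em (suc l) ⊠ a ≡ ⊖ em ((2 + k) * m + 1 + j))

  NormalInterval : (𝔽 → ℕ) → Set
  NormalInterval w = ∃[ a ] ∃[ j ] ((suc j ≤ suc l) ⊎ ((lam + suc l + 2 ≤ suc j) × (suc j ≤ 2 + k))) × (∀ x → supp w x ≡ interval a m x) ×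
    (∀ x → supp w x ≡ true → w x ≡ N) ×
                   (em (2 + k) ⊠ a ⊟ em (suc l) ⊠ a ≡ ⊖ em ((2 + k) * (m ∸ 1) + 1 + j))

  Final : (𝔽 → ℕ) → Set
  Final w = SmallContained w ⊎ NormalInterval w ⊎ Partial₁ w

  _∙_ : (𝔽 → ℕ) → 𝔽 → 𝔽 → ℕ
  (w ∙ d) i = w (d ⊠ i)

  private
    neg⊠ : ∀ x → (⊖ 𝟙ᶠ) ⊠ x ≡ ⊖ x
    neg⊠ x = solve 1 (λ x → (:- con (+ 1)) :* x := :- x) refl x

    reflect : ∀ {X : 𝔽 → Bool} {a} h {x} → interval a (suc h) (⊖ x) ≡ true → suc h ≤ p → interval (⊖ (a ⊞ em h)) (suc h) x ≡ true
    reflect {X} {a} h {x} e h≤p = let i , i< , e′ = interval-elim {a} {suc h} e in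
      trans (cong (interval (⊖ (a ⊞ em h)) (suc h)) (trans (sym (⊖-involutive x))
        (trans (cong ⊖_ e′) (trans (solve 3 (λ a i h → :- (a :+ i) := :- (a :+ h) :+ (h :- i)) refl a (em i) (em h))
        (cong (⊖ (a ⊞ em h) ⊞_) (sym (em-∸ (ℕₚ.≤-pred i<))))))))
        (interval-intro {⊖ (a ⊞ em h)} {suc h} {h ∸ i} h≤p (s≤s (ℕₚ.m∸n≤m h i)))

    reflect-eq : ∀ a h j j′ → suc l * h + 1 + j + ((2 + k) * h + 1 + j′) ≡ p → em (2 + k) ⊠ a ⊟ em (suc l) ⊠ a ≡ ⊖ em ((2 + k) * h + 1 + j) →
      em (2 + k) ⊠ ⊖ (a ⊞ em h) ⊟ em (suc l) ⊠ ⊖ (a ⊞ em h) ≡ ⊖ em ((2 + k) * h + 1 + j′)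
    reflect-eq a h j j′ sum e = begin
      em (2 + k) ⊠ ⊖ (a ⊞ em h) ⊟ em (suc l) ⊠ ⊖ (a ⊞ em h)
        ≡⟨ solve 4 (λ K L a h → K :* (:- (a :+ h)) :- L :* (:- (a :+ h)) := (:- (K :* a :- L :* a)) :- K :* h :+ L :* h) refl (em (2 + k))
          (em (suc l)) a (em h) ⟩
      ⊖ (em (2 + k) ⊠ a ⊟ em (suc l) ⊠ a) ⊟ em (2 + k) ⊠ em h ⊞ em (suc l) ⊠ em h
        ≡⟨ cong₂ _⊞_ (cong₂ _⊟_ (trans (cong ⊖_ e) (⊖-involutive _)) (sym (em-* (2 + k) h))) (sym (em-* (suc l) h)) ⟩
      em ((2 + k) * h + 1 + j) ⊟ em ((2 + k) * h) ⊞ em (suc l * h)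
        ≡⟨ cong (λ u → u ⊟ em ((2 + k) * h) ⊞ em (suc l * h)) (trans (cong em (ℕₚ.+-assoc ((2 + k) * h) 1 j)) (em-+ ((2 + k) * h) (suc j))) ⟩
      em ((2 + k) * h) ⊞ em (suc j) ⊟ em ((2 + k) * h) ⊞ em (suc l * h)
        ≡⟨ solve 3 (λ x y z → x :+ y :- x :+ z := z :+ y) refl (em ((2 + k) * h)) (em (suc j)) (em (suc l * h)) ⟩
      em (suc l * h) ⊞ em (suc j)
        ≡⟨ trans (sym (em-+ (suc l * h) (suc j))) (cong em (sym (ℕₚ.+-assoc (suc l * h) 1 j))) ⟩
      em (suc l * h + 1 + j)
        ≡⟨ solve 2 (λ x y → x := (x :+ y) :- y) refl (em (suc l * h + 1 + j)) (em ((2 + k) * h + 1 + j′)) ⟩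
      em (suc l * h + 1 + j) ⊞ em ((2 + k) * h + 1 + j′) ⊟ em ((2 + k) * h + 1 + j′)
        ≡⟨ cong (_⊟ em ((2 + k) * h + 1 + j′)) (trans (sym (em-+ (suc l * h + 1 + j) _)) (trans (cong em sum) em-p)) ⟩
      𝟘 ⊟ em ((2 + k) * h + 1 + j′)
        ≡⟨ ⊞-identityˡ _ ⟩
      ⊖ em ((2 + k) * h + 1 + j′) ∎
      where open ≡-Reasoning

    supp-neg : ∀ w x → supp (w ∙ (⊖ 𝟙ᶠ)) x ≡ supp w (⊖ x)
    supp-neg w x = cong (supp w) (neg⊠ x)

    K-split : (5 + κ) ≡ 2 + k + suc l
    K-split = sym K≡

  negate-contained : ∀ w → Contained w → Contained (w ∙ (⊖ 𝟙ᶠ))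
  negate-contained w (a , j , j≤ , sub , e) = ⊖ (a ⊞ em m) , lam ∸ j , ℕₚ.m∸n≤m lam j ,
      (λ x ex → reflect {supp w} {a} m (sub (⊖ x) (trans (sym (supp-neg w x)) ex)) (≤-trans (n≤1+n _) m+2≤p)) ,
      reflect-eq a m j (lam ∸ j) (trans (lem k l m j (lam ∸ j)) (trans (cong₂ (λ K t → K * m + 2 + t) K≡ (ℕₚ.m+[n∸m]≡n j≤)) (sym p≡))) e
    where
    lem : ∀ k l m j j′ → suc l * m + 1 + j + ((2 + k) * m + 1 + j′) ≡ (2 + k + suc l) * m + 2 + (j + j′)
    lem = solve-∀

  negate-interval : ∀ w → ((a , j , rest) : FullInterval w) → ∃[ a′ ] (∀ x → supp (w ∙ (⊖ 𝟙ᶠ)) x ≡ interval a′ m x) ×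
    (∀ x → supp (w ∙ (⊖ 𝟙ᶠ)) x ≡ true → (w ∙ (⊖ 𝟙ᶠ)) x ≡ N) ×
                   (em (2 + k) ⊠ a′ ⊟ em (suc l) ⊠ a′ ≡ ⊖ em ((2 + k) * (m ∸ 1) + 1 + (5 + κ + lam ∸ j)))
  negate-interval w (a , j , j≤ , isI , full , e) = a′ , (λ x → trans (supp-neg w x) (trans (isI (⊖ x)) (bool-ext (fwd x) (bwd x)))) , (λ x ex → full _ ex) ,
      reflect-eq a m₁ j j′ (trans (lem k l m₁ j j′) (trans (cong₂ (λ K t → K * m₁ + 2 + t) K≡ (ℕₚ.m+[n∸m]≡n j≤))
        (sym (trans p≡ (trans (cong (λ n → (5 + κ) * n + 2 + lam) (sym m₁≡)) (lem′ κ m₁ lam)))))) e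
    where
    a′ = ⊖ (a ⊞ em m₁)
    j′ = 5 + κ + lam ∸ j
    lem : ∀ k l m j j′ → suc l * m + 1 + j + ((2 + k) * m + 1 + j′) ≡ (2 + k + suc l) * m + 2 + (j + j′)
    lem = solve-∀
    lem′ : ∀ κ n l → (5 + κ) * suc n + 2 + l ≡ (5 + κ) * n + 2 + (5 + κ + l)
    lem′ = solve-∀
    sm₁≤p : suc m₁ ≤ p
    sm₁≤p = ≤-trans (≤-reflexive m₁≡) (≤-trans (≤-trans (n≤1+n m) (n≤1+n _)) m+2≤p)
    fwd : ∀ x → interval a m (⊖ x) ≡ true → interval a′ m x ≡ true
    fwd x h = subst (λ n → interval a′ n x ≡ true) m₁≡ (reflect {supp w} {a} m₁ (subst (λ n → interval a n (⊖ x) ≡ true) (sym m₁≡) h) sm₁≤p)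
    bwd : ∀ x → interval a′ m x ≡ true → interval a m (⊖ x) ≡ true
    bwd x h = subst (λ n → interval a n (⊖ x) ≡ true) m₁≡ (trans (cong (λ u → interval u (suc m₁) (⊖ x)) (sym back))
      (reflect {supp w} {a′} m₁ {⊖ x} (trans (cong (interval a′ (suc m₁)) (⊖-involutive x)) (subst (λ n → interval a′ n x ≡ true) (sym m₁≡) h)) sm₁≤p))
      where
      back : ⊖ (a′ ⊞ em m₁) ≡ a
      back = solve 2 (λ a h → :- (:- (a :+ h) :+ h) := a) refl a (em m₁)

  negate-partial : ∀ w → Partial₂ w → Partial₁ (w ∙ (⊖ 𝟙ᶠ))
  negate-partial w (l≡0 , a , sub , ea , em′ , e) = l≡0 , a′ ,
      (λ x ex → reflect {supp w} {a} m (sub (⊖ x) (trans (sym (supp-neg w x)) ex)) (≤-trans (n≤1+n _) m+2≤p)) ,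
      trans (supp-neg w a′) (trans (cong (supp w) (⊖-involutive _)) em′) ,
      trans (supp-neg w (a′ ⊞ em m)) (trans (cong (supp w) (solve 2 (λ a m → :- (:- (a :+ m) :+ m) := a) refl a (em m))) ea) ,
      trans (cong (em (2 + k) ⊠_) (solve 2 (λ a m → :- (a :+ m) :+ m := :- a) refl a (em m)))
        (trans (solve 2 (λ K a → K :* (:- a) := :- (K :* a)) refl (em (2 + k)) a) (cong ⊖_ e))
    where
    a′ = ⊖ (a ⊞ em m)

  Scaled : (𝔽 → ℕ) → Set
  Scaled w = ∃[ d ] (d ≢ 𝟘) × Final (w ∙ d)

  private
    ⊖1≢0 : ⊖ 𝟙ᶠ ≢ 𝟘
    ⊖1≢0 e = em1≢0 (trans (sym (⊖-involutive 𝟙ᶠ)) (trans (cong ⊖_ e) -ᵛ-0))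

    supp-ext : ∀ {v v′ : 𝔽 → ℕ} → (∀ i → v i ≡ v′ i) → ∀ x → supp v x ≡ supp v′ x
    supp-ext h x = cong (λ n → does (1 ≤? n)) (h x)

    Final-ext : ∀ {v v′ : 𝔽 → ℕ} → (∀ i → v i ≡ v′ i) → Final v → Final v′
    Final-ext h (inj₁ (a , j , b , sub , e)) = inj₁ (a , j , b , (λ x ex → sub x (trans (supp-ext h x) ex)) , e)
    Final-ext h (inj₂ (inj₁ (a , j , b , isI , full , e))) = inj₂ (inj₁
      (a , j , b , (λ x → trans (sym (supp-ext h x)) (isI x)) , (λ x ex → trans (sym (h x)) (full x (trans (supp-ext h x) ex))) , e))
    Final-ext h (inj₂ (inj₂ (l≡0 , a , sub , ea , em′ , e))) = inj₂ (inj₂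
      (l≡0 , a , (λ x ex → sub x (trans (supp-ext h x) ex)) , trans (sym (supp-ext h a)) ea , trans (sym (supp-ext h _)) em′ , e))

    unscaled : ∀ w → Final w → Scaled w
    unscaled w f = 𝟙ᶠ , em1≢0 , Final-ext (λ i → cong w (sym (⊠-identityˡ i))) f

    contained-final : ∀ w → Contained w → Scaled w
    contained-final w c@(a , j , j≤ , sub , e) = aux (j ≤? ⌈ suc lam /2⌉ ∸ 1)
      where
      aux : Dec (j ≤ ⌈ suc lam /2⌉ ∸ 1) → Scaled w
      aux (yes h) = unscaled w (inj₁ (a , j , h , sub , e))
      aux (no h) = let a′ , j′ , _ , sub′ , e′ = negate-contained w c in ⊖ 𝟙ᶠ , ⊖1≢0 , inj₁ (a′ , lam ∸ j , half-bound lam j h , sub′ , e′)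

    -- the position of v = l a - k (a + m - 1) = 1 + j decides the type
    interval-final : ∀ w → FullInterval w → Scaled w
    interval-final w c@(a , j , j≤ , isI , full , e) = aux (suc j ≤? suc l) (suc j ≤? lam + suc l + 1) (suc j ≤? 2 + k) (suc j ≤? 2 + k + lam + 1)
      where
      m≤p = ≤-trans (n≤1+n _) m+2≤p
      aux : Dec (suc j ≤ suc l) → Dec (suc j ≤ lam + suc l + 1) → Dec (suc j ≤ 2 + k) → Dec (suc j ≤ 2 + k + lam + 1) → Scaled w
      aux (yes h) _ _ _ = unscaled w (inj₂ (inj₁ (a , j , inj₁ h , isI , full , e)))
      -- ℓ < v ≤ λ + ℓ + 1: the interval can be enlarged to the left by a - 1, which replaces j by j
      -- - ℓ.
      aux (no h₁) (yes h₂) _ _ = contained-final w (a ⊟ em 1 , j ∸ suc l , j-l≤ , sub , eq)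
        where
        l<j : suc l ≤ j
        l<j = ℕₚ.≤-pred (≰⇒> h₁)
        j-l≤ : j ∸ suc l ≤ lam
        j-l≤ = ℕₚ.m≤n+o⇒m∸n≤o j (suc l) (ℕₚ.≤-pred (≤-trans h₂ (≤-reflexive (trans (ℕₚ.+-comm (lam + suc l) 1) (cong suc (ℕₚ.+-comm lam (suc l)))))))
        sub : supp w ⊆ interval (a ⊟ em 1) (suc m)
        sub x ex = let i , i< , e′ = interval-elim {a} {m} (trans (sym (isI x)) ex) in
          trans (cong (interval (a ⊟ em 1) (suc m)) (trans e′ (trans (solve 3 (λ a o n → a :+ n := a :- o :+ (o :+ n)) refl a (em 1) (em i))
            (cong (a ⊟ em 1 ⊞_) (sym (em-+ 1 i)))))) (interval-intro {a ⊟ em 1} {suc m} {suc i} m≤p (s≤s i<))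
        eq : em (2 + k) ⊠ (a ⊟ em 1) ⊟ em (suc l) ⊠ (a ⊟ em 1) ≡ ⊖ em ((2 + k) * m + 1 + (j ∸ suc l))
        eq = trans (solve 3 (λ K L a → K :* (a :- con (+ 1)) :- L :* (a :- con (+ 1)) := (K :* a :- L :* a) :- K :+ L) refl (em (2 + k)) (em (suc l)) a)
          (trans (cong (λ u → u ⊟ em (2 + k) ⊞ em (suc l)) e)
          (trans (solve 3 (λ x K L → :- x :- K :+ L := :- ((K :+ x) :- L)) refl (em ((2 + k) * m₁ + 1 + j)) (em (2 + k)) (em (suc l)))
          (cong ⊖_ (trans (cong (_⊟ em (suc l)) (trans (sym (em-+ (2 + k) _))
            (trans (cong em (trans (cong (λ t → 2 + k + ((2 + k) * m₁ + 1 + t)) (sym (ℕₚ.m∸n+n≡m l<j)))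
            (trans (lem k m₁ (j ∸ suc l) (suc l)) (cong (λ n → (2 + k) * n + 1 + (j ∸ suc l) + suc l) m₁≡)))) (em-+ _ (suc l)))))
            (add-sub (em ((2 + k) * m + 1 + (j ∸ suc l))) (em (suc l)))))))
          where
          lem : ∀ k n t l → 2 + k + ((2 + k) * n + 1 + (t + l)) ≡ (2 + k) * suc n + 1 + t + l
          lem = solve-∀
      aux _ (no h₂) (yes h₃) _ = unscaled w (inj₂ (inj₁ (a , j , inj₂ (≤-trans (≤-reflexive (ℕₚ.+-suc (lam + suc l) 1)) (≰⇒> h₂) , h₃) , isI , full , e)))
      -- k < v ≤ k + λ + 1: the interval can be enlarged to the right by a + m, which replaces j by
      -- j - k.
      aux _ _ (no h₃) (yes h₄) = contained-final w (a , j ∸ (2 + k) , j-k≤ , (λ x ex → interval-mono {a} (n≤1+n m) x (trans (sym (isI x)) ex)) , trans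
        e (cong (λ n → ⊖ em n) eq))
        where
        k<j : 2 + k ≤ j
        k<j = ℕₚ.≤-pred (≰⇒> h₃)
        j-k≤ : j ∸ (2 + k) ≤ lam
        j-k≤ = ℕₚ.m≤n+o⇒m∸n≤o j (2 + k) (ℕₚ.≤-pred (≤-trans h₄ (≤-reflexive (ℕₚ.+-comm (2 + k + lam) 1))))
        lem : ∀ k n t → (2 + k) * n + 1 + (t + (2 + k)) ≡ (2 + k) * suc n + 1 + t
        lem = solve-∀
        eq : (2 + k) * m₁ + 1 + j ≡ (2 + k) * m + 1 + (j ∸ (2 + k))
        eq = trans (cong (λ t → (2 + k) * m₁ + 1 + t) (sym (ℕₚ.m∸n+n≡m k<j)))
          (trans (lem k m₁ (j ∸ (2 + k))) (cong (λ n → (2 + k) * n + 1 + (j ∸ (2 + k))) m₁≡))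
      -- v > k + λ + 1: reflection replaces j by K + λ - j, and the new v is at most ℓ.
      aux _ _ (no _) (no h₄) = let a′ , isI′ , full′ , e′ = negate-interval w c in
          ⊖ 𝟙ᶠ , ⊖1≢0 , inj₂ (inj₁ (a′ , 5 + κ + lam ∸ j , inj₁ (s≤s (ℕₚ.m≤n+o⇒m∸n≤o (5 + κ + lam) j bound)) , isI′ , full′ , e′))
        where
        lem : ∀ k l lam j → 2 + k + suc l + lam + j ≡ j + l + suc (2 + k + lam)
        lem = solve-∀
        bound : 5 + κ + lam ≤ j + l
        bound = ≤-trans (≤-reflexive (cong (_+ lam) K-split)) (linear (2 + k + suc l + lam) (j + l) 0
          (ℕₚ.≤-pred (≤-trans (s≤s (≤-reflexive (ℕₚ.+-comm 1 (2 + k + lam)))) (≰⇒> h₄))) (trans (ℕₚ.+-identityʳ _) (lem k l lam j)))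

    final : ∀ w → Outcome w → Scaled w
    final w (inj₁ c) = contained-final w c
    final w (inj₂ (inj₁ c)) = interval-final w c
    final w (inj₂ (inj₂ (inj₁ c))) = unscaled w (inj₂ (inj₂ c))
    final w (inj₂ (inj₂ (inj₂ c))) = ⊖ 𝟙ᶠ , ⊖1≢0 , inj₂ (inj₂ (negate-partial w c))

  ⊠≢0 : ∀ {d e} → d ≢ 𝟘 → e ≢ 𝟘 → d ⊠ e ≢ 𝟘
  ⊠≢0 {d} {e} d≢0 e≢0 de≡0 = let d⁻ , _ , h = unscale d d≢0 in e≢0 (trans (sym (h e)) (trans (cong (d⁻ ⊠_) de≡0) (⊠-zeroʳ d⁻)))

  classify : ∀ w → Weighted w → Covers → Scaled w
  classify w W covers = line (Analysis.core w W)
    where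
    scale-kind : ∀ S′ d (d≢0 : d ≢ 𝟘) → Analysis.Kind w W S′ → Analysis.Kind (w ∙ d) (rescale d d≢0 W) (scale d S′)
    scale-kind S′ d d≢0 (inj₁ (same , full)) = inj₁ ((λ x → same (d ⊠ x)) , (λ x → full (d ⊠ x)))
    scale-kind S′ d d≢0 (inj₂ (i₀ , e₁ , e₂ , split)) = let d⁻ , h₁ , h₂ = unscale d d≢0 in
      inj₂ (d⁻ ⊠ i₀ , trans (cong (supp w) (h₁ i₀)) e₁ , trans (cong S′ (h₁ i₀)) e₂ , λ x ex → move x d⁻ h₂ (split (d ⊠ x) ex))
      where
      move : ∀ x d⁻ → (∀ x → d⁻ ⊠ (d ⊠ x) ≡ x) → (S′ (d ⊠ x) ≡ true) ⊎ (d ⊠ x ≡ i₀) → (S′ (d ⊠ x) ≡ true) ⊎ (x ≡ d⁻ ⊠ i₀)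
      move x d⁻ h₂ (inj₁ h) = inj₁ h
      move x d⁻ h₂ (inj₂ h) = inj₂ (trans (sym (h₂ x)) (cong (d⁻ ⊠_) h))
    compose : ∀ d → d ≢ 𝟘 → Scaled (w ∙ d) → Scaled w
    compose d d≢0 (e , e≢0 , fin) = d ⊠ e , ⊠≢0 d≢0 e≢0 , Final-ext (λ i → cong w (sym (⊠-assoc d e i))) fin
    rescaled : ∀ S′ → # S′ ≡ m → Analysis.Heavy w W S′ → Analysis.Kind w W S′ → (∃[ d ] (d ≢ 𝟘) × ∃[ a ] (scale d S′ ⊆ interval a (suc m))) → Scaled w
    rescaled S′ S′≡m (sub′ , hv) kind (d , d≢0 , a , sub) = compose d d≢0
      (final (w ∙ d) (analyse (w ∙ d) (rescale d d≢0 W) (scale d S′) (trans (scale-card d S′ d≢0) S′≡m)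
      ((λ x → sub′ (d ⊠ x)) , (λ i j → hv (d ⊠ i) (d ⊠ j))) (scale-kind S′ d d≢0 kind) a sub))
    line : (∃[ S′ ] (# S′ ≡ m) × Analysis.Heavy w W S′ × Analysis.Kind w W S′) → Scaled w
    line (S′ , S′≡m , hv , kind) = rescaled S′ S′≡m hv kind (progression S′ S′≡m (Analysis.heavy-free w W S′ hv) (covers S′ S′≡m))

-- From slice sizes back to subsets

module SetStructure {p : ℕ} .{{_ : NonZero p}} (F : FieldOps p) (Π : Parameters p) where
  open Parameters Π
  open PrimeField F
  open VectorSpace F
  open Isomorphism F
  open 𝔽-Solver using (solve; _:+_; _:*_; _:-_; :-_; _:=_; con)
  module W = PrimeLine F
  module LS = LineStructure F
  open Tuples F using (flip; IdxSum; card-flip)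

  Σs : List Bool
  Σs = signs (2 + k) (suc l)

  _∈⟦_,_⟧ : 𝔽 → 𝔽 → 𝔽 → Set
  x ∈⟦ b , c ⟧ = toℕ (x ⊟ b) ≤ toℕ (c ⊟ b)

  -- `Trivial` over abstract field operations. For the concrete field the two agree by computation,
  -- and so do `IsType1` and `Type1`.
  IsTrivial : ∀ n → (Vec 𝔽 (suc n) → Bool) → Set
  IsTrivial n A = ∃[ j ] (j ≤ ⌈ suc lam /2⌉ ∸ 1) × ∃[ a ] (em (((2 + k) ∸ suc l) * toℕ a) ≡ ⊖ em ((2 + k) * m + 1 + j)) ×
    ∃[ φ ] Aut φ × (∀ x → A x ≡ true → Vec.head (φ x) ∈⟦ a , a ⊞ em m ⟧)

  IsType1 : ∀ n → (Vec 𝔽 (suc n) → Bool) → Set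
  IsType1 n A = ∃[ a ] (let v = em (suc l * toℕ a) ⊟ em ((2 + k) * toℕ (a ⊞ em (m ∸ 1))) in
      (v ∈⟦ em 1 , em (suc l) ⟧) ⊎ ((lam + suc l + 2 ≤ 2 + k) × (v ∈⟦ em (lam + suc l + 2) , em (2 + k) ⟧))) ×
    ∃[ φ ] Aut φ × (∀ x → (A x ≡ true → Vec.head (φ x) ∈⟦ a , a ⊞ em (m ∸ 1) ⟧) × (Vec.head (φ x) ∈⟦ a , a ⊞ em (m ∸ 1) ⟧ → A x ≡ true))

  IsFree : ∀ n → (Vec 𝔽 (suc n) → Bool) → Set
  IsFree n A = ¬ AdditiveCombinatorics.SumOf (vecSpace n) (map (Spectral.signed F n A) Σs) zeros

  private
    K-length : length Σs ≡ 5 + (lam + mu)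
    K-length = trans (Listₚ.length-++ (replicate (2 + k) true)) (trans (cong₂ _+_ (Listₚ.length-replicate (2 + k)) (Listₚ.length-replicate (suc l))) K≡)
    K+≤p : 5 + (lam + mu) + lam + 4 ≤ p
    K+≤p = ≤-trans m≥ (≤-trans (≤-trans (n≤1+n m) (n≤1+n _)) m+2≤p)

  scaleMap : ∀ {n} → 𝔽 → Vec 𝔽 (suc n) → Vec 𝔽 (suc n)
  scaleMap d (x ∷ y) = (d ⊠ x) ∷ y

  scaleMap-aut : ∀ {n} d d⁻ → (∀ x → d ⊠ (d⁻ ⊠ x) ≡ x) → (∀ x → d⁻ ⊠ (d ⊠ x) ≡ x) → Aut {suc n} (scaleMap d⁻)
  scaleMap-aut d d⁻ h₁ h₂ = (λ { (x ∷ xs) (y ∷ ys) → cong (_∷ (xs ⊹ ys)) (⊠-distribˡ d⁻ x y) }) , scaleMap d ,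
    (λ { (x ∷ xs) → cong (_∷ xs) (h₁ x) }) , (λ { (x ∷ xs) → cong (_∷ xs) (h₂ x) })

  module _ {n : ℕ} (A : Vec 𝔽 (suc n) → Bool) {φ : Vec 𝔽 (suc n) → Vec 𝔽 (suc n)} (aut : Aut φ) where
    private
      module V = AdditiveCombinatorics (vecSpace n)
      module Sp = Spectral F n
      ψ = proj₁ (proj₂ aut)
      ψφ = proj₁ (proj₂ (proj₂ aut))
      ψ-+ = proj₁ (Aut-inverse aut)
      ψ-0 : ψ zeros ≡ zeros
      ψ-0 = trans (sym (V.add-sub (ψ zeros) (ψ zeros))) (trans (cong (V._-ᵛ ψ zeros) (trans (sym (ψ-+ zeros zeros)) (cong ψ (V.+ᵛ-identityˡ zeros))))
        (V.-ᵛ-inverseʳ (ψ zeros)))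
      ψ-neg : ∀ x → ψ (V.-ᵛ x) ≡ V.-ᵛ (ψ x)
      ψ-neg x = trans (sym (V.add-sub (ψ (V.-ᵛ x)) (ψ x))) (trans (cong (V._-ᵛ ψ x)
        (trans (sym (ψ-+ (V.-ᵛ x) x)) (trans (cong ψ (V.-ᵛ-inverseˡ x)) ψ-0))) (V.+ᵛ-identityˡ _))
      ψ-sub : ∀ x y → ψ (x V.-ᵛ y) ≡ ψ x V.-ᵛ ψ y
      ψ-sub x y = trans (ψ-+ x (V.-ᵛ y)) (cong (ψ x V.+ᵛ_) (ψ-neg y))
      SumOf-aut : ∀ σs z → V.SumOf (map (Sp.signed (A ∘ ψ)) σs) z → V.SumOf (map (Sp.signed A) σs) (ψ z)
      SumOf-aut [] z e = trans (cong ψ e) ψ-0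
      SumOf-aut (σ ∷ σs) z (x , ex , s) = ψ x , member σ ex , subst (V.SumOf (map (Sp.signed A) σs)) (ψ-sub z x) (SumOf-aut σs (z V.-ᵛ x) s)
        where
        member : ∀ σ → Sp.signed (A ∘ ψ) σ x ≡ true → Sp.signed A σ (ψ x) ≡ true
        member true  h = h
        member false h = trans (cong A (sym (ψ-neg x))) h

    free-aut : IsFree n A → IsFree n (A ∘ ψ)
    free-aut fr s = fr (subst (V.SumOf (map (Sp.signed A) Σs)) ψ-0 (SumOf-aut Σs zeros s))

    trivial-aut : IsTrivial n (A ∘ ψ) → IsTrivial n A
    trivial-aut (j , j≤ , a , e , φ′ , aut′ , h) = j , j≤ , a , e , φ′ ∘ φ , Aut-∘ aut aut′ , λ x ex → h (φ x) (trans (cong A (ψφ x)) ex)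

    type1-aut : IsType1 n (A ∘ ψ) → IsType1 n A
    type1-aut (a , v , φ′ , aut′ , h) = a , v , φ′ ∘ φ , Aut-∘ aut aut′ , λ x →
      (λ ex → proj₁ (h (φ x)) (trans (cong A (ψφ x)) ex)) , (λ r → trans (cong A (sym (ψφ x))) (proj₂ (h (φ x)) r))

  identity-aut : ∀ {n} → Aut {n} (λ x → x)
  identity-aut = (λ _ _ → refl) , (λ x → x) , (λ _ → refl) , (λ _ → refl)

  toℕ-⊟ : ∀ {x y} → y ≤ x → x < p → toℕ (em x ⊟ em y) ≡ x ∸ y
  toℕ-⊟ {x} {y} y≤x x<p = trans (cong toℕ (sym (LS.em-∸ y≤x))) (toℕ-em-< (≤-trans (s≤s (ℕₚ.m∸n≤m x y)) x<p))

  toℕ-top : ∀ a {h} → h < p → toℕ ((a ⊞ em h) ⊟ a) ≡ h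
  toℕ-top a {h} h<p = trans (cong toℕ (W.add-sub′ a (em h))) (toℕ-em-< h<p)

  em-k∸l : ∀ a → em (((2 + k) ∸ suc l) * toℕ a) ≡ em (2 + k) ⊠ a ⊟ em (suc l) ⊠ a
  em-k∸l a = trans (em-* ((2 + k) ∸ suc l) (toℕ a)) (trans (cong₂ _⊠_ (LS.em-∸ (<⇒≤ l<k)) (em-toℕ a))
    (solve 3 (λ K L a → (K :- L) :* a := K :* a :- L :* a) refl (em (2 + k)) (em (suc l)) a))

  module _ {n : ℕ} (C : Vec 𝔽 (suc n) → Bool) where

    weight-pos : ∀ {i y} → C (i ∷ y) ≡ true → 1 ≤ weight C i
    weight-pos {i} {y} e = FiniteSet.card-pos (Vecs-finite n) (λ y → C (i ∷ y)) e

    weight-full : ∀ {i} → weight C i ≡ p ^ n → ∀ y → C (i ∷ y) ≡ true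
    weight-full {i} e = FiniteSet.⊆-full (Vecs-finite n) (λ y → C (i ∷ y)) (≤-reflexive (trans (card-Vecs n) (sym e)))

    weight≤ : ∀ i → weight C i ≤ p ^ n
    weight≤ i = ≤-trans (FiniteSet.card-≤full (Vecs-finite n) (λ y → C (i ∷ y))) (≤-reflexive (card-Vecs n))

  module Conclusions (n : ℕ) (N≥1 : 1 ≤ p ^ n) (N-odd : ∀ x → x + x ≢ p ^ n) where
    open WeightClassification F Π (p ^ n) N≥1 N-odd using (supp; Weighted; Covers)
    open Outcomes F Π (p ^ n) N≥1 N-odd using (Partial₁)
    open FinalOutcomes F Π (p ^ n) N≥1 N-odd

    trivial-from : (C : Vec 𝔽 (suc n) → Bool) → SmallContained (weight C) → IsTrivial n C
    trivial-from C (a , j , j≤ , sub , e) = j , j≤ , a , trans (em-k∸l a) e , (λ x → x) , identity-aut ,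
      λ { (i ∷ y) ex → ≤-trans (ℕₚ.≤-pred (does-true (toℕ (i ⊟ a) <? suc m) (sub i (does-intro (1 ≤? weight C i) (weight-pos C ex)))))
        (≤-reflexive (sym (toℕ-top a (<⇒≤ m+2≤p)))) }

    type1-from : (C : Vec 𝔽 (suc n) → Bool) → NormalInterval (weight C) → IsType1 n C
    type1-from C (a , j , range , isI , full , e) = a , position range , (λ x → x) , identity-aut , members
      where
      m₁<p : m₁ < p
      m₁<p = ≤-trans (≤-reflexive m₁≡) (≤-trans (≤-trans (n≤1+n m) (n≤1+n _)) m+2≤p)
      v≡ : em (suc l * toℕ a) ⊟ em ((2 + k) * toℕ (a ⊞ em m₁)) ≡ em (suc j)
      v≡ = begin
        em (suc l * toℕ a) ⊟ em ((2 + k) * toℕ (a ⊞ em m₁))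
          ≡⟨ cong₂ _⊟_ (trans (em-* (suc l) (toℕ a)) (cong (em (suc l) ⊠_) (em-toℕ a))) (trans (em-* (2 + k) _) (cong (em (2 + k) ⊠_) (em-toℕ (a ⊞ em m₁)))) ⟩
        em (suc l) ⊠ a ⊟ em (2 + k) ⊠ (a ⊞ em m₁)
          ≡⟨ solve 4 (λ L K a h → L :* a :- K :* (a :+ h) := (:- (K :* a :- L :* a)) :- K :* h) refl (em (suc l)) (em (2 + k)) a (em m₁) ⟩
        ⊖ (em (2 + k) ⊠ a ⊟ em (suc l) ⊠ a) ⊟ em (2 + k) ⊠ em m₁
          ≡⟨ cong₂ _⊟_ (trans (cong ⊖_ e) (⊖-involutive _)) (sym (em-* (2 + k) m₁)) ⟩
        em ((2 + k) * m₁ + 1 + j) ⊟ em ((2 + k) * m₁)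
          ≡⟨ cong (_⊟ em ((2 + k) * m₁)) (trans (cong em (ℕₚ.+-assoc ((2 + k) * m₁) 1 j)) (em-+ ((2 + k) * m₁) (suc j))) ⟩
        em ((2 + k) * m₁) ⊞ em (suc j) ⊟ em ((2 + k) * m₁)
          ≡⟨ W.add-sub′ (em ((2 + k) * m₁)) (em (suc j)) ⟩
        em (suc j) ∎
        where open ≡-Reasoning
      k<p : 2 + k < p
      k<p = ≤-trans (≤-trans (≤-trans (≤-reflexive (ℕₚ.+-comm 1 (2 + k))) (+-monoʳ-≤ (2 + k) (s≤s z≤n)))
        (≤-trans (≤-reflexive K≡) (≤-trans (m≤m+n _ lam) (m≤m+n _ 4)))) K+≤p
      v = em (suc l * toℕ a) ⊟ em ((2 + k) * toℕ (a ⊞ em m₁))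
      within : ∀ {b c} → b ≤ suc j → suc j ≤ c → c < p → v ∈⟦ em b , em c ⟧
      within {b} {c} b≤ ≤c c<p = ≤-trans (≤-reflexive (trans (cong (λ u → toℕ (u ⊟ em b)) v≡) (toℕ-⊟ b≤ (≤-trans (s≤s ≤c) c<p))))
        (≤-trans (ℕₚ.∸-monoˡ-≤ b ≤c) (≤-reflexive (sym (toℕ-⊟ (≤-trans b≤ ≤c) c<p))))
      position : (suc j ≤ suc l) ⊎ ((lam + suc l + 2 ≤ suc j) × (suc j ≤ 2 + k)) → (v ∈⟦ em 1 , em (suc l) ⟧) ⊎
        ((lam + suc l + 2 ≤ 2 + k) × (v ∈⟦ em (lam + suc l + 2) , em (2 + k) ⟧))
      position (inj₁ h) = inj₁ (within (s≤s z≤n) h (≤-trans l<k (<⇒≤ k<p)))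
      position (inj₂ (h₁ , h₂)) = inj₂ (≤-trans h₁ h₂ , within h₁ h₂ k<p)
      members : ∀ x → (C x ≡ true → Vec.head x ∈⟦ a , a ⊞ em m₁ ⟧) × (Vec.head x ∈⟦ a , a ⊞ em m₁ ⟧ → C x ≡ true)
      members (i ∷ y) = (λ ex → ≤-trans (ℕₚ.≤-pred (≤-trans (does-true (toℕ (i ⊟ a) <? m)
        (trans (sym (isI i)) (does-intro (1 ≤? weight C i) (weight-pos C ex)))) (≤-reflexive (sym m₁≡)))) (≤-reflexive (sym (toℕ-top a m₁<p)))) ,
        (λ h → weight-full C (full i (trans (isI i) (does-intro (toℕ (i ⊟ a) <? m)
          (≤-trans (s≤s (≤-trans h (≤-reflexive (toℕ-top a m₁<p)))) (≤-reflexive m₁≡))))) y)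

  -- In dimension 1 slices are points and N = 1. There is no functional to choose, and the
  -- Cauchy-Davenport bound alone limits the support to m + 1.
  weighted-0 : ∀ N≥1 N-odd (A : Vec 𝔽 1 → Bool) → IsFree 0 A → m * p ^ 0 ≤ count A (allVecs p 1) →
               WeightClassification.Weighted F Π (p ^ 0) N≥1 N-odd (weight A)
  weighted-0 N≥1 N-odd A fr mass = record
    { w≤N = weight≤ A
    ; mass = ≤-trans mass (≤-reflexive (card-weight 0 A A))
    ; few = few
    ; pair = λ σ₁ i₁ σ₂ i₂ ps π big pos is → fr (V.SumOf-↭ (↭ₚ.map⁺ (Sp.signed A) π)
        (subst (λ L → V.SumOf (Sp.signed A σ₁ ∷ Sp.signed A σ₂ ∷ L) zeros) (Listₚ.map-∘ ps)
          (lift ((σ₁ , i₁) ∷ (σ₂ , i₂) ∷ ps) 𝟘 (first σ₁ i₁ σ₂ i₂ big ∷ second′ σ₁ i₁ σ₂ i₂ big ∷ pos) is))) }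
    where
    module V = AdditiveCombinatorics (vecSpace 0)
    module Sp = Spectral F 0
    first : ∀ σ₁ i₁ σ₂ i₂ → 1 < weight A (flip σ₁ i₁) + weight A (flip σ₂ i₂) → 1 ≤ weight A (flip σ₁ i₁)
    first σ₁ i₁ σ₂ i₂ big = +-cancelʳ-≤ 1 1 _ (≤-trans big (+-monoʳ-≤ (weight A (flip σ₁ i₁)) (weight≤ A (flip σ₂ i₂))))
    second′ : ∀ σ₁ i₁ σ₂ i₂ → 1 < weight A (flip σ₁ i₁) + weight A (flip σ₂ i₂) → 1 ≤ weight A (flip σ₂ i₂)
    second′ σ₁ i₁ σ₂ i₂ big = +-cancelˡ-≤ 1 1 _ (≤-trans big (+-monoˡ-≤ (weight A (flip σ₂ i₂)) (weight≤ A (flip σ₁ i₁))))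
    at : ∀ σ i → 1 ≤ weight A (flip σ i) → Sp.signed A σ (i ∷ []) ≡ true
    at true  i h = let _ , e = FiniteSet.card-witness (Vecs-finite 0) (λ y → A (i ∷ y)) h in weight-full A (ℕₚ.≤-antisym (weight≤ A i) h) []
    at false i h = weight-full A (ℕₚ.≤-antisym (weight≤ A (⊖ i)) h) []
    lift : ∀ ps z → All (λ z → 1 ≤ weight A (flip (proj₁ z) (proj₂ z))) ps → IdxSum ps z → V.SumOf (map (Sp.signed A ∘ proj₁) ps) (z ∷ [])
    lift [] z [] e = cong (_∷ []) e
    lift ((σ , i) ∷ ps) z (h ∷ pos) s = (i ∷ []) , at σ i h , lift ps (z ⊟ i) pos s
    S = λ i → does (1 ≤? weight A i)
    liftS : ∀ σs z → W.SumOf (map (LS.sg S) σs) z → V.SumOf (map (Sp.signed A) σs) (z ∷ [])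
    liftS [] z e = cong (_∷ []) e
    liftS (σ ∷ σs) z (i , ei , s) = (i ∷ []) , at σ i (does-true (1 ≤? weight A (flip σ i)) ei) , liftS σs (z ⊟ i) s
    few : W.# S ≤ suc m
    few = ℕₚ.≮⇒≥ λ big → fr (liftS Σs 𝟘 (W.SumOf-full (LS.sg S true) (LS.sg S true) (map (LS.sg S) (rest₊ k l)) (nonempty big Σs)
        (≤-trans (enough big) (≤-reflexive (sym (totals Σs)))) 𝟘))
      where
      nonempty : suc m < W.# S → ∀ σs → All W.Nonempty (map (LS.sg S) σs)
      nonempty big [] = []
      nonempty big (σ ∷ σs) = W.card-witness (LS.sg S σ) (≤-trans (≤-trans (s≤s z≤n) big) (≤-reflexive (sym (card-flip σ S)))) ∷ nonempty big σs
      totals : ∀ σs → W.total (map (LS.sg S) σs) ≡ length σs * W.# S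
      totals [] = refl
      totals (σ ∷ σs) = cong₂ _+_ (card-flip σ S) (totals σs)
      len₊ : length (map (LS.sg S) (rest₊ k l)) ≡ 3 + (lam + mu)
      len₊ = trans (Listₚ.length-map (LS.sg S) (rest₊ k l)) (ℕₚ.suc-injective (ℕₚ.suc-injective K-length))
      enough : suc m < W.# S → p * 1 + length (map (LS.sg S) (rest₊ k l)) * 1 < length Σs * W.# S
      enough big = subst₂ (λ u v → p * 1 + u * 1 < v * W.# S) (sym len₊) (sym K-length)
        (linear (suc (p * 1 + (3 + (lam + mu)) * 1)) ((5 + (lam + mu)) * W.# S) (4 + mu) (+-mono-≤ (*-monoʳ-≤ (5 + (lam + mu)) big) (≤-reflexive p≡))
          (lem lam mu m (W.# S) p))
        where
        lem : ∀ l u m s p → suc (p * 1 + (3 + (l + u)) * 1) + ((5 + (l + u)) * s + ((5 + (l + u)) * m + 2 + l)) + (4 + u) ≡ (5 + (l + u)) * s +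
          ((5 + (l + u)) * suc (suc m) + p)
        lem = solve-∀

  weighted-suc : ∀ r N≥1 N-odd (B : Vec 𝔽 (2 + r) → Bool) → IsFree (suc r) B → m * p ^ suc r ≤ count B (allVecs p (2 + r)) →
    p ^ suc r * p * ((5 + (lam + mu) + lam + 4) * (5 + (lam + mu) + 1)) ≤ (5 + (lam + mu)) * ℕΣ.∑ (allFin p)
      (λ i → ℤ.∣ + p ℤ.* + weight B i ℤ.- + count B (allVecs p (2 + r)) ∣) →
    WeightClassification.Weighted F Π (p ^ suc r) N≥1 N-odd (weight B)
  weighted-suc r N≥1 N-odd B fr mass large = record
    { w≤N = weight≤ B
    ; mass = ≤-trans mass (≤-reflexive (card-weight (suc r) B B))
    ; few = Dichotomy.support-bound F r B lam mu m p≡ m≥ Σs K-length fr mass large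
    ; pair = pair }
    where
    open Tuples.Slices F r B
    open Spectral F (suc r) using (signed)
    pair : ∀ σ₁ i₁ σ₂ i₂ ps → (σ₁ ∷ σ₂ ∷ map proj₁ ps) ↭ Σs → p ^ suc r < w (flip σ₁ i₁) + w (flip σ₂ i₂) →
           All (λ z → 1 ≤ w (flip (proj₁ z) (proj₂ z))) ps → ¬ IdxSum ((σ₁ , i₁) ∷ (σ₂ , i₂) ∷ ps) 𝟘
    pair σ₁ i₁ σ₂ i₂ ps π big pos is = fr (V.SumOf-↭ (↭ₚ.map⁺ (signed B) π)
      (subst (λ L → V.SumOf (signed B σ₁ ∷ signed B σ₂ ∷ L) zeros) (Listₚ.map-∘ ps)
        (lift-SumOf ((σ₁ , i₁) ∷ (σ₂ , i₂) ∷ ps) 𝟘 zeros is (H.SumOf-full-++ (X₁ ∷ X₂ ∷ []) (map piece ps) full₂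
          (Allₚ.map⁺ (All.map (λ {z} → member z) pos)) zeros))))
      where
      X₁ = piece (σ₁ , i₁)
      X₂ = piece (σ₂ , i₂)
      member : ∀ z → 1 ≤ w (flip (proj₁ z) (proj₂ z)) → H.Nonempty (piece z)
      member (σ , i) h = H.card-witness (piece (σ , i)) (≤-trans h (≤-reflexive (sym (card-piece σ i))))
      full₂ : ∀ z → H.SumOf (X₁ ∷ X₂ ∷ []) z
      full₂ z = let x , ex , ey = H.⊕-elim X₁ X₂ {z} (H.pigeonhole X₁ X₂ (≤-trans (s≤s (≤-reflexive H.size)) (≤-trans big (≤-reflexive (sym (cong₂ _+_ (card-piece σ₁ i₁) (card-piece σ₂ i₂)))))) z)
                in x , ex , (z H.-ᵛ x) , ey , H.-ᵛ-inverseʳ _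

-- Complementary end slices and type 2

module Cosets {p : ℕ} {F : FieldOps p} (Sp : Space F) where
  open PrimeField F
  open AdditiveCombinatorics Sp
  open 𝔽-Solver using (solve; _:+_; _:*_; _:-_; :-_; _:=_; con)

  -- If T misses U + U + k u₀ and |T| + |U| = |G|, then |U + U| = |U|, so U is
  -- the coset u₀ + V of a subspace V, and T is the complement of (2 + k) u₀ + V.
  module _ (U T : V → Bool) (u₀ : V) (eu₀ : U u₀ ≡ true) (k : ℕ)
           (disjoint : ∀ u u′ y → U u ≡ true → U u′ ≡ true → T y ≡ true → (u +ᵛ u′) +ᵛ em k · u₀ ≢ y) where
    private
      ku₀ = em k · u₀
      UU = U ⊕ U
      Z = shift ku₀ UU

      T⊆∁Z : T ⊆ ∁ Z
      T⊆∁Z y ey = cong not (¬true⇒false λ ez → let u , eu , eu′ = ⊕-elim U U ez in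
        disjoint u ((y -ᵛ ku₀) -ᵛ u) y eu eu′ ey (trans (cong (_+ᵛ ku₀) (trans (+ᵛ-comm u _) (sub-add (y -ᵛ ku₀) u))) (sub-add y ku₀)))

      T+UU : # T + # UU ≤ # full
      T+UU = ≤-trans (+-mono-≤ (card-mono T⊆∁Z) (≤-reflexive (sym (card-shift ku₀ UU)))) (≤-reflexive (card-∁ Z))

      U≤UU : # U ≤ # UU
      U≤UU = card-⊕ˡ U U eu₀

    sizes≤ : # T + # U ≤ # full
    sizes≤ = ≤-trans (+-monoʳ-≤ (# T) U≤UU) T+UU

    module _ (sizes≥ : # full ≤ # T + # U) where
      private
        UU⊆ : UU ⊆ shift u₀ U
        UU⊆ = ⊆-antisym-card (shift u₀ U) UU (λ z ez → ⊕-intro′ U U {z -ᵛ u₀} {z} ez (trans (cong U (sub-sub z u₀)) eu₀))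
          (≤-trans (+-cancelˡ-≤ (# T) _ _ (≤-trans T+UU sizes≥)) (≤-reflexive (sym (card-shift u₀ U))))

        ∁Z⊆T : ∁ Z ⊆ T
        ∁Z⊆T = ⊆-antisym-card T (∁ Z) T⊆∁Z (+-cancelʳ-≤ (# Z) _ _ (≤-trans (≤-reflexive (card-∁ Z))
          (≤-trans sizes≥ (+-monoʳ-≤ (# T) (≤-trans U≤UU (≤-reflexive (sym (card-shift ku₀ UU))))))))

      direction : V → Bool
      direction y = U (y +ᵛ u₀)

      direction-0 : direction 0ᵛ ≡ true
      direction-0 = trans (cong U (+ᵛ-identityˡ u₀)) eu₀

      direction-+ : ∀ x y → direction x ≡ true → direction y ≡ true → direction (x +ᵛ y) ≡ true
      direction-+ x y ex ey = trans (cong U eq) (UU⊆ ((x +ᵛ u₀) +ᵛ (y +ᵛ u₀)) (⊕-intro U U ex ey))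
        where
        eq : (x +ᵛ y) +ᵛ u₀ ≡ ((x +ᵛ u₀) +ᵛ (y +ᵛ u₀)) -ᵛ u₀
        eq = sym (trans (cong (_-ᵛ u₀) (sym (+ᵛ-assoc (x +ᵛ u₀) y u₀)))
          (trans (add-sub ((x +ᵛ u₀) +ᵛ y) u₀) (trans (+ᵛ-assoc x u₀ y) (trans (cong (x +ᵛ_) (+ᵛ-comm u₀ y)) (sym (+ᵛ-assoc x y u₀))))))

      direction-· : ∀ c x → direction x ≡ true → direction (c · x) ≡ true
      direction-· c x ex = subst (λ c → direction (c · x) ≡ true) (em-toℕ c) (go (toℕ c))
        where
        go : ∀ n → direction (em n · x) ≡ true
        go zero    = trans (cong direction (0· x)) direction-0
        go (suc n) = trans (cong direction (trans (cong (_· x) (em-+ 1 n)) (trans (·-distrib 𝟙ᶠ (em n) x) (cong (_+ᵛ em n · x) (·-identity x)))))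
          (direction-+ x (em n · x) ex (go n))

      complement : ∀ y → T y ≡ not (direction (y -ᵛ em (2 + k) · u₀))
      complement y = trans (bool-ext (T⊆∁Z y) (∁Z⊆T y)) (cong not (bool-ext
          (λ ez → trans (cong U (sym eq)) (UU⊆ (y -ᵛ ku₀) ez))
          (λ ev → ⊕-intro′ U U {y -ᵛ ku₀ -ᵛ u₀} {y -ᵛ ku₀} (trans (cong U eq) ev) (trans (cong U (sub-sub (y -ᵛ ku₀) u₀)) eu₀))))
        where
        kk≡ : em (2 + k) · u₀ ≡ (ku₀ +ᵛ u₀) +ᵛ u₀
        kk≡ = trans (cong (_· u₀) (trans (em-+ 1 (suc k)) (trans (cong (𝟙ᶠ ⊞_) (em-+ 1 k))
          (solve 1 (λ k → con (+ 1) :+ (con (+ 1) :+ k) := k :+ con (+ 1) :+ con (+ 1)) refl (em k)))))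
          (trans (·-distrib (em k ⊞ 𝟙ᶠ) 𝟙ᶠ u₀) (cong₂ _+ᵛ_ (trans (·-distrib (em k) 𝟙ᶠ u₀) (cong (ku₀ +ᵛ_) (·-identity u₀))) (·-identity u₀)))
        eq : (y -ᵛ ku₀) -ᵛ u₀ ≡ (y -ᵛ em (2 + k) · u₀) +ᵛ u₀
        eq = sym (trans (cong (λ v → (y -ᵛ v) +ᵛ u₀) kk≡) (trans (cong (_+ᵛ u₀) (sub-+ y (ku₀ +ᵛ u₀) u₀))
          (trans (sub-add (y -ᵛ (ku₀ +ᵛ u₀)) u₀) (sub-+ y ku₀ u₀))))

      -- The shear y ↦ y + c g with b g = - u₀ moves U (at level b) to V; since
      -- a = (2 + k) b it moves T (at level a) to the complement of V.
      module _ (a b b⁻ : 𝔽) (b⁻b : b⁻ ⊠ b ≡ 𝟙ᶠ) (a≡ : em (2 + k) ⊠ b ≡ a) where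
        slope : V
        slope = (⊖ b⁻) · u₀

        private
          bg : b · slope ≡ -ᵛ u₀
          bg = trans (sym (·-assoc b (⊖ b⁻) u₀)) (trans (cong (_· u₀) (trans (solve 2 (λ b w → b :* (:- w) := :- (w :* b)) refl b b⁻) (cong ⊖_ b⁻b)))
            (trans (⊖· 𝟙ᶠ u₀) (cong -ᵛ_ (·-identity u₀))))
          ag : a · slope ≡ -ᵛ (em (2 + k) · u₀)
          ag = trans (cong (_· slope) (sym a≡)) (trans (·-assoc (em (2 + k)) b slope)
            (trans (cong (em (2 + k) ·_) (trans bg (trans (cong -ᵛ_ (sym (·-identity u₀))) (sym (⊖· 𝟙ᶠ u₀)))))
                (trans (sym (·-assoc (em (2 + k)) (⊖ 𝟙ᶠ) u₀)) (trans (cong (_· u₀) (solve 1 (λ K → K :* (:- con (+ 1)) := :- K) refl (em (2 + k))))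
                  (⊖· (em (2 + k)) u₀)))))

        lower : ∀ y → T y ≡ not (direction (y +ᵛ a · slope))
        lower y = trans (complement y) (cong (λ v → not (direction (y +ᵛ v))) (sym ag))

        upper : ∀ y → U y ≡ direction (y +ᵛ b · slope)
        upper y = cong U (sym (trans (cong (λ v → (y +ᵛ v) +ᵛ u₀) bg) (sub-add y u₀)))

module PartialSets {p : ℕ} .{{_ : NonZero p}} (F : FieldOps p) (Π : Parameters p) where
  open Parameters Π
  open PrimeField F
  open VectorSpace F
  open Isomorphism F
  open SetStructure F Π
  open 𝔽-Solver using (solve; _:+_; _:*_; _:-_; :-_; _:=_; con)

  -- `Type2Set` with head and tail as separate arguments, so that it unfolds without matching on the
  -- vector.
  Layers : ∀ {n} → 𝔽 → (Vec 𝔽 n → Bool) → 𝔽 → Vec 𝔽 n → Set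
  Layers a V c y = ((c ≡ a) × (V y ≡ false)) ⊎ (c ∈⟦ a ⊞ em 1 , a ⊞ em (m ∸ 1) ⟧) ⊎ ((c ≡ a ⊞ em m) × (V y ≡ true))

  IsSubspace : ∀ {n} → (Vec 𝔽 n → Bool) → Set
  IsSubspace V = (V zeros ≡ true) × (∀ x y → V x ≡ true → V y ≡ true → V (x ⊹ y) ≡ true) × (∀ c x → V x ≡ true → V (Vec.map (c ⊠_) x) ≡ true) ×
    (∃[ x ] V x ≡ false)

  IsType2 : ∀ n → (Vec 𝔽 (suc n) → Bool) → Set
  IsType2 n A = (suc l ≡ 1) × (1 ≤ n) × ∃[ a ] (⊖ em (((2 + k) ∸ suc l) * toℕ a) ≡ em (m * (2 + k))) ×
    ∃[ V ] IsSubspace V × ∃[ φ ] Aut φ × (∀ x → (A x ≡ true → Layers a V (Vec.head (φ x)) (Vec.tail (φ x))) ×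
      (Layers a V (Vec.head (φ x)) (Vec.tail (φ x)) → A x ≡ true))

  type2-aut : ∀ {n} (A : Vec 𝔽 (suc n) → Bool) {φ} (aut : Aut φ) → IsType2 n (A ∘ proj₁ (proj₂ aut)) → IsType2 n A
  type2-aut A {φ} aut@(_ , ψ , ψφ , _) (l≡ , 1≤n , a , e , V , sub , φ′ , aut′ , h) = l≡ , 1≤n , a , e , V , sub , φ′ ∘ φ , Aut-∘ aut aut′ , λ x →
    (λ ex → proj₁ (h (φ x)) (trans (cong A (ψφ x)) ex)) , (λ r → trans (cong A (sym (ψφ x))) (proj₂ (h (φ x)) r))

  module _ (n : ℕ) (N≥1 : 1 ≤ p ^ n) (N-odd : ∀ x → x + x ≢ p ^ n) (C : Vec 𝔽 (suc n) → Bool) (fr : IsFree n C)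
           (l≡0 : l ≡ 0) (a : 𝔽) (top : em (2 + k) ⊠ (a ⊞ em m) ≡ a) where
    private
      module V = AdditiveCombinatorics (vecSpace n)
      module Sp = Spectral F n
      b = a ⊞ em m
    -- k elements of the layer b = a + m add up to the layer a.
    layers-disjoint : ∀ u u′ u₀ y → C (b ∷ u) ≡ true → C (b ∷ u′) ≡ true → C (b ∷ u₀) ≡ true → C (a ∷ y) ≡ true → (u ⊹ u′) ⊹ Vec.map (em k ⊠_) u₀ ≢ y
    layers-disjoint u u′ u₀ y eu eu′ eu₀ ey e = fr (subst (λ L → V.SumOf L zeros) (sym unfold)
      ((b ∷ u) , eu , (b ∷ u′) , eu′ , V.SumOf-replicate k C (b ∷ u₀) (V.neg C ∷ []) _ eu₀
        ((V.-ᵛ (a ∷ y)) , trans (cong C (V.-ᵛ-involutive (a ∷ y))) ey , last)))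
      where
      unfold : map (Sp.signed C) Σs ≡ C ∷ C ∷ replicate k C ++ (V.neg C ∷ [])
      unfold = trans (cong (λ n → map (Sp.signed C) (signs (2 + k) (suc n))) l≡0)
        (trans (Listₚ.map-++ (Sp.signed C) (replicate (2 + k) true) (false ∷ [])) (cong (_++ (V.neg C ∷ [])) (Listₚ.map-replicate (Sp.signed C) (2 + k) true)))
      x₁ = b ∷ u
      x₂ = b ∷ u′
      x₃ = em k V.· (b ∷ u₀)
      sum≡ : (x₁ V.+ᵛ x₂) V.+ᵛ x₃ ≡ a ∷ y
      sum≡ = cong₂ _∷_ (trans (solve 2 (λ b k → b :+ b :+ k :* b := (con (+ 1) :+ (con (+ 1) :+ k)) :* b) refl b (em k))
        (trans (cong (_⊠ b) (trans (cong (𝟙ᶠ ⊞_) (sym (em-+ 1 k))) (sym (em-+ 1 (suc k))))) top)) e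
      last : (((V.0ᵛ V.-ᵛ x₁) V.-ᵛ x₂) V.-ᵛ x₃) V.-ᵛ (V.-ᵛ (a ∷ y)) ≡ V.0ᵛ
      last = trans (cong (λ z → z V.-ᵛ (V.-ᵛ (a ∷ y))) (trans (cong (V._-ᵛ x₃) (sym (V.sub-+ V.0ᵛ x₁ x₂)))
        (trans (sym (V.sub-+ V.0ᵛ (x₁ V.+ᵛ x₂) x₃)) (trans (cong (λ z → V.0ᵛ V.-ᵛ z) sum≡) (V.+ᵛ-identityˡ _))))) (V.-ᵛ-inverseʳ (V.-ᵛ (a ∷ y)))

  module Shear {r : ℕ} (g : Vec 𝔽 (suc r)) where
    private
      module H = AdditiveCombinatorics (vecSpace r)
    shear : Vec 𝔽 (2 + r) → Vec 𝔽 (2 + r)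
    shear (c ∷ y) = c ∷ (y H.+ᵛ c H.· g)

    shear-aut : Aut shear
    shear-aut = add , unshear , (λ { (c ∷ y) → cong (c ∷_) (H.add-sub y (c H.· g)) }) , (λ { (c ∷ y) → cong (c ∷_) (H.sub-add y (c H.· g)) })
      where
      unshear : Vec 𝔽 (2 + r) → Vec 𝔽 (2 + r)
      unshear (c ∷ y) = c ∷ (y H.-ᵛ c H.· g)
      swap′ : ∀ x y u v → (x H.+ᵛ y) H.+ᵛ (u H.+ᵛ v) ≡ (x H.+ᵛ u) H.+ᵛ (y H.+ᵛ v)
      swap′ x y u v = trans (H.+ᵛ-assoc x y _) (trans (cong (x H.+ᵛ_) (trans (sym (H.+ᵛ-assoc y u v))
        (trans (cong (H._+ᵛ v) (H.+ᵛ-comm y u)) (H.+ᵛ-assoc u y v)))) (sym (H.+ᵛ-assoc x u _)))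
      add : ∀ x y → shear (x ⊹ y) ≡ shear x ⊹ shear y
      add (c ∷ x) (d ∷ y) = cong ((c ⊞ d) ∷_) (trans (cong ((x H.+ᵛ y) H.+ᵛ_) (H.·-distrib c d g)) (swap′ x y (c H.· g) (d H.· g)))

  private
    1≤m₁ : 1 ≤ m₁
    1≤m₁ = ℕₚ.≤-pred (≤-trans (≤-trans (s≤s (s≤s z≤n)) m≥9) (≤-reflexive (sym m₁≡)))
    m<p : m < p
    m<p = <⇒≤ m+2≤p

    shift₁ : ∀ a {i} → 1 ≤ i → i < p → toℕ ((a ⊞ em i) ⊟ (a ⊞ em 1)) ≡ i ∸ 1
    shift₁ a {i} 1≤i i<p = trans (cong toℕ (solve 3 (λ a i o → a :+ i :- (a :+ o) := i :- o) refl a (em i) (em 1))) (toℕ-⊟ 1≤i i<p)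

    top₁ : ∀ a → toℕ ((a ⊞ em (m ∸ 1)) ⊟ (a ⊞ em 1)) ≡ m₁ ∸ 1
    top₁ a = shift₁ a 1≤m₁ (≤-trans (≤-reflexive m₁≡) (<⇒≤ m<p))

  interval-cases : ∀ a c → W.interval a (suc m) c ≡ true → (c ≡ a) ⊎ (c ∈⟦ a ⊞ em 1 , a ⊞ em (m ∸ 1) ⟧) ⊎ (c ≡ a ⊞ em m)
  interval-cases a c e = aux (toℕ (c ⊟ a)) refl (ℕₚ.≤-pred (does-true (toℕ (c ⊟ a) <? suc m) e))
    where
    index : ∀ {i} → toℕ (c ⊟ a) ≡ i → a ⊞ em i ≡ c
    index eq = trans (cong (λ i → a ⊞ em i) (sym eq)) (trans (cong (a ⊞_) (em-toℕ (c ⊟ a))) (solve 2 (λ a c → a :+ (c :- a) := c) refl a c))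
    aux : ∀ i → toℕ (c ⊟ a) ≡ i → i ≤ m → (c ≡ a) ⊎ (c ∈⟦ a ⊞ em 1 , a ⊞ em (m ∸ 1) ⟧) ⊎ (c ≡ a ⊞ em m)
    aux zero eq _ = inj₁ (trans (sym (index eq)) (⊞-identityʳ a))
    aux (suc i) eq i≤ = aux′ (ℕₚ.m≤n⇒m<n∨m≡n i≤)
      where
      aux′ : (suc i < m) ⊎ (suc i ≡ m) → (c ≡ a) ⊎ (c ∈⟦ a ⊞ em 1 , a ⊞ em (m ∸ 1) ⟧) ⊎ (c ≡ a ⊞ em m)
      aux′ (inj₂ i≡m) = inj₂ (inj₂ (trans (sym (index eq)) (cong (λ i → a ⊞ em i) i≡m)))
      aux′ (inj₁ lt) = inj₂ (inj₁ (subst (λ c → c ∈⟦ a ⊞ em 1 , a ⊞ em (m ∸ 1) ⟧) (index eq)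
        (≤-trans (≤-reflexive (shift₁ a (s≤s z≤n) (≤-trans lt (<⇒≤ m<p))))
        (≤-trans (ℕₚ.∸-monoˡ-≤ 1 (ℕₚ.≤-pred (≤-trans lt (≤-reflexive (sym m₁≡))))) (≤-reflexive (sym (top₁ a)))))))

  interval-inner : ∀ a c → c ∈⟦ a ⊞ em 1 , a ⊞ em (m ∸ 1) ⟧ → (W.interval a (suc m) c ≡ true) × (c ≢ a) × (c ≢ a ⊞ em m)
  interval-inner a c h = Ic , c≢a , λ e → <⇒≱ ss<m (≤-reflexive (sym (at m<p e)))
    where
    s = toℕ (c ⊟ (a ⊞ em 1))
    ss<m : suc s < m
    ss<m = ≤-trans (s≤s (≤-trans (s≤s (≤-trans h (≤-reflexive (top₁ a)))) (≤-reflexive (ℕₚ.m+[n∸m]≡n 1≤m₁)))) (≤-reflexive m₁≡)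
    c≡ : a ⊞ em (suc s) ≡ c
    c≡ = trans (cong (a ⊞_) (trans (em-+ 1 s) (cong (em 1 ⊞_) (em-toℕ (c ⊟ (a ⊞ em 1))))))
      (solve 3 (λ a o c → a :+ (o :+ (c :- (a :+ o))) := c) refl a (em 1) c)
    Ic : W.interval a (suc m) c ≡ true
    Ic = trans (cong (W.interval a (suc m)) (sym c≡)) (W.interval-intro {a} {suc m} {suc s} m<p (≤-trans ss<m (n≤1+n m)))
    at : ∀ {i} → i < p → c ≡ a ⊞ em i → suc s ≡ i
    at {i} i<p e = em-injective (≤-trans ss<m (<⇒≤ m<p)) i<p (trans (sym (W.add-sub′ a (em (suc s)))) (trans (cong (_⊟ a) (trans c≡ e)) (W.add-sub′ a (em i))))
    c≢a : c ≢ a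
    c≢a e = ℕₚ.1+n≢0 (at (≤-trans (s≤s z≤n) 1<p) (trans e (sym (⊞-identityʳ a))))

  -- Nonempty slices are whole points here, so k (a + m) = a is a forbidden equation between
  -- elements of the set.
  partial-0 : ∀ N≥1 N-odd (C : Vec 𝔽 1 → Bool) → IsFree 0 C → ¬ Outcomes.Partial₁ F Π (p ^ 0) N≥1 N-odd (weight C)
  partial-0 N≥1 N-odd C fr (l≡0 , a , sub , ea , eb , top) = layers-disjoint 0 N≥1 N-odd C fr l≡0 a top [] [] [] [] (at eb) (at eb) (at eb) (at ea) refl
    where
    at : ∀ {i} → does (1 ≤? weight C i) ≡ true → C (i ∷ []) ≡ true
    at {i} e = weight-full C (ℕₚ.≤-antisym (weight≤ C i) (does-true (1 ≤? weight C i) e)) []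

  module _ (r : ℕ) (N≥1 : 1 ≤ p ^ suc r) (N-odd : ∀ x → x + x ≢ p ^ suc r) (C : Vec 𝔽 (2 + r) → Bool) (fr : IsFree (suc r) C)
           (mass : m * p ^ suc r ≤ ℕΣ.∑ (allFin p) (weight C)) where
    open WeightClassification F Π (p ^ suc r) N≥1 N-odd using (supp; ∑-≥₂; ∑-≥₃)
    open Outcomes F Π (p ^ suc r) N≥1 N-odd using (Partial₁)
    private
      module H = AdditiveCombinatorics (vecSpace r)
      N = p ^ suc r
      w = weight C

    -- Disjointness gives w(a) + w(b) ≤ N, while the deficits over the m + 1 slices add up to at
    -- most N. So the two end slices have exactly N elements together, and no deficit is left for
    -- the slices between them.
    partial-suc : Partial₁ w → IsType2 (suc r) C
    partial-suc (l≡0 , a , sub , ea , eb , top) = cong suc l≡0 , s≤s z≤n , a , equation , V , subspace , shear , shear-aut , λ { (c ∷ y) → fwd c y , bwd c y }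
      where
      b = a ⊞ em m
      U T : Vec 𝔽 (suc r) → Bool
      U y = C (b ∷ y)
      T y = C (a ∷ y)
      1≤m : 1 ≤ m
      1≤m = ≤-trans (s≤s z≤n) m≥9
      u∈ : ∃[ u ] U u ≡ true
      u∈ = H.card-witness U (does-true (1 ≤? w b) eb)
      t∈ : ∃[ y ] T y ≡ true
      t∈ = H.card-witness T (does-true (1 ≤? w a) ea)
      u₀ = proj₁ u∈
      eu₀ : U u₀ ≡ true
      eu₀ = proj₂ u∈
      a≢b : a ≢ b
      a≢b e = <⇒≱ 1≤m (≤-reflexive (em-injective m<p (≤-trans (s≤s z≤n) 1<p) (trans (sym (W.add-sub′ a (em m))) (trans (cong (_⊟ a) (sym e)) (⊖-inverseʳ a)))))
      -- The shear moves the slice at b by a multiple b of its slope, so b must be invertible to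
      -- move U onto V.
      b≢0 : b ≢ 𝟘
      b≢0 e = a≢b (trans (sym top) (trans (cong (em (2 + k) ⊠_) e) (trans (⊠-zeroʳ _) (sym e))))
      equation : ⊖ em (((2 + k) ∸ suc l) * toℕ a) ≡ em (m * (2 + k))
      equation = trans (cong ⊖_ (trans (em-k∸l a) (cong (λ n → em (2 + k) ⊠ a ⊟ em (suc n) ⊠ a) l≡0)))
        (trans (solve 3 (λ K a m → :- (K :* a :- con (+ 1) :* a) := a :- K :* (a :+ m) :+ m :* K) refl (em (2 + k)) a (em m))
        (trans (cong (λ u → a ⊟ u ⊞ em m ⊠ em (2 + k)) top) (trans (cong (_⊞ em m ⊠ em (2 + k)) (⊖-inverseʳ a))
          (trans (⊞-identityˡ _) (sym (em-* m (2 + k)))))))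

      open Cosets (vecSpace r) using (sizes≤; direction; direction-0; direction-+; direction-·; complement; slope)
      disjoint : ∀ u u′ y → U u ≡ true → U u′ ≡ true → T y ≡ true → (u H.+ᵛ u′) H.+ᵛ em k H.· u₀ ≢ y
      disjoint u u′ y eu eu′ ey = layers-disjoint (suc r) N≥1 N-odd C fr l≡0 a top u u′ u₀ y eu eu′ eu₀ ey
      I = W.interval a (suc m)
      D : 𝔽 → ℕ
      D i = ℕΣ.𝟙 (I i) * (N ∸ w i)
      D-sum : ℕΣ.∑ (allFin p) D ≤ N
      D-sum = +-cancelʳ-≤ (m * N) _ N (≤-trans (+-monoʳ-≤ (ℕΣ.∑ (allFin p) D) mass)
        (≤-reflexive (trans (sym (ℕΣ.∑-+ (allFin p) D w)) (trans (ℕΣ.∑-cong (allFin p) (λ i → aux i (I i) refl))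
        (trans (ℕΣ.∑-*ʳ (allFin p) N (λ i → ℕΣ.𝟙 (I i))) (cong (_* N) (W.interval-card a (suc m) m<p)))))))
        where
        aux : ∀ i c → I i ≡ c → ℕΣ.𝟙 c * (N ∸ w i) + w i ≡ ℕΣ.𝟙 c * N
        aux i true e = trans (cong (_+ w i) (ℕₚ.*-identityˡ _)) (trans (ℕₚ.m∸n+n≡m (weight≤ C i)) (sym (ℕₚ.*-identityˡ N)))
        aux i false e = ℕₚ.n<1⇒n≡0 (ℕₚ.≰⇒> λ h → true≢false (sub i (does-intro (1 ≤? w i) h)) e)
      D-in : ∀ {i} → I i ≡ true → D i ≡ N ∸ w i
      D-in {i} e = trans (cong (λ c → ℕΣ.𝟙 c * (N ∸ w i)) e) (ℕₚ.*-identityˡ _)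
      D+w : ∀ i → N ∸ w i + w i ≡ N
      D+w i = ℕₚ.m∸n+n≡m (weight≤ C i)
      Ia : I a ≡ true
      Ia = sub a ea
      Ib : I b ≡ true
      Ib = sub b eb
      wa+wb≤ : w a + w b ≤ N
      wa+wb≤ = ≤-trans (sizes≤ U T u₀ eu₀ k disjoint) (≤-reflexive H.size)
      Da+Db≤ : (N ∸ w a) + (N ∸ w b) ≤ N
      Da+Db≤ = ≤-trans (≤-reflexive (sym (cong₂ _+_ (D-in Ia) (D-in Ib)))) (≤-trans (∑-≥₂ D a b a≢b) D-sum)
      N≤wa+wb : N ≤ w a + w b
      N≤wa+wb = arith (N ∸ w a) (N ∸ w b) (w a) (w b) N (D+w a) (D+w b) Da+Db≤
        where
        arith : ∀ d e x y N → d + x ≡ N → e + y ≡ N → d + e ≤ N → N ≤ x + y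
        arith d e x y N e₁ e₂ h = linear N (x + y) 0 (+-mono-≤ h (≤-reflexive (sym (cong₂ _+_ e₁ e₂)))) (eq d e x y N)
          where
          eq : ∀ d e x y N → N + (N + (d + x + (e + y))) + 0 ≡ x + y + (d + e + (N + N))
          eq = solve-∀
      middle-full : ∀ c → I c ≡ true → c ≢ a → c ≢ b → w c ≡ N
      middle-full c Ic c≢a c≢b = ℕₚ.≤-antisym (weight≤ C c) (ℕₚ.m∸n≡0⇒m≤n (ℕₚ.n≤0⇒n≡0 (arith (N ∸ w c) (N ∸ w a) (N ∸ w b) (w a) (w b) N (D+w a) (D+w b) wa+wb≤
          (≤-trans (≤-reflexive (sym (cong₂ _+_ (D-in Ic) (cong₂ _+_ (D-in Ia) (D-in Ib))))) (≤-trans (∑-≥₃ D c a b c≢a c≢b a≢b) D-sum)))))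
        where
        arith : ∀ f d e x y N → d + x ≡ N → e + y ≡ N → x + y ≤ N → f + (d + e) ≤ N → f ≤ 0
        arith f d e x y N e₁ e₂ h h′ = linear f 0 0 (+-mono-≤ (≤-reflexive (sym (cong₂ _+_ e₁ e₂))) (+-mono-≤ h h′)) (eq f d e x y N)
          where
          eq : ∀ f d e x y N → f + (d + x + (e + y) + (N + N)) + 0 ≡ 0 + (N + N + (x + y + (f + (d + e))))
          eq = solve-∀

      sizes≥ : H.# H.full ≤ H.# T + H.# U
      sizes≥ = ≤-trans (≤-reflexive H.size) N≤wa+wb
      V : Vec 𝔽 (suc r) → Bool
      V = direction U T u₀ eu₀ k disjoint sizes≥
      b⁻ = proj₁ (inverse b b≢0)
      b⁻b = proj₂ (inverse b b≢0)
      subspace : IsSubspace V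
      subspace = direction-0 U T u₀ eu₀ k disjoint sizes≥ , direction-+ U T u₀ eu₀ k disjoint sizes≥ , direction-· U T u₀ eu₀ k disjoint sizes≥ ,
        -- T is nonempty and the complement of a translate of V, so V is a proper subspace.
        (proj₁ t∈ H.-ᵛ em (2 + k) H.· u₀ , not-true (trans (sym (complement U T u₀ eu₀ k disjoint sizes≥ (proj₁ t∈))) (proj₂ t∈)))
      g : Vec 𝔽 (suc r)
      g = slope U T u₀ eu₀ k disjoint sizes≥ a b b⁻ b⁻b top
      open Shear g
      lower : ∀ y → T y ≡ not (V (y H.+ᵛ a H.· g))
      lower = Cosets.lower (vecSpace r) U T u₀ eu₀ k disjoint sizes≥ a b b⁻ b⁻b top
      upper : ∀ y → U y ≡ V (y H.+ᵛ b H.· g)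
      upper = Cosets.upper (vecSpace r) U T u₀ eu₀ k disjoint sizes≥ a b b⁻ b⁻b top
      fwd : ∀ c y → C (c ∷ y) ≡ true → Layers a V c (y H.+ᵛ c H.· g)
      fwd c y e = aux (interval-cases a c (sub c (does-intro (1 ≤? w c) (weight-pos C e))))
        where
        aux : (c ≡ a) ⊎ (c ∈⟦ a ⊞ em 1 , a ⊞ em (m ∸ 1) ⟧) ⊎ (c ≡ b) → Layers a V c (y H.+ᵛ c H.· g)
        aux (inj₁ c≡a) = inj₁ (c≡a , not-true (trans (sym (trans (lower y) (cong (λ c → not (V (y H.+ᵛ c H.· g))) (sym c≡a))))
          (trans (cong (λ c → C (c ∷ y)) (sym c≡a)) e)))
        aux (inj₂ (inj₁ h)) = inj₂ (inj₁ h)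
        aux (inj₂ (inj₂ c≡b)) = inj₂ (inj₂ (c≡b , trans (cong (λ c → V (y H.+ᵛ c H.· g)) c≡b)
          (trans (sym (upper y)) (trans (cong (λ c → C (c ∷ y)) (sym c≡b)) e))))
      bwd : ∀ c y → Layers a V c (y H.+ᵛ c H.· g) → C (c ∷ y) ≡ true
      bwd c y (inj₁ (c≡a , ev)) = trans (cong (λ c → C (c ∷ y)) c≡a) (trans (lower y) (trans (cong (λ c → not (V (y H.+ᵛ c H.· g))) (sym c≡a)) (cong not ev)))
      bwd c y (inj₂ (inj₂ (c≡b , ev))) = trans (cong (λ c → C (c ∷ y)) c≡b) (trans (upper y) (trans (cong (λ c → V (y H.+ᵛ c H.· g)) (sym c≡b)) ev))
      bwd c y (inj₂ (inj₁ h)) = weight-full C (middle-full c (proj₁ inner) (proj₁ (proj₂ inner)) (proj₂ (proj₂ inner))) y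
        where inner = interval-inner a c h

-- Oddness of the slice space rules out slices of exactly half size in `core-extra`.
odd-power : ∀ p → Prime p → 2 < p → ∀ n x → x + x ≢ p ^ n
odd-power p pr 2<p n x e = go n (divides x (trans (sym e) (lem x)))
  where
  lem : ∀ x → x + x ≡ x * 2
  lem = solve-∀
  ¬2∣p : ¬ 2 ∣ p
  ¬2∣p d = aux (prime⇒irreducible pr d)
    where
    aux : (2 ≡ 1) ⊎ (2 ≡ p) → ⊥
    aux (inj₁ ())
    aux (inj₂ e) = <⇒≱ 2<p (≤-reflexive (sym e))
  go : ∀ n → ¬ 2 ∣ p ^ n
  go zero d = aux (∣1⇒≡1 d)
    where
    aux : 2 ≢ 1
    aux ()
  go (suc n) d = aux (euclidsLemma p (p ^ n) prime[2] d)
    where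
    aux : (2 ∣ p) ⊎ (2 ∣ p ^ n) → ⊥
    aux (inj₁ h) = ¬2∣p h
    aux (inj₂ h) = go n h

-- Assembly of the classification

module Assembly {p : ℕ} .{{_ : NonZero p}} (F : FieldOps p) (k l lam mu m : ℕ)
                   (l<k′ : suc l < 2 + k)
                   (K≡′ : 2 + k + suc l ≡ 5 + (lam + mu)) (p≡′ : p ≡ (5 + (lam + mu)) * m + 2 + lam)
                   (rb : RootBound (5 + (lam + mu)) lam m) (odd : ∀ n x → x + x ≢ p ^ n) where
  Π : Parameters p
  Π = record { k = k ; l = l ; lam = lam ; mu = mu ; m = m ; l<k = l<k′ ; K≡ = K≡′ ; p≡ = p≡′
             ; m≥ = ℕₚ.*-cancelʳ-≤ (K + lam + 4) m K (≤-trans (*-monoʳ-≤ (K + lam + 4) (m≤m+n K 1)) (root-bound⇒m (2 + (lam + mu)) lam m rb)) }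
    where K = 5 + (lam + mu)

  open Parameters Π using (l<k; K≡; p≡; m≥)
  open PrimeField F
  open VectorSpace F
  open Isomorphism F
  open SetStructure F Π
  open PartialSets F Π

  private
    1≤N : ∀ n → 1 ≤ p ^ n
    1≤N n = ℕₚ.m^n>0 p {{>-nonZero (<⇒≤ 1<p)}} n

  vsum′ : ∀ {n h} → Vec (Vec 𝔽 n) h → Vec 𝔽 n
  vsum′ = Vec.foldr _ _⊹_ zeros

  module _ {n : ℕ} (A : Vec 𝔽 (suc n) → Bool) where
    private
      module V = AdditiveCombinatorics (vecSpace n)
      open Spectral F n using (signed)

      Members : ∀ {h} → Vec (Vec 𝔽 (suc n)) h → Set
      Members = VAll.All (λ x → A x ≡ true)

      minus : ∀ j z → V.SumOf (map (signed A) (replicate j false)) z → Σ (Vec (Vec 𝔽 (suc n)) j) λ ys → Members ys × (z V.+ᵛ vsum′ ys ≡ zeros)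
      minus zero z e = [] , VAll.[] , trans (cong (V._+ᵛ zeros) e) (V.+ᵛ-identityˡ zeros)
      minus (suc j) z (x , ex , s) = let ys , hs , e = minus j (z V.-ᵛ x) s in
        (V.-ᵛ x) ∷ ys , ex VAll.∷ hs , trans (sym (V.+ᵛ-assoc z (V.-ᵛ x) (vsum′ ys))) e

      plus : ∀ i j z → V.SumOf (map (signed A) (replicate i true ++ replicate j false)) z →
             Σ (Vec (Vec 𝔽 (suc n)) i) λ xs → Σ (Vec (Vec 𝔽 (suc n)) j) λ ys → Members xs × Members ys × (z V.+ᵛ vsum′ ys ≡ vsum′ xs)
      plus zero j z s = let ys , hs , e = minus j z s in [] , ys , VAll.[] , hs , e
      plus (suc i) j z (x , ex , s) = let xs , ys , hs , hs′ , e = plus i j (z V.-ᵛ x) s in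
        x ∷ xs , ys , ex VAll.∷ hs , hs′ , trans (sym (trans (cong (x V.+ᵛ_) (regroup z x (vsum′ ys)))
          (trans (V.+ᵛ-comm x _) (V.sub-add (z V.+ᵛ vsum′ ys) x)))) (cong (x V.+ᵛ_) e)
        where
        regroup : ∀ z x y → (z V.-ᵛ x) V.+ᵛ y ≡ (z V.+ᵛ y) V.-ᵛ x
        regroup z x y = trans (V.+ᵛ-assoc z (V.-ᵛ x) y) (trans (cong (z V.+ᵛ_) (V.+ᵛ-comm (V.-ᵛ x) y)) (sym (V.+ᵛ-assoc z y (V.-ᵛ x))))

    sum-free⇒free : (∀ (xs : Vec (Vec 𝔽 (suc n)) (2 + k)) (ys : Vec (Vec 𝔽 (suc n)) (suc l)) →
                      VAll.All (λ x → A x ≡ true) xs → VAll.All (λ y → A y ≡ true) ys → vsum′ xs ≢ vsum′ ys) → IsFree n A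
    sum-free⇒free sf s = let xs , ys , hs , hs′ , e = plus (2 + k) (suc l) zeros s in sf xs ys hs hs′ (trans (sym e) (V.+ᵛ-identityˡ _))

  Conclusion : ∀ n → (Vec 𝔽 (suc n) → Bool) → Set
  Conclusion n A = IsTrivial n A ⊎ IsType1 n A ⊎ IsType2 n A

  conclusion-aut : ∀ {n} (A : Vec 𝔽 (suc n) → Bool) {φ} (aut : Aut φ) → Conclusion n (A ∘ proj₁ (proj₂ aut)) → Conclusion n A
  conclusion-aut A aut (inj₁ h) = inj₁ (trivial-aut A aut h)
  conclusion-aut A aut (inj₂ (inj₁ h)) = inj₂ (inj₁ (type1-aut A aut h))
  conclusion-aut A aut (inj₂ (inj₂ h)) = inj₂ (inj₂ (type2-aut A aut h))

  -- `Covers` does not depend on N, so its instance for N = 1 serves every dimension by computation.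
  Covers′ : Set
  Covers′ = WeightClassification.Covers F Π 1 (s≤s z≤n) (odd 0)

  module _ (covers : Covers′) where

    conclude : ∀ n (B : Vec 𝔽 (suc n) → Bool) → IsFree n B → WeightClassification.Weighted F Π (p ^ n) (1≤N n) (odd n) (weight B) → Conclusion n B
    conclude n B fr Wt = let d , d≢0 , fin = classify (weight B) Wt covers ; d⁻ , h₁ , h₂ = LS.unscale d d≢0
                         in conclusion-aut B (scaleMap-aut d d⁻ h₁ h₂) (cases n d d≢0 B fr Wt fin)
      where
      open FinalOutcomes F Π (p ^ n) (1≤N n) (odd n) using (classify)
      cases : ∀ n d → d ≢ 𝟘 → (B : Vec 𝔽 (suc n) → Bool) → IsFree n B → WeightClassification.Weighted F Π (p ^ n) (1≤N n) (odd n) (weight B) →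
              FinalOutcomes.Final F Π (p ^ n) (1≤N n) (odd n) (weight (B ∘ scaleMap d)) → Conclusion n (B ∘ scaleMap d)
      cases n d d≢0 B fr Wt (inj₁ c) = inj₁ (Conclusions.trivial-from n (1≤N n) (odd n) (B ∘ scaleMap d) c)
      cases n d d≢0 B fr Wt (inj₂ (inj₁ c)) = inj₂ (inj₁ (Conclusions.type1-from n (1≤N n) (odd n) (B ∘ scaleMap d) c))
      cases n d d≢0 B fr Wt (inj₂ (inj₂ c)) = inj₂ (inj₂ (type2 n B fr Wt c))
        where
        free : ∀ n (B : Vec 𝔽 (suc n) → Bool) → IsFree n B → IsFree n (B ∘ scaleMap d)
        free n B fr = let d⁻ , h₁ , h₂ = LS.unscale d d≢0 in free-aut B (scaleMap-aut d d⁻ h₁ h₂) fr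
        type2 : ∀ n (B : Vec 𝔽 (suc n) → Bool) → IsFree n B → WeightClassification.Weighted F Π (p ^ n) (1≤N n) (odd n) (weight B) →
                Outcomes.Partial₁ F Π (p ^ n) (1≤N n) (odd n) (weight (B ∘ scaleMap d)) → IsType2 n (B ∘ scaleMap d)
        type2 zero B fr Wt c = ⊥-elim (partial-0 (1≤N 0) (odd 0) (B ∘ scaleMap d) (free 0 B fr) c)
        type2 (suc r) B fr Wt c = partial-suc r (1≤N (suc r)) (odd (suc r)) (B ∘ scaleMap d) (free (suc r) B fr)
          (WeightClassification.Weighted.mass (WeightClassification.rescale F Π (p ^ suc r) (1≤N (suc r)) (odd (suc r)) d d≢0 Wt)) c

    structure : ∀ n (A : Vec 𝔽 (suc n) → Bool) → IsFree n A → m * p ^ n ≤ count A (allVecs p (suc n)) → Conclusion n A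
    structure zero A fr mass = conclude 0 A fr (weighted-0 (1≤N 0) (odd 0) A fr mass)
    structure (suc r) A fr mass =
      let c , c≢0 , large = good-functional (suc r) A (2 + (lam + mu)) lam m (p ∸ 1) rb p≡ (sym (ℕₚ.m+[n∸m]≡n (<⇒≤ 1<p))) mass true true (rest₊ k l) length-rest fr
          φ , aut , hd = functional-aut (suc r) c c≢0
      in conclusion-aut A aut (conclude (suc r) (A ∘ proj₁ (proj₂ aut)) (free-aut A aut fr) (weighted-suc r (1≤N (suc r)) (odd (suc r)) (A ∘ proj₁ (proj₂ aut)) (free-aut A aut fr)
           (≤-trans mass (≤-reflexive (sym (card-aut (suc r) A aut))))
           (≤-trans large (≤-reflexive (cong ((5 + (lam + mu)) *_) (trans (spread-weight (suc r) A c aut hd)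
             (cong (λ t → ℕΣ.∑ (allFin p) (λ i → ℤ.∣ + p ℤ.* + weight (A ∘ proj₁ (proj₂ aut)) i ℤ.- + t ∣)) (sym (card-aut (suc r) A aut)))))))))
      where
      length-rest : length (rest₊ k l) ≡ 3 + (lam + mu)
      length-rest = trans (length-₊ k l) (ℕₚ.suc-injective (ℕₚ.suc-injective K≡))

private
  module Concrete (p : ℕ) .{{_ : NonZero p}} (pr : Prime p) (k l lam mu m : ℕ)
                  (l<k : suc l < 2 + k) (K≡ : 2 + k + suc l ≡ 5 + (lam + mu)) (p≡ : p ≡ (5 + (lam + mu)) * m + 2 + lam)
                  (five : FiveTBound (5 + (lam + mu)) m) (rb : RootBound (5 + (lam + mu)) lam m) where
    F = ConcreteField.fieldOps p pr
    K = 5 + (lam + mu)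

    2<p : 2 < p
    2<p = subst (2 <_) (sym p≡) (≤-trans (+-mono-≤ (*-mono-≤ {1} {K} (s≤s z≤n) (≤-trans (s≤s z≤n) (proj₁ five))) (≤-refl {2})) (m≤m+n _ lam))

    open Assembly F k l lam mu m l<k K≡ p≡ rb (λ n → odd-power p pr 2<p n)
    open PrimeField F using (em-*; em-toℕ; em; _⊞_; _⊠_)

    covers : Covers′
    -- The choice τ = 4 / m gives (2 + τ) m - 3 = 2 m + 1, the doubling in question, and stays
    -- strictly below 5 / m.
    covers S S≡m small = let a , d , h = proj₂ five 4 m (s≤s z≤n) (≤-trans (s≤s (s≤s (s≤s (s≤s z≤n)))) (proj₁ five)) (lt m (proj₁ five)) p pr S K≤ bound
                         in a , d , λ x ex → let i , i< , e = h x ex in i , i< , trans e (cong (a ⊞_) (trans (em-* i (toℕ d)) (cong (em i ⊠_) (em-toℕ d))))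
      where
      lt : ∀ m → 5 ≤ m → 4 * m < 5 * m
      lt m h = ≤-trans (≤-trans (≤-reflexive (ℕₚ.+-comm 1 (4 * m))) (+-monoʳ-≤ (4 * m) (≤-trans (s≤s z≤n) h))) (≤-reflexive (ℕₚ.+-comm (4 * m) m))
      K≤ : K * cardₚ p S ≤ p
      K≤ = ≤-trans (≤-reflexive (cong (K *_) S≡m)) (≤-trans (≤-trans (m≤m+n (K * m) 2) (m≤m+n _ lam)) (≤-reflexive (sym p≡)))
      bound : m * cardₚ p (sumset p S) + 3 * m ≤ (2 * m + 4) * cardₚ p S
      bound = ≤-trans (+-monoˡ-≤ (3 * m) (*-monoʳ-≤ m small)) (≤-reflexive (trans (lem m) (cong ((2 * m + 4) *_) (sym S≡m))))
        where
        lem : ∀ m → m * (2 * m + 1) + 3 * m ≡ (2 * m + 4) * m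
        lem = solve-∀

    result : ∀ n (A : Vec (Fin p) (suc n) → Bool) → SumFree p (2 + k) (suc l) A → Nontrivial p (2 + k) (suc l) lam m n A → m * p ^ n ≤ card p A →
      Normal p (2 + k) (suc l) lam m n A
    result n A (_ , sf) nontrivial mass = aux (structure covers n A (sum-free⇒free A sf) mass)
      where
      open PartialSets F Π using (Layers)
      to : ∀ a V (v : Vec (Fin p) (suc n)) → Layers a V (Vec.head v) (Vec.tail v) → Type2Set p m n a V v
      to a V (c ∷ y) h = h
      from : ∀ a V (v : Vec (Fin p) (suc n)) → Type2Set p m n a V v → Layers a V (Vec.head v) (Vec.tail v)
      from a V (c ∷ y) h = h
      aux : Conclusion n A → Normal p (2 + k) (suc l) lam m n A
      aux (inj₁ t) = ⊥-elim (nontrivial t)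
      aux (inj₂ (inj₁ t)) = inj₁ t
      aux (inj₂ (inj₂ (l≡ , 1≤n , a , e , V , sub , φ , aut , h))) =
        inj₂ (l≡ , 1≤n , a , e , V , sub , φ , aut , λ x → (λ ex → to a V (φ x) (proj₁ (h x) ex)) , (λ t → proj₂ (h x) (from a V (φ x) t)))

theorem1p5 : (k l lam m p n' : ℕ) →
    1 ≤ l → l < k → 5 ≤ k + l → lam ≤ k + l ∸ 5 →
    FiveTBound (k + l) m → RootBound (k + l) lam m →
    p ≡ (k + l) * m + 2 + lam → Prime p → .{{_ : NonZero p}} →
    (A : Vec (Fin p) (suc n') → Bool) →
    SumFree p k l A → Nontrivial p k l lam m n' A →
    m * p ^ n' ≤ card p A →
    Normal p k l lam m n' A
theorem1p5 (suc zero) (suc l) lam m p n' 1≤l (s≤s ()) 5≤K lam≤ five rb p≡ pr A sf nt mass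
theorem1p5 (suc (suc k)) (suc l) lam m p n' 1≤l l<k 5≤K lam≤ five rb p≡ pr A sf nt mass =
  Concrete.result p pr k l lam mu m l<k K≡ (subst (λ K → p ≡ K * m + 2 + lam) K≡ p≡) (subst (λ K → FiveTBound K m) K≡ five)
    (subst (λ K → RootBound K lam m) K≡ rb) n' A sf nt mass
  where
  K = 2 + k + suc l
  mu = K ∸ 5 ∸ lam
  K≡ : K ≡ 5 + (lam + mu)
  K≡ = trans (sym (ℕₚ.m+[n∸m]≡n 5≤K)) (cong (_+_ 5) (sym (ℕₚ.m+[n∸m]≡n lam≤)))
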